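{- For every positive integer $n$ such that a connected, nontraceable, locally linear graph with $n$ vertices exists, the minimum number of edges of a connected, nontraceable, locally linear graph with $n$ vertices is $2n+3$.
   Context: All graphs are finite, simple and connected. For a vertex $v$ of a graph $G$, $N(v)$ is the set of neighbours of $v$ and $G[S]$ is the subgraph induced by a vertex set $S$. A graph $G$ is locally linear if for every vertex $v$ of $G$ the induced subgraph $G[N(v)]$ is a path. A graph is traceable if it contains a path through all of its vertices; otherwise it is nontraceable. The size of a graph is its number of edges. -}

module Defs where

open import Data.Nat using (ℕ; zero; suc; _<ᵇ_; _≤_; _<_; _+_)
open import Data.Fin using (Fin; toℕ)
open import Data.Bool using (Bool; true; false; _∧_)
open import Data.List using (List; []; _∷_; allFin; concatMap; map; length; filter)
open import Data.Product using (Σ; ∃; _×_; _,_)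
open import Data.Sum using (_⊎_)
open import Relation.Binary.PropositionalEquality using (_≡_)
open import Relation.Nullary using (¬_)
open import Function.Definitions using (Injective)

record Graph (n : ℕ) : Set where
  field
    adj    : Fin n → Fin n → Bool
    sym    : ∀ u v → adj u v ≡ adj v u
    irrefl : ∀ v → adj v v ≡ false
open Graph public

Adj : ∀ {n} → Graph n → Fin n → Fin n → Set
Adj G u v = adj G u v ≡ true

countTrue : List Bool → ℕ
countTrue [] = 0
countTrue (true ∷ bs) = suc (countTrue bs)
countTrue (false ∷ bs) = countTrue bs

size : ∀ {n} → Graph n → ℕ
size {n} G = countTrue (concatMap (λ i → map (λ j → (toℕ i <ᵇ toℕ j) ∧ adj G i j) (allFin n)) (allFin n))

data Walk {n} (G : Graph n) : Fin n → Fin n → Set where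
  here : ∀ {v} → Walk G v v
  step : ∀ {u w v} → Adj G u w → Walk G w v → Walk G u v

Connected : ∀ {n} → Graph n → Set
Connected {n} G = ∀ (u v : Fin n) → Walk G u v

NbhdIsPath : ∀ {n} → Graph n → Fin n → Set
NbhdIsPath {n} G v =
  Σ ℕ λ k → Σ (Fin k → Fin n) λ x →
    (1 ≤ k)
    × Injective _≡_ _≡_ x
    × (∀ i → Adj G v (x i))
    × (∀ u → Adj G v u → ∃ λ i → x i ≡ u)
    × (∀ i j → (Adj G (x i) (x j) → (toℕ j ≡ suc (toℕ i) ⊎ toℕ i ≡ suc (toℕ j)))
             × ((toℕ j ≡ suc (toℕ i) ⊎ toℕ i ≡ suc (toℕ j)) → Adj G (x i) (x j)))

LocallyLinear : ∀ {n} → Graph n → Set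
LocallyLinear {n} G = ∀ (v : Fin n) → NbhdIsPath G v

Traceable : ∀ {n} → Graph n → Set
Traceable {n} G =
  Σ (Fin n → Fin n) λ x →
    Injective _≡_ _≡_ x
    × (∀ u → ∃ λ i → x i ≡ u)
    × (∀ i j → toℕ j ≡ suc (toℕ i) → Adj G (x i) (x j))

CNLL : ∀ {n} → Graph n → Set
CNLL G = Connected G × ¬ Traceable G × LocallyLinear G

{-# OPTIONS --safe #-}
module Submission where

-- In a locally linear graph every triangle is a face, and the faces form a triangulated surface all of whose vertices lie on the
-- boundary; a boundary edge is an edge in a single triangle (relation B below), and the boundary is a disjoint union of cycles.
-- With at most two boundary cycles the graph is traceable. With three or more, 2 |E| = n + 3 |T|, and after deleting one
-- suitable interior edge for each of two boundary cycles the dual graph is still connected (a cut argument modulo 2), so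
-- |T| + 1 is at most the number |E| - n of interior edges, which gives |E| ≥ 2n + 3.
--
-- Equality holds for a pair of pants, and adding an ear on a boundary edge raises n by 1 and |E| by 2. The smallest nontraceable
-- pair of pants used here has 20 vertices, so it remains to see that nontraceability forces n ≥ 20. A boundary cycle Z separating
-- two others must keep the vertices that see the one away from those that see the other, or else the three cycles could be
-- traversed one after the other. The vertices seeing a cycle form large sets (at least four, since each sees two non-adjacent
-- others at the ends of an interval of its link), so that Z is long. Four boundary cycles are either merged into three along
-- a pair of parallel edges, or treated in the same way; five of them need 20 vertices anyway.

open import Defs
open import Data.Nat hiding (parity) renaming (_≟_ to _≟ⁿ_)
open import Data.Nat.Properties hiding (_≟_; suc-injective; 0≢1+n)
import Data.Nat.Properties as NP
open import Data.Nat.Solver using (module +-*-Solver)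
open import Data.Fin using (Fin; toℕ; fromℕ<; zero; suc; cast; #_)
open import Data.Fin.Properties using (toℕ-injective; toℕ<n; toℕ-fromℕ<; toℕ-cast; _≟_; all?)
import Data.Fin.Properties as Fin
open import Data.Vec as Vec using (Vec; []; _∷_)
open import Data.Bool using (Bool; true; false; _∧_; _∨_; _xor_; not; if_then_else_; T)
open import Data.Bool.Properties using (xor-assoc; xor-comm; xor-same; xor-identityʳ; ∧-comm; not-involutive) renaming (_≟_ to _≟ᵇ_)
open import Data.Product using (Σ; ∃; _×_; _,_; proj₁; proj₂)
open import Data.Product.Properties using (≡-dec)
open import Data.Sum using (_⊎_; inj₁; inj₂; [_,_]′; swap)
open import Data.Empty using (⊥; ⊥-elim)
open import Data.Unit using (tt)
open import Data.List using (List; []; _∷_; _++_; length; map; allFin; tabulate; lookup; concatMap; cartesianProduct)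
open import Data.List.Properties using (length-++; length-tabulate; ++-assoc; length-map; map-tabulate)
open import Data.List.Membership.Propositional using (_∈_; _∉_; find; lose)
open import Data.List.Membership.Propositional.Properties using (∈-∃++; ∈-++⁻; ∈-++⁺ˡ; ∈-++⁺ʳ; ∈-allFin; ∈-lookup; ∈-map⁺; ∈-map⁻; ∈-cartesianProduct⁺; ∈-tabulate⁺)
open import Data.List.Relation.Unary.Any using (here; there; index; any?)
open import Data.List.Relation.Unary.Any.Properties using (lookup-index)
open import Data.List.Relation.Unary.All using (All; []; _∷_)
import Data.List.Relation.Unary.All as All
import Data.List.Relation.Unary.AllPairs as AllPairs
open import Data.List.Relation.Unary.Unique.Propositional using (Unique; []; _∷_)
import Data.List.Relation.Unary.Unique.Propositional.Properties as Unique
open import Data.List.Relation.Unary.Unique.Propositional.Properties using () renaming (Unique[x∷xs]⇒x∉xs to ∉-head)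
open import Data.List.Relation.Binary.Permutation.Propositional using (_↭_; ↭-refl; ↭-sym; ↭-trans; ↭-reflexive; prep)
open import Data.List.Relation.Binary.Permutation.Propositional.Properties using (∈-resp-↭; ↭-length; shift; ++-comm; ++⁺; ++⁺ˡ; ++⁺ʳ)
import Data.List.Relation.Binary.Permutation.Propositional.Properties as Perm
open import Relation.Nullary using (¬_; Dec; yes; no)
open import Relation.Nullary.Decidable using (⌊_⌋; _×-dec_; _⊎-dec_; _→-dec_; toWitness)
open import Relation.Binary.Definitions using (tri<; tri≈; tri>)
open import Relation.Binary.PropositionalEquality using (_≡_; _≢_; refl; trans; cong; cong₂; subst; module ≡-Reasoning) renaming (sym to ≡sym)

-- The number 20 arises as 5 + 10 + 5. The ring of vertices of a separating cycle has at least 10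
-- entries; an outer cycle that is only a square has one vertex less but forces two isolated seers,
-- and these make the ring one longer. The bound for the ring is arithmetical: a vertex that sees
-- both outer cycles, and an isolated seer, is followed by a vertex that sees neither, and the other
-- seers of each kind by at least one such vertex. The counts of these kinds leave finitely many
-- short rings, which the linear order of the links refutes, with one exception: between two squares
-- a ring may cost 11 instead of 12. This one is refuted only in the graph, by placing the common
-- neighbour of its two adjacent seers. No surface is formed. A set closed under boundary edges
-- stands for a union of boundary cycles, and what a vertex sees of it is read off as intervals of
-- its link. In the dual graph, connectivity is phrased by colourings of the triangles, so that
-- deleting edges means dropping equations between colours.

true≢false : ∀ {b} → b ≡ true → b ≡ false → ⊥
true≢false refl ()

bool-cases : ∀ b → b ≡ true ⊎ b ≡ false
bool-cases true = inj₁ refl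
bool-cases false = inj₂ refl

¬true : ∀ {b} → ¬ (b ≡ true) → b ≡ false
¬true {true} f = ⊥-elim (f refl)
¬true {false} f = refl

∧-fst : ∀ {a b} → a ∧ b ≡ true → a ≡ true
∧-fst {true} e = refl

∧-snd : ∀ {a b} → a ∧ b ≡ true → b ≡ true
∧-snd {true} e = e

∧-both : ∀ {a b} → a ≡ true → b ≡ true → a ∧ b ≡ true
∧-both refl refl = refl

∨-elim : ∀ {a b} → a ∨ b ≡ true → a ≡ true ⊎ b ≡ true
∨-elim {true} e = inj₁ refl
∨-elim {false} e = inj₂ e

∨-left : ∀ {a b} → a ≡ true → a ∨ b ≡ true
∨-left refl = refl

∨-right : ∀ {a b} → b ≡ true → a ∨ b ≡ true
∨-right {true} e = refl
∨-right {false} e = e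

not-true : ∀ {a} → not a ≡ true → a ≡ false
not-true {false} e = refl

not-false : ∀ {a} → a ≡ false → not a ≡ true
not-false refl = refl

opaque
  -- Finds the lower end of the interval of true positions that contains `p`; falsity at 0 keeps the
  -- search inside the link.
  search-left : (φ : ℕ → Bool) → φ 0 ≡ false → ∀ p → φ p ≡ true →
    ∃ λ l → l < p × φ l ≡ false × (∀ q → l < q → q ≤ p → φ q ≡ true)
  search-left φ z zero t = ⊥-elim (true≢false t z)
  search-left φ z (suc p) t with bool-cases (φ p)
  ... | inj₂ f = p , ≤-refl , f , λ q a b → subst (λ r → φ r ≡ true) (≤-antisym a b) t
  ... | inj₁ t' with search-left φ z p t'
  ... | l , l<p , f , between = l , m<n⇒m<1+n l<p , f , go
    where
    go : ∀ q → l < q → q ≤ suc p → φ q ≡ true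
    go q a b with m≤n⇒m<n∨m≡n b
    ... | inj₁ c = between q a (s≤s⁻¹ c)
    ... | inj₂ refl = t

opaque
  -- Finds the upper end of the interval; the distance `d` to a position known to be false is the
  -- fuel.
  search-right : (φ : ℕ → Bool) → ∀ d p → φ (d + p) ≡ false → φ p ≡ true →
    ∃ λ r → p < r × r ≤ d + p × φ r ≡ false × (∀ q → p ≤ q → q < r → φ q ≡ true)
  search-right φ zero p z t = ⊥-elim (true≢false t z)
  search-right φ (suc d) p z t with bool-cases (φ (suc p))
  ... | inj₂ f = suc p , ≤-refl , s≤s (m≤n+m p d) , f , λ q a b → subst (λ r → φ r ≡ true) (≤-antisym a (s≤s⁻¹ b)) t
  ... | inj₁ t' with search-right φ d (suc p) (subst (λ r → φ r ≡ false) (≡sym (+-suc d p)) z) t'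
  ... | r , p<r , r≤ , f , between = r , <-trans (n<1+n p) p<r , ≤-trans r≤ (≤-reflexive (+-suc d p)) , f , go
    where
    go : ∀ q → p ≤ q → q < r → φ q ≡ true
    go q a b with m≤n⇒m<n∨m≡n a
    ... | inj₁ c = between q c b
    ... | inj₂ refl = t

-- Links of vertices

module Links {n : ℕ} (G : Graph n) (ll : LocallyLinear G) (walk : Connected G) where

  V : Set
  V = Fin n

  infix 4 _~_
  _~_ : V → V → Set
  u ~ v = Adj G u v

  ~-sym : ∀ {u v} → u ~ v → v ~ u
  ~-sym {u} {v} a = trans (sym G v u) a

  ~-irrefl : ∀ {v} → ¬ (v ~ v)
  ~-irrefl {v} a = true≢false a (irrefl G v)

  ~⇒≢ : ∀ {u v} → u ~ v → u ≢ v
  ~⇒≢ a refl = ~-irrefl a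

  _~?_ : ∀ u v → Dec (u ~ v)
  u ~? v = adj G u v ≟ᵇ true

  everywhere : (P : V → Set) → (∀ {u v} → u ~ v → P u → P v) → ∀ u → P u → ∀ v → P v
  everywhere P step-P u pu v = go (walk u v) pu
    where
    go : ∀ {a b} → Walk G a b → P a → P b
    go here pa = pa
    go (step e w) pa = go w (step-P e pa)

  deg : V → ℕ
  deg v = proj₁ (ll v)

  -- Positions are natural numbers rather than elements of `Fin (deg v)`, so that neighbouring
  -- positions are named by `suc` and identified by matching on `refl`.
  At : V → ℕ → V → Set
  At v p u = Σ (Fin (deg v)) λ i → toℕ i ≡ p × proj₁ (proj₂ (ll v)) i ≡ u

  at-~ : ∀ {v p u} → At v p u → v ~ u
  at-~ {v} (i , _ , refl) = proj₁ (proj₂ (proj₂ (proj₂ (proj₂ (ll v))))) i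

  ~-at : ∀ {v u} → v ~ u → ∃ λ p → At v p u
  ~-at {v} {u} a with proj₁ (proj₂ (proj₂ (proj₂ (proj₂ (proj₂ (ll v)))))) u a
  ... | i , e = toℕ i , i , refl , e

  at-fun : ∀ {v p u w} → At v p u → At v p w → u ≡ w
  at-fun {v} (i , e , refl) (j , e' , refl) = cong (proj₁ (proj₂ (ll v))) (toℕ-injective (trans e (≡sym e')))

  at-inj : ∀ {v p q u} → At v p u → At v q u → p ≡ q
  at-inj {v} (i , refl , e) (j , refl , e') = cong toℕ (proj₁ (proj₂ (proj₂ (proj₂ (ll v)))) (trans e (≡sym e')))

  at-near : ∀ {v p q u w} → At v p u → At v q w → u ~ w → q ≡ suc p ⊎ p ≡ suc q
  at-near {v} (i , refl , refl) (j , refl , refl) a = proj₁ (proj₂ (proj₂ (proj₂ (proj₂ (proj₂ (proj₂ (ll v)))))) i j) a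

  at-next : ∀ {v p u w} → At v p u → At v (suc p) w → u ~ w
  at-next {v} (i , refl , refl) (j , e , refl) = proj₂ (proj₂ (proj₂ (proj₂ (proj₂ (proj₂ (proj₂ (ll v)))))) i j) (inj₁ e)

  at-< : ∀ {v p u} → At v p u → p < deg v
  at-< (i , refl , _) = toℕ<n i

  <-at : ∀ {v p} → p < deg v → ∃ λ u → At v p u
  <-at {v} {p} l = proj₁ (proj₂ (ll v)) (fromℕ< l) , fromℕ< l , toℕ-fromℕ< l , refl

  deg≥1 : ∀ v → 1 ≤ deg v
  deg≥1 v = proj₁ (proj₂ (proj₂ (ll v)))

  -- In such a set, the vertex in the last position would have both its neighbours in the position before.
  opaque
    link-acyclic : ∀ v (P : V → Set) → (∀ u → P u → v ~ u) →
      (∀ u → P u → ∃ λ a → ∃ λ b → P a × P b × a ≢ b × u ~ a × u ~ b) → ∀ u → ¬ P u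
    link-acyclic v P sub two u pu = climb (deg v) (proj₁ here₀) u (proj₂ here₀) pu (m≤m+n (deg v) (proj₁ here₀))
      where
      here₀ : ∃ λ p → At v p u
      here₀ = ~-at (sub u pu)
      climb : ∀ k p w → At v p w → P w → deg v ≤ k + p → ⊥
      climb zero p w at pw le = <-irrefl refl (≤-trans (at-< at) le)
      climb (suc k) p w at pw le with two w pw
      ... | a , b , pa , pb , a≢b , wa , wb with ~-at (sub a pa) | ~-at (sub b pb)
      ... | q , ata | r , atb with at-near at ata wa | at-near at atb wb
      ... | inj₁ refl | _ = climb k (suc p) a ata pa (≤-trans le (≤-reflexive (≡sym (+-suc k p))))
      ... | inj₂ refl | inj₁ refl = climb k (suc p) b atb pb (≤-trans le (≤-reflexive (≡sym (+-suc k p))))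
      ... | inj₂ refl | inj₂ refl = a≢b (at-fun ata atb)

  Common : V → V → V → Set
  Common u v t = u ~ t × v ~ t

  common-sym : ∀ {u v t} → Common u v t → Common v u t
  common-sym (a , b) = b , a

  -- Only uniqueness of the third vertex is demanded. Its existence needs degree at least 2 and
  -- comes from nontraceability in `common`.
  B : V → V → Set
  B u v = u ~ v × (∀ s t → Common u v s → Common u v t → s ≡ t)

  B-sym : ∀ {u v} → B u v → B v u
  B-sym (a , f) = ~-sym a , λ s t c d → f s t (common-sym c) (common-sym d)

  B-~ : ∀ {u v} → B u v → u ~ v
  B-~ = proj₁

  common-at : ∀ {u v t p} → u ~ v → At u p v → Common u v t → At u (suc p) t ⊎ (∃ λ q → p ≡ suc q × At u q t)
  common-at uv at (ut , vt) with ~-at ut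
  ... | q , atq with at-near at atq vt
  ... | inj₁ refl = inj₁ atq
  ... | inj₂ e = inj₂ (q , e , atq)

  at-common : ∀ {u v t p} → At u p v → At u (suc p) t → Common u v t
  at-common a b = at-~ b , at-next a b

  at-common' : ∀ {u v t p} → At u (suc p) v → At u p t → Common u v t
  at-common' a b = at-~ b , ~-sym (at-next b a)

  -- In the link of `u` a common neighbour of `u` and `v` stands next to `v`, which leaves two
  -- places.
  no-three-common : ∀ {u v r s t} → u ~ v → Common u v r → Common u v s → Common u v t → r ≢ s → s ≢ t → r ≢ t → ⊥
  no-three-common uv cr cs ct rs st rt with ~-at uv
  ... | p , at with common-at uv at cr | common-at uv at cs | common-at uv at ct
  ... | inj₁ a | inj₁ b | _ = rs (at-fun a b)
  ... | inj₁ a | inj₂ _ | inj₁ c = rt (at-fun a c)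
  ... | inj₂ _ | inj₁ b | inj₁ c = st (at-fun b c)
  ... | inj₂ (q , refl , a) | inj₂ (q' , refl , b) | _ = rs (at-fun a b)
  ... | inj₂ (q , refl , a) | inj₁ _ | inj₂ (q' , refl , b) = rt (at-fun a b)
  ... | inj₁ _ | inj₂ (q , refl , a) | inj₂ (q' , refl , b) = st (at-fun a b)

  -- At an end of the link, `v` has a neighbour in the link on one side only.
  end-B : ∀ {u v p} → At u p v → p ≡ 0 ⊎ suc p ≡ deg u → B u v
  end-B {u} {v} {p} at e = at-~ at , go e
    where
    go : p ≡ 0 ⊎ suc p ≡ deg u → ∀ s t → Common u v s → Common u v t → s ≡ t
    go e s t cs ct with common-at (at-~ at) at cs | common-at (at-~ at) at ct
    go e s t cs ct | inj₁ a | inj₁ b = at-fun a b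
    go e s t cs ct | inj₂ (q , refl , a) | inj₂ (.q , refl , b) = at-fun a b
    go (inj₁ refl) s t cs ct | _ | inj₂ (q , () , a)
    go (inj₂ e) s t cs ct | inj₁ a | inj₂ _ = ⊥-elim (<-irrefl e (at-< a))
    go (inj₂ e) s t cs ct | inj₂ _ | inj₁ a = ⊥-elim (<-irrefl e (at-< a))

  B-end : ∀ {u v p} → At u p v → B u v → p ≡ 0 ⊎ suc p ≡ deg u
  B-end {p = zero} at b = inj₁ refl
  B-end {u} {v} {suc p} at b with m≤n⇒m<n∨m≡n (at-< at)
  ... | inj₂ e = inj₂ e
  ... | inj₁ l with <-at {u} {p} (<-trans (n<1+n p) (at-< at)) | <-at {u} {suc (suc p)} l
  ... | s , ats | t , att with proj₂ b s t (at-common' at ats) (at-common at att)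
  ... | refl with at-inj ats att
  ... | e = ⊥-elim (<-irrefl e (m<n⇒m<1+n ≤-refl))

  B? : ∀ u v → Dec (B u v)
  B? u v with u ~? v
  ... | no ¬a = no λ b → ¬a (proj₁ b)
  ... | yes a with ~-at a
  ... | p , at with p ≟ⁿ 0 | suc p ≟ⁿ deg u
  ... | yes e | _ = yes (end-B at (inj₁ e))
  ... | no _ | yes e = yes (end-B at (inj₂ e))
  ... | no e | no e' = no λ b → [ e , e' ]′ (B-end at b)

  interior : ∀ {u v} → u ~ v → ¬ B u v → ∃ λ s → ∃ λ t → Common u v s × Common u v t × s ≢ t
  interior {u} {v} a ¬b with ~-at a
  ... | zero , at = ⊥-elim (¬b (end-B at (inj₁ refl)))
  ... | suc p , at with m≤n⇒m<n∨m≡n (at-< at)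
  ... | inj₂ e = ⊥-elim (¬b (end-B at (inj₂ e)))
  ... | inj₁ l with <-at {u} {p} (<-trans (n<1+n p) (at-< at)) | <-at {u} {suc (suc p)} l
  ... | s , ats | t , att = s , t , at-common' at ats , at-common at att , λ { refl → <-irrefl (at-inj ats att) (m<n⇒m<1+n ≤-refl) }

  -- In terms of the surface, `F` is a union of boundary cycles.
  closed-sub : (V → Bool) → Set
  closed-sub F = ∀ {u v} → B u v → F u ≡ F v

  -- Run F s t t': in the link of s, the vertices t and t' enclose a nonempty interval contained in F.
  Run↑ : (V → Bool) → V → V → V → Set
  Run↑ F s t t' = ∃ λ l → ∃ λ r → At s l t × At s r t' × suc l < r × F t ≡ false × F t' ≡ false ×
    (∀ p v → l < p → p < r → At s p v → F v ≡ true)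

  Run : (V → Bool) → V → V → V → Set
  Run F s t t' = Run↑ F s t t' ⊎ Run↑ F s t' t

  run-sym : ∀ {F s t t'} → Run F s t t' → Run F s t' t
  run-sym = swap

  run-≁ : ∀ {F s t t'} → Run F s t t' → ¬ (t ~ t')
  run-≁ (inj₁ (l , r , a , b , lt , _)) e with at-near a b e
  ... | inj₁ refl = <-irrefl refl lt
  ... | inj₂ refl = <-irrefl refl (<-trans (<-trans lt (n<1+n r)) (n<1+n (suc r)))
  run-≁ (inj₂ (l , r , a , b , lt , _)) e with at-near a b (~-sym e)
  ... | inj₁ refl = <-irrefl refl lt
  ... | inj₂ refl = <-irrefl refl (<-trans (<-trans lt (n<1+n r)) (n<1+n (suc r)))

  run-~ : ∀ {F s t t'} → Run F s t t' → s ~ t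
  run-~ (inj₁ (l , r , a , b , _)) = at-~ a
  run-~ (inj₂ (l , r , a , b , _)) = at-~ b

  run-≢ : ∀ {F s t t'} → Run F s t t' → t ≢ t'
  run-≢ (inj₁ (l , r , a , b , lt , _)) refl = <-irrefl (at-inj a b) (<-trans (n<1+n l) lt)
  run-≢ (inj₂ (l , r , a , b , lt , _)) refl = <-irrefl (at-inj a b) (<-trans (n<1+n l) lt)

  run-∉ : ∀ {F s t t'} → Run F s t t' → F t ≡ false
  run-∉ (inj₁ (l , r , a , b , lt , f , f' , _)) = f
  run-∉ (inj₂ (l , r , a , b , lt , f , f' , _)) = f'

  opaque
    -- The entry of the interval next to `t` completes a triangle with `s` and `t`.
    run-face : ∀ {F s t t'} → Run F s t t' → ∃ λ f → F f ≡ true × s ~ f × t ~ f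
    run-face {F} {s} (inj₁ (l , r , a , b , lt , _ , _ , int)) with <-at {s} {suc l} (<-trans lt (at-< b))
    ... | f , at = f , int _ _ ≤-refl lt at , at-~ at , at-next a at
    run-face {F} {s} (inj₂ (l , suc r , a , b , lt , _ , _ , int)) with <-at {s} {r} (<-trans (n<1+n r) (at-< b))
    ... | f , at = f , int _ _ (s≤s⁻¹ lt) ≤-refl at , at-~ at , ~-sym (at-next at b)

  private
    -- Membership in F by position; positions outside the link are junk (false).
    φ : (V → Bool) → V → ℕ → Bool
    φ F s p with p <? deg s
    ... | yes l = F (proj₁ (<-at {s} l))
    ... | no _ = false

    φ-at : ∀ F {s p v} → At s p v → φ F s p ≡ F v
    φ-at F {s} {p} at with p <? deg s
    ... | yes l = cong F (at-fun (proj₂ (<-at {s} l)) at)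
    ... | no ¬l = ⊥-elim (¬l (at-< at))

  opaque
    -- Both ends of the link of `s` are boundary neighbours of `s` and so lie outside `F` like `s`
    -- itself. Hence the interval of `F` that starts with `f` beside `t` ends before the link does.
    face-run : ∀ {F s t f} → closed-sub F → F s ≡ false → F t ≡ false → F f ≡ true → s ~ t → s ~ f → t ~ f → ∃ λ t' → Run F s t t'
    face-run {F} {s} {t} {f} cl fs ft ff st sf tf with ~-at st | ~-at sf
    ... | p , att | q , atf with at-near att atf tf
    ... | inj₁ refl with <-at {s} {pred (deg s)} (≤-reflexive (suc-pred (deg s) {{>-nonZero (deg≥1 s)}}))
    ... | z , atz with search-right (φ F s) (pred (deg s) ∸ suc p) (suc p)
                         (trans (cong (φ F s) (m∸n+n≡m (pred-mono-≤ (at-< atf)))) (trans (φ-at F atz) (trans (≡sym (cl (end-B atz (inj₂ (suc-pred (deg s) {{>-nonZero (deg≥1 s)}}))))) fs)))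
                         (trans (φ-at F atf) ff)
    ... | r , p<r , r≤ , φr , int with <-at {s} {r} (≤-trans (s≤s (≤-trans r≤ (≤-reflexive (m∸n+n≡m (pred-mono-≤ (at-< atf)))))) (≤-reflexive (suc-pred (deg s) {{>-nonZero (deg≥1 s)}})))
    ... | t' , att' = t' , inj₁ (p , r , att , att' , p<r , ft , trans (≡sym (φ-at F att')) φr , λ a v l1 l2 at → trans (≡sym (φ-at F at)) (int a l1 l2))
    face-run {F} {s} {t} {f} cl fs ft ff st sf tf | p , att | q , atf | inj₂ refl with <-at {s} {0} (deg≥1 s)
    ... | z , atz with search-left (φ F s) (trans (φ-at F atz) (trans (≡sym (cl (end-B atz (inj₁ refl)))) fs)) q (trans (φ-at F atf) ff)
    ... | l , l<q , φl , int with <-at {s} {l} (<-trans l<q (at-< atf))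
    ... | t' , att' = t' , inj₂ (l , suc q , att' , att , s≤s l<q , trans (≡sym (φ-at F att')) φl , ft , λ a v l1 l2 at → trans (≡sym (φ-at F at)) (int a l1 (s≤s⁻¹ l2)))

  opaque
    -- Going down the link from `f` one leaves `F` at some `t`, at the latest in position 0; from
    -- there `face-run` applies.
    sees-run : ∀ {F s f} → closed-sub F → F s ≡ false → F f ≡ true → s ~ f → ∃ λ t → ∃ λ t' → Run F s t t'
    sees-run {F} {s} {f} cl fs ff sf with ~-at sf | <-at {s} {0} (deg≥1 s)
    ... | q , atf | z , atz with search-left (φ F s) (trans (φ-at F atz) (trans (≡sym (cl (end-B atz (inj₁ refl)))) fs)) q (trans (φ-at F atf) ff)
    ... | l , l<q , φl , int with <-at {s} {l} (<-trans l<q (at-< atf)) | <-at {s} {suc l} (≤-trans (s≤s l<q) (at-< atf))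
    ... | t , att | f' , atf' = t , face-run cl fs (trans (≡sym (φ-at F att)) φl) (trans (≡sym (φ-at F atf')) (int _ ≤-refl l<q)) (at-~ att) (at-~ atf') (at-next att atf')

  opaque
    -- The triangle at the end `t` of the run, read in the link of `t`, shows `s` beside a member of
    -- `F`.
    run-flip : ∀ {F s t t'} → closed-sub F → F s ≡ false → Run F s t t' → ∃ λ t'' → Run F t s t''
    run-flip cl fs r with run-face r
    ... | f , ff , sf , tf = face-run cl (run-∉ r) fs ff (~-sym (run-~ r)) tf sf

  -- Equal ends enclose the same positions, and there is at least one.
  run-disjoint : ∀ {F F' s t t'} → (∀ v → F v ≡ true → F' v ≡ true → ⊥) → Run F s t t' → Run F' s t t' → ⊥
  run-disjoint {s = s} dis (inj₁ (l , r , a , b , lt , _ , _ , int)) (inj₁ (l' , r' , a' , b' , lt' , _ , _ , int')) with at-inj a a' | at-inj b b' | <-at {s} {suc l} (<-trans lt (at-< b))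
  ... | refl | refl | f , at = dis f (int _ _ ≤-refl lt at) (int' _ _ ≤-refl lt at)
  run-disjoint {s = s} dis (inj₂ (l , r , a , b , lt , _ , _ , int)) (inj₂ (l' , r' , a' , b' , lt' , _ , _ , int')) with at-inj a a' | at-inj b b' | <-at {s} {suc l} (<-trans lt (at-< b))
  ... | refl | refl | f , at = dis f (int _ _ ≤-refl lt at) (int' _ _ ≤-refl lt at)
  run-disjoint dis (inj₁ (l , r , a , b , lt , _)) (inj₂ (l' , r' , a' , b' , lt' , _)) with at-inj a b' | at-inj b a'
  ... | refl | refl = <-asym (<-trans (n<1+n l) lt) (<-trans (n<1+n r) lt')
  run-disjoint dis (inj₂ (l , r , a , b , lt , _)) (inj₁ (l' , r' , a' , b' , lt' , _)) with at-inj a b' | at-inj b a'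
  ... | refl | refl = <-asym (<-trans (n<1+n l) lt) (<-trans (n<1+n r) lt')

  run-inside : ∀ {F s t t' v p q r} → Run F s t t' → At s p t → At s q v → At s r t' → F v ≡ false → (p < q × q < r) ⊎ (r < q × q < p) → ⊥
  run-inside (inj₁ (l , r , a , b , lt , _ , _ , int)) p q r' fv h with at-inj a p | at-inj b r'
  run-inside (inj₁ (l , r , a , b , lt , _ , _ , int)) p q r' fv (inj₁ (x , y)) | refl | refl = true≢false (int _ _ x y q) fv
  run-inside (inj₁ (l , r , a , b , lt , _ , _ , int)) p q r' fv (inj₂ (x , y)) | refl | refl = <-asym (<-trans x y) (<-trans (n<1+n l) lt)
  run-inside (inj₂ (l , r , a , b , lt , _ , _ , int)) p q r' fv h with at-inj a r' | at-inj b p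
  run-inside (inj₂ (l , r , a , b , lt , _ , _ , int)) p q r' fv (inj₂ (x , y)) | refl | refl = true≢false (int _ _ x y q) fv
  run-inside (inj₂ (l , r , a , b , lt , _ , _ , int)) p q r' fv (inj₁ (x , y)) | refl | refl = <-asym (<-trans x y) (<-trans (n<1+n l) lt)

  -- One of the three vertices lies between the other two in the link of `s`, hence inside their
  -- run, although it is outside the set that fills this run.
  run-no-triangle : ∀ {F F' F'' s a b c} → Run F s a b → Run F' s b c → Run F'' s a c →
    F c ≡ false → F' a ≡ false → F'' b ≡ false → ⊥
  run-no-triangle ab bc ac fc fa fb with ~-at (run-~ ab) | ~-at (run-~ bc) | ~-at (run-~ (run-sym bc))
  ... | p , ata | q , atb | r , atc with <-cmp p q | <-cmp q r | <-cmp p r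
  ... | tri≈ _ refl _ | _ | _ = run-≢ ab (at-fun ata atb)
  ... | _ | tri≈ _ refl _ | _ = run-≢ bc (at-fun atb atc)
  ... | _ | _ | tri≈ _ refl _ = run-≢ ac (at-fun ata atc)
  ... | tri< x _ _ | tri< y _ _ | _ = run-inside ac ata atb atc fb (inj₁ (x , y))
  ... | tri> _ _ x | tri> _ _ y | _ = run-inside ac ata atb atc fb (inj₂ (y , x))
  ... | tri< x _ _ | tri> _ _ y | tri< z _ _ = run-inside ab ata atc atb fc (inj₁ (z , y))
  ... | tri< x _ _ | tri> _ _ y | tri> _ _ z = run-inside bc atb ata atc fa (inj₂ (z , x))
  ... | tri> _ _ x | tri< y _ _ | tri< z _ _ = run-inside bc atb ata atc fa (inj₁ (x , z))
  ... | tri> _ _ x | tri< y _ _ | tri> _ _ z = run-inside ab ata atc atb fc (inj₂ (y , z))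

  -- Adjacent `a` and `c` are consecutive in the link, so `b` lies on one side of both; the one
  -- nearer to `b` is then inside the run from `b` to the other.
  run-spread : ∀ {F F' s a b c} → Run F s a b → Run F' s b c → a ≢ c → F c ≡ false → F' a ≡ false → ¬ (a ~ c)
  run-spread ab bc a≢c fc fa ac with ~-at (run-~ ab) | ~-at (run-~ bc) | ~-at (run-~ (run-sym bc))
  ... | p , ata | q , atb | r , atc with <-cmp p q | <-cmp q r | at-near ata atc ac
  ... | tri≈ _ refl _ | _ | _ = run-≢ ab (at-fun ata atb)
  ... | _ | tri≈ _ refl _ | _ = run-≢ bc (at-fun atb atc)
  ... | tri< x _ _ | tri< y _ _ | inj₁ refl = <-irrefl refl (≤-trans y x)
  ... | tri< x _ _ | tri< y _ _ | inj₂ refl = <-asym (<-trans x y) (n<1+n r)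
  ... | tri> _ _ x | tri> _ _ y | inj₁ refl = <-asym (<-trans y x) (n<1+n p)
  ... | tri> _ _ x | tri> _ _ y | inj₂ refl = <-irrefl refl (≤-trans x y)
  ... | tri< x _ _ | tri> _ _ y | inj₁ refl = run-inside ab ata atc atb fc (inj₁ (n<1+n p , y))
  ... | tri< x _ _ | tri> _ _ y | inj₂ refl = run-inside bc atb ata atc fa (inj₂ (n<1+n r , x))
  ... | tri> _ _ x | tri< y _ _ | inj₁ refl = run-inside bc atb ata atc fa (inj₁ (x , n<1+n p))
  ... | tri> _ _ x | tri< y _ _ | inj₂ refl = run-inside ab ata atc atb fc (inj₂ (y , n<1+n r))

-- Lists without repetitions

module _ {A : Set} where

  ∉⇒Unique : {x : A} {xs : List A} → x ∉ xs → Unique xs → Unique (x ∷ xs)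
  ∉⇒Unique {x} {xs} nm u = All.tabulate (λ m e → nm (subst (_∈ xs) (≡sym e) m)) ∷ u

  Unique-++ : {xs ys : List A} → Unique xs → Unique ys → (∀ {v} → v ∈ xs → v ∈ ys → ⊥) → Unique (xs ++ ys)
  Unique-++ ux uy d = Unique.++⁺ ux uy λ (a , b) → d a b

  Unique-++ˡ : (xs : List A) {ys : List A} → Unique (xs ++ ys) → Unique xs
  Unique-++ˡ [] u = []
  Unique-++ˡ (x ∷ xs) (a ∷ u) = ∉⇒Unique (λ m → All.lookup a (∈-++⁺ˡ m) refl) (Unique-++ˡ xs u)

  Unique-disjoint : (xs : List A) {ys : List A} → Unique (xs ++ ys) → ∀ {v} → v ∈ xs → v ∈ ys → ⊥
  Unique-disjoint (x ∷ xs) (a ∷ u) (here refl) m = All.lookup a (∈-++⁺ʳ xs m) refl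
  Unique-disjoint (x ∷ xs) (a ∷ u) (there k) m = Unique-disjoint xs u k m

  Unique-resp-↭ : {xs ys : List A} → xs ↭ ys → Unique xs → Unique ys
  Unique-resp-↭ _↭_.refl u = u
  Unique-resp-↭ (_↭_.prep x p) u@(_ ∷ u') = ∉⇒Unique (λ m → ∉-head u (∈-resp-↭ (↭-sym p) m)) (Unique-resp-↭ p u')
  Unique-resp-↭ (_↭_.swap x y p) u@((x≢y ∷ _) ∷ u'@(_ ∷ u'')) =
    ∉⇒Unique (λ { (here refl) → x≢y refl ; (there m) → ∉-head u' (∈-resp-↭ (↭-sym p) m) })
      (∉⇒Unique (λ m → ∉-head u (there (∈-resp-↭ (↭-sym p) m))) (Unique-resp-↭ p u''))
  Unique-resp-↭ (_↭_.trans p q) u = Unique-resp-↭ q (Unique-resp-↭ p u)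

  Unique-⊆-length : {xs ys : List A} → Unique xs → (∀ {x} → x ∈ xs → x ∈ ys) → length xs ≤ length ys
  Unique-⊆-length {[]} u s = z≤n
  Unique-⊆-length {x ∷ xs} (a ∷ u) s with ∈-∃++ (s (here refl))
  ... | ys , zs , refl = ≤-trans (s≤s (Unique-⊆-length u go)) (≤-reflexive (≡sym (↭-length (shift x ys zs))))
    where
    go : ∀ {v} → v ∈ xs → v ∈ ys ++ zs
    go {v} m with ∈-resp-↭ (shift x ys zs) (s (there m))
    ... | here refl = ⊥-elim (All.lookup a m refl)
    ... | there k = k

-- Paths and cyclic orders

module Paths {A : Set} (_≟_ : (a b : A) → Dec (a ≡ b)) where

  data Path (R : A → A → Set) : A → A → List A → Set where
    [-] : ∀ {v} → Path R v v (v ∷ [])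
    _∷_ : ∀ {u w v l} → R u w → Path R w v l → Path R u v (u ∷ l)

  module _ {R : A → A → Set} where

    start-∈ : ∀ {u v l} → Path R u v l → u ∈ l
    start-∈ [-] = here refl
    start-∈ (r ∷ p) = here refl

    end-∈ : ∀ {u v l} → Path R u v l → v ∈ l
    end-∈ [-] = here refl
    end-∈ (r ∷ p) = there (end-∈ p)

    join : ∀ {u v w z l l'} → Path R u v l → R v w → Path R w z l' → Path R u z (l ++ l')
    join [-] r q = r ∷ q
    join (s ∷ p) r q = s ∷ join p r q

    rev : (∀ {a b} → R a b → R b a) → ∀ {u v l} → Path R u v l → ∃ λ l' → Path R v u l' × l' ↭ l
    rev sy [-] = _ , [-] , ↭-refl
    rev sy {u} (_∷_ {l = l} r p) with rev sy p
    ... | l' , p' , e = _ , join p' (sy r) [-] , ↭-trans (++-comm l' (u ∷ [])) (prep u e)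

    map-Path : {S : A → A → Set} → (∀ {a b} → R a b → S a b) → ∀ {u v l} → Path R u v l → Path S u v l
    map-Path f [-] = [-]
    map-Path f (r ∷ p) = f r ∷ map-Path f p

    record Split (u v z w : A) (c : List A) : Set where
      constructor splitting
      field
        {l₁ l₂} : List A
        before : Path R u z l₁
        joint : R z w
        after : Path R w v l₂
        whole : c ≡ l₁ ++ l₂

    split-after : ∀ {u v c z} → Path R u v c → z ∈ c → z ≡ v ⊎ ∃ λ w → Split u v z w c
    split-after [-] (here refl) = inj₁ refl
    split-after (r ∷ p) (here refl) = inj₂ (_ , splitting [-] r p refl)
    split-after (r ∷ p) (there m) with split-after p m
    ... | inj₁ e = inj₁ e
    ... | inj₂ (w , splitting b j a refl) = inj₂ (w , splitting (r ∷ b) j a refl)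

    split-before : ∀ {u v c w} → Path R u v c → w ∈ c → w ≡ u ⊎ ∃ λ z → Split u v z w c
    split-before [-] (here refl) = inj₁ refl
    split-before (r ∷ p) (here refl) = inj₁ refl
    split-before (r ∷ p) (there m) with split-before p m
    ... | inj₁ refl = inj₂ (_ , splitting [-] r p refl)
    ... | inj₂ (z , splitting b j a refl) = inj₂ (z , splitting (r ∷ b) j a refl)

    along : ∀ {u v c} (P : A → Set) → Path R u v c → (∀ {z w} → Split u v z w c → P z → P w) → P u → ∀ {x} → x ∈ c → P x
    along P [-] f pu (here refl) = pu
    along P (r ∷ p) f pu (here refl) = pu
    along P (r ∷ p) f pu (there m) = along P p (λ { (splitting b j a refl) → f (splitting (r ∷ b) j a refl) }) (f (splitting [-] r p refl) pu) m

  first : A → List A → A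
  first d [] = d
  first d (a ∷ _) = a

  -- Successor and predecessor in a list without repetitions; d is the value at the last (first) entry.
  next : A → List A → A → A
  next d [] z = d
  next d (a ∷ l) z with z ≟ a
  ... | yes _ = first d l
  ... | no _ = next d l z

  prev : A → List A → A → A
  prev d [] w = d
  prev d (a ∷ l) w with w ≟ a
  ... | yes _ = d
  ... | no _ = prev a l w

  module _ {R : A → A → Set} where

    next-end : ∀ {u v c d} → Path R u v c → Unique c → next d c v ≡ d
    next-end {v = v} [-] u with v ≟ v
    ... | yes _ = refl
    ... | no ne = refl
    next-end {u} {v} (r ∷ p) (a ∷ uq) with v ≟ u
    ... | yes refl = ⊥-elim (All.lookup a (end-∈ p) refl)
    ... | no _ = next-end p uq

    prev-start : ∀ {u v c d} → Path R u v c → prev d c u ≡ d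
    prev-start {u} [-] with u ≟ u
    ... | yes _ = refl
    ... | no ne = ⊥-elim (ne refl)
    prev-start {u} (r ∷ p) with u ≟ u
    ... | yes _ = refl
    ... | no ne = ⊥-elim (ne refl)

    first-start : ∀ {u v c d} → Path R u v c → first d c ≡ u
    first-start [-] = refl
    first-start (r ∷ p) = refl

    next-split : ∀ {u v z w c d} → Split {R} u v z w c → Unique c → next d c z ≡ w
    next-split {z = z} (splitting [-] j a refl) uq with z ≟ z
    ... | yes _ = first-start a
    ... | no ne = ⊥-elim (ne refl)
    next-split {u} {z = z} (splitting (r ∷ b) j a refl) (al ∷ uq) with z ≟ u
    ... | yes refl = ⊥-elim (All.lookup al (∈-++⁺ˡ (end-∈ b)) refl)
    ... | no _ = next-split (splitting b j a refl) uq

    prev-split : ∀ {u v z w c d} → Split {R} u v z w c → Unique c → prev d c w ≡ z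
    prev-split {z = z} {w = w} (splitting [-] j a refl) (al ∷ uq) with w ≟ z
    ... | yes refl = ⊥-elim (All.lookup al (start-∈ a) refl)
    ... | no _ = prev-start a
    prev-split {u} {w = w} (splitting (r ∷ b) j a refl) (al ∷ uq) with w ≟ u
    ... | yes refl = ⊥-elim (All.lookup al (∈-++⁺ʳ _ (start-∈ a)) refl)
    ... | no _ = prev-split (splitting b j a refl) uq

  record Cycle (R : A → A → Set) (c : List A) : Set where
    constructor cycle
    field
      {from to} : A
      path : Path R from to c
      close : R to from
      unique : Unique c

  -- The entries are fixed only up to permutation, so that tours of disjoint lists concatenate
  -- whatever their orders are.
  Tour : (A → A → Set) → List A → A → A → Set
  Tour R c u v = ∃ λ l → Path R u v l × l ↭ c

  module Order {R : A → A → Set} (R-sym : ∀ {a b} → R a b → R b a) (R-irrefl : ∀ {a} → R a a → ⊥) {c : List A} (cyc : Cycle R c) where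
    open Cycle cyc

    σ σ⁻ : A → A
    σ = next from c
    σ⁻ = prev to c

    private
      data SuccView (z : A) : Set where
        last : z ≡ to → σ z ≡ from → SuccView z
        inner : Split {R} from to z (σ z) c → SuccView z

      view : ∀ {z} → z ∈ c → SuccView z
      view m with split-after path m
      ... | inj₁ refl = last refl (next-end path unique)
      ... | inj₂ (w , s) = inner (subst (λ w → Split from to _ w c) (≡sym (next-split s unique)) s)

    σ-~ : ∀ {z} → z ∈ c → R z (σ z)
    σ-~ m with view m
    ... | last refl e = subst (R _) (≡sym e) close
    ... | inner s = Split.joint s

    σ-∈ : ∀ {z} → z ∈ c → σ z ∈ c
    σ-∈ m with view m
    ... | last _ e = subst (_∈ c) (≡sym e) (start-∈ path)
    ... | inner (splitting b j a e) = subst (σ _ ∈_) (≡sym e) (∈-++⁺ʳ _ (start-∈ a))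

    σ-tour : ∀ {z} → z ∈ c → Tour R c (σ z) z
    σ-tour m with view m
    ... | last refl e = c , subst (λ u → Path R u to c) (≡sym e) path , ↭-refl
    ... | inner (splitting {l₁} {l₂} b j a e) = l₂ ++ l₁ , join a close b , ↭-trans (++-comm l₂ l₁) (↭-reflexive (≡sym e))

    σ⁻σ : ∀ {z} → z ∈ c → σ⁻ (σ z) ≡ z
    σ⁻σ m with view m
    ... | last refl e = trans (cong σ⁻ e) (prev-start path)
    ... | inner s = prev-split s unique

    σσ⁻ : ∀ {w} → w ∈ c → σ (σ⁻ w) ≡ w
    σσ⁻ m with split-before path m
    ... | inj₁ refl = trans (cong σ (prev-start path)) (next-end path unique)
    ... | inj₂ (z , s) = trans (cong σ (prev-split s unique)) (next-split s unique)

    σ⁻-∈ : ∀ {w} → w ∈ c → σ⁻ w ∈ c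
    σ⁻-∈ m with split-before path m
    ... | inj₁ refl = subst (_∈ c) (≡sym (prev-start path)) (end-∈ path)
    ... | inj₂ (z , s@(splitting b j a e)) = subst (_∈ c) (≡sym (prev-split s unique)) (subst (z ∈_) (≡sym e) (∈-++⁺ˡ (end-∈ b)))

    -- From `z` the property is carried to the last entry, from there to the first one, and then
    -- along the whole list.
    σ-closed : (P : A → Set) → ∀ {z} → z ∈ c → P z → (∀ {u} → u ∈ c → P u → P (σ u)) → ∀ {w} → w ∈ c → P w
    σ-closed P {z} m pz f {w} = along P path (advance _ refl) from-P
      where
      advance : ∀ l → l ≡ c → ∀ {z w} → Split {R} from to z w l → P z → P w
      advance .c refl {z} {w} s@(splitting b j a e) pz = subst P (next-split s unique) (f (subst (z ∈_) (≡sym e) (∈-++⁺ˡ (end-∈ b))) pz)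
      to-P : P to
      to-P with view m
      ... | last refl _ = pz
      ... | inner (splitting {l₁} b j a e) =
        along P a (λ { (splitting {l₃} {l₄} b' j' a' refl) → advance _ (≡sym (trans e (≡sym (++-assoc l₁ l₃ l₄)))) (splitting (join b j b') j' a' refl) }) (f m pz) (end-∈ a)
      from-P : P from
      from-P = subst P (next-end path unique) (f (end-∈ path) to-P)

    -- A chord turns the cycle into a spanning path between the successors of its ends.
    rotate : ∀ {y g} → y ∈ c → g ∈ c → R y g → Tour R c (σ y) (σ g)
    rotate {y} {g} my mg yg with view my
    rotate {y} {g} my mg yg | last refl ey with view mg
    ... | last refl _ = ⊥-elim (R-irrefl yg)
    ... | inner (splitting {l₁} b j a e) with rev R-sym a
    ... | l₂' , a' , e' = l₁ ++ l₂' , subst (λ u → Path R u (σ g) (l₁ ++ l₂')) (≡sym ey) (join b (R-sym yg) a') , ↭-trans (++⁺ˡ l₁ e') (↭-reflexive (≡sym e))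
    rotate {y} {g} my mg yg | inner (splitting {l₁} {l₂} b j a e) with ∈-++⁻ l₁ (subst (g ∈_) e mg)
    rotate {y} {g} my mg yg | inner (splitting {l₁} {l₂} b j a e) | inj₁ m with split-after b m
    ... | inj₁ refl = ⊥-elim (R-irrefl yg)
    ... | inj₂ (w , splitting {l₃} {l₄} b' j' a' refl) with rev R-sym a'
    ... | l₄' , a'' , e' = _ , subst (λ u → Path R _ u _) (≡sym (next-split s unique)) (join a close (join b' (R-sym yg) a'')) ,
        ↭-trans (++⁺ˡ l₂ (++⁺ˡ l₃ e')) (↭-trans (++-comm l₂ _) (↭-reflexive (≡sym e)))
      where
      s : Split {R} from to g w c
      s = splitting b' j' (join a' j a) (trans e (++-assoc l₃ l₄ l₂))
    rotate {y} {g} my mg yg | inner (splitting {l₁} {l₂} b j a e) | inj₂ m with rev R-sym b | split-after a m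
    ... | l₁' , b' , e₁ | inj₁ refl = _ , subst (λ u → Path R (σ y) u (l₂ ++ l₁')) (≡sym (next-end path unique)) (join a (R-sym yg) b') ,
        ↭-trans (++⁺ˡ l₂ e₁) (↭-trans (++-comm l₂ _) (↭-reflexive (≡sym e)))
    ... | l₁' , b' , e₁ | inj₂ (w , splitting {l₃} {l₄} b'' j' a' refl) with rev R-sym a'
    ... | l₄' , a'' , e₄ = _ , subst (λ u → Path R _ u _) (≡sym (next-split s unique)) (join b'' (R-sym yg) (join b' (R-sym close) a'')) ,
        ↭-trans (++⁺ˡ l₃ (++⁺ e₁ e₄)) (↭-trans (Perm.shifts l₃ l₁) (↭-reflexive (≡sym e)))
      where
      s : Split {R} from to g w c
      s = splitting (join b j b'') j' a' (trans e (≡sym (++-assoc l₁ l₃ l₄)))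

    private
      subst₂′ : ∀ {u u' v v' l} → u ≡ u' → v ≡ v' → Path R u v l → Path R u' v' l
      subst₂′ refl refl p = p

    -- The mirror image of `rotate`: backwards from `σ⁻ y` to `g`, over the chord to `y`, and
    -- forwards to `σ⁻ g`.
    rotate⁻ : ∀ {y g} → y ∈ c → g ∈ c → R y g → Tour R c (σ⁻ y) (σ⁻ g)
    rotate⁻ {y} {g} my mg yg with split-before path my
    rotate⁻ {y} {g} my mg yg | inj₁ refl with split-before path mg
    ... | inj₁ refl = ⊥-elim (R-irrefl yg)
    ... | inj₂ (w , s@(splitting {l₁} {l₂} b j a e)) with rev R-sym a
    ... | l₂' , a' , e' = l₂' ++ l₁ , subst₂′ (≡sym (prev-start path)) (≡sym (prev-split s unique)) (join a' (R-sym yg) b) ,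
        ↭-trans (++⁺ʳ l₁ e') (↭-trans (++-comm l₂ l₁) (↭-reflexive (≡sym e)))
    rotate⁻ {y} {g} my mg yg | inj₂ (z , s@(splitting {l₁} {l₂} b j a e)) with ∈-++⁻ l₁ (subst (g ∈_) e mg)
    rotate⁻ {y} {g} my mg yg | inj₂ (z , s@(splitting {l₁} {l₂} b j a e)) | inj₁ m with split-before b m
    ... | inj₁ refl with rev R-sym b
    ... | l₁' , b' , e' = l₁' ++ l₂ , subst₂′ (≡sym (prev-split s unique)) (≡sym (prev-start path)) (join b' (R-sym yg) a) ,
        ↭-trans (++⁺ʳ l₂ e') (↭-reflexive (≡sym e))
    rotate⁻ {y} {g} my mg yg | inj₂ (z , s@(splitting {l₁} {l₂} b j a e)) | inj₁ m | inj₂ (w , splitting {l₃} {l₄} b' j' a' refl) with rev R-sym a'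
    ... | l₄' , a'' , e' = _ , subst₂′ (≡sym (prev-split s unique)) (≡sym (prev-split s' unique)) (join a'' (R-sym yg) (join a close b')) ,
        ↭-trans (++⁺ʳ _ e') (↭-trans (++⁺ˡ l₄ (++-comm l₂ l₃)) (↭-trans (Perm.shifts l₄ l₃) (↭-trans (↭-reflexive (≡sym (++-assoc l₃ l₄ l₂))) (↭-reflexive (≡sym e)))))
      where
      s' : Split {R} from to w g c
      s' = splitting b' j' (join a' j a) (trans e (++-assoc l₃ l₄ l₂))
    rotate⁻ {y} {g} my mg yg | inj₂ (z , s@(splitting {l₁} {l₂} b j a e)) | inj₂ m with split-before a m
    ... | inj₁ refl = ⊥-elim (R-irrefl yg)
    ... | inj₂ (w , splitting {l₃} {l₄} b' j' a' refl) with rev R-sym b | rev R-sym a'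
    ... | l₁' , b'' , e₁ | l₄' , a'' , e₄ = _ , subst₂′ (≡sym (prev-split s unique)) (≡sym (prev-split s' unique)) (join b'' (R-sym close) (join a'' (R-sym yg) b')) ,
        ↭-trans (++⁺ e₁ (++⁺ʳ l₃ e₄)) (↭-trans (++⁺ˡ l₁ (++-comm l₄ l₃)) (↭-reflexive (≡sym e)))
      where
      s' : Split {R} from to w g c
      s' = splitting (join b j b') j' a' (trans e (≡sym (++-assoc l₁ l₃ l₄)))

-- Counting

⟦_⟧ : Bool → ℕ
⟦ true ⟧ = 1
⟦ false ⟧ = 0

module _ {A : Set} where

  ∑ : List A → (A → ℕ) → ℕ
  ∑ [] f = 0
  ∑ (x ∷ l) f = f x + ∑ l f

  ∑-mono : ∀ l {f g : A → ℕ} → (∀ {x} → x ∈ l → f x ≤ g x) → ∑ l f ≤ ∑ l g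
  ∑-mono [] h = z≤n
  ∑-mono (x ∷ l) h = +-mono-≤ (h (here refl)) (∑-mono l (λ m → h (there m)))

  ∑-cong : ∀ l {f g : A → ℕ} → (∀ {x} → x ∈ l → f x ≡ g x) → ∑ l f ≡ ∑ l g
  ∑-cong [] h = refl
  ∑-cong (x ∷ l) h = cong₂ _+_ (h (here refl)) (∑-cong l (λ m → h (there m)))

  ∑-+ : ∀ l (f g : A → ℕ) → ∑ l (λ x → f x + g x) ≡ ∑ l f + ∑ l g
  ∑-+ [] f g = refl
  ∑-+ (x ∷ l) f g = begin
    (f x + g x) + ∑ l (λ x → f x + g x) ≡⟨ cong ((f x + g x) +_) (∑-+ l f g) ⟩
    (f x + g x) + (∑ l f + ∑ l g) ≡⟨ +-assoc (f x) (g x) _ ⟩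
    f x + (g x + (∑ l f + ∑ l g)) ≡⟨ cong (f x +_) (≡sym (+-assoc (g x) _ _)) ⟩
    f x + ((g x + ∑ l f) + ∑ l g) ≡⟨ cong (λ k → f x + (k + ∑ l g)) (+-comm (g x) _) ⟩
    f x + ((∑ l f + g x) + ∑ l g) ≡⟨ cong (f x +_) (+-assoc (∑ l f) _ _) ⟩
    f x + (∑ l f + (g x + ∑ l g)) ≡⟨ ≡sym (+-assoc (f x) _ _) ⟩
    (f x + ∑ l f) + (g x + ∑ l g) ∎
    where open ≡-Reasoning

  ∑-one : ∀ l → ∑ l (λ _ → 1) ≡ length l
  ∑-one [] = refl
  ∑-one (x ∷ l) = cong suc (∑-one l)

  ∑-++ : ∀ xs ys (f : A → ℕ) → ∑ (xs ++ ys) f ≡ ∑ xs f + ∑ ys f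
  ∑-++ [] ys f = refl
  ∑-++ (x ∷ xs) ys f = trans (cong (f x +_) (∑-++ xs ys f)) (≡sym (+-assoc (f x) _ _))

  ∑-⊆ : ∀ {xs ys} (f : A → ℕ) → Unique xs → (∀ {x} → x ∈ xs → x ∈ ys) → ∑ xs f ≤ ∑ ys f
  ∑-⊆ {[]} f u s = z≤n
  ∑-⊆ {x ∷ xs} f (a ∷ u) s with ∈-∃++ (s (here refl))
  ... | ys , zs , refl = begin
    f x + ∑ xs f ≤⟨ +-monoʳ-≤ (f x) (∑-⊆ f u go) ⟩
    f x + ∑ (ys ++ zs) f ≡⟨ cong (f x +_) (∑-++ ys zs f) ⟩
    f x + (∑ ys f + ∑ zs f) ≡⟨ ≡sym (+-assoc (f x) _ _) ⟩
    (f x + ∑ ys f) + ∑ zs f ≡⟨ cong (_+ ∑ zs f) (+-comm (f x) _) ⟩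
    (∑ ys f + f x) + ∑ zs f ≡⟨ +-assoc (∑ ys f) _ _ ⟩
    ∑ ys f + (f x + ∑ zs f) ≡⟨ ≡sym (∑-++ ys (x ∷ zs) f) ⟩
    ∑ (ys ++ x ∷ zs) f ∎
    where
    open ≤-Reasoning
    go : ∀ {v} → v ∈ xs → v ∈ ys ++ zs
    go {v} m with ∈-resp-↭ (shift x ys zs) (s (there m))
    ... | here refl = ⊥-elim (All.lookup a m refl)
    ... | there k = k

  count : (A → Bool) → List A → ℕ
  count P l = ∑ l (λ v → ⟦ P v ⟧)

  select : (A → Bool) → List A → List A
  select P [] = []
  select P (x ∷ l) = if P x then x ∷ select P l else select P l

  select-length : ∀ P l → length (select P l) ≡ count P l
  select-length P [] = refl
  select-length P (x ∷ l) with P x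
  ... | true = cong suc (select-length P l)
  ... | false = select-length P l

  select-∈ : ∀ P {l v} → v ∈ l → P v ≡ true → v ∈ select P l
  select-∈ P {x ∷ l} m e with P x in eq
  select-∈ P {x ∷ l} (here refl) e | true = here refl
  select-∈ P {x ∷ l} (there m) e | true = there (select-∈ P m e)
  select-∈ P {x ∷ l} (here refl) e | false = ⊥-elim (true≢false e eq)
  select-∈ P {x ∷ l} (there m) e | false = select-∈ P m e

  ∈-select : ∀ P l {v} → v ∈ select P l → v ∈ l × P v ≡ true
  ∈-select P (x ∷ l) m with P x in eq
  ∈-select P (x ∷ l) (here refl) | true = here refl , eq
  ∈-select P (x ∷ l) (there m) | true = there (proj₁ (∈-select P l m)) , proj₂ (∈-select P l m)
  ∈-select P (x ∷ l) m | false = there (proj₁ (∈-select P l m)) , proj₂ (∈-select P l m)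

  Holds : (A → Bool) → List A → List A → Set
  Holds P l xs = ∀ {v} → v ∈ xs → v ∈ l × P v ≡ true

  count-≥ : ∀ P l {xs} → Unique xs → Holds P l xs → length xs ≤ count P l
  count-≥ P l u h = ≤-trans (Unique-⊆-length u (λ m → select-∈ P (proj₁ (h m)) (proj₂ (h m)))) (≤-reflexive (select-length P l))

  count-pos : ∀ P l → 1 ≤ count P l → ∃ λ v → v ∈ l × P v ≡ true
  count-pos P l le with select P l in eq | select-length P l
  ... | [] | e = ⊥-elim (<-irrefl e le)
  ... | x ∷ _ | _ = x , ∈-select P l (subst (x ∈_) (≡sym eq) (here refl))

  count-zero : ∀ P l → (∀ {v} → v ∈ l → P v ≡ true → ⊥) → count P l ≡ 0
  count-zero P l h with m≤n⇒m<n∨m≡n (z≤n {count P l})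
  ... | inj₂ e = ≡sym e
  ... | inj₁ lt with count-pos P l lt
  ... | v , m , e = ⊥-elim (h m e)

  count-none : ∀ P l → count P l ≡ 0 → ∀ {v} → v ∈ l → P v ≡ true → ⊥
  count-none P l e m pv = <-irrefl (≡sym e) (≤-trans (count-≥ P l {_ ∷ []} ([] ∷ []) (λ { (here refl) → m , pv })) ≤-refl)

  pair : ∀ {a b : A} → a ≢ b → Unique (a ∷ b ∷ [])
  pair ne = ∉⇒Unique (λ { (here e) → ne e }) (∉⇒Unique (λ ()) [])

  distinct₃ : ∀ {a b c : A} → a ≢ b → a ≢ c → b ≢ c → Unique (a ∷ b ∷ c ∷ [])
  distinct₃ ab ac bc = ∉⇒Unique (λ { (here e) → ab e ; (there (here e)) → ac e }) (pair bc)

  distinct₄ : ∀ {a b c d : A} → a ≢ b → a ≢ c → a ≢ d → b ≢ c → b ≢ d → c ≢ d → Unique (a ∷ b ∷ c ∷ d ∷ [])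
  distinct₄ ab ac ad bc bd cd = ∉⇒Unique (λ { (here e) → ab e ; (there (here e)) → ac e ; (there (there (here e))) → ad e }) (distinct₃ bc bd cd)

  select-unique : ∀ (P : A → Bool) l → Unique l → Unique (select P l)
  select-unique P [] _ = []
  select-unique P (x ∷ l) u@(_ ∷ u') with P x
  ... | true = ∉⇒Unique (λ m → ∉-head u (proj₁ (∈-select P l m))) (select-unique P l u')
  ... | false = select-unique P l u'

  count-one : ∀ P l → count P l ≤ 1 → (_≟′_ : (a b : A) → Dec (a ≡ b)) → ∀ {v w} → v ∈ l → P v ≡ true → w ∈ l → P w ≡ true → v ≡ w
  count-one P l le _≟′_ {v} {w} mv pv mw pw with v ≟′ w
  ... | yes e = e
  ... | no ne = ⊥-elim (<-irrefl refl (≤-trans (count-≥ P l (pair ne) (λ { (here refl) → mv , pv ; (there (here refl)) → mw , pw })) le))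

  any-in : (P : A → Bool) (l : List A) → (∃ λ v → v ∈ l × P v ≡ true) ⊎ (∀ {v} → v ∈ l → P v ≡ false)
  any-in P [] = inj₂ λ ()
  any-in P (x ∷ l) with P x in eq | any-in P l
  ... | true | _ = inj₁ (x , here refl , eq)
  ... | false | inj₁ (v , m , e) = inj₁ (v , there m , e)
  ... | false | inj₂ f = inj₂ λ { (here refl) → eq ; (there m) → f m }

  module _ (_≟′_ : (a b : A) → Dec (a ≡ b)) where
    open import Data.List.Membership.DecPropositional _≟′_ using (_∈?_)

    count-full : ∀ P l {xs} → Unique xs → Holds P l xs → count P l ≤ length xs → ∀ {v} → v ∈ l → P v ≡ true → v ∈ xs
    count-full P l {xs} u h le {v} m pv with v ∈? xs
    ... | yes k = k
    ... | no k = ⊥-elim (<-irrefl refl (≤-trans (count-≥ P l (∉⇒Unique k u) λ { (here refl) → m , pv ; (there q) → h q }) le))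

    pick-other : ∀ (P : A → Bool) (l xs : List A) → Unique l → length xs < count P l → ∃ λ v → v ∈ l × P v ≡ true × v ∉ xs
    pick-other P l xs u lt with any-in (λ v → P v ∧ not ⌊ v ∈? xs ⌋) l
    ... | inj₁ (v , m , e) = v , m , ∧-fst e , out v (∧-snd {P v} e)
      where
      out : ∀ v → not ⌊ v ∈? xs ⌋ ≡ true → v ∉ xs
      out v e with v ∈? xs
      ... | no n = n
    ... | inj₂ f = ⊥-elim (<-irrefl refl (≤-trans lt (≤-trans (≤-reflexive (≡sym (select-length P l))) (Unique-⊆-length (select-unique P l u) sub))))
      where
      sub : ∀ {v} → v ∈ select P l → v ∈ xs
      sub {v} m with ∈-select P l m
      ... | mv , pv with v ∈? xs | f mv
      ... | yes k | _ = k
      ... | no k | g = ⊥-elim (true≢false (∧-both pv refl) g)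

-- Rings of vertices and their gaps

record Ring {A : Set} (Z : List A) : Set where
  field
    σ σ⁻ : A → A
    σ-∈ : ∀ {z} → z ∈ Z → σ z ∈ Z
    σ⁻-∈ : ∀ {z} → z ∈ Z → σ⁻ z ∈ Z
    σσ⁻ : ∀ {z} → z ∈ Z → σ (σ⁻ z) ≡ z
    σ⁻σ : ∀ {z} → z ∈ Z → σ⁻ (σ z) ≡ z
    unique : Unique Z

  gap : (A → Bool) → A → Bool
  gap S v = S v ∧ not (S (σ v))

  -- Non-members that follow a member are counted by `gap`, those that follow a non-member by this,
  -- each through its predecessor.
  empty-gap : (A → Bool) → A → Bool
  empty-gap S v = not (S v) ∧ not (S (σ v))

  map-σ-Unique : ∀ xs → (∀ {x} → x ∈ xs → x ∈ Z) → Unique xs → Unique (map σ xs)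
  map-σ-Unique [] s u = []
  map-σ-Unique (x ∷ xs) s (a ∷ u) = ∉⇒Unique no-dup (map-σ-Unique xs (λ m → s (there m)) u)
    where
    no-dup : σ x ∉ map σ xs
    no-dup m with ∈-map⁻ σ m
    ... | y , my , e = All.lookup a my (trans (≡sym (σ⁻σ (s (here refl)))) (trans (cong σ⁻ e) (σ⁻σ (s (there my)))))

  -- The vertices whose successor lies outside `S` are the gaps and the empty gaps. As the successor
  -- is injective, there are at most as many of them as non-members of `S`.
  gap-bound : ∀ S → count S Z + (count (gap S) Z + count (empty-gap S) Z) ≤ length Z
  gap-bound S = begin
    count S Z + (count (gap S) Z + count (empty-gap S) Z) ≡⟨ cong (count S Z +_) (≡sym (∑-+ Z _ _)) ⟩
    count S Z + ∑ Z (λ v → ⟦ gap S v ⟧ + ⟦ empty-gap S v ⟧) ≡⟨ cong (count S Z +_) (∑-cong Z (λ {v} _ → pointwise (S v) (S (σ v)))) ⟩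
    count S Z + ∑ Z (λ v → ⟦ not (S (σ v)) ⟧) ≡⟨ cong (count S Z +_) (≡sym (mapped Z)) ⟩
    count S Z + ∑ (map σ Z) (λ v → ⟦ not (S v) ⟧) ≤⟨ +-monoʳ-≤ (count S Z) (∑-⊆ _ (map-σ-Unique Z (λ m → m) unique) back) ⟩
    count S Z + ∑ Z (λ v → ⟦ not (S v) ⟧) ≡⟨ ≡sym (∑-+ Z _ _) ⟩
    ∑ Z (λ v → ⟦ S v ⟧ + ⟦ not (S v) ⟧) ≡⟨ ∑-cong Z (λ {v} _ → total (S v)) ⟩
    ∑ Z (λ _ → 1) ≡⟨ ∑-one Z ⟩
    length Z ∎
    where
    open ≤-Reasoning
    pointwise : ∀ a b → ⟦ a ∧ not b ⟧ + ⟦ not a ∧ not b ⟧ ≡ ⟦ not b ⟧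
    pointwise true b = +-identityʳ _
    pointwise false b = refl
    total : ∀ a → ⟦ a ⟧ + ⟦ not a ⟧ ≡ 1
    total true = refl
    total false = refl
    mapped : ∀ l → ∑ (map σ l) (λ v → ⟦ not (S v) ⟧) ≡ ∑ l (λ v → ⟦ not (S (σ v)) ⟧)
    mapped [] = refl
    mapped (x ∷ l) = cong (_ +_) (mapped l)
    back : ∀ {v} → v ∈ map σ Z → v ∈ Z
    back m with ∈-map⁻ σ m
    ... | y , my , refl = σ-∈ my

-- Boolean, so that a finite case analysis is settled by evaluation.
∀< : ℕ → (ℕ → Bool) → Bool
∀< zero P = true
∀< (suc m) P = P m ∧ ∀< m P

∀<-sound : ∀ m P → ∀< m P ≡ true → ∀ {k} → k < m → P k ≡ true
∀<-sound (suc m) P e {k} lt with m≤n⇒m<n∨m≡n (s≤s⁻¹ lt)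
... | inj₁ l = ∀<-sound m P (∧-snd {P m} e) l
... | inj₂ refl = ∧-fst e

-- Two obstacles seen from a ring

-- Two disjoint obstacles F true and F false seen from the vertices of Z, which are arranged in a ring.
-- S i v: the vertex v of Z sees F i.  Run i s t t': t and t' enclose an interval of F i in the link of s.
record Config : Set₁ where
  field
    A : Set
    _≟A_ : (a b : A) → Dec (a ≡ b)
    Z : List A
    ring : Ring Z
  open Ring ring public
  field
    _∼_ : A → A → Set
    ∼-sym : ∀ {a b} → a ∼ b → b ∼ a
    ∼-irrefl : ∀ {a} → a ∼ a → ⊥
    σ-∼ : ∀ {z} → z ∈ Z → z ∼ σ z
    S : Bool → A → Bool
    S-∈ : ∀ {i v} → S i v ≡ true → v ∈ Z
    run : Bool → A → A → A → Set
    run-exists : ∀ {i s} → S i s ≡ true → ∃ λ t → ∃ λ t' → run i s t t'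
    run-back : ∀ {i s t t'} → run i s t t' → ∃ λ t'' → run i t s t''
    run-swap : ∀ {i s t t'} → run i s t t' → run i s t' t
    run-∼ : ∀ {i s t t'} → run i s t t' → s ∼ t
    run-≁′ : ∀ {i s t t'} → run i s t t' → t ∼ t' → ⊥
    run-≢′ : ∀ {i s t t'} → run i s t t' → t ≢ t'
    run-S : ∀ {i s t t'} → run i s t t' → S i t ≡ true
    run-apart : ∀ {i s t t'} → run i s t t' → run (not i) s t t' → ⊥
    run-three : ∀ {i j k s a b c} → run i s a b → run j s b c → run k s a c → ⊥
    run-far : ∀ {i j s a b c} → run i s a b → run j s b c → a ≢ c → a ∼ c → ⊥
    -- On a single cycle, two consecutive vertices that see different obstacles would be the ends of
    -- a tour of `Z` that extends to a spanning path.
    barrier : ∀ {i v} → S i v ≡ true → S (not i) (σ v) ≡ true → ⊥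
    nonempty : ∀ i → ∃ λ v → S i v ≡ true
  any : A → Bool
  any v = S true v ∨ S false v
  iso : A → Bool
  iso v = not (any (σ v)) ∧ not (any (σ⁻ v))
  K : A → Bool
  K v = S true v ∧ S false v
  pure : Bool → A → Bool
  pure i v = S i v ∧ not (S (not i) v)
  I : Bool → A → Bool
  I i v = pure i v ∧ iso v
  J : Bool → A → Bool
  J i v = pure i v ∧ not (iso v)
  field
    -- The non-isolated seers of one obstacle must not close up into a whole cycle; this gives each
    -- kind at least one gap.
    exit : ∀ {i v} → J i v ≡ true → ∃ λ w → J i w ≡ true × gap any w ≡ true
    -- In the application `four i` says that obstacle `i` is a square.
    four : Bool → Bool
    isolated : ∀ {i} → four i ≡ true → ∃ λ p → ∃ λ p' → S i p ≡ true × S i p' ≡ true × iso p ≡ true × iso p' ≡ true × p ≢ p' × ¬ (p ∼ p')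

module Obstacles (C : Config) where
  open Config C

  S-any : ∀ i {v} → S i v ≡ true → any v ≡ true
  S-any true e = ∨-left e
  S-any false e = ∨-right e

  any-S : ∀ i {v} → any v ≡ true → S i v ≡ true ⊎ S (not i) v ≡ true
  any-S true e = ∨-elim e
  any-S false e with ∨-elim e
  ... | inj₁ a = inj₂ a
  ... | inj₂ b = inj₁ b

  K-S : ∀ i {v} → K v ≡ true → S i v ≡ true
  K-S true e = ∧-fst e
  K-S false e = ∧-snd e

  S-K : ∀ i {v} → S i v ≡ true → S (not i) v ≡ true → K v ≡ true
  S-K true a b = ∧-both a b
  S-K false a b = ∧-both b a

  pure-S : ∀ i {v} → pure i v ≡ true → S i v ≡ true
  pure-S i e = ∧-fst e

  S-split : ∀ i {v} → S i v ≡ true → K v ≡ true ⊎ pure i v ≡ true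
  S-split i {v} e with S (not i) v in eq
  ... | true = inj₁ (S-K i e eq)
  ... | false = inj₂ (∧-both e refl)

  barrier⁻ : ∀ {i v} → v ∈ Z → S i v ≡ true → S (not i) (σ⁻ v) ≡ true → ⊥
  barrier⁻ {i} {v} m e f = barrier f (trans (cong₂ S (not-involutive i) (σσ⁻ m)) e)

  K-gap : ∀ {v} → K v ≡ true → any (σ v) ≡ false
  K-gap {v} k with bool-cases (any (σ v))
  ... | inj₂ f = f
  ... | inj₁ t with any-S true t
  ... | inj₁ a = ⊥-elim (barrier (K-S false k) a)
  ... | inj₂ b = ⊥-elim (barrier (K-S true k) b)

  -- A non-isolated seer has a seer beside it on the ring. By the barrier this one sees the same
  -- obstacle only, and having `v` beside it, it is not isolated either.
  mate : ∀ {i v} → J i v ≡ true → ∃ λ w → J i w ≡ true × v ∼ w × (w ≡ σ v ⊎ w ≡ σ⁻ v)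
  mate {i} {v} j = go (bool-cases (any (σ v))) (bool-cases (any (σ⁻ v)))
    where
    v∈ : v ∈ Z
    v∈ = S-∈ (pure-S i (∧-fst j))
    next-pure : any (σ v) ≡ true → pure i (σ v) ≡ true
    next-pure t with any-S i t
    ... | inj₂ b = ⊥-elim (barrier (pure-S i (∧-fst j)) b)
    ... | inj₁ a with S-split i a
    ... | inj₁ k = ⊥-elim (barrier (pure-S i (∧-fst j)) (K-S (not i) k))
    ... | inj₂ p = p
    prev-pure : any (σ⁻ v) ≡ true → pure i (σ⁻ v) ≡ true
    prev-pure t with any-S i t
    ... | inj₂ b = ⊥-elim (barrier⁻ v∈ (pure-S i (∧-fst j)) b)
    ... | inj₁ a with S-split i a
    ... | inj₁ k = ⊥-elim (barrier⁻ v∈ (pure-S i (∧-fst j)) (K-S (not i) k))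
    ... | inj₂ p = p
    any-v : any v ≡ true
    any-v = S-any i (pure-S i (∧-fst j))
    go : any (σ v) ≡ true ⊎ any (σ v) ≡ false → any (σ⁻ v) ≡ true ⊎ any (σ⁻ v) ≡ false → ∃ λ w → J i w ≡ true × v ∼ w × (w ≡ σ v ⊎ w ≡ σ⁻ v)
    go (inj₁ t) _ = σ v , ∧-both (next-pure t) (not-false (¬true λ e → true≢false (trans (cong any (σ⁻σ v∈)) any-v) (not-true (∧-snd e)))) , σ-∼ v∈ , inj₁ refl
    go (inj₂ _) (inj₁ t) = σ⁻ v , ∧-both (prev-pure t) (not-false (¬true λ e → true≢false (trans (cong any (σσ⁻ v∈)) any-v) (not-true (∧-fst e)))) ,
      subst (_∼ σ⁻ v) (σσ⁻ v∈) (∼-sym (σ-∼ (σ⁻-∈ v∈))) , inj₂ refl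
    go (inj₂ f) (inj₂ f') = ⊥-elim (true≢false (∧-both (not-false f) (not-false f')) (not-true (∧-snd j)))

  ∼⇒≢ : ∀ {a b} → a ∼ b → a ≢ b
  ∼⇒≢ e refl = ∼-irrefl e

  -- Four distinct seers along a path `t' s t q`, obtained from a run at `s` and the run back at
  -- `t`. The obstacle itself need not be a square.
  record Square (i : Bool) (s t t' q : A) : Set where
    field
      at-s : run i s t t'
      at-t : run i t s q
      sq : s ≢ q
      t'q : t' ≢ q
    list-unique : Unique (s ∷ t ∷ t' ∷ q ∷ [])
    list-unique = distinct₄ (∼⇒≢ (run-∼ at-s)) (∼⇒≢ (run-∼ (run-swap at-s))) sq (run-≢′ at-s) (∼⇒≢ (run-∼ (run-swap at-t))) t'q

  square : ∀ {i s t t'} → run i s t t' → ∃ λ q → Square i s t t' q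
  square r with run-back r
  ... | q , r' = q , record { at-s = r ; at-t = r' ; sq = run-≢′ r' ; t'q = λ { refl → run-≁′ r (run-∼ (run-swap r')) } }

  #S : Bool → ℕ
  #S i = count (S i) Z
  k : ℕ
  k = count K Z

  Square-holds : ∀ {i s t t' q} → Square i s t t' q → Holds (S i) Z (s ∷ t ∷ t' ∷ q ∷ [])
  Square-holds {i} sqr m = S-∈ (go m) , go m
    where
    open Square sqr
    go : ∀ {v} → v ∈ _ → S i v ≡ true
    go (here refl) = run-S at-t
    go (there (here refl)) = run-S at-s
    go (there (there (here refl))) = run-S (run-swap at-s)
    go (there (there (there (here refl)))) = run-S (run-swap at-t)

  S≥4 : ∀ i → 4 ≤ #S i
  S≥4 i with nonempty i
  ... | s , e with run-exists e
  ... | t , t' , r with square r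
  ... | q , sqr = count-≥ (S i) Z (Square.list-unique sqr) (Square-holds sqr)

  square-full : ∀ {i s t t' q} → Square i s t t' q → #S i ≡ 4 → ∀ {v} → S i v ≡ true → v ∈ s ∷ t ∷ t' ∷ q ∷ []
  square-full {i} sqr e sv = count-full _≟A_ (S i) Z (Square.list-unique sqr) (Square-holds sqr) (≤-reflexive e) (S-∈ sv) sv

  -- Besides `s`, `r` and `r'` there is one seer left, and it is not adjacent to `s`: together with
  -- `s` it encloses a run at `r`.
  square-neighbours : ∀ {i s r r' t} → #S i ≡ 4 → run i s r r' → S i t ≡ true → s ∼ t → t ≡ r ⊎ t ≡ r'
  square-neighbours e rs st s∼t with square rs
  ... | q , sqr with square-full sqr e st
  ... | here refl = ⊥-elim (∼-irrefl s∼t)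
  ... | there (here refl) = inj₁ refl
  ... | there (there (here refl)) = inj₂ refl
  ... | there (there (there (here refl))) = ⊥-elim (run-≁′ (Square.at-t sqr) s∼t)

  pure-∈ : ∀ {i v} → pure i v ≡ true → v ∈ Z
  pure-∈ p = S-∈ (∧-fst p)

  -- The run at s of a vertex of K cannot have both ends in K, as these are the ends of the other run.
  mixed-run : ∀ {i} → #S (not i) ≡ 4 → (∀ {v w} → pure i v ≡ true → pure i w ≡ true → v ≢ w → v ∼ w) →
    ∀ {s} → K s ≡ true → ∃ λ r → ∃ λ x → run i s r x × K r ≡ true × pure i x ≡ true
  mixed-run {i} e adj-pure {s} ks with run-exists (K-S i ks) | run-exists (K-S (not i) ks)
  ... | t , t' , rt | r , r' , rr with S-split i (run-S rt) | S-split i (run-S (run-swap rt))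
  ... | inj₂ p | inj₂ p' = ⊥-elim (run-≁′ rt (adj-pure p p' (run-≢′ rt)))
  ... | inj₁ a | inj₂ p = t , t' , rt , a , p
  ... | inj₂ p | inj₁ a = t' , t , run-swap rt , a , p
  ... | inj₁ a | inj₁ b with square-neighbours e rr (K-S (not i) a) (run-∼ rt) | square-neighbours e rr (K-S (not i) b) (run-∼ (run-swap rt))
  ... | inj₁ refl | inj₁ refl = ⊥-elim (run-≢′ rt refl)
  ... | inj₂ refl | inj₂ refl = ⊥-elim (run-≢′ rt refl)
  ... | inj₁ refl | inj₂ refl = ⊥-elim (run-apart rt rr)
  ... | inj₂ refl | inj₁ refl = ⊥-elim (run-apart rt (run-swap rr))

  -- A shared `s` has a run from a shared `r` to a pure vertex, and so has `r`. With only one pure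
  -- vertex, `r` is adjacent to the other end of the run at `s`.
  no-shared : ∀ i → #S (not i) ≡ 4 → count (pure i) Z ≤ 1 → k ≡ 0
  no-shared i e le = count-zero K Z λ _ ks → go ks
    where
    same : ∀ {v w} → pure i v ≡ true → pure i w ≡ true → v ≡ w
    same p q = count-one (pure i) Z le _≟A_ (pure-∈ {i} p) p (pure-∈ {i} q) q
    go : ∀ {s} → K s ≡ true → ⊥
    go ks with mixed-run {i} e (λ p q ne → ⊥-elim (ne (same p q))) ks
    ... | r , x , rs , kr , px with mixed-run {i} e (λ p q ne → ⊥-elim (ne (same p q))) kr
    ... | _ , x' , rr , _ , px' = run-≁′ rs (subst (r ∼_) (same px' px) (run-∼ (run-swap rr)))

  module Five (k5 : k ≡ 5) (all-K : ∀ {i v} → S i v ≡ true → K v ≡ true) where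

    no-six : ∀ {xs} → Unique xs → length xs ≡ 6 → (∀ {v} → v ∈ xs → K v ≡ true) → ⊥
    no-six {xs} u l h = <-irrefl refl (≤-trans (≤-reflexive (≡sym l)) (≤-trans (count-≥ K Z u (λ m → S-∈ (K-S true (h m)) , h m)) (≤-reflexive k5)))

    six : ∀ {a b c d x y : A} → Unique (a ∷ b ∷ c ∷ d ∷ []) → x ∉ a ∷ b ∷ c ∷ d ∷ [] → y ∉ a ∷ b ∷ c ∷ d ∷ [] → x ≢ y →
      K a ≡ true → K b ≡ true → K c ≡ true → K d ≡ true → K x ≡ true → K y ≡ true → ⊥
    six u nx ny xy ka kb kc kd kx ky = no-six (∉⇒Unique (λ { (here e) → xy e ; (there m) → nx m }) (∉⇒Unique ny u)) refl
      λ { (here refl) → kx ; (there (here refl)) → ky ; (there (there (here refl))) → ka ; (there (there (there (here refl)))) → kb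
        ; (there (there (there (there (here refl))))) → kc ; (there (there (there (there (there (here refl)))))) → kd }

    K-run : ∀ {i s t t'} → run i s t t' → K t ≡ true
    K-run r = all-K (run-S r)

    -- `a` is adjacent neither to `b` nor to `d`, so the ends of its runs other than `s` are new.
    -- Two new ends give six shared vertices; if there is only one, both obstacles fill the same run
    -- at `a`.
    shared : ∀ {i s a b d} → run i s a b → run (not i) s b d → a ≢ d → ⊥
    shared {i} {s} {a} {b} {d} r r' a≢d with run-back r | run-back' r r' a≢d
      where
      run-back' : run i s a b → run (not i) s b d → a ≢ d → ∃ λ w → run (not i) a s w
      run-back' r r' a≢d with run-exists (K-S (not i) (K-run r))
      ... | p , q , rp with p ≟A s | q ≟A s
      ... | yes refl | _ = q , rp
      ... | no _ | yes refl = p , run-swap rp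
      ... | no np | no nq = ⊥-elim (six (distinct₄ (∼⇒≢ (run-∼ r)) (∼⇒≢ (run-∼ r')) (∼⇒≢ (run-∼ (run-swap r'))) (run-≢′ r) a≢d (run-≢′ r'))
            (out np (run-∼ rp)) (out nq (run-∼ (run-swap rp))) (run-≢′ rp) (K-run (proj₂ (run-back r))) (K-run r) (K-run r') (K-run (run-swap r')) (K-run rp) (K-run (run-swap rp)))
        where
        out : ∀ {x} → x ≢ s → a ∼ x → x ∉ s ∷ a ∷ b ∷ d ∷ []
        out ns ax (here e) = ns e
        out ns ax (there (here refl)) = ∼-irrefl ax
        out ns ax (there (there (here refl))) = run-≁′ r ax
        out ns ax (there (there (there (here refl)))) = run-far r r' a≢d ax
    ... | w , rw | w' , rw' with w ≟A w'
    ... | yes refl = run-apart rw rw'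
    ... | no ne = six (distinct₄ (∼⇒≢ (run-∼ r)) (∼⇒≢ (run-∼ r')) (∼⇒≢ (run-∼ (run-swap r'))) (run-≢′ r) a≢d (run-≢′ r'))
            (out (λ e → run-≢′ rw (≡sym e)) (run-∼ (run-swap rw))) (out (λ e → run-≢′ rw' (≡sym e)) (run-∼ (run-swap rw'))) ne
            (K-run (proj₂ (run-back r))) (K-run r) (K-run r') (K-run (run-swap r')) (K-run (run-swap rw)) (K-run (run-swap rw'))
      where
      out : ∀ {x} → x ≢ s → a ∼ x → x ∉ s ∷ a ∷ b ∷ d ∷ []
      out ns ax (here e) = ns e
      out ns ax (there (here refl)) = ∼-irrefl ax
      out ns ax (there (there (here refl))) = run-≁′ r ax
      out ns ax (there (there (there (here refl)))) = run-far r r' a≢d ax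

    record Spread (s : A) : Set where
      field
        {a b c d} : A
        ab : run true s a b
        cd : run false s c d
        ac : a ≢ c
        ad : a ≢ d
        bc : b ≢ c
        bd : b ≢ d

    spread : ∀ {s} → K s ≡ true → Spread s
    spread ks with run-exists (K-S true ks) | run-exists (K-S false ks)
    ... | a , b , ab | c , d , cd with a ≟A c | a ≟A d | b ≟A c | b ≟A d
    ... | no ac | no ad | no bc | no bd = record { ab = ab ; cd = cd ; ac = ac ; ad = ad ; bc = bc ; bd = bd }
    ... | yes refl | _ | _ | yes refl = ⊥-elim (run-apart ab cd)
    ... | yes refl | _ | _ | no bd = ⊥-elim (shared (run-swap ab) cd bd)
    ... | no _ | yes refl | yes refl | _ = ⊥-elim (run-apart ab (run-swap cd))
    ... | no _ | yes refl | no bc | _ = ⊥-elim (shared (run-swap ab) (run-swap cd) bc)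
    ... | no _ | no ad | yes refl | _ = ⊥-elim (shared ab cd ad)
    ... | no ac | no _ | no _ | yes refl = ⊥-elim (shared ab (run-swap cd) ac)

    -- The four run ends at `a` are neighbours of `a`, and `b` is not; together with `a` and `b`
    -- they are six shared vertices.
    impossible : ⊥
    impossible with count-pos K Z (≤-trans (s≤s z≤n) (≤-reflexive (≡sym k5)))
    ... | s , _ , ks with spread ks
    ... | sp with spread {Spread.a sp} (K-run (Spread.ab sp))
    ... | tp = six (distinct₄ (run-≢′ T.ab) T.ac T.ad T.bc T.bd (run-≢′ T.cd)) out-a out-b (run-≢′ P.ab)
                 (K-run T.ab) (K-run (run-swap T.ab)) (K-run T.cd) (K-run (run-swap T.cd)) (K-run P.ab) (K-run (run-swap P.ab))
      where
      module P = Spread sp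
      module T = Spread tp
      out-a : P.a ∉ T.a ∷ T.b ∷ T.c ∷ T.d ∷ []
      out-a (here e) = ∼⇒≢ (run-∼ T.ab) e
      out-a (there (here e)) = ∼⇒≢ (run-∼ (run-swap T.ab)) e
      out-a (there (there (here e))) = ∼⇒≢ (run-∼ T.cd) e
      out-a (there (there (there (here e)))) = ∼⇒≢ (run-∼ (run-swap T.cd)) e
      out-b : P.b ∉ T.a ∷ T.b ∷ T.c ∷ T.d ∷ []
      out-b (here e) = run-≁′ P.ab (subst (P.a ∼_) (≡sym e) (run-∼ T.ab))
      out-b (there (here e)) = run-≁′ P.ab (subst (P.a ∼_) (≡sym e) (run-∼ (run-swap T.ab)))
      out-b (there (there (here e))) = run-≁′ P.ab (subst (P.a ∼_) (≡sym e) (run-∼ T.cd))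
      out-b (there (there (there (here e)))) = run-≁′ P.ab (subst (P.a ∼_) (≡sym e) (run-∼ (run-swap T.cd)))

-- Configurations with few seers

module MoreObstacles (C : Config) where
  open Config C
  open Obstacles C

  ci cj : Bool → ℕ
  ci i = count (I i) Z
  cj i = count (J i) Z

  pure-count : ∀ i → count (pure i) Z ≡ ci i + cj i
  pure-count i = trans (∑-cong Z (λ {v} _ → split (pure i v) (iso v))) (∑-+ Z _ _)
    where
    split : ∀ a b → ⟦ a ⟧ ≡ ⟦ a ∧ b ⟧ + ⟦ a ∧ not b ⟧
    split true true = refl
    split true false = refl
    split false b = refl

  S-count : ∀ i → #S i ≡ k + (ci i + cj i)
  S-count i = trans (∑-cong Z (λ {v} _ → split i (S true v) (S false v) (S i v) (S (not i) v) (by i))) (trans (∑-+ Z _ _) (cong (k +_) (pure-count i)))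
    where
    by : ∀ i {v} → (S i v ≡ (if i then S true v else S false v)) × (S (not i) v ≡ (if i then S false v else S true v))
    by true = refl , refl
    by false = refl , refl
    split : ∀ i a b p q → p ≡ (if i then a else b) × q ≡ (if i then b else a) → ⟦ p ⟧ ≡ ⟦ a ∧ b ⟧ + ⟦ p ∧ not q ⟧
    split true true true _ _ (refl , refl) = refl
    split true true false _ _ (refl , refl) = refl
    split true false b _ _ (refl , refl) = refl
    split false true true _ _ (refl , refl) = refl
    split false true false _ _ (refl , refl) = refl
    split false false true _ _ (refl , refl) = refl
    split false false false _ _ (refl , refl) = refl

  no-pure : ∀ i → ci i + cj i ≡ 0 → ∀ {v} → pure i v ≡ true → ⊥
  no-pure i e p = count-none (pure i) Z (trans (pure-count i) e) (pure-∈ {i} p) p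

  pure-J : ∀ i → ci i ≡ 0 → ∀ {v} → pure i v ≡ true → J i v ≡ true
  pure-J i e {v} p with bool-cases (iso v)
  ... | inj₁ t = ⊥-elim (count-none (I i) Z e (pure-∈ {i} p) (∧-both p t))
  ... | inj₂ f = ∧-both p (not-false f)

  cover-pure : ∀ i → ci i + cj i ≡ 2 → ∀ {v w} → pure i v ≡ true → pure i w ≡ true → v ≢ w → ∀ {x} → pure i x ≡ true → x ≡ v ⊎ x ≡ w
  cover-pure i e pv pw ne px with count-full _≟A_ (pure i) Z (pair ne) (λ { (here refl) → pure-∈ {i} pv , pv ; (there (here refl)) → pure-∈ {i} pw , pw })
                                  (≤-reflexive (trans (pure-count i) e)) (pure-∈ {i} px) px
  ... | here refl = inj₁ refl
  ... | there (here refl) = inj₂ refl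

  pure-adjacent : ∀ i → ci i ≡ 0 → cj i ≡ 2 → ∀ {v w} → pure i v ≡ true → pure i w ≡ true → v ≢ w → v ∼ w
  pure-adjacent i e e' pv pw ne with mate {i} (pure-J i e pv)
  ... | x , jx , vx , _ with cover-pure i (cong₂ _+_ e e') pv (∧-fst jx) (∼⇒≢ vx) pw
  ... | inj₁ refl = ⊥-elim (ne refl)
  ... | inj₂ refl = vx

  -- By `mate` these vertices do not occur singly.
  J≢1 : ∀ i → cj i ≢ 1
  J≢1 i e with count-pos (J i) Z (≤-reflexive (≡sym e))
  ... | v , mv , jv with mate {i} jv
  ... | w , jw , vw , _ = ∼⇒≢ vw (count-one (J i) Z (≤-reflexive e) _≟A_ mv jv (pure-∈ {i} (∧-fst jw)) jw)

  -- The pure vertex `x` and the shared `a`, `b`, `c` are all seers of obstacle `i`, and `b` has the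
  -- run from `a` to `c`. The other obstacle then gives `b` a run from `a` and a run from `c`, both
  -- to pure vertices, and there is no room for these.
  no-three-shared : ∀ i → k ≡ 3 → ci i + cj i ≡ 1 → ci (not i) ≡ 0 → cj (not i) ≡ 2 → ⊥
  no-three-shared i k3 p1 i0 j2 with count-pos (pure i) Z (≤-reflexive (≡sym (trans (pure-count i) p1)))
  ... | x , mx , px with run-exists (pure-S i px)
  ... | a , c , rx with square rx
  ... | b , sqr = finish
    where
    j = not i
    open Square sqr
    x-only : ∀ {v} → S i v ≡ true → v ≢ x → K v ≡ true
    x-only sv ne with S-split i sv
    ... | inj₁ kv = kv
    ... | inj₂ pv = ⊥-elim (ne (count-one (pure i) Z (≤-reflexive (trans (pure-count i) p1)) _≟A_ (pure-∈ {i} pv) pv mx px))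
    ka : K a ≡ true
    ka = x-only (run-S at-s) (λ e → ∼⇒≢ (run-∼ at-s) (≡sym e))
    kc : K c ≡ true
    kc = x-only (run-S (run-swap at-s)) (λ e → ∼⇒≢ (run-∼ (run-swap at-s)) (≡sym e))
    kb : K b ≡ true
    kb = x-only (run-S (run-swap at-t)) (λ e → sq (≡sym e))
    a≢b : a ≢ b
    a≢b = ∼⇒≢ (run-∼ (run-swap at-t))
    inK : ∀ {v} → K v ≡ true → v ∈ a ∷ b ∷ c ∷ []
    inK kv = count-full _≟A_ K Z (distinct₃ a≢b (run-≢′ at-s) (λ e → t'q (≡sym e)))
      (λ { (here refl) → S-∈ (K-S true ka) , ka ; (there (here refl)) → S-∈ (K-S true kb) , kb ; (there (there (here refl))) → S-∈ (K-S true kc) , kc })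
      (≤-reflexive k3) (S-∈ (K-S true kv)) kv
    -- The run at `b` that starts with `a` can only end in `c`: of the four seers, `x` is not
    -- adjacent to `b`, and the other two are `a` and `b`.
    rb : run i b a c
    rb with run-back (run-swap at-t)
    ... | q , r with square-full sqr (trans (S-count i) (cong₂ _+_ k3 p1)) (run-S (run-swap r))
    ... | here refl = ⊥-elim (run-≁′ at-t (∼-sym (run-∼ (run-swap r))))
    ... | there (here refl) = ⊥-elim (run-≢′ r refl)
    ... | there (there (here refl)) = r
    ... | there (there (there (here refl))) = ⊥-elim (∼-irrefl (run-∼ (run-swap r)))
    adjacent : ∀ {v w} → pure j v ≡ true → pure j w ≡ true → v ≢ w → v ∼ w
    adjacent = pure-adjacent j i0 j2
    -- Among the shared vertices only `b` is adjacent to `e`, and the two pure vertices are adjacent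
    -- to each other; so a run at `e` leads from `b` to a pure vertex.
    exposed : ∀ {e e'} → K e ≡ true → run i b e e' → (∀ {v} → v ∈ a ∷ b ∷ c ∷ [] → v ≡ e ⊎ v ≡ b ⊎ v ≡ e') →
      ∃ λ η → ∃ λ η' → run j e b η × pure j η ≡ true × run j b e η' × pure j η' ≡ true
    exposed {e} {e'} ke re cov = found
      where
      K-b : ∀ {v} → K v ≡ true → e ∼ v → v ≡ b
      K-b kv ev with cov (inK kv)
      ... | inj₁ refl = ⊥-elim (∼-irrefl ev)
      ... | inj₂ (inj₁ refl) = refl
      ... | inj₂ (inj₂ refl) = ⊥-elim (run-≁′ re ev)
      outer : ∃ λ η → run j e b η × pure j η ≡ true
      outer with run-exists (K-S j ke)
      ... | p , q , r with S-split j (run-S r) | S-split j (run-S (run-swap r))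
      ... | inj₁ kp | inj₁ kq = ⊥-elim (run-≢′ r (trans (K-b kp (run-∼ r)) (≡sym (K-b kq (run-∼ (run-swap r))))))
      ... | inj₂ pp | inj₂ pq = ⊥-elim (run-≁′ r (adjacent pp pq (run-≢′ r)))
      ... | inj₁ kp | inj₂ pq with K-b kp (run-∼ r)
      ... | refl = q , r , pq
      outer | p , q , r | inj₂ pp | inj₁ kq with K-b kq (run-∼ (run-swap r))
      ... | refl = p , run-swap r , pp
      found : ∃ λ η → ∃ λ η' → run j e b η × pure j η ≡ true × run j b e η' × pure j η' ≡ true
      found with outer
      ... | η , r , pη with run-back r
      ... | η' , r' with S-split j (run-S (run-swap r'))
      ... | inj₂ p' = η , η' , r , pη , r' , p'
      ... | inj₁ k' with cov (inK k')
      ... | inj₁ refl = ⊥-elim (run-≢′ r' refl)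
      ... | inj₂ (inj₁ refl) = ⊥-elim (∼-irrefl (run-∼ (run-swap r')))
      ... | inj₂ (inj₂ refl) = ⊥-elim (run-apart re r')
    finish : ⊥
    finish with exposed ka rb (λ { (here e) → inj₁ e ; (there (here e)) → inj₂ (inj₁ e) ; (there (there (here e))) → inj₂ (inj₂ e) })
              | exposed kc (run-swap rb) (λ { (here e) → inj₂ (inj₂ e) ; (there (here e)) → inj₂ (inj₁ e) ; (there (there (here e))) → inj₁ e })
    ... | η , η₂ , r , pη , r₂ , p₂ | _ , η₃ , _ , _ , r₃ , p₃ with η₂ ≟A η₃
    ... | yes refl = run-three rb r₃ r₂
    -- `η` is now `η₂` or `η₃`, both adjacent to `b`, but the run at `a` separates `η` from `b`.
    ... | no ne with cover-pure j (cong₂ _+_ i0 j2) p₂ p₃ ne pη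
    ... | inj₁ refl = run-≁′ r (run-∼ (run-swap r₂))
    ... | inj₂ refl = run-≁′ r (run-∼ (run-swap r₃))

  -- The configuration that survives the count: four shared vertices and two consecutive pure ones
  -- cost 11, one less than two squares demand.
  record Hex (i : Bool) : Set where
    field
      {y z} : A
      Jy : J i y ≡ true
      Jz : J i z ≡ true
      σy : σ y ≡ z
      only : ∀ {t} → any t ≡ true → K t ≡ true ⊎ t ≡ y ⊎ t ≡ z
      no-common : ∀ {t} → any t ≡ true → y ∼ t → z ∼ t → ⊥
      exposed : ∀ {w} → w ≡ y ⊎ w ≡ z → ∃ λ s → ∃ λ s' → ∃ λ t → ∃ λ t' → K s ≡ true × K s' ≡ true × s ≢ s' × run i w s t × run i w s' t'
      four-true : four true ≡ true
      four-false : four false ≡ true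
      long : 11 + count (empty-gap any) Z ≤ length Z

  module Hexagon (i : Bool) (k4 : k ≡ 4) (i0 : ci i ≡ 0) (j2 : cj i ≡ 2) (p0 : ci (not i) + cj (not i) ≡ 0) where
    j = not i

    sj : #S j ≡ 4
    sj = trans (S-count j) (cong₂ _+_ k4 p0)

    adjacent : ∀ {v w} → pure i v ≡ true → pure i w ≡ true → v ≢ w → v ∼ w
    adjacent = pure-adjacent i i0 j2

    -- The four shared vertices are matched in pairs, which are disjoint by `clash`.
    record Pair (s r : A) : Set where
      field
        {η η'} : A
        there-run : run i s r η
        back-run : run i r s η'
        Ks : K s ≡ true
        Kr : K r ≡ true
        pη : pure i η ≡ true
        pη' : pure i η' ≡ true

      η≢η' : η ≢ η'
      η≢η' e = run-≁′ there-run (subst (r ∼_) (≡sym e) (run-∼ (run-swap back-run)))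

      either : ∀ {x} → pure i x ≡ true → x ≡ η ⊎ x ≡ η'
      either = cover-pure i (cong₂ _+_ i0 j2) pη pη' η≢η'

    -- `mixed-run` gives `r`. If the run back at `r` ended in a shared vertex as well, its ends
    -- would be the only two neighbours of `r` that see the other obstacle, hence also the ends of a
    -- run of that obstacle.
    pairing : ∀ {s} → K s ≡ true → ∃ λ r → Pair s r
    pairing {s} ks with mixed-run {i} sj adjacent ks
    ... | r , η , rs , kr , pη with run-back rs
    ... | η' , rr with S-split i (run-S (run-swap rr))
    ... | inj₂ pη' = r , record { there-run = rs ; back-run = rr ; Ks = ks ; Kr = kr ; pη = pη ; pη' = pη' }
    ... | inj₁ k' with run-exists (K-S j kr)
    ... | α , β , ra with square-neighbours sj ra (K-S j ks) (run-∼ rr) | square-neighbours sj ra (K-S j k') (run-∼ (run-swap rr))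
    ... | inj₁ refl | inj₁ refl = ⊥-elim (run-≢′ rr refl)
    ... | inj₂ refl | inj₂ refl = ⊥-elim (run-≢′ rr refl)
    ... | inj₁ refl | inj₂ refl = ⊥-elim (run-apart rr ra)
    ... | inj₂ refl | inj₁ refl = ⊥-elim (run-apart rr (run-swap ra))

    swap-pair : ∀ {s r} → Pair s r → Pair r s
    swap-pair p = record { there-run = back-run ; back-run = there-run ; Ks = Kr ; Kr = Ks ; pη = pη' ; pη' = pη }
      where open Pair p

    -- The runs at `r` from `s` and from `w` end in the same pure vertex, as the other one is not
    -- adjacent to `r`. Moreover `s` and `w` are the ends of the other obstacle's run at `r`: a
    -- triangle of runs.
    clash : ∀ {s w r} → Pair s r → Pair w r → s ≢ w → ⊥
    clash {s} {w} {r} p q ne with run-exists (K-S j (Pair.Kr p))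
    ... | α , β , ra = run-three (subst (run i r w) same (Pair.back-run q)) (run-swap (Pair.back-run p)) other-run
      where
      same : Pair.η' q ≡ Pair.η' p
      same with Pair.either p (Pair.pη' q)
      ... | inj₂ e = e
      ... | inj₁ e = ⊥-elim (run-≁′ (Pair.there-run p) (subst (r ∼_) e (run-∼ (run-swap (Pair.back-run q)))))
      other-run : run j r w s
      other-run with square-neighbours sj ra (K-S j (Pair.Ks p)) (run-∼ (Pair.back-run p)) | square-neighbours sj ra (K-S j (Pair.Ks q)) (run-∼ (Pair.back-run q))
      ... | inj₁ e | inj₁ e' = ⊥-elim (ne (trans e (≡sym e')))
      ... | inj₂ e | inj₂ e' = ⊥-elim (ne (trans e (≡sym e')))
      ... | inj₁ refl | inj₂ refl = run-swap ra
      ... | inj₂ refl | inj₁ refl = ra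

    touch : ∀ {s r x} → Pair s r → pure i x ≡ true → ∃ λ e → ∃ λ t → (e ≡ s ⊎ e ≡ r) × K e ≡ true × run i x e t
    touch p px with Pair.either p px
    ... | inj₁ refl with run-back (run-swap (Pair.there-run p))
    ... | t , r = _ , t , inj₁ refl , Pair.Ks p , r
    touch p px | inj₂ refl with run-back (run-swap (Pair.back-run p))
    ... | t , r = _ , t , inj₂ refl , Pair.Kr p , r

    third : ∀ u r → ∃ λ w → K w ≡ true × w ≢ u × w ≢ r
    third u r with pick-other _≟A_ K Z (u ∷ r ∷ []) unique (≤-trans (n≤1+n 3) (≤-reflexive (≡sym k4)))
    ... | w , _ , kw , nw = w , kw , (λ e → nw (here e)) , λ e → nw (there (here e))

    module _ (f-true : four true ≡ true) (f-false : four false ≡ true) (len : 11 + count (empty-gap any) Z ≤ length Z) where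

      build : ∀ {y z} → J i y ≡ true → J i z ≡ true → y ∼ z → σ y ≡ z → Hex i
      build {y} {z} jy jz yz e = record { Jy = jy ; Jz = jz ; σy = e ; only = only ; no-common = no-common ; exposed = exposed
                                        ; four-true = f-true ; four-false = f-false ; long = len }
        where
        either : ∀ {x} → pure i x ≡ true → x ≡ y ⊎ x ≡ z
        either = cover-pure i (cong₂ _+_ i0 j2) (∧-fst jy) (∧-fst jz) (∼⇒≢ yz)
        only : ∀ {t} → any t ≡ true → K t ≡ true ⊎ t ≡ y ⊎ t ≡ z
        only at with any-S i at
        ... | inj₁ st with S-split i st
        ... | inj₁ kt = inj₁ kt
        ... | inj₂ pt = inj₂ (either pt)
        only at | inj₂ st with S-split j st
        ... | inj₁ kt = inj₁ kt
        ... | inj₂ pt = ⊥-elim (no-pure j p0 pt)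
        no-common : ∀ {t} → any t ≡ true → y ∼ t → z ∼ t → ⊥
        no-common at yt zt with only at
        ... | inj₂ (inj₁ refl) = ∼-irrefl yt
        ... | inj₂ (inj₂ refl) = ∼-irrefl zt
        -- The partner of `t` has a run from `t` to `y` or `z`, so `t` is not adjacent to both.
        ... | inj₁ kt with pairing kt
        ... | r , p with either (Pair.pη' p)
        ... | inj₁ e = run-≁′ (Pair.back-run p) (∼-sym (subst (_∼ _) (≡sym e) yt))
        ... | inj₂ e = run-≁′ (Pair.back-run p) (∼-sym (subst (_∼ _) (≡sym e) zt))
        exposed : ∀ {w} → w ≡ y ⊎ w ≡ z → ∃ λ s → ∃ λ s' → ∃ λ t → ∃ λ t' → K s ≡ true × K s' ≡ true × s ≢ s' × run i w s t × run i w s' t'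
        exposed {w} yz = go
          where
          pw : pure i w ≡ true
          pw = [ (λ { refl → ∧-fst jy }) , (λ { refl → ∧-fst jz }) ]′ yz
          go : ∃ λ s → ∃ λ s' → ∃ λ t → ∃ λ t' → K s ≡ true × K s' ≡ true × s ≢ s' × run i w s t × run i w s' t'
          go with count-pos K Z (≤-trans (s≤s z≤n) (≤-reflexive (≡sym k4)))
          ... | u , _ , ku with pairing ku
          ... | r , p with third u r
          ... | v , kv , v≢u , v≢r with pairing kv
          ... | x , q with touch p pw | touch q pw
          ... | e , t , m , ke , re | e' , t' , m' , ke' , re' = e , e' , t , t' , ke , ke' , ne m m' , re , re'
            where
            ne : e ≡ u ⊎ e ≡ r → e' ≡ v ⊎ e' ≡ x → e ≢ e'
            ne (inj₁ refl) (inj₁ refl) refl = v≢u refl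
            ne (inj₁ refl) (inj₂ refl) refl = clash (swap-pair p) q (λ e → v≢r (≡sym e))
            ne (inj₂ refl) (inj₁ refl) refl = v≢r refl
            ne (inj₂ refl) (inj₂ refl) refl = clash p q (λ e → v≢u (≡sym e))

      hex : Hex i
      hex with count-pos (J i) Z (≤-trans (s≤s z≤n) (≤-reflexive (≡sym j2)))
      ... | y , my , jy with mate {i} jy
      ... | z , jz , yz , inj₁ e = build jy jz yz (≡sym e)
      ... | z , jz , yz , inj₂ e = build jz jy (∼-sym yz) (trans (cong σ e) (σσ⁻ my))

-- The numerical case analysis

hat : ℕ → ℕ
hat zero = 0
hat (suc c) = suc (suc c)

-- A lower bound for the length of the ring. Shared and isolated vertices count twice, for the gaps
-- after them; `hat` adds one gap to the non-isolated vertices of a kind, if there are any.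
cost : ℕ → ℕ → ℕ → ℕ → ℕ → ℕ
cost k a b c d = k + k + (a + a + (b + b + (hat c + hat d)))

toT : ∀ {b} → b ≡ true → T b
toT refl = tt

-- k vertices see both obstacles; a, b (c, d) count the isolated (non-isolated) vertices seeing only one of them.
-- The disjuncts before the last are the configurations excluded by separate arguments.
excluded : ℕ → ℕ → ℕ → ℕ → ℕ → Bool → Bool → Bool
excluded k a b c d f g =
  ((k + (a + c)) <ᵇ 4) ∨ (((k + (b + d)) <ᵇ 4) ∨ ((c ≡ᵇ 1) ∨ ((d ≡ᵇ 1)
  ∨ ((((k + (b + d)) ≡ᵇ 4) ∧ (((a + c) <ᵇ 2) ∧ (0 <ᵇ k)))
  ∨ ((((k + (a + c)) ≡ᵇ 4) ∧ (((b + d) <ᵇ 2) ∧ (0 <ᵇ k)))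
  ∨ (((k ≡ᵇ 5) ∧ (((a + c) ≡ᵇ 0) ∧ ((b + d) ≡ᵇ 0)))
  ∨ ((f ∧ ((k + a) <ᵇ 2)) ∨ ((g ∧ ((k + b) <ᵇ 2))
  ∨ ((f ∧ (((k + (a + c)) ≡ᵇ 4) ∧ (0 <ᵇ c))) ∨ ((g ∧ (((k + (b + d)) ≡ᵇ 4) ∧ (0 <ᵇ d)))
  ∨ (((k ≡ᵇ 3) ∧ (((a + c) ≡ᵇ 1) ∧ ((b ≡ᵇ 0) ∧ (d ≡ᵇ 2))))
  ∨ (((k ≡ᵇ 3) ∧ (((b + d) ≡ᵇ 1) ∧ ((a ≡ᵇ 0) ∧ (c ≡ᵇ 2))))
  ∨ (((f ∧ g) ∧ ((k ≡ᵇ 4) ∧ ((a ≡ᵇ 0) ∧ ((c ≡ᵇ 2) ∧ ((b + d) ≡ᵇ 0)))))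
  ∨ (((f ∧ g) ∧ ((k ≡ᵇ 4) ∧ ((b ≡ᵇ 0) ∧ ((d ≡ᵇ 2) ∧ ((a + c) ≡ᵇ 0)))))
  ∨ ((10 + (⟦ f ⟧ + ⟦ g ⟧)) ≤ᵇ cost k a b c d)))))))))))))))

-- Decided by evaluation. A cost below 12 leaves values below 6 for the terms counted twice and
-- below 12 for the others.
excluded-small : ∀ f g → ∀< 6 (λ k → ∀< 6 (λ a → ∀< 6 (λ b → ∀< 12 (λ c → ∀< 12 (λ d → excluded k a b c d f g))))) ≡ true
excluded-small true true = refl
excluded-small true false = refl
excluded-small false true = refl
excluded-small false false = refl

≤-or-> : ∀ m n → m ≤ n ⊎ n < m
≤-or-> m n with m ≤? n
... | yes p = inj₁ p
... | no p = inj₂ (≰⇒> p)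

half<6 : ∀ {k} → k + k < 12 → k < 6
half<6 {k} lt with ≤-or-> 6 k
... | inj₂ l = l
... | inj₁ l = ⊥-elim (<-irrefl refl (≤-trans lt (+-mono-≤ l l)))

≤-hat : ∀ c → c ≤ hat c
≤-hat zero = z≤n
≤-hat (suc c) = n≤1+n _

⟦⟧≤1 : ∀ b → ⟦ b ⟧ ≤ 1
⟦⟧≤1 true = ≤-refl
⟦⟧≤1 false = z≤n

-- A cost of 12 meets even the largest demand, 10 + 2; any smaller cost is in the range of the
-- finite check.
excluded-all : ∀ k a b c d f g → excluded k a b c d f g ≡ true ⊎ 10 + (⟦ f ⟧ + ⟦ g ⟧) ≤ cost k a b c d
excluded-all k a b c d f g with ≤-or-> 12 (cost k a b c d)
... | inj₁ le = inj₂ (≤-trans (+-monoʳ-≤ 10 (+-mono-≤ (⟦⟧≤1 f) (⟦⟧≤1 g))) le)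
... | inj₂ lt = inj₁ (∀<-sound 12 (p₅ k a b c) (∀<-sound 12 (p₄ k a b) (∀<-sound 6 (p₃ k a) (∀<-sound 6 (p₂ k) (∀<-sound 6 p₁ (excluded-small f g) k<) a<) b<) c<) d<)
  where
  p₅ = λ k a b c d → excluded k a b c d f g
  p₄ = λ k a b c → ∀< 12 (p₅ k a b c)
  p₃ = λ k a b → ∀< 12 (p₄ k a b)
  p₂ = λ k a → ∀< 6 (p₃ k a)
  p₁ = λ k → ∀< 6 (p₂ k)
  r₁ = a + a + (b + b + (hat c + hat d))
  r₂ = b + b + (hat c + hat d)
  k< : k < 6
  k< = half<6 (≤-trans (s≤s (m≤m+n (k + k) r₁)) lt)
  a< : a < 6
  a< = half<6 (≤-trans (s≤s (≤-trans (m≤m+n (a + a) r₂) (m≤n+m r₁ (k + k)))) lt)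
  b< : b < 6
  b< = half<6 (≤-trans (s≤s (≤-trans (m≤m+n (b + b) _) (≤-trans (m≤n+m r₂ (a + a)) (m≤n+m r₁ (k + k))))) lt)
  tail< : hat c + hat d < 12
  tail< = ≤-trans (s≤s (≤-trans (m≤n+m (hat c + hat d) (b + b)) (≤-trans (m≤n+m r₂ (a + a)) (m≤n+m r₁ (k + k))))) lt
  c< : c < 12
  c< = ≤-trans (s≤s (≤-trans (≤-hat c) (m≤m+n _ _))) tail<
  d< : d < 12
  d< = ≤-trans (s≤s (≤-trans (≤-hat d) (m≤n+m _ (hat c)))) tail<

module Bound (C : Config) where
  open Config C
  open Obstacles C
  open MoreObstacles C

  Jgap : Bool → A → Bool
  Jgap i v = J i v ∧ gap any v

  -- The cost distributed over the ring: each vertex is charged for itself and, where `cost` counts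
  -- it, for the gap after it.
  weight : A → ℕ
  weight v = (⟦ K v ⟧ + ⟦ K v ⟧) + ((⟦ I true v ⟧ + ⟦ I true v ⟧) + ((⟦ I false v ⟧ + ⟦ I false v ⟧) + ((⟦ J true v ⟧ + ⟦ Jgap true v ⟧) + (⟦ J false v ⟧ + ⟦ Jgap false v ⟧))))

  weight-≤ : ∀ v → weight v ≤ ⟦ any v ⟧ + ⟦ gap any v ⟧
  weight-≤ v = go (S true v) (S false v) (any (σ v)) (any (σ⁻ v)) K-gap
    where
    go : ∀ a b x y → (a ∧ b ≡ true → x ≡ false) →
      let is = not x ∧ not y ; pt = a ∧ not b ; pf = b ∧ not a ; gp = (a ∨ b) ∧ not x in
      (⟦ a ∧ b ⟧ + ⟦ a ∧ b ⟧) + ((⟦ pt ∧ is ⟧ + ⟦ pt ∧ is ⟧) + ((⟦ pf ∧ is ⟧ + ⟦ pf ∧ is ⟧)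
        + ((⟦ pt ∧ not is ⟧ + ⟦ (pt ∧ not is) ∧ gp ⟧) + (⟦ pf ∧ not is ⟧ + ⟦ (pf ∧ not is) ∧ gp ⟧)))) ≤ ⟦ a ∨ b ⟧ + ⟦ gp ⟧
    go true true true y h = ⊥-elim (true≢false refl (h refl))
    go true true false y h = ≤ᵇ⇒≤ _ _ tt
    go true false true true h = ≤ᵇ⇒≤ _ _ tt
    go true false true false h = ≤ᵇ⇒≤ _ _ tt
    go true false false true h = ≤ᵇ⇒≤ _ _ tt
    go true false false false h = ≤ᵇ⇒≤ _ _ tt
    go false true true true h = ≤ᵇ⇒≤ _ _ tt
    go false true true false h = ≤ᵇ⇒≤ _ _ tt
    go false true false true h = ≤ᵇ⇒≤ _ _ tt
    go false true false false h = ≤ᵇ⇒≤ _ _ tt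
    go false false x y h = z≤n

  weight-sum : ∑ Z weight ≡ (k + k) + ((ci true + ci true) + ((ci false + ci false) + ((cj true + count (Jgap true) Z) + (cj false + count (Jgap false) Z))))
  weight-sum =
    trans (∑-+ Z _ _) (cong₂ _+_ (∑-+ Z _ _) (trans (∑-+ Z _ _) (cong₂ _+_ (∑-+ Z _ _) (trans (∑-+ Z _ _) (cong₂ _+_ (∑-+ Z _ _) (trans (∑-+ Z _ _) (cong₂ _+_ (∑-+ Z _ _) (∑-+ Z _ _))))))))

  -- The additional 1 in `hat` is the gap supplied by `exit`.
  hat-≤ : ∀ i → hat (cj i) ≤ cj i + count (Jgap i) Z
  hat-≤ i with cj i in eq
  ... | zero = z≤n
  ... | suc c with count-pos (J i) Z (≤-trans (s≤s z≤n) (≤-reflexive (≡sym eq)))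
  ... | v , _ , jv with exit {i} jv
  ... | w , jw , gw = ≤-trans (≤-reflexive (+-comm 1 (suc c))) (+-monoʳ-≤ (suc c) (count-≥ (Jgap i) Z {w ∷ []} ([] ∷ []) λ { (here refl) → pure-∈ {i} (∧-fst jw) , ∧-both jw gw }))

  total : ℕ
  total = cost k (ci true) (ci false) (cj true) (cj false)

  total-≤ : total + count (empty-gap any) Z ≤ length Z
  total-≤ = begin
    total + e ≤⟨ +-monoˡ-≤ e (+-monoʳ-≤ (k + k) (+-monoʳ-≤ (ci true + ci true) (+-monoʳ-≤ (ci false + ci false) (+-mono-≤ (hat-≤ true) (hat-≤ false))))) ⟩
    _ ≡⟨ cong (_+ e) (≡sym weight-sum) ⟩
    ∑ Z weight + e ≤⟨ +-monoˡ-≤ e (∑-mono Z (λ {v} _ → weight-≤ v)) ⟩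
    ∑ Z (λ v → ⟦ any v ⟧ + ⟦ gap any v ⟧) + e ≡⟨ cong (_+ e) (∑-+ Z _ _) ⟩
    (count any Z + count (gap any) Z) + e ≡⟨ +-assoc (count any Z) _ e ⟩
    count any Z + (count (gap any) Z + e) ≤⟨ gap-bound any ⟩
    length Z ∎
    where
    open ≤-Reasoning
    e = count (empty-gap any) Z

  KI≥2 : ∀ i → four i ≡ true → 2 ≤ k + ci i
  KI≥2 i f with isolated {i} f
  ... | p , p' , sp , sp' , ip , ip' , ne , _ =
    ≤-trans (count-≥ (λ v → K v ∨ I i v) Z (pair ne) (λ { (here refl) → S-∈ sp , KI sp ip ; (there (here refl)) → S-∈ sp' , KI sp' ip' }))
      (≤-trans (∑-mono Z (λ {v} _ → or (K v) (I i v))) (≤-reflexive (∑-+ Z _ _)))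
    where
    KI : ∀ {v} → S i v ≡ true → iso v ≡ true → K v ∨ I i v ≡ true
    KI sv iv with S-split i sv
    ... | inj₁ kv = ∨-left kv
    ... | inj₂ pv = ∨-right (∧-both pv iv)
    or : ∀ a b → ⟦ a ∨ b ⟧ ≤ ⟦ a ⟧ + ⟦ b ⟧
    or true b = s≤s z≤n
    or false b = ≤-refl

  -- Two isolated seers and two mates would be all four. The run at `p` avoids `p'`, so its ends
  -- would be the mates, which are adjacent.
  no-J : ∀ i → four i ≡ true → #S i ≡ 4 → cj i ≡ 0
  no-J i f s4 with isolated {i} f
  ... | p , p' , sp , sp' , ip , ip' , ne , non = count-zero (J i) Z λ _ jv → go jv
    where
    go : ∀ {v} → J i v ≡ true → ⊥
    go {v} jv with mate {i} jv
    ... | w , jw , vw , _ with run-exists sp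
    ... | t , t' , r = run-≁′ r (close (where-is r) (where-is (run-swap r)))
      where
      J≢ : ∀ {q u} → iso q ≡ true → J i u ≡ true → q ≢ u
      J≢ iq ju refl = true≢false iq (not-true (∧-snd ju))
      where-is : ∀ {t t'} → run i p t t' → t ≡ v ⊎ t ≡ w
      where-is r' with count-full _≟A_ (S i) Z (distinct₄ ne (J≢ ip jv) (J≢ ip jw) (J≢ ip' jv) (J≢ ip' jw) (∼⇒≢ vw))
                       (λ { (here refl) → S-∈ sp , sp ; (there (here refl)) → S-∈ sp' , sp' ; (there (there (here refl))) → pure-∈ {i} (∧-fst jv) , pure-S i (∧-fst jv)
                          ; (there (there (there (here refl)))) → pure-∈ {i} (∧-fst jw) , pure-S i (∧-fst jw) })
                       (≤-reflexive s4) (S-∈ (run-S r')) (run-S r')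
      ... | here refl = ⊥-elim (∼-irrefl (run-∼ r'))
      ... | there (here refl) = ⊥-elim (non (run-∼ r'))
      ... | there (there (here e)) = inj₁ e
      ... | there (there (there (here e))) = inj₂ e
      close : t ≡ v ⊎ t ≡ w → t' ≡ v ⊎ t' ≡ w → t ∼ t'
      close (inj₁ refl) (inj₂ refl) = vw
      close (inj₂ refl) (inj₁ refl) = ∼-sym vw
      close (inj₁ refl) (inj₁ refl) = ⊥-elim (run-≢′ r refl)
      close (inj₂ refl) (inj₂ refl) = ⊥-elim (run-≢′ r refl)

  -- Each disjunct of `excluded` before the last is refuted by one of the lemmas above, except for
  -- the hexagon, which is handed on.
  ring-bound : 10 + (⟦ four true ⟧ + ⟦ four false ⟧) ≤ length Z ⊎ ∃ Hex
  ring-bound with excluded-all k (ci true) (ci false) (cj true) (cj false) (four true) (four false)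
  ... | inj₂ le = inj₁ (≤-trans le (≤-trans (m≤m+n total _) total-≤))
  ... | inj₁ e = c₁ e
    where
    f = four true
    g = four false
    lt : ∀ {m n} → (m <ᵇ n) ≡ true → m < n
    lt e = <ᵇ⇒< _ _ (toT e)
    eq : ∀ {m n} → (m ≡ᵇ n) ≡ true → m ≡ n
    eq e = ≡ᵇ⇒≡ _ _ (toT e)
    small : ∀ i → ((k + (ci i + cj i)) <ᵇ 4) ≡ true → ⊥
    small i e = <-irrefl refl (≤-trans (lt e) (≤-trans (S≥4 i) (≤-reflexive (S-count i))))
    isE : ∀ i → (((k + (ci (not i) + cj (not i))) ≡ᵇ 4) ∧ (((ci i + cj i) <ᵇ 2) ∧ (0 <ᵇ k))) ≡ true → ⊥
    isE i e = <-irrefl (≡sym (no-shared i (trans (S-count (not i)) (eq (∧-fst e))) (≤-trans (≤-reflexive (pure-count i)) (s≤s⁻¹ (lt (∧-fst (∧-snd {(k + (ci (not i) + cj (not i))) ≡ᵇ 4} e)))))))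
                (lt (∧-snd {(ci i + cj i) <ᵇ 2} (∧-snd {(k + (ci (not i) + cj (not i))) ≡ᵇ 4} e)))
    is5 : ((k ≡ᵇ 5) ∧ (((ci true + cj true) ≡ᵇ 0) ∧ ((ci false + cj false) ≡ᵇ 0))) ≡ true → ⊥
    is5 e = Five.impossible (eq (∧-fst e)) all-K
      where
      z : ∀ i → ci i + cj i ≡ 0
      z true = eq (∧-fst (∧-snd {k ≡ᵇ 5} e))
      z false = eq (∧-snd {(ci true + cj true) ≡ᵇ 0} (∧-snd {k ≡ᵇ 5} e))
      all-K : ∀ {i v} → S i v ≡ true → K v ≡ true
      all-K {i} sv with S-split i sv
      ... | inj₁ kv = kv
      ... | inj₂ pv = ⊥-elim (no-pure i (z i) pv)
    isP : ∀ i → (four i ∧ ((k + ci i) <ᵇ 2)) ≡ true → ⊥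
    isP i e = <-irrefl refl (≤-trans (lt (∧-snd {four i} e)) (KI≥2 i (∧-fst e)))
    isQ : ∀ i → (four i ∧ (((k + (ci i + cj i)) ≡ᵇ 4) ∧ (0 <ᵇ cj i))) ≡ true → ⊥
    isQ i e = <-irrefl (≡sym (no-J i (∧-fst e) (trans (S-count i) (eq (∧-fst (∧-snd {four i} e)))))) (lt (∧-snd {(k + (ci i + cj i)) ≡ᵇ 4} (∧-snd {four i} e)))
    isK : ∀ i → ((k ≡ᵇ 3) ∧ (((ci i + cj i) ≡ᵇ 1) ∧ ((ci (not i) ≡ᵇ 0) ∧ (cj (not i) ≡ᵇ 2)))) ≡ true → ⊥
    isK i e = no-three-shared i (eq (∧-fst e)) (eq (∧-fst e₂)) (eq (∧-fst e₃)) (eq (∧-snd {ci (not i) ≡ᵇ 0} e₃))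
      where
      e₂ = ∧-snd {k ≡ᵇ 3} e
      e₃ = ∧-snd {(ci i + cj i) ≡ᵇ 1} e₂
    -- 4 + 4 for the shared vertices and `hat 2 = 3` for the two mates.
    tot : ∀ i → k ≡ 4 → ci i ≡ 0 → cj i ≡ 2 → ci (not i) + cj (not i) ≡ 0 → total ≡ 11
    tot true a b c d with m+n≡0⇒m≡0 (ci false) d | m+n≡0⇒n≡0 (ci false) d
    ... | x | y rewrite a | b | c | x | y = refl
    tot false a b c d with m+n≡0⇒m≡0 (ci true) d | m+n≡0⇒n≡0 (ci true) d
    ... | x | y rewrite a | b | c | x | y = refl
    isH : ∀ i → ((f ∧ g) ∧ ((k ≡ᵇ 4) ∧ ((ci i ≡ᵇ 0) ∧ ((cj i ≡ᵇ 2) ∧ ((ci (not i) + cj (not i)) ≡ᵇ 0))))) ≡ true → ∃ Hex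
    isH i e = i , Hexagon.hex i (eq (∧-fst e₁)) (eq (∧-fst e₂)) (eq (∧-fst e₃)) (eq (∧-snd {cj i ≡ᵇ 2} e₃)) (∧-fst (∧-fst e)) (∧-snd {f} (∧-fst e))
                (≤-trans (≤-reflexive (cong (_+ count (empty-gap any) Z) (≡sym (tot i (eq (∧-fst e₁)) (eq (∧-fst e₂)) (eq (∧-fst e₃)) (eq (∧-snd {cj i ≡ᵇ 2} e₃)))))) total-≤)
      where
      e₁ = ∧-snd {f ∧ g} e
      e₂ = ∧-snd {k ≡ᵇ 4} e₁
      e₃ = ∧-snd {ci i ≡ᵇ 0} e₂
    Goal = 10 + (⟦ f ⟧ + ⟦ g ⟧) ≤ length Z ⊎ ∃ Hex
    c₁ : excluded k (ci true) (ci false) (cj true) (cj false) f g ≡ true → Goal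
    c₁ e with ∨-elim e
    ... | inj₁ h = ⊥-elim (small true h)
    ... | inj₂ e with ∨-elim e
    ... | inj₁ h = ⊥-elim (small false h)
    ... | inj₂ e with ∨-elim e
    ... | inj₁ h = ⊥-elim (J≢1 true (eq h))
    ... | inj₂ e with ∨-elim e
    ... | inj₁ h = ⊥-elim (J≢1 false (eq h))
    ... | inj₂ e with ∨-elim e
    ... | inj₁ h = ⊥-elim (isE true h)
    ... | inj₂ e with ∨-elim e
    ... | inj₁ h = ⊥-elim (isE false h)
    ... | inj₂ e with ∨-elim e
    ... | inj₁ h = ⊥-elim (is5 h)
    ... | inj₂ e with ∨-elim e
    ... | inj₁ h = ⊥-elim (isP true h)
    ... | inj₂ e with ∨-elim e
    ... | inj₁ h = ⊥-elim (isP false h)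
    ... | inj₂ e with ∨-elim e
    ... | inj₁ h = ⊥-elim (isQ true h)
    ... | inj₂ e with ∨-elim e
    ... | inj₁ h = ⊥-elim (isQ false h)
    ... | inj₂ e with ∨-elim e
    ... | inj₁ h = ⊥-elim (isK true h)
    ... | inj₂ e with ∨-elim e
    ... | inj₁ h = ⊥-elim (isK false h)
    ... | inj₂ e with ∨-elim e
    ... | inj₁ h = inj₂ (isH true h)
    ... | inj₂ e with ∨-elim e
    ... | inj₁ h = inj₂ (isH false h)
    ... | inj₂ h = inj₁ (≤-trans (≤ᵇ⇒≤ _ _ (toT h)) (≤-trans (m≤m+n total _) total-≤))

module _ {A : Set} where

  lookup-injective : {l : List A} → Unique l → ∀ {i j} → lookup l i ≡ lookup l j → i ≡ j
  lookup-injective {x ∷ l} u {zero} {zero} e = refl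
  lookup-injective {x ∷ l} u {zero} {suc j} e = ⊥-elim (∉-head u (subst (_∈ l) (≡sym e) (∈-lookup {xs = l} j)))
  lookup-injective {x ∷ l} u {suc i} {zero} e = ⊥-elim (∉-head u (subst (_∈ l) e (∈-lookup {xs = l} i)))
  lookup-injective {x ∷ l} (_ ∷ u) {suc i} {suc j} e = cong suc (lookup-injective u e)

-- Isolated vertices of a ring

module Isolation {A : Set} (_≟A_ : (a b : A) → Dec (a ≡ b)) {Z : List A} (ring : Ring Z)
  (σ-all : ∀ (P : A → Set) {z} → z ∈ Z → P z → (∀ {u} → u ∈ Z → P u → P (Ring.σ ring u)) → ∀ {w} → w ∈ Z → P w)
  (S : A → Bool) (S-∈ : ∀ {v} → S v ≡ true → v ∈ Z) where
  open Ring ring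
  open import Data.List.Membership.DecPropositional _≟A_ using (_∈?_)

  Iso : A → Set
  Iso v = S v ≡ true × S (σ v) ≡ false × S (σ⁻ v) ≡ false

  Iso-gap : ∀ {v} → Iso v → gap S v ≡ true
  Iso-gap (a , b , _) = ∧-both a (not-false b)

  -- Without a further gap the successors of `s` are seers for ever, and none is in `xs`, since an
  -- isolated vertex does not follow a seer; but going round the ring one has to meet `x`.
  extra-gap : ∀ xs → (∀ {x} → x ∈ xs → Iso x) → ∀ {x} → x ∈ xs → ∀ {s} → S s ≡ true → s ∉ xs →
    ∃ λ s' → s' ∉ xs × s' ∈ Z × gap S s' ≡ true
  extra-gap xs iso {x} mx {s} ss ns with any-in (λ v → gap S v ∧ not ⌊ v ∈? xs ⌋) Z
  ... | inj₁ (v , mv , e) = v , out v (∧-snd {gap S v} e) , mv , ∧-fst e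
    where
    out : ∀ v → not ⌊ v ∈? xs ⌋ ≡ true → v ∉ xs
    out v e with v ∈? xs
    ... | no n = n
  ... | inj₂ f = ⊥-elim (proj₂ (σ-all (λ v → S v ≡ true × v ∉ xs) (S-∈ ss) (ss , ns) advance (S-∈ (proj₁ (iso mx)))) mx)
    where
    advance : ∀ {u} → u ∈ Z → S u ≡ true × u ∉ xs → S (σ u) ≡ true × σ u ∉ xs
    advance {u} mu (su , nu) = stays , λ m → true≢false (trans (cong S (σ⁻σ mu)) su) (proj₂ (proj₂ (iso m)))
      where
      stays : S (σ u) ≡ true
      stays with bool-cases (S (σ u)) | f mu
      ... | inj₁ t | _ = t
      ... | inj₂ e | g with u ∈? xs
      ... | yes m = ⊥-elim (nu m)
      ... | no _ = ⊥-elim (true≢false (∧-both (∧-both su (not-false e)) refl) g)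

  isolated-bound : ∀ {xs} → Unique xs → (∀ {x} → x ∈ xs → Iso x) → ∀ {x} → x ∈ xs → ∀ {s} → S s ≡ true → s ∉ xs →
    count S Z + suc (length xs) ≤ length Z
  isolated-bound {xs} u iso mx ss ns with extra-gap xs iso mx ss ns
  ... | s' , ns' , mz , g = ≤-trans (+-monoʳ-≤ (count S Z) (≤-trans (count-≥ (gap S) Z (∉⇒Unique ns' u)
          (λ { (here refl) → mz , g ; (there m) → S-∈ (proj₁ (iso m)) , Iso-gap (iso m) })) (m≤m+n _ _))) (gap-bound S)

  module _ (_∼_ : A → A → Set) (∼-sym : ∀ {a b} → a ∼ b → b ∼ a) (∼-irrefl : ∀ {a} → a ∼ a → ⊥) (σ-∼ : ∀ {z} → z ∈ Z → z ∼ σ z)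
    (two : ∀ {s} → S s ≡ true → ∃ λ t → ∃ λ t' → S t ≡ true × S t' ≡ true × s ∼ t × s ∼ t' × t ≢ t' × ¬ (t ∼ t')) where

    private
      ne : ∀ {a b} → a ∼ b → a ≢ b
      ne e refl = ∼-irrefl e

      holds4 : ∀ {a b c d} → S a ≡ true → S b ≡ true → S c ≡ true → S d ≡ true → Holds S Z (a ∷ b ∷ c ∷ d ∷ [])
      holds4 a b c d (here refl) = S-∈ a , a
      holds4 a b c d (there (here refl)) = S-∈ b , b
      holds4 a b c d (there (there (here refl))) = S-∈ c , c
      holds4 a b c d (there (there (there (here refl)))) = S-∈ d , d

    -- One of the two neighbours that `two` gives for `t` differs from `s`, and neither is `t'`,
    -- which is not adjacent to `t`.
    four-seers : ∀ {s} → S s ≡ true → 4 ≤ count S Z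
    four-seers {s} ss with two ss
    ... | t , t' , st , st' , s∼t , s∼t' , t≢t' , t≁t' with two st
    ... | q , q' , sq , sq' , t∼q , t∼q' , q≢q' , _ with q ≟A s
    ... | no q≢s = count-≥ S Z (distinct₄ (ne s∼t) (ne s∼t') (λ e → q≢s (≡sym e)) t≢t' (ne t∼q) (λ { refl → t≁t' t∼q })) (holds4 ss st st' sq)
    ... | yes refl = count-≥ S Z (distinct₄ (ne s∼t) (ne s∼t') q≢q' t≢t' (ne t∼q') (λ { refl → t≁t' t∼q' })) (holds4 ss st st' sq')

    one-isolated : ∀ {p} → Iso p → 6 ≤ length Z
    one-isolated {p} ip with two (proj₁ ip)
    ... | t , _ , st , _ , p∼t , _ = ≤-trans (+-monoˡ-≤ 2 (four-seers (proj₁ ip)))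
          (isolated-bound {p ∷ []} ([] ∷ []) (λ { (here refl) → ip }) (here refl) st (λ { (here refl) → ∼-irrefl p∼t }))

    -- At least five seers come with three gaps. If there are only four, they are `p`, `p'`, `t`,
    -- `t'`, no two of them consecutive, so all four are gaps.
    two-isolated : ∀ {p p'} → Iso p → Iso p' → p ≢ p' → ¬ (p ∼ p') → 8 ≤ length Z
    two-isolated {p} {p'} ip ip' p≢p' p≁p' with two (proj₁ ip)
    ... | t , t' , st , st' , p∼t , p∼t' , t≢t' , t≁t' with m≤n⇒m<n∨m≡n (four-seers (proj₁ ip))
    ... | inj₁ five = ≤-trans (+-monoˡ-≤ 3 five) (isolated-bound (pair p≢p') (λ { (here refl) → ip ; (there (here refl)) → ip' }) (here refl) st
                        (λ { (here refl) → ∼-irrefl p∼t ; (there (here refl)) → p≁p' p∼t }))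
    ... | inj₂ eq = ≤-trans (+-mono-≤ (≤-reflexive eq) (≤-trans (count-≥ (gap S) Z u gaps) (m≤m+n _ _))) (gap-bound S)
      where
      u : Unique (p ∷ p' ∷ t ∷ t' ∷ [])
      u = distinct₄ p≢p' (ne p∼t) (ne p∼t') (λ { refl → p≁p' p∼t }) (λ { refl → p≁p' p∼t' }) t≢t'
      is-gap : ∀ {v w} → S v ≡ true → ¬ (v ∼ w) → (∀ {x} → x ∈ p ∷ p' ∷ t ∷ t' ∷ [] → x ≡ p ⊎ x ≡ p' ⊎ x ≡ v ⊎ x ≡ w) → gap S v ≡ true
      is-gap {v} sv v≁w cov with bool-cases (S (σ v))
      ... | inj₂ f = ∧-both sv (not-false f)
      ... | inj₁ t = ⊥-elim (bad (cov (count-full _≟A_ S Z u (holds4 (proj₁ ip) (proj₁ ip') st st') (≤-reflexive (≡sym eq)) (S-∈ t) t)))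
        where
        back : ∀ {x} → Iso x → σ v ≡ x → ⊥
        back ix e = true≢false (trans (cong S (trans (cong σ⁻ (≡sym e)) (σ⁻σ (S-∈ sv)))) sv) (proj₂ (proj₂ ix))
        bad : σ v ≡ p ⊎ σ v ≡ p' ⊎ σ v ≡ v ⊎ σ v ≡ _ → ⊥
        bad (inj₁ e) = back ip e
        bad (inj₂ (inj₁ e)) = back ip' e
        bad (inj₂ (inj₂ (inj₁ e))) = ∼-irrefl (subst (v ∼_) e (σ-∼ (S-∈ sv)))
        bad (inj₂ (inj₂ (inj₂ e))) = v≁w (subst (v ∼_) e (σ-∼ (S-∈ sv)))
      gaps : Holds (gap S) Z (p ∷ p' ∷ t ∷ t' ∷ [])
      gaps (here refl) = S-∈ (proj₁ ip) , Iso-gap ip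
      gaps (there (here refl)) = S-∈ (proj₁ ip') , Iso-gap ip'
      gaps (there (there (here refl))) = S-∈ st , is-gap st t≁t'
        (λ { (here e) → inj₁ e ; (there (here e)) → inj₂ (inj₁ e) ; (there (there (here e))) → inj₂ (inj₂ (inj₁ e)) ; (there (there (there (here e)))) → inj₂ (inj₂ (inj₂ e)) })
      gaps (there (there (there (here refl)))) = S-∈ st' , is-gap st' (λ e → t≁t' (∼-sym e))
        (λ { (here e) → inj₁ e ; (there (here e)) → inj₂ (inj₁ e) ; (there (there (here e))) → inj₂ (inj₂ (inj₂ e)) ; (there (there (there (here e)))) → inj₂ (inj₂ (inj₁ e)) })

module _ {A : Set} where

  count-exact : ∀ (P : A → Bool) {l xs} → Unique l → Unique xs → Holds P l xs → (∀ {v} → v ∈ l → P v ≡ true → v ∈ xs) → count P l ≡ length xs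
  count-exact P {l} {xs} ul ux h cov = ≤-antisym
    (≤-trans (≤-reflexive (≡sym (select-length P l))) (Unique-⊆-length (select-unique P l ul) (λ m → let (a , b) = ∈-select P l m in cov a b)))
    (count-≥ P l ux h)

  -- Fewer than |xs| - 1 identifications cannot connect xs: contract one edge at a time.
  bicolour-≤ : (_≟A_ : (a b : A) → Dec (a ≡ b)) → ∀ k (es : List (A × A)) → length es ≤ k → (xs : List A) → Unique xs → suc (length es) < length xs →
    ∃ λ (c : A → Bool) → (∀ {a b} → (a , b) ∈ es → c a ≡ c b) × ∃ λ x → ∃ λ y → x ∈ xs × y ∈ xs × c x ≢ c y
  bicolour-≤ _≟A_ k [] le (x ∷ []) u (s≤s ())
  bicolour-≤ _≟A_ k [] le (x ∷ y ∷ xs) ((x≢y ∷ _) ∷ _) lt = (λ v → ⌊ v ≟A x ⌋) , (λ ()) , x , y , here refl , there (here refl) , differ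
    where
    differ : ⌊ x ≟A x ⌋ ≢ ⌊ y ≟A x ⌋
    differ e with x ≟A x | y ≟A x
    ... | yes _ | yes e' = x≢y (≡sym e')
    differ () | yes _ | no _
    ... | no n | _ = n refl
  bicolour-≤ _≟A_ (suc k) ((a , b) ∷ es) (s≤s le) xs u lt with a ≟A b
  ... | yes refl with bicolour-≤ _≟A_ k es le xs u (≤-trans (s≤s (n≤1+n _)) lt)
  ... | c , h , r = c , (λ { (here refl) → refl ; (there m) → h m }) , r
  bicolour-≤ _≟A_ (suc k) ((a , b) ∷ es) (s≤s le) xs u lt | no a≢b with bicolour-≤ _≟A_ k (map (λ e → ρ (proj₁ e) , ρ (proj₂ e)) es) (≤-trans (≤-reflexive (length-map _ es)) le) ys (select-unique keep xs u)
      (≤-trans (s≤s (s≤s (≤-reflexive (length-map _ es)))) (s≤s⁻¹ (≤-trans lt shorter)))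
    where
    ρ : A → A
    ρ v = if ⌊ v ≟A b ⌋ then a else v
    keep : A → Bool
    keep v = not ⌊ v ≟A b ⌋
    ys : List A
    ys = select keep xs
    shorter : length xs ≤ suc (length ys)
    shorter = Unique-⊆-length u into
      where
      into : ∀ {v} → v ∈ xs → v ∈ b ∷ ys
      into {v} m with v ≟A b in eq
      ... | yes e = here e
      ... | no n = there (select-∈ keep m (cong (λ d → not ⌊ d ⌋) eq))
  ... | c , h , x , y , mx , my , ne = (λ v → c (ρ v)) , edges , x , y , proj₁ (∈-select keep xs mx) , proj₁ (∈-select keep xs my) ,
      λ e → ne (trans (≡sym (cong c (fixed mx))) (trans e (cong c (fixed my))))
    where
    ρ : A → A
    ρ v = if ⌊ v ≟A b ⌋ then a else v
    keep : A → Bool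
    keep v = not ⌊ v ≟A b ⌋
    fixed : ∀ {v} → v ∈ select keep xs → ρ v ≡ v
    fixed {v} m = cong (λ d → if d then a else v) (not-true (proj₂ (∈-select keep xs m)))
    ρa : ρ a ≡ a
    ρa with a ≟A b
    ... | yes e = ⊥-elim (a≢b e)
    ... | no _ = refl
    ρb : ρ b ≡ a
    ρb with b ≟A b
    ... | yes _ = refl
    ... | no n = ⊥-elim (n refl)
    edges : ∀ {p q} → (p , q) ∈ (a , b) ∷ es → c (ρ p) ≡ c (ρ q)
    edges (here refl) = cong c (trans ρa (≡sym ρb))
    edges (there m) = h (∈-map⁺ (λ e → ρ (proj₁ e) , ρ (proj₂ e)) m)

  bicolour : (_≟A_ : (a b : A) → Dec (a ≡ b)) (es : List (A × A)) (xs : List A) → Unique xs → suc (length es) < length xs →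
    ∃ λ (c : A → Bool) → (∀ {a b} → (a , b) ∈ es → c a ≡ c b) × ∃ λ x → ∃ λ y → x ∈ xs × y ∈ xs × c x ≢ c y
  bicolour _≟A_ es = bicolour-≤ _≟A_ (length es) es ≤-refl

-- Sums modulo 2

module _ {A : Set} where

  parity : List A → (A → Bool) → Bool
  parity [] f = false
  parity (x ∷ l) f = f x xor parity l f

  parity-cong : ∀ l {f g : A → Bool} → (∀ x → f x ≡ g x) → parity l f ≡ parity l g
  parity-cong [] h = refl
  parity-cong (x ∷ l) h = cong₂ _xor_ (h x) (parity-cong l h)

  parity-zero : ∀ l {f : A → Bool} → (∀ {x} → x ∈ l → f x ≡ false) → parity l f ≡ false
  parity-zero [] h = refl
  parity-zero (x ∷ l) h = cong₂ _xor_ (h (here refl)) (parity-zero l (λ m → h (there m)))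

  xor-mid : ∀ a b c d → (a xor b) xor (c xor d) ≡ (a xor c) xor (b xor d)
  xor-mid a b c d = begin
    (a xor b) xor (c xor d) ≡⟨ xor-assoc a b (c xor d) ⟩
    a xor (b xor (c xor d)) ≡⟨ cong (a xor_) (≡sym (xor-assoc b c d)) ⟩
    a xor ((b xor c) xor d) ≡⟨ cong (λ e → a xor (e xor d)) (xor-comm b c) ⟩
    a xor ((c xor b) xor d) ≡⟨ cong (a xor_) (xor-assoc c b d) ⟩
    a xor (c xor (b xor d)) ≡⟨ ≡sym (xor-assoc a c (b xor d)) ⟩
    (a xor c) xor (b xor d) ∎
    where open ≡-Reasoning

  parity-xor : ∀ l (f g : A → Bool) → parity l (λ x → f x xor g x) ≡ parity l f xor parity l g
  parity-xor [] f g = refl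
  parity-xor (x ∷ l) f g = trans (cong ((f x xor g x) xor_) (parity-xor l f g)) (xor-mid (f x) (g x) (parity l f) (parity l g))

  parity-single : ∀ {l} (f : A → Bool) → Unique l → ∀ {x} → x ∈ l → (∀ {y} → y ∈ l → y ≢ x → f y ≡ false) → parity l f ≡ f x
  parity-single {y ∷ l} f u (here refl) h = trans (cong (f y xor_) (parity-zero l (λ m → h (there m) (λ { refl → ∉-head u m })))) (xor-identityʳ (f y))
  parity-single {y ∷ l} f u@(_ ∷ u') (there m) h = trans (cong (_xor parity l f) (h (here refl) (λ { refl → ∉-head u m }))) (parity-single f u' m (λ m' → h (there m')))

  parity-double : ∀ {l} (f : A → Bool) → Unique l → ∀ {x y} → x ∈ l → y ∈ l → x ≢ y → (∀ {z} → z ∈ l → z ≢ x → z ≢ y → f z ≡ false) → parity l f ≡ f x xor f y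
  parity-double {z ∷ l} f u (here refl) (here refl) ne h = ⊥-elim (ne refl)
  parity-double {z ∷ l} f u@(_ ∷ u') (here refl) (there m) ne h = cong (f z xor_) (parity-single f u' m (λ k n → h (there k) (λ { refl → ∉-head u k }) n))
  parity-double {z ∷ l} f u@(_ ∷ u') {x} {y} (there m) (here refl) ne h = trans (cong (f z xor_) (parity-single f u' m (λ k n → h (there k) n (λ { refl → ∉-head u k })))) (xor-comm (f z) (f x))
  parity-double {z ∷ l} f u@(_ ∷ u') (there m) (there m') ne h = trans (cong (_xor parity l f) (h (here refl) (λ { refl → ∉-head u m }) (λ { refl → ∉-head u m' }))) (parity-double f u' m m' ne (λ k → h (there k)))

  -- The terms at `(x , y)` and `(y , x)` cancel.
  parity-sym : ∀ l (f : A → A → Bool) → (∀ x → f x x ≡ false) → (∀ x y → f x y ≡ f y x) → parity l (λ x → parity l (f x)) ≡ false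
  parity-sym [] f d s = refl
  parity-sym (x ∷ l) f d s = begin
    (f x x xor p) xor parity l (λ y → f y x xor parity l (f y)) ≡⟨ cong₂ _xor_ (cong (_xor p) (d x)) (parity-xor l (λ y → f y x) (λ y → parity l (f y))) ⟩
    p xor (parity l (λ y → f y x) xor parity l (λ y → parity l (f y))) ≡⟨ cong₂ (λ a b → p xor (a xor b)) (parity-cong l (λ y → s y x)) (parity-sym l f d s) ⟩
    p xor (p xor false) ≡⟨ cong (p xor_) (xor-identityʳ p) ⟩
    p xor p ≡⟨ xor-same p ⟩
    false ∎
    where
    open ≡-Reasoning
    p = parity l (f x)

parity-swap : ∀ {A C : Set} (l : List A) (m : List C) (f : A → C → Bool) → parity l (λ x → parity m (f x)) ≡ parity m (λ y → parity l (λ x → f x y))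
parity-swap [] m f = ≡sym (parity-zero m (λ _ → refl))
parity-swap (x ∷ l) m f = trans (cong (parity m (f x) xor_) (parity-swap l m f)) (≡sym (parity-xor m (f x) (λ y → parity l (λ x → f x y))))

∑-zero : ∀ {A : Set} (l : List A) → ∑ l (λ _ → 0) ≡ 0
∑-zero [] = refl
∑-zero (x ∷ l) = ∑-zero l

∑-swap : ∀ {A C : Set} (l : List A) (m : List C) (f : A → C → ℕ) → ∑ l (λ x → ∑ m (f x)) ≡ ∑ m (λ y → ∑ l (λ x → f x y))
∑-swap [] m f = ≡sym (∑-zero m)
∑-swap (x ∷ l) m f = trans (cong (∑ m (f x) +_) (∑-swap l m f)) (≡sym (∑-+ m (f x) (λ y → ∑ l (λ x → f x y))))

∑-× : ∀ {A C : Set} (l : List A) (m : List C) (f : A × C → ℕ) → ∑ (cartesianProduct l m) f ≡ ∑ l (λ x → ∑ m (λ y → f (x , y)))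
∑-× [] m f = refl
∑-× (x ∷ l) m f = trans (∑-++ (map (x ,_) m) (cartesianProduct l m) f) (cong₂ _+_ (mapped m) (∑-× l m f))
  where
  mapped : ∀ m → ∑ (map (x ,_) m) f ≡ ∑ m (λ y → f (x , y))
  mapped [] = refl
  mapped (y ∷ m) = cong (f (x , y) +_) (mapped m)

size-∑ : ∀ {n} (G : Graph n) → size G ≡ ∑ (allFin n) (λ i → ∑ (allFin n) (λ j → ⟦ (toℕ i <ᵇ toℕ j) ∧ adj G i j ⟧))
size-∑ {n} G = rows (allFin n)
  where
  Vs = allFin n
  countTrue-++ : ∀ xs ys → countTrue (xs ++ ys) ≡ countTrue xs + countTrue ys
  countTrue-++ [] ys = refl
  countTrue-++ (true ∷ xs) ys = cong suc (countTrue-++ xs ys)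
  countTrue-++ (false ∷ xs) ys = countTrue-++ xs ys
  row : ∀ (f : Fin n → Bool) l → countTrue (map f l) ≡ ∑ l (λ j → ⟦ f j ⟧)
  row f [] = refl
  row f (x ∷ l) with f x
  ... | true = cong suc (row f l)
  ... | false = row f l
  rows : ∀ l → countTrue (concatMap (λ i → map (λ j → (toℕ i <ᵇ toℕ j) ∧ adj G i j) Vs) l) ≡ ∑ l (λ i → ∑ Vs (λ j → ⟦ (toℕ i <ᵇ toℕ j) ∧ adj G i j ⟧))
  rows [] = refl
  rows (i ∷ l) = trans (countTrue-++ (map (λ j → (toℕ i <ᵇ toℕ j) ∧ adj G i j) Vs) _) (cong₂ _+_ (row _ Vs) (rows l))

-- Nontraceable locally linear graphs and their boundary cycles

module World {n : ℕ} (G : Graph n) (ll : LocallyLinear G) (walk : Connected G) (¬tr : ¬ Traceable G) where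

  open Links G ll walk public
  open Paths {V} _≟_ public
  open import Data.List.Membership.DecPropositional {A = V} _≟_ using (_∈?_) public

  path-lookup : ∀ {R : V → V → Set} {u v l} → Path R u v l → ∀ i j → toℕ j ≡ suc (toℕ i) → R (lookup l i) (lookup l j)
  path-lookup [-] zero zero ()
  path-lookup (r ∷ [-]) zero (suc zero) e = r
  path-lookup (r ∷ (r' ∷ p)) zero (suc zero) e = r
  path-lookup (r ∷ p) (suc i) (suc j) e = path-lookup p i j (NP.suc-injective e)

  Unique-length : ∀ {l : List V} → Unique l → length l ≤ n
  Unique-length u = ≤-trans (Unique-⊆-length u (λ {x} _ → ∈-allFin x)) (≤-reflexive (length-tabulate {n = n} (λ i → i)))

  untraceable : ∀ {u v l} → Path _~_ u v l → Unique l → (∀ x → x ∈ l) → ⊥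
  untraceable {l = l} p u cov = ¬tr ((λ i → lookup l (cast eq i)) , inj , sur , nbr)
    where
    eq : n ≡ length l
    eq = ≤-antisym (≤-trans (≤-reflexive (≡sym (length-tabulate {n = n} (λ i → i)))) (Unique-⊆-length (Unique.allFin⁺ n) (λ {x} _ → cov x))) (Unique-length u)
    inj : ∀ {i j} → lookup l (cast eq i) ≡ lookup l (cast eq j) → i ≡ j
    inj {i} {j} e = toℕ-injective (trans (≡sym (toℕ-cast eq i)) (trans (cong toℕ (lookup-injective u e)) (toℕ-cast eq j)))
    sur : ∀ x → ∃ λ i → lookup l (cast eq i) ≡ x
    sur x = cast (≡sym eq) (index (cov x)) , trans (cong (lookup l) (toℕ-injective (trans (toℕ-cast eq _) (toℕ-cast (≡sym eq) _)))) (≡sym (lookup-index (cov x)))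
    nbr : ∀ i j → toℕ j ≡ suc (toℕ i) → lookup l (cast eq i) ~ lookup l (cast eq j)
    nbr i j e = path-lookup p _ _ (trans (toℕ-cast eq j) (trans e (cong suc (≡sym (toℕ-cast eq i)))))

  opaque
    common-if : ∀ {u v} → u ~ v → 2 ≤ deg u → ∃ λ t → Common u v t
    common-if {u} uv d with ~-at uv
    ... | suc p , at with <-at {u} {p} (<-trans (n<1+n p) (at-< at))
    ... | t , att = t , at-common' at att
    common-if {u} uv d | zero , at with <-at {u} {1} d
    ... | t , att = t , at-common at att

  only-neighbour : ∀ {u v w} → 1 ≡ deg v → v ~ u → v ~ w → w ≡ u
  only-neighbour e a b with ~-at a | ~-at b
  ... | p , ata | q , atb with subst (p <_) (≡sym e) (at-< ata) | subst (q <_) (≡sym e) (at-< atb)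
  ... | s≤s z≤n | s≤s z≤n = at-fun atb ata

  -- Suppose that `u` is the only neighbour of `v`. If `u` has degree at least 2, the edge has a
  -- common neighbour, which would be another neighbour of `v`; otherwise the graph is a single edge
  -- and traceable.
  deg≥2 : ∀ v → 2 ≤ deg v
  deg≥2 v with m≤n⇒m<n∨m≡n (deg≥1 v)
  ... | inj₁ l = l
  ... | inj₂ e with <-at {v} (deg≥1 v)
  ... | u , atu with m≤n⇒m<n∨m≡n (deg≥1 u)
  ... | inj₁ l with common-if (~-sym (at-~ atu)) l
  ... | w , uw , vw with only-neighbour e (at-~ atu) vw
  ... | refl = ⊥-elim (~-irrefl uw)
  deg≥2 v | inj₂ e | u , atu | inj₂ e' =
    ⊥-elim (untraceable (at-~ atu ∷ [-]) (∉⇒Unique (λ { (here refl) → ~-irrefl (at-~ atu) }) (∉⇒Unique (λ ()) []))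
      (everywhere (_∈ v ∷ u ∷ []) (λ { a (here refl) → there (here (only-neighbour e (at-~ atu) a)) ; a (there (here refl)) → here (only-neighbour e' (~-sym (at-~ atu)) a) }) v (here refl)))

  opaque
    common : ∀ {u v} → u ~ v → ∃ λ t → Common u v t
    common {u} a = common-if a (deg≥2 u)

  opaque
    -- These are the two ends of the link. So every vertex lies on the boundary, and the boundary is
    -- 2-regular.
    B-ends : ∀ v → ∃ λ a → ∃ λ b → B v a × B v b × a ≢ b × (∀ {w} → B v w → w ≡ a ⊎ w ≡ b)
    B-ends v with deg v in eq | deg≥2 v
    ... | suc zero | s≤s ()
    ... | suc (suc m) | _ with <-at {v} {0} (subst (0 <_) (≡sym eq) (s≤s z≤n)) | <-at {v} {suc m} (subst (suc m <_) (≡sym eq) ≤-refl)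
    ... | a , ata | b , atb = a , b , end-B ata (inj₁ refl) , end-B atb (inj₂ (≡sym eq)) , (λ { refl → NP.0≢1+n (at-inj ata atb) }) , go
      where
      go : ∀ {w} → B v w → w ≡ a ⊎ w ≡ b
      go bw with ~-at (B-~ bw)
      ... | p , at with B-end at bw
      ... | inj₁ refl = inj₁ (at-fun at ata)
      ... | inj₂ e with trans e eq
      ... | refl = inj₂ (at-fun at atb)

  B-three : ∀ {v a b c} → B v a → B v b → B v c → a ≡ b ⊎ a ≡ c ⊎ b ≡ c
  B-three {v} ba bb bc with B-ends v
  ... | x , y , _ , _ , _ , f with f ba | f bb | f bc
  ... | inj₁ refl | inj₁ refl | _ = inj₁ refl
  ... | inj₂ refl | inj₂ refl | _ = inj₁ refl
  ... | inj₁ refl | inj₂ _ | inj₁ refl = inj₂ (inj₁ refl)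
  ... | inj₂ refl | inj₁ _ | inj₂ refl = inj₂ (inj₁ refl)
  ... | inj₁ _ | inj₂ refl | inj₂ refl = inj₂ (inj₂ refl)
  ... | inj₂ _ | inj₁ refl | inj₁ refl = inj₂ (inj₂ refl)

  opaque
    B-other : ∀ {v a} → B v a → ∃ λ b → B v b × a ≢ b
    B-other {v} ba with B-ends v
    ... | x , y , bx , by , x≢y , f with f ba
    ... | inj₁ refl = y , by , x≢y
    ... | inj₂ refl = x , bx , λ e → x≢y (≡sym e)

  -- The ends of the link of `z` are adjacent, so they are the whole link.
  ear : ∀ {z y t f} → B z y → B z t → y ≢ t → y ~ t → z ~ f → f ≡ y ⊎ f ≡ t
  ear {z} by bt y≢t yt zf with ~-at (B-~ by) | ~-at (B-~ bt) | ~-at zf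
  ... | p , aty | q , att | r , atf with B-end aty by | B-end att bt
  ... | inj₁ refl | inj₁ refl = ⊥-elim (y≢t (at-fun aty att))
  ... | inj₂ e | inj₂ e' = ⊥-elim (y≢t (at-fun aty (subst (λ k → At z k _) (NP.suc-injective (trans e' (≡sym e))) att)))
  ear {z} by bt y≢t yt zf | p , aty | q , att | r , atf | inj₁ refl | inj₂ e with at-near aty att yt
  ... | inj₁ refl with subst (r <_) (≡sym e) (at-< atf)
  ... | s≤s z≤n = inj₁ (at-fun atf aty)
  ... | s≤s (s≤s z≤n) = inj₂ (at-fun atf att)
  ear {z} by bt y≢t yt zf | p , aty | q , att | r , atf | inj₂ e | inj₁ refl with at-near aty att yt
  ... | inj₂ refl with subst (r <_) (≡sym e) (at-< atf)
  ... | s≤s z≤n = inj₂ (at-fun atf att)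
  ... | s≤s (s≤s z≤n) = inj₁ (at-fun atf aty)

  B-irrefl : ∀ {v} → B v v → ⊥
  B-irrefl b = ~-irrefl (B-~ b)

  opaque
    -- The boundary path is extended beyond `t` until it meets itself. It can only meet its other
    -- end `v`, since an inner vertex would get a third boundary neighbour. `k` is fuel.
    grow : ∀ k {t p v l} → B t p → Path B p v l → Unique (t ∷ l) → k + length (t ∷ l) ≡ suc n →
      ∃ λ c → Cycle B c × 3 ≤ length c × v ∈ c
    grow zero r P u e = ⊥-elim (<-irrefl refl (≤-trans (≤-reflexive (≡sym e)) (Unique-length u)))
    grow (suc k) {t} {p} {v} {l} r P u e with B-other r
    ... | q , bq , p≢q with q ∈? (t ∷ l)
    ... | no q∉ = grow k (B-sym bq) (r ∷ P) (∉⇒Unique q∉ u) (trans (+-suc k _) e)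
    ... | yes (here refl) = ⊥-elim (B-irrefl bq)
    ... | yes (there q∈l) with split-before P q∈l
    ... | inj₁ refl = ⊥-elim (p≢q refl)
    ... | inj₂ (z , splitting before j [-] refl) = _ , cycle (r ∷ P) (B-sym bq) u , s≤s (long before) , there (end-∈ P)
      where
      long : ∀ {R : V → V → Set} {a b m} → Path R a b m → 2 ≤ length (m ++ q ∷ [])
      long [-] = s≤s (s≤s z≤n)
      long (_ ∷ w) = s≤s (≤-trans (s≤s z≤n) (long w))
    ... | inj₂ (z , splitting {l₁} {l₂} before j (_∷_ {w = w} j' after) refl) with B-three (B-sym bq) (B-sym j) j'
    ... | inj₁ refl = ⊥-elim (∉-head u (∈-++⁺ˡ (end-∈ before)))
    ... | inj₂ (inj₁ refl) = ⊥-elim (∉-head u (∈-++⁺ʳ l₁ (there (start-∈ after))))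
    ... | inj₂ (inj₂ refl) = ⊥-elim (Unique-disjoint l₁ (AllPairs.tail u) (end-∈ before) (there (start-∈ after)))

  opaque
    boundary-cycle : ∀ v → ∃ λ c → Cycle B c × 3 ≤ length c × v ∈ c
    boundary-cycle v with B-ends v
    ... | a , _ , ba , _ = grow (suc n ∸ 2) (B-sym ba) [-] u (m∸n+n≡m (≤-trans (Unique-length u) (n≤1+n n)))
      where
      u : Unique (a ∷ v ∷ [])
      u = ∉⇒Unique (λ { (here refl) → B-irrefl ba }) (∉⇒Unique (λ ()) [])

  module BOrder {c : List V} (cyc : Cycle B c) = Order {R = B} B-sym B-irrefl cyc

  cycle-constant : ∀ {c} → Cycle B c → (P : V → Set) → (∀ {u w} → B u w → P u → P w) → ∀ {x y} → x ∈ c → P x → y ∈ c → P y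
  cycle-constant cyc P f mx px my = BOrder.σ-closed cyc P mx px (λ m → f (BOrder.σ-~ cyc m)) my

  σ≢σ⁻ : ∀ {c} (cyc : Cycle B c) → 3 ≤ length c → ∀ {z} → z ∈ c → BOrder.σ cyc z ≢ BOrder.σ⁻ cyc z
  σ≢σ⁻ {c} cyc le {z} m e = <-irrefl refl (≤-trans le (Unique-⊆-length (Cycle.unique cyc) in-two))
    where
    open BOrder cyc
    in-two : ∀ {x} → x ∈ c → x ∈ z ∷ σ z ∷ []
    in-two = σ-closed (_∈ z ∷ σ z ∷ []) m (here refl)
      λ { _ (here refl) → there (here refl) ; _ (there (here refl)) → here (trans (cong σ e) (σσ⁻ m)) }

  cycle-neighbours : ∀ {c} (cyc : Cycle B c) → 3 ≤ length c → ∀ {z w} → z ∈ c → B z w → w ≡ BOrder.σ cyc z ⊎ w ≡ BOrder.σ⁻ cyc z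
  cycle-neighbours cyc le {z} m b with B-three b (BOrder.σ-~ cyc m) (B-sym (subst (B _) (BOrder.σσ⁻ cyc m) (BOrder.σ-~ cyc (BOrder.σ⁻-∈ cyc m))))
  ... | inj₁ e = inj₁ e
  ... | inj₂ (inj₁ e) = inj₂ e
  ... | inj₂ (inj₂ e) = ⊥-elim (σ≢σ⁻ cyc le m e)

  cycle-closed : ∀ {c} → Cycle B c → 3 ≤ length c → ∀ {z w} → z ∈ c → B z w → w ∈ c
  cycle-closed cyc le m b with cycle-neighbours cyc le m b
  ... | inj₁ refl = BOrder.σ-∈ cyc m
  ... | inj₂ refl = BOrder.σ⁻-∈ cyc m

  -- In a boundary triangle each vertex is an ear over the opposite edge, so the triangle is the
  -- whole graph, which would be traceable.
  cycle≥4 : ∀ {c} → Cycle B c → 3 ≤ length c → 4 ≤ length c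
  cycle≥4 {_ ∷ _ ∷ _ ∷ _ ∷ _} cyc le = s≤s (s≤s (s≤s (s≤s z≤n)))
  cycle≥4 {_ ∷ []} cyc (s≤s ())
  cycle≥4 {_ ∷ _ ∷ []} cyc (s≤s (s≤s ()))
  cycle≥4 {a ∷ b ∷ d ∷ []} cyc@(cycle (ab ∷ (bd ∷ [-])) da u) le =
    ⊥-elim (untraceable (map-Path B-~ (ab ∷ (bd ∷ [-]))) u (everywhere (_∈ a ∷ b ∷ d ∷ []) stay a (here refl)))
    where
    stay : ∀ {u v} → u ~ v → u ∈ a ∷ b ∷ d ∷ [] → v ∈ a ∷ b ∷ d ∷ []
    stay e (here refl) with ear ab (B-sym da) (λ { refl → B-irrefl bd }) (B-~ bd) e
    ... | inj₁ refl = there (here refl)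
    ... | inj₂ refl = there (there (here refl))
    stay e (there (here refl)) with ear (B-sym ab) bd (λ { refl → B-irrefl da }) (~-sym (B-~ da)) e
    ... | inj₁ refl = here refl
    ... | inj₂ refl = there (there (here refl))
    stay e (there (there (here refl))) with ear da (B-sym bd) (λ { refl → B-irrefl ab }) (B-~ ab) e
    ... | inj₁ refl = here refl
    ... | inj₂ refl = there (here refl)

  opaque
    fresh-cycle : (P : V → Set) → (∀ {u w} → B u w → P u → P w) → ∀ v → ¬ P v →
      ∃ λ c → Cycle B c × 4 ≤ length c × (∀ {z w} → z ∈ c → B z w → w ∈ c) × v ∈ c × (∀ {x} → x ∈ c → ¬ P x)
    fresh-cycle P cl v ¬pv with boundary-cycle v
    ... | c , cyc , le , m = c , cyc , cycle≥4 cyc le , cycle-closed cyc le , m , λ mx px → ¬pv (cycle-constant cyc P cl mx px m)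

  -- Squares in the boundary

  record Quad (a b c d : V) : Set where
    field
      ab : B a b
      bc : B b c
      cd : B c d
      da : B d a
      a≢c : a ≢ c
      b≢d : b ≢ d
      outside : ∃ λ x → x ∉ a ∷ b ∷ c ∷ d ∷ []

  turn : ∀ {a b c d} → Quad a b c d → Quad b c d a
  turn {a} {b} {c} {d} q = record { ab = bc ; bc = cd ; cd = da ; da = ab ; a≢c = b≢d ; b≢d = λ e → a≢c (≡sym e)
    ; outside = proj₁ outside , λ { (here e) → proj₂ outside (there (here e)) ; (there (here e)) → proj₂ outside (there (there (here e)))
        ; (there (there (here e))) → proj₂ outside (there (there (there (here e)))) ; (there (there (there (here e)))) → proj₂ outside (here e) } }
    where open Quad q

  -- The link of `a` ends in `b` and `d`, and `c` is next to both.
  middle : ∀ {a b c d x} → B a b → B a d → b ≢ d → b ~ c → c ~ d → a ~ c → a ~ x → x ≡ b ⊎ x ≡ c ⊎ x ≡ d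
  middle {a} ab ad b≢d bc cd ac ax with ~-at (B-~ ab) | ~-at (B-~ ad) | ~-at ac | ~-at ax
  ... | p , atb | q , atd | r , atc | s , atx with B-end atb ab | B-end atd ad
  ... | inj₁ refl | inj₁ refl = ⊥-elim (b≢d (at-fun atb atd))
  ... | inj₂ e | inj₂ e' = ⊥-elim (b≢d (at-fun atb (subst (λ k → At a k _) (NP.suc-injective (trans e' (≡sym e))) atd)))
  ... | inj₁ refl | inj₂ e with at-near atb atc bc
  ... | inj₁ refl with at-near atc atd cd
  ... | inj₂ refl = ⊥-elim (b≢d (at-fun atb atd))
  ... | inj₁ refl with subst (s <_) (≡sym e) (at-< atx)
  ... | s≤s z≤n = inj₁ (at-fun atx atb)
  ... | s≤s (s≤s z≤n) = inj₂ (inj₁ (at-fun atx atc))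
  ... | s≤s (s≤s (s≤s z≤n)) = inj₂ (inj₂ (at-fun atx atd))
  middle {a} ab ad b≢d bc cd ac ax | p , atb | q , atd | r , atc | s , atx | inj₂ e | inj₁ refl with at-near atd atc (~-sym cd)
  ... | inj₁ refl with at-near atc atb (~-sym bc)
  ... | inj₂ refl = ⊥-elim (b≢d (at-fun atb atd))
  ... | inj₁ refl with subst (s <_) (≡sym e) (at-< atx)
  ... | s≤s z≤n = inj₂ (inj₂ (at-fun atx atd))
  ... | s≤s (s≤s z≤n) = inj₂ (inj₁ (at-fun atx atc))
  ... | s≤s (s≤s (s≤s z≤n)) = inj₁ (at-fun atx atb)

  -- A diagonal would make b and d ears over it, so that the four vertices form a component.
  chordless : ∀ {a b c d} → Quad a b c d → ¬ (a ~ c)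
  chordless {a} {b} {c} {d} q ac = proj₂ outside (everywhere (_∈ a ∷ b ∷ c ∷ d ∷ []) stay a (here refl) (proj₁ outside))
    where
    open Quad q
    stay : ∀ {u v} → u ~ v → u ∈ a ∷ b ∷ c ∷ d ∷ [] → v ∈ a ∷ b ∷ c ∷ d ∷ []
    stay e (here refl) with middle ab (B-sym da) b≢d (B-~ bc) (B-~ cd) ac e
    ... | inj₁ refl = there (here refl)
    ... | inj₂ (inj₁ refl) = there (there (here refl))
    ... | inj₂ (inj₂ refl) = there (there (there (here refl)))
    stay e (there (here refl)) with ear (B-sym ab) bc a≢c ac e
    ... | inj₁ refl = here refl
    ... | inj₂ refl = there (there (here refl))
    stay e (there (there (here refl))) with middle (B-sym bc) cd b≢d (B-~ (B-sym ab)) (~-sym (B-~ da)) (~-sym ac) e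
    ... | inj₁ refl = there (here refl)
    ... | inj₂ (inj₁ refl) = here refl
    ... | inj₂ (inj₂ refl) = there (there (there (here refl)))
    stay e (there (there (there (here refl)))) with ear da (B-sym cd) a≢c ac e
    ... | inj₁ refl = here refl
    ... | inj₂ refl = there (there (here refl))

  -- For a boundary square `A`, `p` is the third vertex of the triangle on one of its edges. The
  -- field `near` keeps what is needed of the square without fixing where its list begins.
  record Apex (A : List V) (p : V) : Set where
    field
      p∉ : p ∉ A
      {f f'} : V
      f∈ : f ∈ A
      f'∈ : f' ∈ A
      edge : B f f'
      pf : p ~ f
      pf' : p ~ f'
      near : ∀ {g} → g ∈ A → g ≡ f ⊎ g ≡ f' ⊎ B g f ⊎ B g f'

  -- An apex sees a boundary neighbour of every vertex of the square. So if a vertex beside `p` on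
  -- its cycle sees the square, two edges are parallel.
  near-apex : ∀ {A p} → Apex A p → ∀ {g} → g ∈ A → ∃ λ h → h ∈ A × p ~ h × B h g
  near-apex x mg with Apex.near x mg
  ... | inj₁ refl = _ , Apex.f'∈ x , Apex.pf' x , B-sym (Apex.edge x)
  ... | inj₂ (inj₁ refl) = _ , Apex.f∈ x , Apex.pf x , Apex.edge x
  ... | inj₂ (inj₂ (inj₁ b)) = _ , Apex.f∈ x , Apex.pf x , B-sym b
  ... | inj₂ (inj₂ (inj₂ b)) = _ , Apex.f'∈ x , Apex.pf' x , B-sym b

  Found : List V → Set
  Found A = ∃ λ p → ∃ λ p' → Apex A p × Apex A p' × p ≢ p' × ¬ (p ~ p')

  apex : ∀ {a b c d} → Quad a b c d → ∀ {p} → Common a b p → Apex (a ∷ b ∷ c ∷ d ∷ []) p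
  apex {a} {b} {c} {d} q {p} (ap , bp) = record
    { p∉ = λ { (here refl) → ~-irrefl ap ; (there (here refl)) → ~-irrefl bp ; (there (there (here refl))) → chordless q ap ; (there (there (there (here refl)))) → chordless (turn q) bp }
    ; f∈ = here refl ; f'∈ = there (here refl) ; edge = ab ; pf = ~-sym ap ; pf' = ~-sym bp
    ; near = λ { (here e) → inj₁ e ; (there (here e)) → inj₂ (inj₁ e) ; (there (there (here refl))) → inj₂ (inj₂ (inj₂ (B-sym bc))) ; (there (there (there (here refl)))) → inj₂ (inj₂ (inj₁ da)) } }
    where open Quad q

  apex-↭ : ∀ {A A' p} → A ↭ A' → Apex A p → Apex A' p
  apex-↭ e x = record { p∉ = λ m → p∉ (∈-resp-↭ (↭-sym e) m) ; f∈ = ∈-resp-↭ e f∈ ; f'∈ = ∈-resp-↭ e f'∈ ; edge = edge ; pf = pf ; pf' = pf'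
                      ; near = λ m → near (∈-resp-↭ (↭-sym e) m) }
    where open Apex x

  found-↭ : ∀ {A A'} → A ↭ A' → Found A → Found A'
  found-↭ e (p , p' , x , x' , r) = p , p' , apex-↭ e x , apex-↭ e x' , r

  rotated : ∀ (a b c d : V) → b ∷ c ∷ d ∷ a ∷ [] ↭ a ∷ b ∷ c ∷ d ∷ []
  rotated a b c d = ++-comm (b ∷ c ∷ d ∷ []) (a ∷ [])

  no-cycle : ∀ p (l : List V) → (∀ {u} → u ∈ l → p ~ u) →
    (∀ {u} → u ∈ l → ∃ λ x → ∃ λ y → x ∈ l × y ∈ l × x ≢ y × u ~ x × u ~ y) → ∀ {u} → u ∈ l → ⊥
  no-cycle p l sub two m = link-acyclic p (_∈ l) (λ _ → sub) (λ u mu → two mu) _ m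

  no-4 : ∀ {p a b c d} → p ~ a → p ~ b → p ~ c → p ~ d → a ~ b → b ~ c → c ~ d → d ~ a → a ≢ c → b ≢ d → ⊥
  no-4 {p} {a} {b} {c} {d} pa pb pc pd ab bc cd da a≢c b≢d = no-cycle p (a ∷ b ∷ c ∷ d ∷ [])
    (λ { (here refl) → pa ; (there (here refl)) → pb ; (there (there (here refl))) → pc ; (there (there (there (here refl)))) → pd })
    (λ { (here refl) → b , d , there (here refl) , there (there (there (here refl))) , b≢d , ab , ~-sym da
       ; (there (here refl)) → a , c , here refl , there (there (here refl)) , a≢c , ~-sym ab , bc
       ; (there (there (here refl))) → b , d , there (here refl) , there (there (there (here refl))) , b≢d , ~-sym bc , cd
       ; (there (there (there (here refl)))) → a , c , here refl , there (there (here refl)) , a≢c , da , ~-sym cd })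
    (here refl)

  no-3 : ∀ {p a b c} → p ~ a → p ~ b → p ~ c → a ~ b → b ~ c → c ~ a → ⊥
  no-3 {p} {a} {b} {c} pa pb pc ab bc ca = no-cycle p (a ∷ b ∷ c ∷ [])
    (λ { (here refl) → pa ; (there (here refl)) → pb ; (there (there (here refl))) → pc })
    (λ { (here refl) → b , c , there (here refl) , there (there (here refl)) , ~⇒≢ bc , ab , ~-sym ca
       ; (there (here refl)) → a , c , here refl , there (there (here refl)) , (λ { refl → ~-irrefl ca }) , ~-sym ab , bc
       ; (there (there (here refl))) → a , b , here refl , there (here refl) , ~⇒≢ ab , ca , ~-sym bc })
    (here refl)

  no-5 : ∀ {p a b c d e} → p ~ a → p ~ b → p ~ c → p ~ d → p ~ e → a ~ b → b ~ c → c ~ d → d ~ e → e ~ a → a ≢ c → b ≢ d → c ≢ e → d ≢ a → e ≢ b → ⊥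
  no-5 {p} {a} {b} {c} {d} {e} pa pb pc pd pe ab bc cd de ea a≢c b≢d c≢e d≢a e≢b = no-cycle p (a ∷ b ∷ c ∷ d ∷ e ∷ [])
    (λ { (here refl) → pa ; (there (here refl)) → pb ; (there (there (here refl))) → pc ; (there (there (there (here refl)))) → pd ; (there (there (there (there (here refl))))) → pe })
    (λ { (here refl) → b , e , there (here refl) , there (there (there (there (here refl)))) , (λ x → e≢b (≡sym x)) , ab , ~-sym ea
       ; (there (here refl)) → a , c , here refl , there (there (here refl)) , a≢c , ~-sym ab , bc
       ; (there (there (here refl))) → b , d , there (here refl) , there (there (there (here refl))) , b≢d , ~-sym bc , cd
       ; (there (there (there (here refl)))) → c , e , there (there (here refl)) , there (there (there (there (here refl)))) , c≢e , ~-sym cd , de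
       ; (there (there (there (there (here refl))))) → d , a , there (there (there (here refl))) , here refl , d≢a , ~-sym de , ea })
    (here refl)

  apart : ∀ p q → p ≡ q ⊎ p ~ q ⊎ (p ≢ q × ¬ (p ~ q))
  apart p q with p ≟ q | p ~? q
  ... | yes e | _ = inj₁ e
  ... | no _ | yes a = inj₂ (inj₁ a)
  ... | no n | no a = inj₂ (inj₂ (n , a))

  -- Let two consecutive edges share the apex `p`. If no two apexes were distinct and non-adjacent,
  -- the link of `p` would contain the cycle `a b c q` or `a b c q r`.
  coincide : ∀ {a b c d p q r} → Quad a b c d → Common a b p → Common b c p → Common c d q → Common d a r → Found (a ∷ b ∷ c ∷ d ∷ [])
  coincide {a} {b} {c} {d} {p} {q} {r} Q abp@(ap , bp) bcp@(_ , cp) cdq@(cq , dq) dar@(dr , ar) = go (apart p q) (apart p r) (apart q r)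
    where
    open Quad Q
    A = a ∷ b ∷ c ∷ d ∷ []
    xp : Apex A p
    xp = apex Q abp
    xq : Apex A q
    xq = apex-↭ (↭-trans (rotated b c d a) (rotated a b c d)) (apex (turn (turn Q)) cdq)
    xr : Apex A r
    xr = apex-↭ (↭-trans (rotated c d a b) (↭-trans (rotated b c d a) (rotated a b c d))) (apex (turn (turn (turn Q))) dar)
    not-d : ¬ (p ~ d)
    not-d pd = no-4 (~-sym ap) (~-sym bp) (~-sym cp) pd (B-~ ab) (B-~ bc) (B-~ cd) (B-~ da) a≢c b≢d
    b≢ : ∀ {x} → d ~ x → b ≢ x
    b≢ dx refl = chordless (turn Q) (~-sym dx)
    go : _ → _ → _ → Found A
    go (inj₂ (inj₂ (n , m))) _ _ = p , q , xp , xq , n , m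
    go _ (inj₂ (inj₂ (n , m))) _ = p , r , xp , xr , n , m
    go _ _ (inj₂ (inj₂ (n , m))) = q , r , xq , xr , n , m
    go (inj₁ refl) _ _ = ⊥-elim (not-d (~-sym dq))
    go _ (inj₁ refl) _ = ⊥-elim (not-d (~-sym dr))
    go (inj₂ (inj₁ pq)) (inj₂ (inj₁ pr)) (inj₁ refl) = ⊥-elim (no-4 (~-sym ap) (~-sym bp) (~-sym cp) pq (B-~ ab) (B-~ bc) cq (~-sym ar) a≢c (b≢ dq))
    go (inj₂ (inj₁ pq)) (inj₂ (inj₁ pr)) (inj₂ (inj₁ qr)) =
      ⊥-elim (no-5 (~-sym ap) (~-sym bp) (~-sym cp) pq pr (B-~ ab) (B-~ bc) cq qr (~-sym ar) a≢c (b≢ dq)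
        (λ { refl → chordless Q ar }) (λ { refl → chordless Q (~-sym cq) }) (λ e → b≢ dr (≡sym e)))

  -- Opposite edges have different apexes, for otherwise the square is a cycle in the link of the
  -- apex. Four pairwise adjacent apexes would put a triangle into the link of `p`.
  apexes : ∀ {a b c d} → Quad a b c d → Found (a ∷ b ∷ c ∷ d ∷ [])
  apexes {a} {b} {c} {d} Q with common (B-~ (Quad.ab Q)) | common (B-~ (Quad.bc Q)) | common (B-~ (Quad.cd Q)) | common (B-~ (Quad.da Q))
  ... | p , cp | q , cq | r , cr | s , cs = go (apart p q) (apart q r) (apart r s) (apart s p) (apart p r) (apart q s)
    where
    open Quad Q
    A = a ∷ b ∷ c ∷ d ∷ []
    xp : Apex A p
    xp = apex Q cp
    xq : Apex A q
    xq = apex-↭ (rotated a b c d) (apex (turn Q) cq)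
    xr : Apex A r
    xr = apex-↭ (↭-trans (rotated b c d a) (rotated a b c d)) (apex (turn (turn Q)) cr)
    xs : Apex A s
    xs = apex-↭ (↭-trans (rotated c d a b) (↭-trans (rotated b c d a) (rotated a b c d))) (apex (turn (turn (turn Q))) cs)
    opposite : ∀ {a b c d p} → Quad a b c d → Common a b p → Common c d p → ⊥
    opposite q (ap , bp) (cp , dp) = no-4 (~-sym ap) (~-sym bp) (~-sym cp) (~-sym dp) (B-~ (Quad.ab q)) (B-~ (Quad.bc q)) (B-~ (Quad.cd q)) (B-~ (Quad.da q)) (Quad.a≢c q) (Quad.b≢d q)
    go : _ → _ → _ → _ → _ → _ → Found A
    go (inj₂ (inj₂ (n , m))) _ _ _ _ _ = p , q , xp , xq , n , m
    go _ (inj₂ (inj₂ (n , m))) _ _ _ _ = q , r , xq , xr , n , m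
    go _ _ (inj₂ (inj₂ (n , m))) _ _ _ = r , s , xr , xs , n , m
    go _ _ _ (inj₂ (inj₂ (n , m))) _ _ = s , p , xs , xp , n , m
    go _ _ _ _ (inj₂ (inj₂ (n , m))) _ = p , r , xp , xr , n , m
    go _ _ _ _ _ (inj₂ (inj₂ (n , m))) = q , s , xq , xs , n , m
    go _ _ _ _ (inj₁ refl) _ = ⊥-elim (opposite Q cp cr)
    go _ _ _ _ _ (inj₁ refl) = ⊥-elim (opposite (turn Q) cq cs)
    go (inj₁ refl) _ _ _ _ _ = coincide Q cp cq cr cs
    go _ (inj₁ refl) _ _ _ _ = found-↭ (rotated a b c d) (coincide (turn Q) cq cr cs cp)
    go _ _ (inj₁ refl) _ _ _ = found-↭ (↭-trans (rotated b c d a) (rotated a b c d)) (coincide (turn (turn Q)) cr cs cp cq)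
    go _ _ _ (inj₁ refl) _ _ = found-↭ (↭-trans (rotated c d a b) (↭-trans (rotated b c d a) (rotated a b c d))) (coincide (turn (turn (turn Q))) cs cp cq cr)
    go (inj₂ (inj₁ pq)) (inj₂ (inj₁ qr)) (inj₂ (inj₁ rs)) (inj₂ (inj₁ sp)) (inj₂ (inj₁ pr)) (inj₂ (inj₁ qs)) =
      ⊥-elim (no-3 pq pr (~-sym sp) qr rs (~-sym qs))

  -- Closed sets and their cyclic orders

  opaque
    inL : List V → V → Bool
    inL l v = ⌊ v ∈? l ⌋

    inL-∈ : ∀ {l v} → inL l v ≡ true → v ∈ l
    inL-∈ {l} {v} e with v ∈? l
    ... | yes m = m

    ∈-inL : ∀ {l v} → v ∈ l → inL l v ≡ true
    ∈-inL {l} {v} m with v ∈? l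
    ... | yes _ = refl
    ... | no n = ⊥-elim (n m)

    ∉-inL : ∀ {l v} → v ∉ l → inL l v ≡ false
    ∉-inL {l} {v} m with v ∈? l
    ... | yes k = ⊥-elim (m k)
    ... | no n = refl

    inL-∉ : ∀ {l v} → inL l v ≡ false → v ∉ l
    inL-∉ e m = true≢false (∈-inL m) e

    sees : List V → V → Bool
    sees l v = ⌊ any? (v ~?_) l ⌋

    sees-intro : ∀ {l v f} → f ∈ l → v ~ f → sees l v ≡ true
    sees-intro {l} {v} m a with any? (v ~?_) l
    ... | yes _ = refl
    ... | no n = ⊥-elim (n (lose m a))

    sees-elim : ∀ {l v} → sees l v ≡ true → ∃ λ f → f ∈ l × v ~ f
    sees-elim {l} {v} e with any? (v ~?_) l
    ... | yes a = find a

  Closed : List V → Set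
  Closed l = ∀ {z w} → z ∈ l → B z w → w ∈ l

  closed-inL : ∀ {l} → Closed l → closed-sub (inL l)
  closed-inL {l} cl {u} {v} b with bool-cases (inL l u) | bool-cases (inL l v)
  ... | inj₁ t | inj₁ t' = trans t (≡sym t')
  ... | inj₂ f | inj₂ f' = trans f (≡sym f')
  ... | inj₁ t | inj₂ f = ⊥-elim (inL-∉ f (cl (inL-∈ t) b))
  ... | inj₂ f | inj₁ t = ⊥-elim (inL-∉ f (cl (inL-∈ t) (B-sym b)))

  Closed-++ : ∀ {k l} → Closed k → Closed l → Closed (k ++ l)
  Closed-++ {k} ck cl m b with ∈-++⁻ k m
  ... | inj₁ x = ∈-++⁺ˡ (ck x b)
  ... | inj₂ x = ∈-++⁺ʳ k (cl x b)

  Whole : List V → Set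
  Whole L = Unique L × (∀ x → x ∈ L)

  Whole-↭ : ∀ {K L} → K ↭ L → Whole K → Whole L
  Whole-↭ e (u , c) = Unique-resp-↭ e u , λ x → ∈-resp-↭ e (c x)

  Trip : List V → V → V → Set
  Trip = Tour _~_

  trip-sym : ∀ {c u v} → Trip c u v → Trip c v u
  trip-sym (l , p , e) with rev ~-sym p
  ... | l' , p' , e' = l' , p' , ↭-trans e' e

  trip-join : ∀ {P Q u v w z} → Trip P u v → v ~ w → Trip Q w z → Trip (P ++ Q) u z
  trip-join (l , p , e) a (l' , p' , e') = l ++ l' , join p a p' , ++⁺ e e'

  no-trip : ∀ {L u v} → Whole L → Trip L u v → ⊥
  no-trip (u , c) (l , p , e) = untraceable p (Unique-resp-↭ (↭-sym e) u) (λ x → ∈-resp-↭ (↭-sym e) (c x))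

  opaque
    crossing : (P : V → Bool) → ∀ {u v} → P u ≡ true → P v ≡ false → ∃ λ a → ∃ λ b → P a ≡ true × P b ≡ false × a ~ b
    crossing P {u} {v} pu pv = go (walk u v) pu pv
      where
      go : ∀ {u v} → Walk G u v → P u ≡ true → P v ≡ false → ∃ λ a → ∃ λ b → P a ≡ true × P b ≡ false × a ~ b
      go here t f = ⊥-elim (true≢false t f)
      go (step {u} {w} a r) t f with bool-cases (P w)
      ... | inj₁ t' = go r t' f
      ... | inj₂ f' = u , w , t , f' , a

  module Ord {c : List V} (cyc : Cycle _~_ c) = Order {R = _~_} ~-sym ~-irrefl cyc

  cycle-ring : ∀ {c} → Cycle _~_ c → Ring c
  cycle-ring cyc = record { σ = σ ; σ⁻ = σ⁻ ; σ-∈ = σ-∈ ; σ⁻-∈ = σ⁻-∈ ; σσ⁻ = σσ⁻ ; σ⁻σ = σ⁻σ ; unique = Cycle.unique cyc }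
    where open Ord cyc

  -- A boundary cycle, or two of them merged into one cyclic order along two edges (z, σ z) and (m, m').
  record Group : Set where
    field
      mem : List V
      cyc : Cycle _~_ mem
      closed : Closed mem
      len : 4 ≤ length mem
      square-cycle : length mem ≡ 4 → Cycle B mem
    open Ord cyc public
    field
      seam : ∀ {z} → z ∈ mem → ¬ B z (σ z) → ∃ λ m → ∃ λ m' → (m' ≡ σ m ⊎ m ≡ σ m') × m ∈ mem × m' ∈ mem ×
        (∀ {t} → B z t → t ≡ m ⊎ t ≡ σ⁻ z) × (∀ {t} → B (σ z) t → t ≡ m' ⊎ t ≡ σ (σ z))

    ring : Ring mem
    ring = cycle-ring cyc

    unique : Unique mem
    unique = Cycle.unique cyc

    some : ∃ λ v → v ∈ mem
    some = _ , start-∈ (Cycle.path cyc)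

    enter : ∀ {f} → f ∈ mem → ∃ λ f' → Trip mem f f'
    enter m = _ , trip-sym (σ-tour m)

  boundary-group : ∀ {c} → Cycle B c → 4 ≤ length c → Closed c → Group
  boundary-group {c} cyc le cl = record { mem = c ; cyc = cycle (map-Path B-~ path) (B-~ close) unique ; closed = cl ; len = le ; square-cycle = λ _ → cyc
    ; seam = λ m nb → ⊥-elim (nb (BOrder.σ-~ cyc m)) }
    where open Cycle cyc

  -- Merging along A's edge h g and Z's edge p q gives a spanning cycle of A ∪ Z, to which C can be attached.
  no-merge : ∀ {A Z C p q h g} → Whole (A ++ (Z ++ C)) → (∃ λ v → v ∈ Z) → (Γ : Group) → Group.mem Γ ≡ C →
    Trip Z q p → p ~ h → Trip A h g → g ~ q → ⊥
  no-merge {A} {Z} {.(Group.mem Γ)} {p} {q} {h} {g} wh (z , mz) Γ refl (l , P , e) ph (l' , Q , e') gq =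
    no-trip (Whole-↭ (↭-trans (↭-reflexive (≡sym (++-assoc A Z C))) (++⁺ʳ C (++-comm A Z))) wh)
      (Tour-resp (trip-join (σ-tour ma) ab (proj₂ (Group.enter Γ mb))))
    where
    C = Group.mem Γ
    big : Cycle _~_ (l ++ l')
    big = cycle (join P ph Q) gq (Unique-resp-↭ (↭-trans (++-comm l' l) ↭-refl) (Unique-++ˡ (l' ++ l) {C} (Unique-resp-↭
            (↭-trans (↭-reflexive (≡sym (++-assoc A Z C))) (++⁺ʳ C (++⁺ (↭-sym e') (↭-sym e)))) (proj₁ wh))))
    open Ord big
    in-ZA : ∀ x → x ∈ l ++ l' ⊎ x ∈ C
    in-ZA x with ∈-++⁻ A (proj₂ wh x)
    ... | inj₁ m = inj₁ (∈-++⁺ʳ l (∈-resp-↭ (↭-sym e') m))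
    ... | inj₂ m with ∈-++⁻ Z m
    ... | inj₁ k = inj₁ (∈-++⁺ˡ (∈-resp-↭ (↭-sym e) k))
    ... | inj₂ k = inj₂ k
    cross = crossing (inL (l ++ l')) {z} {proj₁ (Group.some Γ)} (∈-inL (∈-++⁺ˡ (∈-resp-↭ (↭-sym e) mz)))
      (∉-inL λ m → apart′ m (proj₂ (Group.some Γ)))
      where
      apart′ : ∀ {x} → x ∈ l ++ l' → x ∈ C → ⊥
      apart′ m k with ∈-++⁻ l m
      ... | inj₁ a = Unique-disjoint (A ++ Z) (subst Unique (≡sym (++-assoc A Z C)) (proj₁ wh)) (∈-++⁺ʳ A (∈-resp-↭ e a)) k
      ... | inj₂ a = Unique-disjoint A (proj₁ wh) (∈-resp-↭ e' a) (∈-++⁺ʳ Z k)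
    a = proj₁ cross
    b = proj₁ (proj₂ cross)
    ma : a ∈ l ++ l'
    ma = inL-∈ (proj₁ (proj₂ (proj₂ cross)))
    mb : b ∈ C
    mb with in-ZA b
    ... | inj₁ m = ⊥-elim (inL-∉ (proj₁ (proj₂ (proj₂ (proj₂ cross)))) m)
    ... | inj₂ m = m
    ab : a ~ b
    ab = proj₂ (proj₂ (proj₂ (proj₂ cross)))
    Tour-resp : ∀ {u v} → Trip ((l ++ l') ++ C) u v → Trip ((Z ++ A) ++ C) u v
    Tour-resp (k , r , f) = k , r , ↭-trans f (++⁺ʳ C (++⁺ e e'))

  -- Two sides seen from a middle part

  record Layout : Set where
    field
      A Z C : List V
      whole : Whole (A ++ (Z ++ C))
      closed-A : Closed A
      closed-Z : Closed Z
      closed-C : Closed C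
      ring : Ring Z
    open Ring ring public
    field
      σ-~ : ∀ {z} → z ∈ Z → z ~ σ z
    side : Bool → List V
    side i = if i then A else C
    S : Bool → V → Bool
    S i v = inL Z v ∧ sees (side i) v
    field
      barrier : ∀ {i v} → S i v ≡ true → S (not i) (σ v) ≡ true → ⊥

    any : V → Bool
    any v = S true v ∨ S false v
    iso : V → Bool
    iso v = not (any (σ v)) ∧ not (any (σ⁻ v))
    K : V → Bool
    K v = S true v ∧ S false v
    pure : Bool → V → Bool
    pure i v = S i v ∧ not (S (not i) v)
    J : Bool → V → Bool
    J i v = pure i v ∧ not (iso v)

    side-closed : ∀ i → Closed (side i)
    side-closed true = closed-A
    side-closed false = closed-C

    side-Z : ∀ i {v} → v ∈ side i → v ∈ Z → ⊥
    side-Z true a z = Unique-disjoint A (proj₁ whole) a (∈-++⁺ˡ z)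
    side-Z false c z = Unique-disjoint Z {C} (AllPairs-drop A (proj₁ whole)) z c
      where
      AllPairs-drop : ∀ (xs : List V) {ys} → Unique (xs ++ ys) → Unique ys
      AllPairs-drop [] u = u
      AllPairs-drop (x ∷ xs) (_ ∷ u) = AllPairs-drop xs u

    A-C : ∀ {v} → v ∈ A → v ∈ C → ⊥
    A-C a c = Unique-disjoint A (proj₁ whole) a (∈-++⁺ʳ Z c)

    side-other : ∀ i {v} → v ∈ side i → v ∈ side (not i) → ⊥
    side-other true a c = A-C a c
    side-other false c a = A-C a c

    where-is : ∀ i x → x ∈ side i ⊎ x ∈ Z ⊎ x ∈ side (not i)
    where-is i x with ∈-++⁻ A (proj₂ whole x)
    where-is true x | inj₁ a = inj₁ a
    where-is false x | inj₁ a = inj₂ (inj₂ a)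
    ... | inj₂ m with ∈-++⁻ Z m
    ... | inj₁ z = inj₂ (inj₁ z)
    where-is true x | inj₂ m | inj₂ c = inj₂ (inj₂ c)
    where-is false x | inj₂ m | inj₂ c = inj₁ c

    S-intro : ∀ i {v f} → v ∈ Z → f ∈ side i → v ~ f → S i v ≡ true
    S-intro i mz mf a = ∧-both (∈-inL mz) (sees-intro mf a)

    S-Z : ∀ {i v} → S i v ≡ true → v ∈ Z
    S-Z e = inL-∈ (∧-fst e)

    S-elim : ∀ i {v} → S i v ≡ true → ∃ λ f → f ∈ side i × v ~ f
    S-elim i {v} e = sees-elim {side i} (∧-snd {inL Z v} e)

    any-S : ∀ i {v} → any v ≡ true → S i v ≡ true ⊎ S (not i) v ≡ true
    any-S true e = ∨-elim e
    any-S false e with ∨-elim e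
    ... | inj₁ a = inj₂ a
    ... | inj₂ b = inj₁ b

    S-any : ∀ i {v} → S i v ≡ true → any v ≡ true
    S-any true e = ∨-left e
    S-any false e = ∨-right e

    any-Z : ∀ {v} → any v ≡ true → v ∈ Z
    any-Z {v} e with any-S true {v} e
    ... | inj₁ s = S-Z {true} s
    ... | inj₂ s = S-Z {false} s

    K-S : ∀ i {x} → K x ≡ true → S i x ≡ true
    K-S true e = ∧-fst e
    K-S false {x} e = ∧-snd {S true x} e

    barrier⁻ : ∀ {i v} → S i v ≡ true → S (not i) (σ⁻ v) ≡ true → ⊥
    barrier⁻ {i} {v} e f = barrier {not i} {σ⁻ v} f (trans (cong₂ S (not-involutive i) (σσ⁻ (S-Z {i} e))) e)

    -- Otherwise J i is closed under the successor.
    exit-or-all : ∀ {X} → (∀ {u} → u ∈ X → u ∈ Z) →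
      (∀ (P : V → Set) {z} → z ∈ X → P z → (∀ {u} → u ∈ X → P u → P (σ u)) → ∀ {w} → w ∈ X → P w) →
      ∀ i {v} → v ∈ X → J i v ≡ true → (∃ λ w → J i w ≡ true × gap any w ≡ true) ⊎ (∀ {w} → w ∈ X → J i w ≡ true)
    exit-or-all {X} sub all i {v} mv jv with any-in (λ w → J i w ∧ gap any w) Z
    ... | inj₁ (w , _ , e) = inj₁ (w , ∧-fst e , ∧-snd {J i w} e)
    ... | inj₂ f = inj₂ (all (λ w → J i w ≡ true) mv jv advance)
      where
      advance : ∀ {u} → u ∈ X → J i u ≡ true → J i (σ u) ≡ true
      advance {u} mu ju = ∧-both next-pure (not-false (¬true λ e → true≢false (trans (cong any (σ⁻σ (sub mu))) any-u) (not-true (∧-snd {not (any (σ (σ u)))} e))))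
        where
        si : S i u ≡ true
        si = ∧-fst {S i u} (∧-fst {pure i u} ju)
        any-u : any u ≡ true
        any-u = S-any i si
        next-any : any (σ u) ≡ true
        next-any with bool-cases (any (σ u))
        ... | inj₁ t = t
        ... | inj₂ e = ⊥-elim (true≢false (∧-both ju (∧-both any-u (not-false e))) (f (sub mu)))
        next-pure : pure i (σ u) ≡ true
        next-pure with any-S i next-any
        ... | inj₂ b = ⊥-elim (barrier {i} {u} si b)
        ... | inj₁ a = ∧-both a (not-false (¬true (λ b → barrier {i} {u} si b)))

    -- Excludes a ring edge parallel to a boundary edge of side `i`; opening both cycles there would
    -- join them into one.
    NoMerge : Bool → Set
    NoMerge i = ∀ {v h g} → v ∈ Z → h ∈ side i → g ∈ side i → B h g → v ~ h → σ v ~ g → ⊥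

    -- If a ring neighbour of `p` sees a vertex `g` of the square, then `p` sees a boundary
    -- neighbour of `g`, which gives parallel edges. The other side is excluded by the barrier.
    apex-iso : ∀ i → NoMerge i → ∀ {p} → p ∈ Z → Apex (side i) p → iso p ≡ true
    apex-iso i nm {p} mp x = ∧-both (not-false (¬true after)) (not-false (¬true before))
      where
      sp : S i p ≡ true
      sp = S-intro i mp (Apex.f∈ x) (Apex.pf x)
      after : any (σ p) ≡ true → ⊥
      after e with any-S i e
      ... | inj₂ b = barrier {i} {p} sp b
      ... | inj₁ a with S-elim i a
      ... | g , mg , qg with near-apex x mg
      ... | h , mh , ph , hg = nm mp mh mg hg ph qg
      before : any (σ⁻ p) ≡ true → ⊥
      before e with any-S i e
      ... | inj₂ b = barrier⁻ {i} {p} sp b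
      ... | inj₁ a with S-elim i a
      ... | g , mg , qg with near-apex x mg
      ... | h , mh , ph , hg = nm (σ⁻-∈ mp) mg mh (B-sym hg) qg (subst (_~ h) (≡sym (σσ⁻ mp)) ph)

  quad-of : ∀ {l} → Cycle B l → length l ≡ 4 → (∃ λ x → x ∉ l) → ∃ λ a → ∃ λ b → ∃ λ c → ∃ λ d → l ≡ a ∷ b ∷ c ∷ d ∷ [] × Quad a b c d
  quad-of {a ∷ b ∷ c ∷ d ∷ []} (cycle (ab ∷ (bc ∷ (cd ∷ [-]))) da ((_ ∷ a≢c ∷ _) ∷ ((_ ∷ b≢d ∷ _) ∷ _))) refl out =
    a , b , c , d , refl , record { ab = ab ; bc = bc ; cd = cd ; da = da ; a≢c = a≢c ; b≢d = b≢d ; outside = out }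

  square-apexes : ∀ {l} → Cycle B l → length l ≡ 4 → (∃ λ x → x ∉ l) → Found l
  square-apexes cyc e out with quad-of cyc e out
  ... | a , b , c , d , refl , q = apexes q

  square-opposite : ∀ {l} → Cycle B l → length l ≡ 4 → ∀ {t f g} → t ∈ l → f ∈ l → g ∈ l → f ≢ t → g ≢ t → ¬ B f t → ¬ B g t → f ≡ g
  square-opposite {a ∷ b ∷ c ∷ d ∷ []} (cycle (ab ∷ (bc ∷ (cd ∷ [-]))) da _) refl {t} {f} {g} mt mf mg ft gt bf bg = go mt mf mg
    where
    L = a ∷ b ∷ c ∷ d ∷ []
    opp : t ∈ L → ∃ λ o → ∀ {x} → x ∈ L → x ≢ t → ¬ B x t → x ≡ o
    opp (here refl) = c , λ { (here e) n _ → ⊥-elim (n e) ; (there (here refl)) _ n → ⊥-elim (n (B-sym ab)) ; (there (there (here e))) _ _ → e ; (there (there (there (here refl)))) _ n → ⊥-elim (n da) }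
    opp (there (here refl)) = d , λ { (here refl) _ n → ⊥-elim (n ab) ; (there (here e)) n _ → ⊥-elim (n e) ; (there (there (here refl))) _ n → ⊥-elim (n (B-sym bc)) ; (there (there (there (here e)))) _ _ → e }
    opp (there (there (here refl))) = a , λ { (here e) _ _ → e ; (there (here refl)) _ n → ⊥-elim (n bc) ; (there (there (here e))) n _ → ⊥-elim (n e) ; (there (there (there (here refl)))) _ n → ⊥-elim (n (B-sym cd)) }
    opp (there (there (there (here refl)))) = b , λ { (here refl) _ n → ⊥-elim (n (B-sym da)) ; (there (here e)) _ _ → e ; (there (there (here refl))) _ n → ⊥-elim (n cd) ; (there (there (there (here e)))) n _ → ⊥-elim (n e) }
    go : t ∈ L → f ∈ L → g ∈ L → f ≡ g
    go mt mf mg with opp mt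
    ... | o , h = trans (h mf ft bf) (≡sym (h mg gt bg))

  B-trip : ∀ {c} → Cycle B c → 3 ≤ length c → ∀ {h g} → h ∈ c → B h g → Trip c h g
  B-trip {c} cyc le {h} {g} mh b with cycle-neighbours cyc le mh b
  ... | inj₁ refl = trip-sym (weak (BOrder.σ-tour cyc mh))
    where
    weak : ∀ {u v} → Tour B c u v → Trip c u v
    weak (l , p , e) = l , map-Path B-~ p , e
  ... | inj₂ refl with BOrder.σ-tour cyc (BOrder.σ⁻-∈ cyc mh)
  ... | l , p , e = l , map-Path B-~ (subst (λ x → Path B x (BOrder.σ⁻ cyc h) l) (BOrder.σσ⁻ cyc mh) p) , e

  -- The configuration `Hex` in terms of the graph; of a run only the triangle at its end is kept.
  record Hexagonal (L : Layout) (i : Bool) : Set where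
    open Layout L
    field
      y z : V
      Jy : J i y ≡ true
      Jz : J i z ≡ true
      σy : σ y ≡ z
      only : ∀ {t} → any t ≡ true → K t ≡ true ⊎ t ≡ y ⊎ t ≡ z
      no-common : ∀ {t} → any t ≡ true → y ~ t → z ~ t → ⊥
      exposed : ∀ {w} → w ≡ y ⊎ w ≡ z → ∃ λ s → ∃ λ s' → K s ≡ true × K s' ≡ true × s ≢ s' × w ~ s × w ~ s' ×
        (∃ λ f → f ∈ side i × w ~ f × s ~ f) × (∃ λ f → f ∈ side i × w ~ f × s' ~ f)
      squares : ∀ j → length (side j) ≡ 4
      long : 11 + count (empty-gap any) Z ≤ length Z

  is4 : ℕ → Bool
  is4 l = ⌊ l ≟ⁿ 4 ⌋

  is4-≡ : ∀ {l} → is4 l ≡ true → l ≡ 4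
  is4-≡ {l} e with l ≟ⁿ 4
  ... | yes p = p

  is4-five : ∀ {l} → 4 ≤ l → 5 ≤ l + ⟦ is4 l ⟧
  is4-five {l} le with l ≟ⁿ 4
  ... | yes e = +-monoˡ-≤ 1 le
  ... | no ne with m≤n⇒m<n∨m≡n le
  ... | inj₁ lt = ≤-trans lt (m≤m+n _ 0)
  ... | inj₂ e = ⊥-elim (ne (≡sym e))

  -- What has to be supplied in both uses of the ring bound: a middle part with a single cyclic
  -- order, and one consisting of two cycles.
  record Ready (L : Layout) : Set where
    open Layout L
    field
      separate : ∀ {a c} → a ∈ A → c ∈ C → a ~ c → ⊥
      nonempty : ∀ i → ∃ λ v → S i v ≡ true
      exit : ∀ {i v} → J i v ≡ true → ∃ λ w → J i w ≡ true × gap any w ≡ true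
      no-merges : ∀ i → length (side i) ≡ 4 → NoMerge i
      cycles : ∀ i → length (side i) ≡ 4 → Cycle B (side i)

  module Facing (L : Layout) (ready : Ready L) where
    open Layout L
    open Ready ready

    F : Bool → V → Bool
    F i = inL (side i)

    F-closed : ∀ i → closed-sub (F i)
    F-closed i = closed-inL (side-closed i)

    F-Z : ∀ i {v} → v ∈ Z → F i v ≡ false
    F-Z i m = ∉-inL λ k → side-Z i k m

    across : ∀ i {a c} → a ∈ side i → c ∈ side (not i) → a ~ c → ⊥
    across true = separate
    across false c a e = separate a c (~-sym e)

    run : Bool → V → V → V → Set
    run i s t t' = s ∈ Z × Run (F i) s t t'

    -- The end `t` lies outside side `i` and sees it. No edge joins the two sides, so `t` is in `Z`;
    -- this is where `separate` is essential.
    run-S : ∀ {i s t t'} → run i s t t' → S i t ≡ true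
    run-S {i} {s} {t} (ms , r) with run-face r
    ... | f , ff , sf , tf with where-is i t
    ... | inj₁ a = ⊥-elim (inL-∉ (run-∉ r) a)
    ... | inj₂ (inj₁ z) = S-intro i z (inL-∈ ff) tf
    ... | inj₂ (inj₂ c) = ⊥-elim (across i (inL-∈ ff) c (~-sym tf))

    run-Z : ∀ {i s t t'} → run i s t t' → t ∈ Z
    run-Z {i} r = S-Z {i} (run-S r)

    flipped : ∀ {i s t t'} → run i s t t' → run i s t' t
    flipped (m , r) = m , run-sym r

    four : Bool → Bool
    four i = is4 (length (side i))

    four-4 : ∀ {i} → four i ≡ true → length (side i) ≡ 4
    four-4 e = is4-≡ e

    apex-Z : ∀ i {p} → Apex (side i) p → p ∈ Z
    apex-Z i {p} x with where-is i p
    ... | inj₁ m = ⊥-elim (Apex.p∉ x m)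
    ... | inj₂ (inj₁ z) = z
    ... | inj₂ (inj₂ c) = ⊥-elim (across i (Apex.f∈ x) c (~-sym (Apex.pf x)))

    isolated : ∀ {i} → four i ≡ true → ∃ λ p → ∃ λ p' → S i p ≡ true × S i p' ≡ true × iso p ≡ true × iso p' ≡ true × p ≢ p' × ¬ (p ~ p')
    isolated {i} e with nonempty i
    ... | v , sv with square-apexes (cycles i (four-4 {i} e)) (four-4 {i} e) (v , λ m → side-Z i m (S-Z {i} sv))
    ... | p , p' , x , x' , ne , na = p , p' , seen x , seen x' , apex-iso i (no-merges i (four-4 {i} e)) (apex-Z i x) x ,
            apex-iso i (no-merges i (four-4 {i} e)) (apex-Z i x') x' , ne , na
      where
      seen : ∀ {p} → Apex (side i) p → S i p ≡ true
      seen x = S-intro i (apex-Z i x) (Apex.f∈ x) (Apex.pf x)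

    config : Config
    config = record
      { A = V ; _≟A_ = _≟_ ; Z = Z ; ring = ring ; _∼_ = _~_ ; ∼-sym = ~-sym ; ∼-irrefl = ~-irrefl ; σ-∼ = σ-~ ; S = S
      ; S-∈ = λ {i} → S-Z {i} ; run = run
      ; run-exists = λ {i} e → let (f , mf , a) = S-elim i e ; (t , t' , r) = sees-run (F-closed i) (F-Z i (S-Z {i} e)) (∈-inL mf) a in t , t' , S-Z {i} e , r
      ; run-back = λ {i} r → let (t'' , r') = run-flip (F-closed i) (F-Z i (proj₁ r)) (proj₂ r) in t'' , run-Z r , r'
      ; run-swap = flipped
      ; run-∼ = λ r → run-~ (proj₂ r) ; run-≁′ = λ r → run-≁ (proj₂ r) ; run-≢′ = λ r → run-≢ (proj₂ r) ; run-S = run-S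
      ; run-apart = λ {i} r r' → run-disjoint (λ v a b → side-other i (inL-∈ a) (inL-∈ b)) (proj₂ r) (proj₂ r')
      ; run-three = λ {i} {j} {k} ab bc ac → run-no-triangle (proj₂ ab) (proj₂ bc) (proj₂ ac) (F-Z i (run-Z (flipped bc))) (F-Z j (run-Z ab)) (F-Z k (run-Z bc))
      ; run-far = λ {i} {j} ab bc a≢c → run-spread (proj₂ ab) (proj₂ bc) a≢c (F-Z i (run-Z (flipped bc))) (F-Z j (run-Z ab))
      ; barrier = barrier ; nonempty = nonempty ; exit = exit ; four = four ; isolated = isolated }

    hexagonal : ∀ {i} → MoreObstacles.Hex config i → Hexagonal L i
    hexagonal {i} h = record { y = H.y h ; z = H.z h ; Jy = H.Jy h ; Jz = H.Jz h ; σy = H.σy h ; only = H.only h ; no-common = H.no-common h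
      ; exposed = λ m → faces (H.exposed h m) ; squares = λ { true → four-4 {true} (H.four-true h) ; false → four-4 {false} (H.four-false h) } ; long = H.long h }
      where
      module H = MoreObstacles.Hex
      face : ∀ {w s t} → run i w s t → ∃ λ f → f ∈ side i × w ~ f × s ~ f
      face (_ , r) with run-face r
      ... | f , ff , wf , sf = f , inL-∈ ff , wf , sf
      faces : ∀ {w} → (∃ λ s → ∃ λ s' → ∃ λ t → ∃ λ t' → K s ≡ true × K s' ≡ true × s ≢ s' × run i w s t × run i w s' t') →
        ∃ λ s → ∃ λ s' → K s ≡ true × K s' ≡ true × s ≢ s' × w ~ s × w ~ s' × (∃ λ f → f ∈ side i × w ~ f × s ~ f) × (∃ λ f → f ∈ side i × w ~ f × s' ~ f)
      faces (s , s' , _ , _ , ks , ks' , ne , r , r') = s , s' , ks , ks' , ne , run-~ (proj₂ r) , run-~ (proj₂ r') , face r , face r'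

    bound : 10 + (⟦ is4 (length A) ⟧ + ⟦ is4 (length C) ⟧) ≤ length Z ⊎ ∃ (Hexagonal L)
    bound with Bound.ring-bound config
    ... | inj₁ le = inj₁ le
    ... | inj₂ (i , h) = inj₂ (i , hexagonal h)

  opaque
    layout-bound : (L : Layout) → Ready L → 10 + (⟦ is4 (length (Layout.A L)) ⟧ + ⟦ is4 (length (Layout.C L)) ⟧) ≤ length (Layout.Z L) ⊎ ∃ (Hexagonal L)
    layout-bound L r = Facing.bound L r

  module _ (L : Layout) (ready : Ready L) where
    open Layout L
    open Ready ready

    -- y and z both see the two opposite vertices of the square, so the edge yz lies on two triangles.
    hex-face : ∀ {i} → (h : Hexagonal L i) → B (Hexagonal.y h) (Hexagonal.z h) → ∀ {t} → t ∈ side i → Common (Hexagonal.y h) (Hexagonal.z h) t → ⊥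
    hex-face {i} h b {t} mt (yt , zt) = finish (second (inj₁ refl) (inj₂ refl) yt (~-sym zt) y~z) (second (inj₂ refl) (inj₁ refl) zt (~-sym yt) (~-sym y~z))
      where
      open Hexagonal h
      e4 : length (side i) ≡ 4
      e4 = squares i
      nm : NoMerge i
      nm = no-merges i e4
      y~z : y ~ z
      y~z = B-~ b
      y∈ : y ∈ Z
      y∈ = S-Z {i} (∧-fst {S i y} (∧-fst {pure i y} Jy))
      second : ∀ {w w'} → w ≡ y ⊎ w ≡ z → w' ≡ y ⊎ w' ≡ z → w ~ t → t ~ w' → w ~ w' → ∃ λ f → f ∈ side i × w ~ f × f ≢ t
      second {w} {w'} m m' wt tw' ww' with exposed m
      ... | s , s' , ks , ks' , s≢s' , ws , ws' , (f , ff , wf , sf) , (f' , ff' , wf' , sf') with f ≟ t | f' ≟ t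
      ... | no ne | _ = f , ff , wf , ne
      ... | yes _ | no ne = f' , ff' , wf' , ne
      ... | yes refl | yes refl = ⊥-elim (no-three-common wt (ws , ~-sym sf) (ws' , ~-sym sf') (ww' , tw') s≢s' (K≢ ks' ) (K≢ ks))
        where
        K≢ : ∀ {x} → K x ≡ true → x ≢ w'
        K≢ kx refl = true≢false (K-S (not i) kx) (not-true (∧-snd {S i w'} (pure-w m')))
          where
          pure-w : w' ≡ y ⊎ w' ≡ z → pure i w' ≡ true
          pure-w (inj₁ refl) = ∧-fst {pure i w'} Jy
          pure-w (inj₂ refl) = ∧-fst {pure i w'} Jz
      finish : (∃ λ f → f ∈ side i × y ~ f × f ≢ t) → (∃ λ f → f ∈ side i × z ~ f × f ≢ t) → ⊥
      finish (f , mf , yf , f≢t) (g , mg , zg , g≢t) with square-opposite (cycles i e4) e4 mt mf mg f≢t g≢t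
            (λ bft → nm y∈ mf mt bft yf (subst (_~ t) (≡sym σy) zt)) (λ bgt → nm y∈ mt mg (B-sym bgt) yt (subst (_~ g) (≡sym σy) zg))
      ... | refl = f≢t (proj₂ b _ _ (yf , zg) (yt , zt))

  -- Two groups separated by a third

  three-trip : ∀ {Z} (Α Γ : Group) → Whole (Group.mem Α ++ (Z ++ Group.mem Γ)) → ∀ {u v a c} → Trip Z u v →
    a ∈ Group.mem Α → u ~ a → c ∈ Group.mem Γ → v ~ c → ⊥
  three-trip Α Γ wh t ma ua mc vc =
    no-trip wh (trip-join (trip-sym (proj₂ (Group.enter Α ma))) (~-sym ua) (trip-join t vc (proj₂ (Group.enter Γ mc))))

  swap-ends : ∀ (A Z C : List V) → A ++ (Z ++ C) ↭ C ++ (Z ++ A)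
  swap-ends A Z C = ↭-trans (++-comm A (Z ++ C)) (↭-trans (↭-reflexive (++-assoc Z C A)) (Perm.shifts Z C))

  rotate-parts : ∀ (A Z C : List V) → A ++ (Z ++ C) ↭ Z ++ (C ++ A)
  rotate-parts A Z C = ↭-trans (++-comm A (Z ++ C)) (↭-reflexive (++-assoc Z C A))

  whole-length : ∀ (A Z C : List V) → Whole (A ++ (Z ++ C)) → length A + (length Z + length C) ≤ n
  whole-length A Z C wh = ≤-trans (≤-reflexive (≡sym (trans (length-++ A) (cong (length A +_) (length-++ Z))))) (Unique-length (proj₁ wh))

  -- 5 + 10 + 5: `f` and `g` mark the squares, each of which is one vertex short and lengthens the
  -- ring by one.
  sum20 : ∀ a z c f g → 5 ≤ a + f → 5 ≤ c + g → 10 + (f + g) ≤ z → 20 ≤ a + (z + c)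
  sum20 a z c f g p q r = +-cancelˡ-≤ (f + g) 20 (a + (z + c)) (begin
    (f + g) + 20 ≡⟨ solve 2 (λ f g → (f :+ g) :+ con 20 := (con 5 :+ con 5) :+ (con 10 :+ (f :+ g))) refl f g ⟩
    (5 + 5) + (10 + (f + g)) ≤⟨ +-mono-≤ (+-mono-≤ p q) r ⟩
    ((a + f) + (c + g)) + z ≡⟨ solve 5 (λ a z c f g → ((a :+ f) :+ (c :+ g)) :+ z := (f :+ g) :+ (a :+ (z :+ c))) refl a z c f g ⟩
    (f + g) + (a + (z + c)) ∎)
    where
    open ≤-Reasoning
    open +-*-Solver

  -- The groups Α, Ζ, Γ are Greek letters; A, Z, C are their vertex lists.
  module Trio (Α Ζ Γ : Group) (whole : Whole (Group.mem Α ++ (Group.mem Ζ ++ Group.mem Γ))) where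
    module Zg = Group Ζ

    private
      A = Group.mem Α
      Z = Group.mem Ζ
      C = Group.mem Γ

    sideG : Bool → Group
    sideG i = if i then Α else Γ

    trip-barrier : ∀ i {u v a c} → Trip Z u v → a ∈ Group.mem (sideG i) → u ~ a → c ∈ Group.mem (sideG (not i)) → v ~ c → ⊥
    trip-barrier true t = three-trip Α Γ whole t
    trip-barrier false t ma ua mc vc = three-trip Α Γ whole (trip-sym t) mc vc ma ua

    side-mem : ∀ i {v} → v ∈ (if i then A else C) → v ∈ Group.mem (sideG i)
    side-mem true m = m
    side-mem false m = m

    layout : Layout
    layout = record { A = A ; Z = Z ; C = C ; whole = whole ; closed-A = Group.closed Α ; closed-Z = Zg.closed ; closed-C = Group.closed Γ
                    ; ring = Zg.ring ; σ-~ = Zg.σ-~ ; barrier = λ {i} {v} → bar i {v} }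
      where
      bar : ∀ i {v} → inL Z v ∧ sees (if i then A else C) v ≡ true → inL Z (Zg.σ v) ∧ sees (if not i then A else C) (Zg.σ v) ≡ true → ⊥
      bar i {v} e f with sees-elim {if i then A else C} (∧-snd {inL Z v} e) | sees-elim {if not i then A else C} (∧-snd {inL Z (Zg.σ v)} f)
      ... | a , ma , va | c , mc , vc = trip-barrier i (trip-sym (Zg.σ-tour (inL-∈ (∧-fst e)))) (side-mem i ma) va (side-mem (not i) mc) vc

    open Layout layout using (S; any; K; pure; J; iso; side; K-S; S-intro; S-elim; S-Z; any-S; S-any; any-Z; where-is; side-Z; NoMerge; exit-or-all; barrier; barrier⁻) public

    S-barrier : ∀ i {u v} → Trip Z u v → S i u ≡ true → S (not i) v ≡ true → ⊥
    S-barrier i t su sv with S-elim i su | S-elim (not i) sv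
    ... | a , ma , ua | c , mc , vc = trip-barrier i t (side-mem i ma) ua (side-mem (not i) mc) vc

    no-merges : ∀ i → Cycle B (side i) → 3 ≤ length (side i) → NoMerge i
    no-merges true cyc le mv mh mg hg vh vg = no-merge whole Zg.some Γ refl (Zg.σ-tour mv) vh (B-trip cyc le mh hg) (~-sym vg)
    no-merges false cyc le mv mh mg hg vh vg = no-merge (Whole-↭ (swap-ends A Z C) whole) Zg.some Α refl (Zg.σ-tour mv) vh (B-trip cyc le mh hg) (~-sym vg)

    squares : ∀ i → length (side i) ≡ 4 → Cycle B (side i)
    squares true e = Group.square-cycle Α e
    squares false e = Group.square-cycle Γ e

    -- On a single cycle, non-isolated seers of one side without an exit would fill all of `Z` and
    -- leave no seer for the other side.
    both-exit : (∀ i → ∃ λ v → S i v ≡ true) → ∀ {i v} → J i v ≡ true → ∃ λ w → J i w ≡ true × Ring.gap Zg.ring any w ≡ true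
    both-exit ne {i} {v} jv with exit-or-all (λ m → m) Zg.σ-closed i (S-Z {i} (∧-fst {S i v} (∧-fst {pure i v} jv))) jv
    ... | inj₁ w = w
    ... | inj₂ all with ne (not i)
    ... | u , su = ⊥-elim (true≢false su (not-true (∧-snd {S i u} (∧-fst {pure i u} (all (S-Z {not i} su))))))

  -- Either the ring bound suffices, or the hexagon occurs, and then the middle part has exactly 11
  -- vertices if `n < 20`. The common neighbour of `y` and `z` cannot be placed in that case.
  separated : ∀ (Α Ζ Γ : Group) → Whole (Group.mem Α ++ (Group.mem Ζ ++ Group.mem Γ)) →
    (∀ {a c} → a ∈ Group.mem Α → c ∈ Group.mem Γ → a ~ c → ⊥) → 20 ≤ n
  separated Α Ζ Γ whole sep with ≤-or-> 20 n
  ... | inj₁ le = le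
  ... | inj₂ n<20 = ⊥-elim contradiction
    where
    open Trio Α Ζ Γ whole
    A = Group.mem Α
    Z = Group.mem Ζ
    C = Group.mem Γ
    lenS : ∀ i → 4 ≤ length (side i)
    lenS true = Group.len Α
    lenS false = Group.len Γ
    across : ∀ i {a c} → a ∈ side i → c ∈ side (not i) → a ~ c → ⊥
    across true = sep
    across false c a e = sep a c (~-sym e)
    nonempty : ∀ i → ∃ λ v → S i v ≡ true
    nonempty i with crossing (inL (side i)) (∈-inL (proj₂ (some i))) (∉-inL λ m → side-Z i m (proj₂ Zg.some))
      where
      some : ∀ i → ∃ λ v → v ∈ side i
      some true = Group.some Α
      some false = Group.some Γ
    ... | a , b , ta , fb , ab with where-is i b
    ... | inj₁ m = ⊥-elim (inL-∉ fb m)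
    ... | inj₂ (inj₁ mz) = b , S-intro i mz (inL-∈ ta) (~-sym ab)
    ... | inj₂ (inj₂ mc) = ⊥-elim (across i (inL-∈ ta) mc ab)
    ready : Ready layout
    ready = record { separate = sep ; nonempty = nonempty ; exit = λ {i} {v} → both-exit nonempty {i} {v}
                   ; no-merges = λ i e → no-merges i (squares i e) (≤-trans (n≤1+n 3) (lenS i)) ; cycles = squares }
    total : length A + (length Z + length C) ≤ 19
    total = ≤-trans (whole-length A Z C whole) (s≤s⁻¹ n<20)
    Z≤11 : length Z ≤ 11
    Z≤11 = +-cancelˡ-≤ 8 (length Z) 11 (≤-trans (≤-trans (≤-reflexive (trans (cong (_+ length Z) {8} {4 + 4} refl) (trans (+-assoc 4 4 (length Z)) (cong (4 +_) (+-comm 4 (length Z))))))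
             (+-mono-≤ (Group.len Α) (+-monoʳ-≤ (length Z) (Group.len Γ)))) total)
    no-hex : ∀ i → Hexagonal layout i → ⊥
    no-hex i h = go (common y~z)
      where
      open Hexagonal h hiding (squares)
      si : ∀ {x} → J i x ≡ true → S i x ≡ true
      si {x} j = ∧-fst {S i x} (∧-fst {pure i x} j)
      other : ∀ {x} → J i x ≡ true → S (not i) x ≡ true → ⊥
      other {x} j e = true≢false e (not-true (∧-snd {S i x} (∧-fst {pure i x} j)))
      y∈ : y ∈ Z
      y∈ = S-Z {i} (si Jy)
      z∈ : z ∈ Z
      z∈ = S-Z {i} (si Jz)
      y~z : y ~ z
      y~z = subst (y ~_) σy (Zg.σ-~ y∈)
      σ⁻z : Zg.σ⁻ z ≡ y
      σ⁻z = trans (cong Zg.σ⁻ (≡sym σy)) (Zg.σ⁻σ y∈)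
      -- `long` and `Z≤11` leave no room for empty gaps: of two consecutive vertices at least one is
      -- a seer.
      full : ∀ {v} → v ∈ Z → Ring.empty-gap Zg.ring any v ≡ true → ⊥
      full m e = count-none (Ring.empty-gap Zg.ring any) Z (n≤0⇒n≡0 (+-cancelˡ-≤ 11 _ 0 (≤-trans long Z≤11))) m e
      next-any : ∀ {t} → t ∈ Z → any t ≡ false → any (Zg.σ t) ≡ true
      next-any {t} mt f with bool-cases (any (Zg.σ t))
      ... | inj₁ e = e
      ... | inj₂ e = ⊥-elim (full mt (∧-both (not-false f) (not-false e)))
      prev-any : ∀ {t} → t ∈ Z → any t ≡ false → any (Zg.σ⁻ t) ≡ true
      prev-any {t} mt f with bool-cases (any (Zg.σ⁻ t))
      ... | inj₁ e = e
      ... | inj₂ e = ⊥-elim (full (Zg.σ⁻-∈ mt) (∧-both (not-false e) (not-false (trans (cong any (Zg.σσ⁻ mt)) f))))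
      -- Otherwise rotating at the chord y t gives a spanning path.
      gap-y : ∀ {t} → t ∈ Z → any t ≡ false → y ~ t → Zg.σ t ≡ y
      gap-y {t} mt f yt with only (next-any mt f)
      ... | inj₁ k = ⊥-elim (S-barrier i (Zg.rotate y∈ mt yt) (trans (cong (S i) σy) (si Jz)) (K-S (not i) k))
      ... | inj₂ (inj₁ e) = e
      ... | inj₂ (inj₂ e) = ⊥-elim (~-irrefl (subst (y ~_) (trans (≡sym (Zg.σ⁻σ mt)) (trans (cong Zg.σ⁻ e) σ⁻z)) yt))
      gap-z : ∀ {t} → t ∈ Z → any t ≡ false → z ~ t → Zg.σ⁻ t ≡ z
      gap-z {t} mt f zt with only (prev-any mt f)
      ... | inj₁ k = ⊥-elim (S-barrier i (Zg.rotate⁻ z∈ mt zt) (trans (cong (S i) σ⁻z) (si Jy)) (K-S (not i) k))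
      ... | inj₂ (inj₂ e) = e
      ... | inj₂ (inj₁ e) = ⊥-elim (~-irrefl (subst (z ~_) (trans (≡sym (Zg.σσ⁻ mt)) (trans (cong Zg.σ e) σy)) zt))
      -- Here `y z` is an edge along which two boundary cycles were merged. The boundary neighbours
      -- `m` and `m'` across the seam are consecutive, and both turn out to be shared, against the
      -- barrier.
      seamed : ¬ B y z → ⊥
      seamed nb with Zg.seam y∈ (λ b → nb (subst (B y) σy b))
      ... | m , m' , con , mm , mm' , ends , ends' = bad con
        where
        ends-z : ∀ {t} → B z t → t ≡ m' ⊎ t ≡ Zg.σ z
        ends-z b with ends' (subst (λ x → B x _) (≡sym σy) b)
        ... | inj₁ e = inj₁ e
        ... | inj₂ e = inj₂ (trans e (cong Zg.σ σy))
        -- There are exactly two boundary neighbours, so two candidates must be distinct and both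
        -- occur.
        pick : ∀ {v x w} → (∀ {t} → B v t → t ≡ x ⊎ t ≡ w) → B v x × x ≢ w
        pick {v} f with B-ends v
        ... | e₁ , e₂ , b₁ , b₂ , ne , _ with f b₁ | f b₂
        ... | inj₁ refl | inj₁ refl = ⊥-elim (ne refl)
        ... | inj₂ refl | inj₂ refl = ⊥-elim (ne refl)
        ... | inj₁ refl | inj₂ refl = b₁ , ne
        ... | inj₂ refl | inj₁ refl = b₂ , λ e → ne (≡sym e)
        Km : K m ≡ true
        Km with bool-cases (any m)
        ... | inj₂ f = ⊥-elim (proj₂ (pick ends) (trans (≡sym (Zg.σ⁻σ mm)) (cong Zg.σ⁻ (gap-y mm f (B-~ (proj₁ (pick ends)))))))
        ... | inj₁ t with only t
        ... | inj₁ k = k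
        ... | inj₂ (inj₁ refl) = ⊥-elim (B-irrefl (proj₁ (pick ends)))
        ... | inj₂ (inj₂ refl) = ⊥-elim (nb (proj₁ (pick ends)))
        Km' : K m' ≡ true
        Km' with bool-cases (any m')
        ... | inj₂ f = ⊥-elim (proj₂ (pick ends-z) (trans (≡sym (Zg.σσ⁻ mm')) (cong Zg.σ (gap-z mm' f (B-~ (proj₁ (pick ends-z)))))))
        ... | inj₁ t with only t
        ... | inj₁ k = k
        ... | inj₂ (inj₂ refl) = ⊥-elim (B-irrefl (proj₁ (pick ends-z)))
        ... | inj₂ (inj₁ refl) = ⊥-elim (nb (B-sym (proj₁ (pick ends-z))))
        bad : m' ≡ Zg.σ m ⊎ m ≡ Zg.σ m' → ⊥
        bad (inj₁ e) = barrier {true} {m} (K-S true Km) (subst (λ x → S false x ≡ true) e (K-S false Km'))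
        bad (inj₂ e) = barrier {true} {m'} (K-S true Km') (subst (λ x → S false x ≡ true) e (K-S false Km))
      go : (∃ λ t → Common y z t) → ⊥
      go (t , yt , zt) with where-is i t
      ... | inj₂ (inj₂ mc) = other Jy (S-intro (not i) y∈ mc yt)
      ... | inj₁ mi with B? y z
      ... | yes b = hex-face layout ready h b mi (yt , zt)
      ... | no nb = seamed nb
      go (t , yt , zt) | inj₂ (inj₁ mz) with bool-cases (any t)
      ... | inj₁ e = no-common e yt zt
      -- Now `t` lies between `z` and `y` on the ring, which would have only three vertices.
      ... | inj₂ f = <-irrefl refl (≤-trans (s≤s (s≤s (s≤s (s≤s z≤n)))) (≤-trans long (≤-trans (Unique-⊆-length Zg.unique in-three) ≤-refl)))
        where
        in-three : ∀ {x} → x ∈ Z → x ∈ y ∷ z ∷ t ∷ []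
        in-three = Zg.σ-closed (_∈ y ∷ z ∷ t ∷ []) y∈ (here refl)
          λ { _ (here refl) → there (here σy) ; _ (there (here refl)) → there (there (here (trans (cong Zg.σ (≡sym (gap-z mz f zt))) (Zg.σσ⁻ mz)))) ; _ (there (there (here refl))) → here (gap-y mz f yt) }
    contradiction : ⊥
    contradiction with layout-bound layout ready
    ... | inj₂ (i , h) = no-hex i h
    ... | inj₁ le = <-irrefl refl (≤-trans (sum20 (length A) (length Z) (length C) ⟦ is4 (length A) ⟧ ⟦ is4 (length C) ⟧ (is4-five (Group.len Α)) (is4-five (Group.len Γ)) le) total)

  -- Three groups

  record Outward (Z : List V) (s : V) : Set where
    field
      {t t' g g'} : V
      t∈ : t ∈ Z
      t'∈ : t' ∈ Z
      g∉ : g ∉ Z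
      g'∉ : g' ∉ Z
      tg : t ~ g
      t'g' : t' ~ g'
      st : s ~ t
      st' : s ~ t'
      t≢t' : t ≢ t'
      t≁t' : ¬ (t ~ t')

  opaque
    -- A run of the complement of `Z`: its ends are back in `Z`, and each of them sees a vertex
    -- outside.
    outward : ∀ {Z} → Closed Z → ∀ {s f} → s ∈ Z → f ∉ Z → s ~ f → Outward Z s
    outward {Z} cl {s} {f} ms nf sf with sees-run {λ v → not (inL Z v)} (λ b → cong not (closed-inL cl b)) (cong not (∈-inL ms)) (cong not (∉-inL nf)) sf
    ... | t , t' , r = record { t∈ = back (run-∉ r) ; t'∈ = back (run-∉ (run-sym r)) ; g∉ = proj₁ (proj₂ (face r)) ; g'∉ = proj₁ (proj₂ (face (run-sym r)))
                              ; tg = proj₂ (proj₂ (face r)) ; t'g' = proj₂ (proj₂ (face (run-sym r)))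
                              ; st = run-~ r ; st' = run-~ (run-sym r) ; t≢t' = run-≢ r ; t≁t' = run-≁ r }
      where
      back : ∀ {v} → not (inL Z v) ≡ false → v ∈ Z
      back {v} e with bool-cases (inL Z v)
      ... | inj₁ t = inL-∈ t
      ... | inj₂ f = ⊥-elim (true≢false (not-false f) e)
      face : ∀ {t t'} → Run (λ v → not (inL Z v)) s t t' → ∃ λ g → g ∉ Z × t ~ g
      face r with run-face r
      ... | g , e , _ , tg = g , inL-∉ (not-true e) , tg

  module Tight (Α Ζ Γ : Group) (whole : Whole (Group.mem Α ++ (Group.mem Ζ ++ Group.mem Γ))) where
    open Trio Α Ζ Γ whole
    private
      A = Group.mem Α
      Z = Group.mem Ζ
      C = Group.mem Γ
    gap′ : V → Bool
    gap′ = Ring.gap Zg.ring any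

    S-split : ∀ i {v} → S i v ≡ true → K v ≡ true ⊎ pure i v ≡ true
    S-split i {v} e with S (not i) v in eq
    S-split true e | true = inj₁ (∧-both e eq)
    S-split false e | true = inj₁ (∧-both eq e)
    ... | false = inj₂ (∧-both e refl)

    K-pure : ∀ i {v w} → K v ≡ true → pure i w ≡ true → v ≢ w
    K-pure i {v} k p refl = true≢false (K-S (not i) k) (not-true (∧-snd {S i v} p))

    pure-pure : ∀ i {v w} → pure i v ≡ true → pure (not i) w ≡ true → v ≢ w
    pure-pure i {v} p q refl = true≢false (∧-fst {S i v} p) (trans (cong (λ j → S j v) (≡sym (not-involutive i))) (not-true (∧-snd {S (not i) v} q)))

    K-next : ∀ {v} → K v ≡ true → any (Zg.σ v) ≡ false
    K-next {v} k = ¬true λ e → [ (λ s → barrier {false} {v} (K-S false k) s) , (λ s → barrier {true} {v} (K-S true k) s) ]′ (any-S true {Zg.σ v} e)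

    K-prev : ∀ {v} → K v ≡ true → any (Zg.σ⁻ v) ≡ false
    K-prev {v} k = ¬true λ e → [ (λ s → barrier⁻ {false} {v} (K-S false k) s) , (λ s → barrier⁻ {true} {v} (K-S true k) s) ]′ (any-S true {Zg.σ⁻ v} e)

    K-gap : ∀ {v} → K v ≡ true → gap′ v ≡ true
    K-gap {v} k = ∧-both (S-any true {v} (K-S true k)) (not-false (K-next k))

    opaque
      any-out : ∀ {v} → any v ≡ true → ∃ λ f → f ∉ Z × v ~ f
      any-out {v} e with any-S true {v} e
      ... | inj₁ s with S-elim true s
      ... | f , m , a = f , side-Z true m , a
      any-out e | inj₂ s with S-elim false s
      ... | f , m , a = f , side-Z false m , a

    opaque
      out-any : ∀ {v f} → v ∈ Z → f ∉ Z → v ~ f → any v ≡ true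
      out-any {v} {f} mv nf a with where-is true f
      ... | inj₁ m = S-any true {v} (S-intro true mv m a)
      ... | inj₂ (inj₁ m) = ⊥-elim (nf m)
      ... | inj₂ (inj₂ m) = S-any false {v} (S-intro false mv m a)

    opaque
      -- Runs of everything outside `Z` are used, because a run of one side may end on the other
      -- side now that the sides may touch.
      two-any : ∀ {s} → any s ≡ true → ∃ λ t → ∃ λ t' → any t ≡ true × any t' ≡ true × s ~ t × s ~ t' × t ≢ t' × ¬ (t ~ t')
      two-any {s} e = t , t' , out-any t∈ g∉ tg , out-any t'∈ g'∉ t'g' , st , st' , t≢t' , t≁t'
        where
        o : Outward Z s
        o = outward Zg.closed (any-Z {s} e) (proj₁ (proj₂ (any-out {s} e))) (proj₂ (proj₂ (any-out {s} e)))
        open Outward o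

    K-two : ∀ {p p'} → K p ≡ true → K p' ≡ true → p ≢ p' → ¬ (p ~ p') → 8 ≤ length Z
    K-two kp kp' ne na = Isolation.two-isolated _≟_ Zg.ring Zg.σ-closed any (λ {v} → any-Z {v}) _~_ ~-sym ~-irrefl Zg.σ-~ two-any (is kp) (is kp') ne na
      where
      is : ∀ {v} → K v ≡ true → any v ≡ true × any (Zg.σ v) ≡ false × any (Zg.σ⁻ v) ≡ false
      is {v} k = S-any true {v} (K-S true k) , K-next k , K-prev k

    module _ (nonempty : ∀ i → ∃ λ v → S i v ≡ true) where

      opaque
        some-gap : ∀ i {s} → pure i s ≡ true → ∃ λ g → gap′ g ≡ true × pure i g ≡ true
        some-gap i {s} p with bool-cases (iso s)
        ... | inj₁ e = s , ∧-both (S-any i {s} (∧-fst {S i s} p)) (∧-fst e) , p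
        ... | inj₂ f with both-exit nonempty {i} {s} (∧-both p (not-false f))
        ... | w , jw , g = w , g , ∧-fst {pure i w} jw

      opaque
        any≥4 : 4 ≤ count any Z
        any≥4 with nonempty true
        ... | v , s = Isolation.four-seers _≟_ Zg.ring Zg.σ-closed any (λ {v} → any-Z {v}) _~_ ~-sym ~-irrefl Zg.σ-~ two-any {v} (S-any true {v} s)

      gap-Z : ∀ {v} → gap′ v ≡ true → v ∈ Z
      gap-Z {v} g = any-Z {v} (∧-fst {any v} g)

      opaque
        -- Each side has a shared seer, which is itself a gap, or a pure one that leads to a gap.
        -- Should one shared vertex serve both sides, a neighbour of it that sees something supplies
        -- the second gap.
        two-gaps : ∃ λ g → ∃ λ g' → gap′ g ≡ true × gap′ g' ≡ true × g ≢ g'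
        two-gaps with nonempty true | nonempty false
        ... | a , sa | c , sc with S-split true sa | S-split false sc
        ... | inj₂ p | inj₁ k with some-gap true p
        ... | g , gg , pg = c , g , K-gap k , gg , K-pure true k pg
        two-gaps | a , sa | c , sc | inj₂ p | inj₂ q with some-gap true p | some-gap false q
        ... | g , gg , pg | g' , gg' , pg' = g , g' , gg , gg' , pure-pure true pg pg'
        two-gaps | a , sa | c , sc | inj₁ k | _ with two-any {a} (S-any true {a} sa)
        ... | t , _ , at , _ , a~t , _ with any-S true {t} at
        ... | inj₁ st with S-split true st
        ... | inj₁ kt = a , t , K-gap k , K-gap kt , ~⇒≢ a~t
        ... | inj₂ pt with some-gap true pt
        ... | g , gg , pg = a , g , K-gap k , gg , K-pure true k pg
        two-gaps | a , sa | c , sc | inj₁ k | _ | t , _ , at , _ , a~t , _ | inj₂ st with S-split false st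
        ... | inj₁ kt = a , t , K-gap k , K-gap kt , ~⇒≢ a~t
        ... | inj₂ pt with some-gap false pt
        ... | g , gg , pg = a , g , K-gap k , gg , K-pure false k pg

      six : 6 ≤ length Z
      six with two-gaps
      ... | g , g' , gg , gg' , ne = ≤-trans (+-mono-≤ any≥4 (≤-trans (count-≥ gap′ Z (pair ne) λ { (here refl) → gap-Z gg , gg ; (there (here refl)) → gap-Z gg' , gg' }) (m≤m+n _ _))) (Ring.gap-bound Zg.ring any)

      module _ (le6 : length Z ≤ 6) where

        bound6 : count any Z + count gap′ Z ≤ 6
        bound6 = ≤-trans (+-monoʳ-≤ (count any Z) (m≤m+n _ _)) (≤-trans (Ring.gap-bound Zg.ring any) le6)

        no-three : ∀ {a b c} → gap′ a ≡ true → gap′ b ≡ true → gap′ c ≡ true → a ≢ b → a ≢ c → b ≢ c → ⊥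
        no-three ga gb gc ab ac bc = <-irrefl refl (≤-trans (+-mono-≤ any≥4 (count-≥ gap′ Z
            (∉⇒Unique (λ { (here e) → ab e ; (there (here e)) → ac e }) (pair bc))
            λ { (here refl) → gap-Z ga , ga ; (there (here refl)) → gap-Z gb , gb ; (there (there (here refl))) → gap-Z gc , gc })) bound6)

        opaque
          -- Without shared vertices the runs of either side end in `Z`, so each side has four seers
          -- of its own, eight in all.
          K-some : ∃ λ a → K a ≡ true
          K-some with any-in K Z
          ... | inj₁ (a , _ , k) = a , k
          ... | inj₂ none = ⊥-elim (<-irrefl refl (≤-trans (≤-trans (≤-trans (s≤s (s≤s (s≤s (s≤s (s≤s (s≤s (s≤s z≤n))))))) (+-mono-≤ (S4 true) (S4 false)))
                (≤-trans (≤-reflexive (≡sym (∑-+ Z _ _))) (∑-mono Z (λ {v} m → disj (S true v) (S false v) (none m))))) (≤-trans (m≤m+n _ _) bound6)))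
            where
            disj : ∀ a b → a ∧ b ≡ false → ⟦ a ⟧ + ⟦ b ⟧ ≤ ⟦ a ∨ b ⟧
            disj true false e = ≤-refl
            disj false b e = ≤-refl
            not-K : ∀ i {v} → S i v ≡ true → S (not i) v ≡ true → ⊥
            not-K true {v} a b = true≢false (∧-both a b) (none (S-Z {true} a))
            not-K false {v} a b = true≢false (∧-both b a) (none (S-Z {true} b))
            two-S : ∀ i {s} → S i s ≡ true → ∃ λ t → ∃ λ t' → S i t ≡ true × S i t' ≡ true × s ~ t × s ~ t' × t ≢ t' × ¬ (t ~ t')
            two-S i {s} e with S-elim i e
            ... | f , mf , sf with sees-run {inL (side i)} (closed-inL (Layout.side-closed layout i)) (∉-inL λ m → side-Z i m (S-Z {i} e)) (∈-inL mf) sf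
            ... | t , t' , r = t , t' , seen r , seen (run-sym r) , run-~ r , run-~ (run-sym r) , run-≢ r , run-≁ r
              where
              seen : ∀ {t t'} → Run (inL (side i)) s t t' → S i t ≡ true
              seen {t} r with where-is i t
              ... | inj₁ m = ⊥-elim (inL-∉ (run-∉ r) m)
              ... | inj₂ (inj₂ m) = ⊥-elim (not-K i e (S-intro (not i) (S-Z {i} e) m (run-~ r)))
              ... | inj₂ (inj₁ m) with run-face r
              ... | g , tg , _ , a = S-intro i m (inL-∈ tg) a
            S4 : ∀ i → 4 ≤ count (S i) Z
            S4 i = Isolation.four-seers _≟_ Zg.ring Zg.σ-closed (S i) (λ {v} → S-Z {i} {v}) _~_ ~-sym ~-irrefl Zg.σ-~ (two-S i) (proj₂ (nonempty i))

        opaque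
          -- Only two gaps exist. One is a shared `a`, the other a pure vertex of some side `i`; a
          -- further seer of the side `not i` would bring a third.
          sole : ∃ λ i → ∃ λ a → K a ≡ true × (∀ {v} → S (not i) v ≡ true → v ≡ a)
          sole with K-some
          ... | a , ka with two-any {a} (S-any true {a} (K-S true ka))
          ... | t , _ , at , _ , a~t , _ = go (any-S true {t} at)
            where
            by-pure : ∀ i → pure i t ≡ true → ∃ λ i → ∃ λ a → K a ≡ true × (∀ {v} → S (not i) v ≡ true → v ≡ a)
            by-pure i p with some-gap i p
            ... | g , gg , pg = i , a , ka , all
              where
              all : ∀ {v} → S (not i) v ≡ true → v ≡ a
              all {v} sv with v ≟ a
              ... | yes e = e
              ... | no ne with S-split (not i) sv
              ... | inj₁ kv = ⊥-elim (no-three (K-gap ka) (K-gap kv) gg (λ e → ne (≡sym e)) (K-pure i ka pg) (K-pure i kv pg))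
              ... | inj₂ pv with some-gap (not i) pv
              ... | g' , gg' , pg' = ⊥-elim (no-three (K-gap ka) gg gg' (K-pure i ka pg) (K-pure (not i) ka pg') (pure-pure i pg pg'))
            by-K : K t ≡ true → ⊥
            by-K kt with pick-other _≟_ any Z (a ∷ t ∷ []) Zg.unique (≤-trans (n≤1+n 3) any≥4)
            ... | s , _ , as , ns = third (any-S true {s} as)
              where
              a≢s : a ≢ s
              a≢s e = ns (here (≡sym e))
              t≢s : t ≢ s
              t≢s e = ns (there (here (≡sym e)))
              pure-s : ∀ i → pure i s ≡ true → ⊥
              pure-s i p with some-gap i p
              ... | g , gg , pg = no-three (K-gap ka) (K-gap kt) gg (~⇒≢ a~t) (K-pure i ka pg) (K-pure i kt pg)
              third : S true s ≡ true ⊎ S false s ≡ true → ⊥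
              third (inj₁ e) with S-split true e
              ... | inj₁ ks = no-three (K-gap ka) (K-gap kt) (K-gap ks) (~⇒≢ a~t) a≢s t≢s
              ... | inj₂ p = pure-s true p
              third (inj₂ e) with S-split false e
              ... | inj₁ ks = no-three (K-gap ka) (K-gap kt) (K-gap ks) (~⇒≢ a~t) a≢s t≢s
              ... | inj₂ p = pure-s false p
            go : S true t ≡ true ⊎ S false t ≡ true → ∃ λ i → ∃ λ a → K a ≡ true × (∀ {v} → S (not i) v ≡ true → v ≡ a)
            go (inj₁ e) with S-split true e
            ... | inj₁ kt = ⊥-elim (by-K kt)
            ... | inj₂ p = by-pure true p
            go (inj₂ e) with S-split false e
            ... | inj₁ kt = ⊥-elim (by-K kt)
            ... | inj₂ p = by-pure false p

        opaque
          -- At `a` take a run of the side `not i`. Its ends see that side, so they are not in `Z`,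
          -- where `a` alone does; hence they are non-adjacent vertices of side `i` that see both
          -- other groups.
          witnesses : ∃ λ i → ∃ λ t → ∃ λ t' → t ∈ side i × t' ∈ side i × t ≢ t' × ¬ (t ~ t') ×
            (∃ λ a → a ∈ Z × t ~ a × t' ~ a) × (∃ λ g → g ∈ side (not i) × t ~ g) × (∃ λ g → g ∈ side (not i) × t' ~ g)
          witnesses with sole
          ... | i , a , ka , only with S-elim (not i) (K-S (not i) ka)
          ... | f , mf , af with sees-run {inL (side (not i))} (closed-inL (Layout.side-closed layout (not i))) (∉-inL λ m → side-Z (not i) m a∈) (∈-inL mf) af
            where
            a∈ : a ∈ Z
            a∈ = S-Z {true} (K-S true ka)
          ... | t , t' , r = i , t , t' , in-side r , in-side (run-sym r) , run-≢ r , run-≁ r , (a , S-Z {true} (K-S true ka) , ~-sym (run-~ r) , ~-sym (run-~ (run-sym r))) , face r , face (run-sym r)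
            where
            face : ∀ {t t'} → Run (inL (side (not i))) a t t' → ∃ λ g → g ∈ side (not i) × t ~ g
            face r with run-face r
            ... | g , e , _ , tg = g , inL-∈ e , tg
            in-side : ∀ {t t'} → Run (inL (side (not i))) a t t' → t ∈ side i
            in-side {t} r with where-is i t
            ... | inj₁ m = m
            ... | inj₂ (inj₂ m) = ⊥-elim (inL-∉ (run-∉ r) m)
            ... | inj₂ (inj₁ m) with face r
            ... | g , mg , tg = ⊥-elim (~-irrefl (subst (a ~_) (only (S-intro (not i) m mg tg)) (run-~ r)))

  -- With the group of the two witnesses in the middle, these are non-adjacent shared vertices, and
  -- `K-two` applies.
  crowded : ∀ (Α Ζ Γ : Group) (whole : Whole (Group.mem Α ++ (Group.mem Ζ ++ Group.mem Γ))) →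
    (∀ i → ∃ λ v → Trio.S Α Ζ Γ whole i v ≡ true) → length (Group.mem Ζ) ≤ 6 → 8 ≤ length (Group.mem Α) ⊎ 8 ≤ length (Group.mem Γ)
  crowded Α Ζ Γ whole ne le with Tight.witnesses Α Ζ Γ whole ne le
  ... | true , t , t' , m , m' , d , na , (a , ma , ta , ta') , (g , mg , tg) , (g' , mg' , tg') =
    inj₁ (Tight.K-two Ζ Α Γ wh (∧-both (T.S-intro true m ma ta) (T.S-intro false m mg tg)) (∧-both (T.S-intro true m' ma ta') (T.S-intro false m' mg' tg')) d na)
    where
    wh = Whole-↭ (Perm.shifts (Group.mem Α) (Group.mem Ζ)) whole
    module T = Trio Ζ Α Γ wh
  ... | false , t , t' , m , m' , d , na , (a , ma , ta , ta') , (g , mg , tg) , (g' , mg' , tg') =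
    inj₂ (Tight.K-two Ζ Γ Α wh (∧-both (T.S-intro true m ma ta) (T.S-intro false m mg tg)) (∧-both (T.S-intro true m' ma ta') (T.S-intro false m' mg' tg')) d na)
    where
    wh = Whole-↭ (rotate-parts (Group.mem Α) (Group.mem Ζ) (Group.mem Γ)) whole
    module T = Trio Ζ Γ Α wh

  Touch : Group → Group → Set
  Touch P Q = ∃ λ p → ∃ λ q → p ∈ Group.mem P × q ∈ Group.mem Q × p ~ q

  touch-sym : ∀ {P Q} → Touch P Q → Touch Q P
  touch-sym (p , q , mp , mq , a) = q , p , mq , mp , ~-sym a

  touch? : ∀ P Q → Touch P Q ⊎ (∀ {p q} → p ∈ Group.mem P → q ∈ Group.mem Q → p ~ q → ⊥)
  touch? P Q with any-in (sees (Group.mem Q)) (Group.mem P)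
  ... | inj₁ (p , mp , e) with sees-elim {Group.mem Q} e
  ... | q , mq , a = inj₁ (p , q , mp , mq , a)
  touch? P Q | inj₂ f = inj₂ λ mp mq a → true≢false (sees-intro mq a) (f mp)

  -- If every two groups touch, each has at least 6 vertices. One with only 6 forces 8 in another
  -- one, and 6 + 6 + 8 = 20; otherwise 7 + 7 + 7 is enough.
  three-groups : ∀ (P Q R : Group) → Whole (Group.mem P ++ (Group.mem Q ++ Group.mem R)) → 20 ≤ n
  three-groups P Q R wh = go (touch? P Q) (touch? Q R) (touch? P R)
    where
    p = length (Group.mem P)
    q = length (Group.mem Q)
    r = length (Group.mem R)
    wh₁ : Whole (Group.mem Q ++ (Group.mem P ++ Group.mem R))
    wh₁ = Whole-↭ (Perm.shifts (Group.mem P) (Group.mem Q)) wh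
    wh₂ : Whole (Group.mem P ++ (Group.mem R ++ Group.mem Q))
    wh₂ = Whole-↭ (++⁺ˡ (Group.mem P) (++-comm (Group.mem Q) (Group.mem R))) wh
    sees-both : ∀ (Α Ζ Γ : Group) (whole : Whole (Group.mem Α ++ (Group.mem Ζ ++ Group.mem Γ))) → Touch Ζ Α → Touch Ζ Γ → ∀ i → ∃ λ v → Trio.S Α Ζ Γ whole i v ≡ true
    sees-both Α Ζ Γ whole (z , a , mz , ma , e) _ true = z , Trio.S-intro Α Ζ Γ whole true mz ma e
    sees-both Α Ζ Γ whole _ (z , c , mz , mc , e) false = z , Trio.S-intro Α Ζ Γ whole false mz mc e
    add : ∀ {a b c x y z} → a ≤ x → b ≤ y → c ≤ z → a + (b + c) ≤ x + (y + z)
    add l m k = +-mono-≤ l (+-mono-≤ m k)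
    sum : p + (q + r) ≤ n
    sum = whole-length (Group.mem P) (Group.mem Q) (Group.mem R) wh
    go : _ → _ → _ → 20 ≤ n
    go (inj₂ s) _ _ = separated P R Q wh₂ s
    go _ (inj₂ s) _ = separated Q P R wh₁ s
    go _ _ (inj₂ s) = separated P Q R wh s
    go (inj₁ pq) (inj₁ qr) (inj₁ pr) = sizes (≤-or-> p 6) (≤-or-> q 6) (≤-or-> r 6)
      where
      neQ = sees-both P Q R wh (touch-sym {P} {Q} pq) qr
      neP = sees-both Q P R wh₁ pq pr
      neR = sees-both P R Q wh₂ (touch-sym {P} {R} pr) (touch-sym {Q} {R} qr)
      p6 : 6 ≤ p
      p6 = Tight.six Q P R wh₁ neP
      q6 : 6 ≤ q
      q6 = Tight.six P Q R wh neQ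
      r6 : 6 ≤ r
      r6 = Tight.six P R Q wh₂ neR
      sizes : _ → _ → _ → 20 ≤ n
      sizes (inj₁ l) _ _ with crowded Q P R wh₁ neP l
      ... | inj₁ e = ≤-trans (add p6 e r6) sum
      ... | inj₂ e = ≤-trans (add p6 q6 e) sum
      sizes _ (inj₁ l) _ with crowded P Q R wh neQ l
      ... | inj₁ e = ≤-trans (add e q6 r6) sum
      ... | inj₂ e = ≤-trans (add p6 q6 e) sum
      sizes _ _ (inj₁ l) with crowded P R Q wh₂ neR l
      ... | inj₁ e = ≤-trans (add e q6 r6) sum
      ... | inj₂ e = ≤-trans (add p6 e r6) sum
      sizes (inj₂ a) (inj₂ b) (inj₂ c) = ≤-trans (n≤1+n 20) (≤-trans (add a b c) sum)

  -- Four boundary cycles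

  record Orig : Set where
    field
      mem : List V
      bcyc : Cycle B mem
      len : 4 ≤ length mem
      closed : Closed mem

    len3 : 3 ≤ length mem
    len3 = ≤-trans (n≤1+n 3) len

    group : Group
    group = boundary-group bcyc len closed

    open Group group public using (σ; σ⁻; σ-∈; σ⁻-∈; σσ⁻; σ⁻σ; σ-closed; σ-tour; ring; some; enter; unique)

    σ-B : ∀ {v} → v ∈ mem → B v (σ v)
    σ-B = BOrder.σ-~ bcyc

    σ⁻-B : ∀ {v} → v ∈ mem → B v (σ⁻ v)
    σ⁻-B m = B-sym (subst (B _) (σσ⁻ m) (σ-B (σ⁻-∈ m)))

    σ≢ : ∀ {v} → v ∈ mem → σ v ≢ σ⁻ v
    σ≢ = σ≢σ⁻ bcyc len3

    trip : ∀ {h g} → h ∈ mem → B h g → Trip mem h g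
    trip = B-trip bcyc len3

  open Orig using (mem) public

  path-loop : ∀ {R : V → V → Set} {u l} → Path R u u l → Unique l → l ≡ u ∷ []
  path-loop [-] _ = refl
  path-loop (r ∷ p) (a ∷ _) = ⊥-elim (All.lookup a (end-∈ p) refl)

  opaque
    last-two : ∀ {u v l} → Path B u v l → B v u → Unique l → 3 ≤ length l → ∃ λ z → Split {B} u v z v l × (∀ {t} → B v t → t ≡ u ⊎ t ≡ z)
    last-two {u} {v} {l} p b uq le with split-before p (end-∈ p)
    ... | inj₁ refl = ⊥-elim (B-irrefl b)
    ... | inj₂ (z , s@(splitting {l₁} {l₂} bf j af refl)) = z , s , ends
      where
      ends : ∀ {t} → B v t → t ≡ u ⊎ t ≡ z
      ends bt with B-three bt b (B-sym j)
      ... | inj₁ e = inj₁ e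
      ... | inj₂ (inj₁ e) = inj₂ e
      ... | inj₂ (inj₂ refl) with path-loop bf (Unique-++ˡ l₁ uq) | path-loop af (Unique-++ˡ l₂ {l₁} (Unique-resp-↭ (++-comm l₁ l₂) uq))
      ... | refl | refl = ⊥-elim (<-irrefl refl le)

    first-two : ∀ {u v l} → Path B u v l → B v u → Unique l → 3 ≤ length l → ∃ λ w → Split {B} u v u w l × (∀ {t} → B u t → t ≡ v ⊎ t ≡ w)
    first-two {u} {v} {l} p b uq le with split-after p (start-∈ p)
    ... | inj₁ refl = ⊥-elim (B-irrefl b)
    ... | inj₂ (w , s@(splitting {l₁} {l₂} bf j af refl)) = w , s , ends
      where
      ends : ∀ {t} → B u t → t ≡ v ⊎ t ≡ w
      ends bt with B-three bt (B-sym b) j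
      ... | inj₁ e = inj₁ e
      ... | inj₂ (inj₁ e) = inj₂ e
      ... | inj₂ (inj₂ refl) with path-loop bf (Unique-++ˡ l₁ uq) | path-loop af (Unique-++ˡ l₂ {l₁} (Unique-resp-↭ (++-comm l₁ l₂) uq))
      ... | refl | refl = ⊥-elim (<-irrefl refl le)

  -- Two boundary cycles, traversed u … v and h … g, joined by the edges v h and g u.
  module Merge {u v h g l l'} (P : Path B u v l) (Q : Path B h g l') (vu : B v u) (gh : B g h) (vh : v ~ h) (gu : g ~ u)
    (uq : Unique (l ++ l')) (le : 4 ≤ length l) (le' : 4 ≤ length l') (cl : Closed l) (cl' : Closed l') where

    ul : Unique l
    ul = Unique-++ˡ l uq
    ul' : Unique l'
    ul' = Unique-++ˡ l' {l} (Unique-resp-↭ (++-comm l l') uq)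

    P~ : Path _~_ u v l
    P~ = map-Path B-~ P
    Q~ : Path _~_ h g l'
    Q~ = map-Path B-~ Q

    big : Cycle _~_ (l ++ l')
    big = cycle (join P~ vh Q~) gu uq

    open Ord big using () renaming (σ to τ; σ⁻ to τ⁻)

    left : ∀ {z w} → Split {B} u v z w l → Split {_~_} u g z w (l ++ l')
    left (splitting {l₁} {l₂} b j a refl) = splitting (map-Path B-~ b) (B-~ j) (join (map-Path B-~ a) vh Q~) (++-assoc l₁ l₂ l')

    right : ∀ {z w} → Split {B} h g z w l' → Split {_~_} u g z w (l ++ l')
    right (splitting {l₁} {l₂} b j a refl) = splitting (join P~ vh (map-Path B-~ b)) (B-~ j) (map-Path B-~ a) (≡sym (++-assoc l l₁ l₂))

    middle-split : Split {_~_} u g v h (l ++ l')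
    middle-split = splitting P~ vh Q~ refl

    τv : τ v ≡ h
    τv = next-split middle-split uq
    τg : τ g ≡ u
    τg = next-end (join P~ vh Q~) uq

    data Kind (z : V) : Set where
      ordinary : B z (τ z) → Kind z
      at-v : z ≡ v → Kind z
      at-g : z ≡ g → Kind z

    kind : ∀ {z} → z ∈ l ++ l' → Kind z
    kind {z} m with ∈-++⁻ l m
    ... | inj₁ k with split-after P k
    ... | inj₁ e = at-v e
    ... | inj₂ (w , s) = ordinary (subst (B z) (≡sym (next-split (left s) uq)) (Split.joint s))
    kind {z} m | inj₂ k with split-after Q k
    ... | inj₁ e = at-g e
    ... | inj₂ (w , s) = ordinary (subst (B z) (≡sym (next-split (right s) uq)) (Split.joint s))

    Seam : V → Set
    Seam z = ∃ λ m → ∃ λ m' → (m' ≡ τ m ⊎ m ≡ τ m') × m ∈ l ++ l' × m' ∈ l ++ l' ×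
        (∀ {t} → B z t → t ≡ m ⊎ t ≡ τ⁻ z) × (∀ {t} → B (τ z) t → t ≡ m' ⊎ t ≡ τ (τ z))

    u∈ : u ∈ l ++ l'
    u∈ = ∈-++⁺ˡ (start-∈ P)
    v∈ : v ∈ l ++ l'
    v∈ = ∈-++⁺ˡ (end-∈ P)
    h∈ : h ∈ l ++ l'
    h∈ = ∈-++⁺ʳ l (start-∈ Q)
    g∈ : g ∈ l ++ l'
    g∈ = ∈-++⁺ʳ l (end-∈ Q)

    -- Across the joining edge `v h` lies the other joining edge `g u`.
    seam-v : Seam v
    seam-v with last-two P vu ul (≤-trans (n≤1+n 3) le) | first-two Q gh ul' (≤-trans (n≤1+n 3) le')
    ... | z , s , f | w , s' , f' = u , g , inj₂ (≡sym τg) , u∈ , g∈ ,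
      (λ {t} b → subst (λ x → t ≡ u ⊎ t ≡ x) (≡sym (prev-split (left s) uq)) (f b)) ,
      (λ {t} b → subst (λ x → t ≡ g ⊎ t ≡ x) (≡sym (trans (cong τ τv) (next-split (right s') uq))) (f' (subst (λ x → B x t) τv b)))

    seam-g : Seam g
    seam-g with last-two Q gh ul' (≤-trans (n≤1+n 3) le') | first-two P vu ul (≤-trans (n≤1+n 3) le)
    ... | z , s , f | w , s' , f' = h , v , inj₂ (≡sym τv) , h∈ , v∈ ,
      (λ {t} b → subst (λ x → t ≡ h ⊎ t ≡ x) (≡sym (prev-split (right s) uq)) (f b)) ,
      (λ {t} b → subst (λ x → t ≡ v ⊎ t ≡ x) (≡sym (trans (cong τ τg) (next-split (left s') uq))) (f' (subst (λ x → B x t) τg b)))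

    merged : Group
    merged = record { mem = l ++ l' ; cyc = big ; closed = Closed-++ cl cl'
      ; len = ≤-trans le (≤-trans (m≤m+n _ _) (≤-reflexive (≡sym (length-++ l))))
      ; square-cycle = λ e → ⊥-elim (<-irrefl (≡sym e) (≤-trans (s≤s (s≤s (s≤s (s≤s (s≤s z≤n))))) (≤-trans (+-mono-≤ le le') (≤-reflexive (≡sym (length-++ l))))))
      ; seam = λ m nb → go m nb (kind m) }
      where
      go : ∀ {z} → z ∈ l ++ l' → ¬ B z (τ z) → Kind z → Seam z
      go m nb (ordinary b) = ⊥-elim (nb b)
      go m nb (at-v refl) = seam-v
      go m nb (at-g refl) = seam-g

  -- No boundary edge of `P` is parallel to one of `Q`. If one is, `merge` reduces four cycles to
  -- three groups.
  NM : Orig → Orig → Set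
  NM P Q = ∀ {v v' h g} → v ∈ mem P → h ∈ mem Q → B v v' → B h g → v ~ h → v' ~ g → ⊥

  NM-sym : ∀ {P Q} → NM P Q → NM Q P
  NM-sym nm mv mh b b' a a' = nm mh mv b' b (~-sym a) (~-sym a')

  B-tour : ∀ (P : Orig) {v v'} → v ∈ mem P → B v v' → ∃ λ l → Path B v' v l × l ↭ mem P
  B-tour P {v} {v'} m b with cycle-neighbours (Orig.bcyc P) (Orig.len3 P) m b
  ... | inj₁ refl = BOrder.σ-tour (Orig.bcyc P) m
  ... | inj₂ refl with BOrder.σ-tour (Orig.bcyc P) (Orig.σ⁻-∈ P m)
  ... | l , p , e with rev B-sym p
  ... | l' , p' , e' = l' , subst (λ x → Path B (Orig.σ⁻ P v) x l') (Orig.σσ⁻ P m) p' , ↭-trans e' e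

  opaque
    merge : ∀ (P Q : Orig) → Unique (mem P ++ mem Q) → ∀ {v v' h g} → v ∈ mem P → h ∈ mem Q → B v v' → B h g → v ~ h → v' ~ g →
      ∃ λ (Γ : Group) → Group.mem Γ ↭ mem P ++ mem Q
    merge P Q uq {v} {v'} {h} {g} mv mh b b' vh v'g with B-tour P mv b | B-tour Q (Orig.closed Q mh b') (B-sym b')
    ... | l , p , e | l' , p' , e' = Merge.merged p p' b (B-sym b') vh (~-sym v'g)
            (Unique-resp-↭ (++⁺ (↭-sym e) (↭-sym e')) uq) (≤-trans (Orig.len P) (≤-reflexive (≡sym (↭-length e)))) (≤-trans (Orig.len Q) (≤-reflexive (≡sym (↭-length e'))))
            (λ m bz → ∈-resp-↭ (↭-sym e) (Orig.closed P (∈-resp-↭ e m) bz)) (λ m bz → ∈-resp-↭ (↭-sym e') (Orig.closed Q (∈-resp-↭ e' m) bz)) , ++⁺ e e'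

    merge? : ∀ P Q → NM P Q ⊎ ∃ λ v → ∃ λ v' → ∃ λ h → ∃ λ g → v ∈ mem P × h ∈ mem Q × B v v' × B h g × v ~ h × v' ~ g
    merge? P Q with any? (λ v → any? (λ v' → any? (λ h → any? (λ g → B? v v' ×-dec B? h g ×-dec v ~? h ×-dec v' ~? g) (mem Q)) (mem Q)) (mem P)) (mem P)
    ... | yes a with find a
    ... | v , mv , a₁ with find a₁
    ... | v' , _ , a₂ with find a₂
    ... | h , mh , a₃ with find a₃
    ... | g , _ , b , b' , e , e' = inj₂ (v , v' , h , g , mv , mh , b , b' , e , e')
    merge? P Q | no na = inj₁ λ mv mh b b' e e' → na (lose mv (lose (Orig.closed P mv b) (lose mh (lose (Orig.closed Q mh b') (b , b' , e , e')))))

  record Quartet (P Q R S : Orig) : Set where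
    field
      whole : Whole (mem P ++ (mem Q ++ (mem R ++ mem S)))
      pq : NM P Q
      pr : NM P R
      ps : NM P S
      qr : NM Q R
      qs : NM Q S
      rs : NM R S

  sw₁₂ : ∀ {P Q R S} → Quartet P Q R S → Quartet Q P R S
  sw₁₂ {P} {Q} {R} {S} q = record { whole = Whole-↭ (Perm.shifts (mem P) (mem Q)) whole ; pq = NM-sym {P} {Q} pq ; pr = qr ; ps = qs ; qr = pr ; qs = ps ; rs = rs }
    where open Quartet q

  sw₂₃ : ∀ {P Q R S} → Quartet P Q R S → Quartet P R Q S
  sw₂₃ {P} {Q} {R} {S} q = record { whole = Whole-↭ (++⁺ˡ (mem P) (Perm.shifts (mem Q) (mem R))) whole ; pq = pr ; pr = pq ; ps = ps ; qr = NM-sym {Q} {R} qr ; qs = rs ; rs = qs }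
    where open Quartet q

  sw₃₄ : ∀ {P Q R S} → Quartet P Q R S → Quartet P Q S R
  sw₃₄ {P} {Q} {R} {S} q = record { whole = Whole-↭ (++⁺ˡ (mem P) (++⁺ˡ (mem Q) (++-comm (mem R) (mem S)))) whole ; pq = pq ; pr = ps ; ps = pr ; qr = qs ; qs = qr ; rs = NM-sym {R} {S} rs }
    where open Quartet q

  -- The outer two cycles may be entered anywhere; only the inner two need tours with prescribed
  -- ends.
  chain : ∀ {P Q R S} → Quartet P Q R S → ∀ {p q q' r r' s} → p ∈ mem P → p ~ q → Trip (mem Q) q q' → q' ~ r → Trip (mem R) r r' → r' ~ s → s ∈ mem S → ⊥
  chain {P} {Q} {R} {S} q mp pq t qr t' rs ms =
    no-trip (Quartet.whole q) (trip-join (trip-sym (proj₂ (Orig.enter P mp))) pq (trip-join t qr (trip-join t' rs (proj₂ (Orig.enter S ms)))))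

  whole-merge : ∀ (P Q R S : Orig) → Whole (mem P ++ (mem Q ++ (mem R ++ mem S))) →
    (∃ λ v → ∃ λ v' → ∃ λ h → ∃ λ g → v ∈ mem P × h ∈ mem Q × B v v' × B h g × v ~ h × v' ~ g) → 20 ≤ n
  whole-merge P Q R S wh (v , v' , h , g , mv , mh , b , b' , e , e') with merge P Q
      (Unique-++ˡ (mem P ++ mem Q) {mem R ++ mem S} (subst Unique (≡sym (++-assoc (mem P) (mem Q) (mem R ++ mem S))) (proj₁ wh))) mv mh b b' e e'
  ... | Γ , eq = three-groups Γ (Orig.group R) (Orig.group S)
        (Whole-↭ (↭-trans (↭-reflexive (≡sym (++-assoc (mem P) (mem Q) (mem R ++ mem S)))) (++⁺ʳ (mem R ++ mem S) (↭-sym eq))) wh)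

  quartet : ∀ (P Q R S : Orig) → Whole (mem P ++ (mem Q ++ (mem R ++ mem S))) → 20 ≤ n ⊎ Quartet P Q R S
  quartet P Q R S wh = go (merge? P Q) (merge? P R) (merge? P S) (merge? Q R) (merge? Q S) (merge? R S)
    where
    p = mem P
    q = mem Q
    r = mem R
    s = mem S
    go : _ → _ → _ → _ → _ → _ → 20 ≤ n ⊎ Quartet P Q R S
    go (inj₂ m) _ _ _ _ _ = inj₁ (whole-merge P Q R S wh m)
    go _ (inj₂ m) _ _ _ _ = inj₁ (whole-merge P R Q S (Whole-↭ (++⁺ˡ p (Perm.shifts q r)) wh) m)
    go _ _ (inj₂ m) _ _ _ = inj₁ (whole-merge P S Q R (Whole-↭ (++⁺ˡ p (↭-trans (++⁺ˡ q (++-comm r s)) (Perm.shifts q s))) wh) m)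
    go _ _ _ (inj₂ m) _ _ = inj₁ (whole-merge Q R P S (Whole-↭ (↭-trans (Perm.shifts p q) (++⁺ˡ q (Perm.shifts p r))) wh) m)
    go _ _ _ _ (inj₂ m) _ = inj₁ (whole-merge Q S P R (Whole-↭ (↭-trans (Perm.shifts p q) (++⁺ˡ q (↭-trans (++⁺ˡ p (++-comm r s)) (Perm.shifts p s)))) wh) m)
    go _ _ _ _ _ (inj₂ m) = inj₁ (whole-merge R S P Q (Whole-↭ (↭-trans (↭-reflexive (≡sym (++-assoc p q (r ++ s)))) (↭-trans (++-comm (p ++ q) (r ++ s)) (↭-reflexive (++-assoc r s (p ++ q))))) wh) m)
    go (inj₁ a) (inj₁ b) (inj₁ c) (inj₁ d) (inj₁ e) (inj₁ f) = inj₂ (record { whole = wh ; pq = a ; pr = b ; ps = c ; qr = d ; qs = e ; rs = f })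

  -- Squares among four cycles and where their apexes lie

  module Inside (X : Orig) (L : List V) where
    private
      module X = Orig X

    S : V → Bool
    S v = inL X.mem v ∧ sees L v

    S-X : ∀ {v} → S v ≡ true → v ∈ X.mem
    S-X e = inL-∈ (∧-fst e)

    S-intro : ∀ {v f} → v ∈ X.mem → f ∈ L → v ~ f → S v ≡ true
    S-intro mv mf a = ∧-both (∈-inL mv) (sees-intro mf a)

    Iso : V → Set
    Iso v = S v ≡ true × S (X.σ v) ≡ false × S (X.σ⁻ v) ≡ false

    mk-iso : ∀ {p f} → p ∈ X.mem → f ∈ L → p ~ f → (∀ {q g} → B p q → g ∈ L → q ~ g → ⊥) → Iso p
    mk-iso {p} mp mf pf quiet = S-intro mp mf pf , ¬true (silent (X.σ-B mp)) , ¬true (silent (X.σ⁻-B mp))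
      where
      silent : ∀ {q} → B p q → S q ≡ true → ⊥
      silent {q} b e with sees-elim {L} (∧-snd {inL X.mem q} e)
      ... | g , mg , qg = quiet b mg qg

    -- A third seer makes a third gap, and 4 + 3 = 7.
    gap3 : ∀ {p p'} → Iso p → Iso p' → p ≢ p' → 4 ≤ count S X.mem → 7 ≤ length X.mem
    gap3 {p} {p'} ip ip' ne le with pick-other _≟_ S X.mem (p ∷ p' ∷ []) X.unique (≤-trans (n≤1+n 3) le)
    ... | s , _ , ss , ns = ≤-trans (+-monoˡ-≤ 3 le) (Isolation.isolated-bound _≟_ X.ring X.σ-closed S (λ {v} → S-X {v}) (pair ne) (λ { (here refl) → ip ; (there (here refl)) → ip' }) (here refl) ss ns)

    module _ (cl : Closed L) (dis : ∀ {v} → v ∈ X.mem → v ∈ L → ⊥) (only : ∀ {t f} → t ∉ L → f ∈ L → t ~ f → t ∈ X.mem) where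

      opaque
        two : ∀ {s} → S s ≡ true → ∃ λ t → ∃ λ t' → S t ≡ true × S t' ≡ true × s ~ t × s ~ t' × t ≢ t' × ¬ (t ~ t')
        two {s} e with sees-elim {L} (∧-snd {inL X.mem s} e)
        ... | f , mf , sf with sees-run {inL L} (closed-inL cl) (∉-inL λ m → dis (S-X {s} e) m) (∈-inL mf) sf
        ... | t , t' , r = t , t' , seen r , seen (run-sym r) , run-~ r , run-~ (run-sym r) , run-≢ r , run-≁ r
          where
          seen : ∀ {t t'} → Run (inL L) s t t' → S t ≡ true
          seen {t} r with run-face r
          ... | g , eg , _ , tg = S-intro (only (inL-∉ (run-∉ r)) (inL-∈ eg) tg) (inL-∈ eg) tg

      four-in : ∀ {s} → S s ≡ true → 4 ≤ count S X.mem
      four-in {s} = Isolation.four-seers _≟_ X.ring X.σ-closed S (λ {v} → S-X {v}) _~_ ~-sym ~-irrefl (λ m → B-~ (X.σ-B m)) two {s}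

      one-iso : ∀ {p} → Iso p → 6 ≤ length X.mem
      one-iso {p} = Isolation.one-isolated _≟_ X.ring X.σ-closed S (λ {v} → S-X {v}) _~_ ~-sym ~-irrefl (λ m → B-~ (X.σ-B m)) two {p}

      two-iso : ∀ {p p'} → Iso p → Iso p' → p ≢ p' → ¬ (p ~ p') → 8 ≤ length X.mem
      two-iso {p} {p'} = Isolation.two-isolated _≟_ X.ring X.σ-closed S (λ {v} → S-X {v}) _~_ ~-sym ~-irrefl (λ m → B-~ (X.σ-B m)) two {p} {p'}

  Touches : Orig → Orig → Set
  Touches P Q = Touch (Orig.group P) (Orig.group Q)

  Apart : Orig → Orig → Set
  Apart P Q = ∀ {p q} → p ∈ mem P → q ∈ mem Q → p ~ q → ⊥

  Apart-sym : ∀ {P Q} → Apart P Q → Apart Q P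
  Apart-sym f mq mp a = f mp mq (~-sym a)

  touches? : ∀ P Q → Touches P Q ⊎ Apart P Q
  touches? P Q = touch? (Orig.group P) (Orig.group Q)

  module _ {P Q R S : Orig} (q : Quartet P Q R S) where

    place : ∀ x → x ∈ mem P ⊎ x ∈ mem Q ⊎ x ∈ mem R ⊎ x ∈ mem S
    place x with ∈-++⁻ (mem P) (proj₂ (Quartet.whole q) x)
    ... | inj₁ m = inj₁ m
    ... | inj₂ m with ∈-++⁻ (mem Q) m
    ... | inj₁ k = inj₂ (inj₁ k)
    ... | inj₂ k with ∈-++⁻ (mem R) k
    ... | inj₁ j = inj₂ (inj₂ (inj₁ j))
    ... | inj₂ j = inj₂ (inj₂ (inj₂ j))

    disjoint : ∀ {x} → x ∈ mem P → x ∈ mem Q ⊎ x ∈ mem R ⊎ x ∈ mem S → ⊥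
    disjoint m k = Unique-disjoint (mem P) (proj₁ (Quartet.whole q)) m (go k)
      where
      go : ∀ {x} → x ∈ mem Q ⊎ x ∈ mem R ⊎ x ∈ mem S → x ∈ mem Q ++ (mem R ++ mem S)
      go (inj₁ a) = ∈-++⁺ˡ a
      go (inj₂ (inj₁ b)) = ∈-++⁺ʳ (mem Q) (∈-++⁺ˡ b)
      go (inj₂ (inj₂ c)) = ∈-++⁺ʳ (mem Q) (∈-++⁺ʳ (mem R) c)

    sizes : length (mem P) + (length (mem Q) + (length (mem R) + length (mem S))) ≤ n
    sizes = ≤-trans (≤-reflexive (≡sym (trans (length-++ (mem P)) (cong (length (mem P) +_) (trans (length-++ (mem Q)) (cong (length (mem Q) +_) (length-++ (mem R)))))))) (Unique-length (proj₁ (Quartet.whole q)))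

    at-least : ∀ {a b c d} → a ≤ length (mem P) → b ≤ length (mem Q) → c ≤ length (mem R) → d ≤ length (mem S) → a + (b + (c + d)) ≤ n
    at-least ha hb hc hd = ≤-trans (+-mono-≤ ha (+-mono-≤ hb (+-mono-≤ hc hd))) sizes

  found-apexes : ∀ {A X Y W} → Quartet A X Y W → length (mem A) ≡ 4 → Found (mem A)
  found-apexes {A} {X} q e = square-apexes (Orig.bcyc A) e (proj₁ (Orig.some X) , λ m → disjoint q m (inj₁ (proj₂ (Orig.some X))))

  quiet-own : ∀ {A X Y W} → Quartet A X Y W → ∀ {p} → p ∈ mem X → Apex (mem A) p → ∀ {q g} → B p q → g ∈ mem A → q ~ g → ⊥
  quiet-own {A} {X} Q mp x b mg qg with near-apex x mg
  ... | h , mh , ph , hg = NM-sym {A} {X} (Quartet.pq Q) mp mh b hg ph qg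

  -- If `q` saw `Y`, a spanning path would come from `Y`, go round `X` from `q` to `p`, through `A`,
  -- and on to `W`.
  quiet-next : ∀ {A X Y W} → Quartet A X Y W → Touches A W → ∀ {p} → p ∈ mem X → Apex (mem A) p → ∀ {q g} → B p q → g ∈ mem Y → q ~ g → ⊥
  quiet-next {A} {X} Q (a , w , ma , mw , aw) mp x b mg qg with near-apex x ma
  ... | h , mh , ph , ha = chain (sw₁₂ (sw₂₃ (sw₁₂ Q))) mg (~-sym qg) (trip-sym (Orig.trip X mp b)) ph (Orig.trip A mh ha) aw mw

  -- Both apexes lie on `X` and are isolated there, so `X` has 8 vertices: 4 + 8 + 4 + 4 = 20.
  one-colour : ∀ {A X Y W} → Quartet A X Y W → length (mem A) ≡ 4 → Apart A Y → Apart A W → 20 ≤ n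
  one-colour {A} {X} {Y} {W} q e ay aw with found-apexes q e
  ... | p , p' , x , x' , ne , na = at-least q (Orig.len A) (two-iso (Orig.closed A) (λ m k → disjoint q k (inj₁ m)) only (iso x) (iso x') ne na) (Orig.len Y) (Orig.len W)
    where
    open Inside X (mem A)
    only : ∀ {t f} → t ∉ mem A → f ∈ mem A → t ~ f → t ∈ mem X
    only {t} nt mf tf with place q t
    ... | inj₁ m = ⊥-elim (nt m)
    ... | inj₂ (inj₁ m) = m
    ... | inj₂ (inj₂ (inj₁ m)) = ⊥-elim (ay mf m (~-sym tf))
    ... | inj₂ (inj₂ (inj₂ m)) = ⊥-elim (aw mf m (~-sym tf))
    iso : ∀ {p} → Apex (mem A) p → Iso p
    iso x = mk-iso mp (Apex.f∈ x) (Apex.pf x) (quiet-own q mp x)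
      where mp = only (Apex.p∉ x) (Apex.f∈ x) (Apex.pf x)

  module ThreeColour {A X Y W : Orig} (q : Quartet A X Y W) (ay : Touches A Y) (aw : Touches A W) where
    private
      L = mem A ++ (mem Y ++ mem W)
    open Inside X L

    in-L : ∀ {f} → f ∈ L → f ∈ mem A ⊎ f ∈ mem Y ⊎ f ∈ mem W
    in-L m with ∈-++⁻ (mem A) m
    ... | inj₁ k = inj₁ k
    ... | inj₂ k with ∈-++⁻ (mem Y) k
    ... | inj₁ j = inj₂ (inj₁ j)
    ... | inj₂ j = inj₂ (inj₂ j)

    cl : Closed L
    cl = Closed-++ (Orig.closed A) (Closed-++ (Orig.closed Y) (Orig.closed W))

    dis : ∀ {v} → v ∈ mem X → v ∈ L → ⊥
    dis m k = disjoint (sw₁₂ q) m (in-L k)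

    only : ∀ {t f} → t ∉ L → f ∈ L → t ~ f → t ∈ mem X
    only {t} nt _ _ with place q t
    ... | inj₁ m = ⊥-elim (nt (∈-++⁺ˡ m))
    ... | inj₂ (inj₁ m) = m
    ... | inj₂ (inj₂ (inj₁ m)) = ⊥-elim (nt (∈-++⁺ʳ (mem A) (∈-++⁺ˡ m)))
    ... | inj₂ (inj₂ (inj₂ m)) = ⊥-elim (nt (∈-++⁺ʳ (mem A) (∈-++⁺ʳ (mem Y) m)))

    iso : ∀ {p} → p ∈ mem X → Apex (mem A) p → Iso p
    iso {p} mp x = mk-iso mp (∈-++⁺ˡ (Apex.f∈ x)) (Apex.pf x) quiet
      where
      quiet : ∀ {r g} → B p r → g ∈ L → r ~ g → ⊥
      quiet b mg rg with in-L mg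
      ... | inj₁ m = quiet-own q mp x b m rg
      ... | inj₂ (inj₁ m) = quiet-next q aw mp x b m rg
      ... | inj₂ (inj₂ m) = quiet-next (sw₃₄ q) ay mp x b m rg

    six : ∀ {p} → p ∈ mem X → Apex (mem A) p → 6 ≤ length (mem X)
    six mp x = one-iso cl dis only (iso mp x)

    eight : ∀ {p p'} → p ∈ mem X → p' ∈ mem X → Apex (mem A) p → Apex (mem A) p' → p ≢ p' → ¬ (p ~ p') → 8 ≤ length (mem X)
    eight mp mp' x x' ne na = two-iso cl dis only (iso mp x) (iso mp' x') ne na

  -- The two apexes lie on one cycle, which then has 8 vertices, or on two, which have 6 each; the
  -- total is 20 either way.
  three-colours : ∀ {A X Y W} → Quartet A X Y W → length (mem A) ≡ 4 → Touches A X → Touches A Y → Touches A W → 20 ≤ n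
  three-colours {A} {X} {Y} {W} q e ax ay aw with found-apexes q e
  ... | p , p' , x , x' , ne , na = go (place q p) (place q p')
    where
    a4 = Orig.len A
    x4 = Orig.len X
    y4 = Orig.len Y
    w4 = Orig.len W
    qY : Quartet A Y X W
    qY = sw₂₃ q
    qW : Quartet A W X Y
    qW = sw₂₃ (sw₃₄ q)
    module TX = ThreeColour q ay aw
    module TY = ThreeColour qY ax aw
    module TW = ThreeColour qW ax ay
    go : _ → _ → 20 ≤ n
    go (inj₁ m) _ = ⊥-elim (Apex.p∉ x m)
    go _ (inj₁ m) = ⊥-elim (Apex.p∉ x' m)
    go (inj₂ (inj₁ m)) (inj₂ (inj₁ m')) = at-least q a4 (TX.eight m m' x x' ne na) y4 w4
    go (inj₂ (inj₂ (inj₁ m))) (inj₂ (inj₂ (inj₁ m'))) = at-least q a4 x4 (TY.eight m m' x x' ne na) w4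
    go (inj₂ (inj₂ (inj₂ m))) (inj₂ (inj₂ (inj₂ m'))) = at-least q a4 x4 y4 (TW.eight m m' x x' ne na)
    go (inj₂ (inj₁ m)) (inj₂ (inj₂ (inj₁ m'))) = at-least q a4 (TX.six m x) (TY.six m' x') w4
    go (inj₂ (inj₂ (inj₁ m))) (inj₂ (inj₁ m')) = at-least q a4 (TX.six m' x') (TY.six m x) w4
    go (inj₂ (inj₁ m)) (inj₂ (inj₂ (inj₂ m'))) = at-least q a4 (TX.six m x) y4 (TW.six m' x')
    go (inj₂ (inj₂ (inj₂ m))) (inj₂ (inj₁ m')) = at-least q a4 (TX.six m' x') y4 (TW.six m x)
    go (inj₂ (inj₂ (inj₁ m))) (inj₂ (inj₂ (inj₂ m'))) = at-least q a4 x4 (TY.six m x) (TW.six m' x')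
    go (inj₂ (inj₂ (inj₂ m))) (inj₂ (inj₂ (inj₁ m'))) = at-least q a4 x4 (TY.six m' x') (TW.six m x)

  -- A square that touches two of the other three cycles

  module Crossing {A X Y W : Orig} (q : Quartet A X Y W) (ay : Touches A Y) where
    L : List V
    L = mem A ++ mem W
    open Inside X L public

    iso : ∀ {p} → p ∈ mem X → Apex (mem A) p → Iso p
    iso {p} mp x = mk-iso mp (∈-++⁺ˡ (Apex.f∈ x)) (Apex.pf x) quiet
      where
      quiet : ∀ {r g} → B p r → g ∈ L → r ~ g → ⊥
      quiet b mg rg with ∈-++⁻ (mem A) mg
      ... | inj₁ m = quiet-own q mp x b m rg
      ... | inj₂ m = quiet-next (sw₃₄ q) ay mp x b m rg

    iso-B : ∀ {p r} → p ∈ mem X → Iso p → B p r → S r ≡ true → ⊥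
    iso-B mp (_ , f , f') b s with cycle-neighbours (Orig.bcyc X) (Orig.len3 X) mp b
    ... | inj₁ refl = true≢false s f
    ... | inj₂ refl = true≢false s f'

    -- `p`, `p'`, `v`, `v'` are four seers of `A` or `W`: no seer stands beside an isolated one, so
    -- `v` and `v'` differ from the apexes.
    exception : ∀ {p p'} → p ∈ mem X → p' ∈ mem X → Apex (mem A) p → Apex (mem A) p' → p ≢ p' →
      ∀ {v v' a w} → v ∈ mem X → v' ∈ mem X → B v v' → a ∈ mem A → v ~ a → w ∈ mem W → v' ~ w → 7 ≤ length (mem X)
    exception {p} {p'} mp mp' x x' ne {v} {v'} mv mv' b ma va mw vw = gap3 (iso mp x) (iso mp' x') ne
        (count-≥ S (mem X) uq λ { (here refl) → mp , proj₁ (iso mp x) ; (there (here refl)) → mp' , proj₁ (iso mp' x') ; (there (there (here refl))) → mv , sv ; (there (there (there (here refl)))) → mv' , sv' })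
      where
      sv : S v ≡ true
      sv = S-intro mv (∈-++⁺ˡ ma) va
      sv' : S v' ≡ true
      sv' = S-intro mv' (∈-++⁺ʳ (mem A) mw) vw
      ≢v : ∀ {p} → p ∈ mem X → Apex (mem A) p → p ≢ v
      ≢v mp x refl = iso-B mp (iso mp x) b sv'
      ≢v' : ∀ {p} → p ∈ mem X → Apex (mem A) p → p ≢ v'
      ≢v' mp x refl = iso-B mp (iso mp x) (B-sym b) sv
      uq : Unique (p ∷ p' ∷ v ∷ v' ∷ [])
      uq = ∉⇒Unique (λ { (here e) → ne e ; (there (here e)) → ≢v mp x e ; (there (there (here e))) → ≢v' mp x e })
             (∉⇒Unique (λ { (here e) → ≢v mp' x' e ; (there (here e)) → ≢v' mp' x' e }) (pair (~⇒≢ (B-~ b))))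

    -- The apex is the door from `A` to `Y`, so that `W`, `X`, `A`, `Y` can be traversed in this
    -- order.
    via : ∀ {p} → p ∈ mem Y → Apex (mem A) p → ∀ {v v' a w} → v ∈ mem X → B v v' → a ∈ mem A → v ~ a → w ∈ mem W → v' ~ w → ⊥
    via mp x mv b ma va mw vw with near-apex x ma
    ... | h , mh , ph , ha = chain (sw₂₃ (sw₁₂ (sw₂₃ (sw₃₄ q)))) mw (~-sym vw) (trip-sym (Orig.trip X mv b)) va (trip-sym (Orig.trip A mh ha)) (~-sym ph) mp

  count-mono : ∀ {P Q : V → Bool} l → (∀ {v} → P v ≡ true → Q v ≡ true) → count P l ≤ count Q l
  count-mono {P} {Q} l h = ∑-mono l (λ {v} _ → go (P v) (Q v) h)
    where
    go : ∀ a b → (a ≡ true → b ≡ true) → ⟦ a ⟧ ≤ ⟦ b ⟧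
    go false b h = z≤n
    go true b h with h refl
    ... | refl = ≤-refl

  -- `W` is seen from `Y` only, so `Y` contains four seers of it, besides which the two apexes count
  -- as isolated.
  sole-witness : ∀ {A X Y W} (q : Quartet A X Y W) → Touches A X → Apart A W → Apart X W → Touches Y W →
    ∀ {p p'} → p ∈ mem Y → p' ∈ mem Y → Apex (mem A) p → Apex (mem A) p' → p ≢ p' → 7 ≤ length (mem Y)
  sole-witness {A} {X} {Y} {W} q ax aw xw (y , w , my , mw , yw) mp mp' x x' ne =
    C.gap3 (C.iso mp x) (C.iso mp' x') ne (≤-trans (I.four-in (Orig.closed W) dis only {y} (I.S-intro my mw yw)) (count-mono {I.S} {C.S} (mem Y) up))
    where
    module C = Crossing (sw₂₃ q) ax
    module I = Inside Y (mem W)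
    dis : ∀ {v} → v ∈ mem Y → v ∈ mem W → ⊥
    dis m k = disjoint (sw₁₂ (sw₂₃ q)) m (inj₂ (inj₂ k))
    only : ∀ {t f} → t ∉ mem W → f ∈ mem W → t ~ f → t ∈ mem Y
    only {t} nt mf tf with place q t
    ... | inj₁ m = ⊥-elim (aw m mf tf)
    ... | inj₂ (inj₁ m) = ⊥-elim (xw m mf tf)
    ... | inj₂ (inj₂ (inj₁ m)) = m
    ... | inj₂ (inj₂ (inj₂ m)) = ⊥-elim (nt m)
    up : ∀ {v} → I.S v ≡ true → C.S v ≡ true
    up {v} e with sees-elim {mem W} (∧-snd {inL (mem Y) v} e)
    ... | f , mf , vf = C.S-intro (I.S-X {v} e) (∈-++⁺ʳ (mem A) mf) vf

  too-big : ∀ {l} → l ≤ 6 → 7 ≤ l → ⊥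
  too-big a b = <-irrefl refl (≤-trans b a)

  -- `X` and `Y` side by side form the middle part between `A` and `W`. The ring bound uses the
  -- successor as a permutation only, so it does not matter that there are two cycles; the price is
  -- a separate proof of `exit`.
  module TwoColours {A X Y W : Orig} (q : Quartet A X Y W) (e4 : length (mem A) ≡ 4) (ax : Touches A X) (ay : Touches A Y) (aw : Apart A W)
    (n<20 : n < 20) (lX : length (mem X) ≤ 6) (lY : length (mem Y) ≤ 6) where

    qY : Quartet A Y X W
    qY = sw₂₃ q

    found : Found (mem A)
    found = found-apexes q e4

    apex-XY : ∀ {p} → Apex (mem A) p → p ∈ mem X ⊎ p ∈ mem Y
    apex-XY {p} x with place q p
    ... | inj₁ m = ⊥-elim (Apex.p∉ x m)
    ... | inj₂ (inj₁ m) = inj₁ m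
    ... | inj₂ (inj₂ (inj₁ m)) = inj₂ m
    ... | inj₂ (inj₂ (inj₂ m)) = ⊥-elim (aw (Apex.f∈ x) m (~-sym (Apex.pf x)))

    opaque
      -- An apex on `Y` permits the spanning path of `via`; with both apexes on `X`, that cycle
      -- would have 7 vertices.
      cross-X : ∀ {v v' a w} → v ∈ mem X → v' ∈ mem X → B v v' → a ∈ mem A → v ~ a → w ∈ mem W → v' ~ w → ⊥
      cross-X mv mv' b ma va mw vw with found
      ... | p , p' , x , x' , ne , _ with apex-XY x | apex-XY x'
      ... | inj₂ m | _ = Crossing.via q ay m x mv b ma va mw vw
      ... | inj₁ _ | inj₂ m = Crossing.via q ay m x' mv b ma va mw vw
      ... | inj₁ m | inj₁ m' = too-big lX (Crossing.exception q ay m m' x x' ne mv mv' b ma va mw vw)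

      cross-Y : ∀ {v v' a w} → v ∈ mem Y → v' ∈ mem Y → B v v' → a ∈ mem A → v ~ a → w ∈ mem W → v' ~ w → ⊥
      cross-Y mv mv' b ma va mw vw with found
      ... | p , p' , x , x' , ne , _ with apex-XY x | apex-XY x'
      ... | inj₁ m | _ = Crossing.via qY ax m x mv b ma va mw vw
      ... | inj₂ _ | inj₁ m = Crossing.via qY ax m x' mv b ma va mw vw
      ... | inj₂ m | inj₂ m' = too-big lY (Crossing.exception qY ax m m' x x' ne mv mv' b ma va mw vw)

    Z : List V
    Z = mem X ++ mem Y

    pick : V → V → V → V
    pick v a b = if inL (mem X) v then a else b

    τ τ⁻ : V → V
    τ v = pick v (Orig.σ X v) (Orig.σ Y v)
    τ⁻ v = pick v (Orig.σ⁻ X v) (Orig.σ⁻ Y v)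

    pick-X : ∀ {v} → v ∈ mem X → ∀ {a b} → pick v a b ≡ a
    pick-X m {a} {b} = cong (λ c → if c then a else b) (∈-inL m)

    pick-Y : ∀ {v} → v ∈ mem Y → ∀ {a b} → pick v a b ≡ b
    pick-Y m {a} {b} = cong (λ c → if c then a else b) (∉-inL λ k → disjoint (sw₁₂ q) k (inj₂ (inj₁ m)))

    XY : ∀ {v} → v ∈ Z → v ∈ mem X ⊎ v ∈ mem Y
    XY = ∈-++⁻ (mem X)

    ring : Ring Z
    ring = record { σ = τ ; σ⁻ = τ⁻ ; σ-∈ = σ-∈ ; σ⁻-∈ = σ⁻-∈ ; σσ⁻ = σσ⁻ ; σ⁻σ = σ⁻σ
                  ; unique = Unique-++ (Orig.unique X) (Orig.unique Y) (λ m k → disjoint (sw₁₂ q) m (inj₂ (inj₁ k))) }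
      where
      σ-∈ : ∀ {z} → z ∈ Z → τ z ∈ Z
      σ-∈ m with XY m
      ... | inj₁ k = subst (_∈ Z) (≡sym (pick-X k)) (∈-++⁺ˡ (Orig.σ-∈ X k))
      ... | inj₂ k = subst (_∈ Z) (≡sym (pick-Y k)) (∈-++⁺ʳ (mem X) (Orig.σ-∈ Y k))
      σ⁻-∈ : ∀ {z} → z ∈ Z → τ⁻ z ∈ Z
      σ⁻-∈ m with XY m
      ... | inj₁ k = subst (_∈ Z) (≡sym (pick-X k)) (∈-++⁺ˡ (Orig.σ⁻-∈ X k))
      ... | inj₂ k = subst (_∈ Z) (≡sym (pick-Y k)) (∈-++⁺ʳ (mem X) (Orig.σ⁻-∈ Y k))
      σσ⁻ : ∀ {z} → z ∈ Z → τ (τ⁻ z) ≡ z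
      σσ⁻ m with XY m
      ... | inj₁ k = trans (cong τ (pick-X k)) (trans (pick-X (Orig.σ⁻-∈ X k)) (Orig.σσ⁻ X k))
      ... | inj₂ k = trans (cong τ (pick-Y k)) (trans (pick-Y (Orig.σ⁻-∈ Y k)) (Orig.σσ⁻ Y k))
      σ⁻σ : ∀ {z} → z ∈ Z → τ⁻ (τ z) ≡ z
      σ⁻σ m with XY m
      ... | inj₁ k = trans (cong τ⁻ (pick-X k)) (trans (pick-X (Orig.σ-∈ X k)) (Orig.σ⁻σ X k))
      ... | inj₂ k = trans (cong τ⁻ (pick-Y k)) (trans (pick-Y (Orig.σ-∈ Y k)) (Orig.σ⁻σ Y k))

    τ-B : ∀ {v} → v ∈ Z → B v (τ v)
    τ-B m with XY m
    ... | inj₁ k = subst (B _) (≡sym (pick-X k)) (Orig.σ-B X k)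
    ... | inj₂ k = subst (B _) (≡sym (pick-Y k)) (Orig.σ-B Y k)

    cross : ∀ {v a w} → v ∈ Z → ∀ {v'} → B v v' → a ∈ mem A → v ~ a → w ∈ mem W → v' ~ w → ⊥
    cross m b ma va mw vw with XY m
    ... | inj₁ k = cross-X k (Orig.closed X k b) b ma va mw vw
    ... | inj₂ k = cross-Y k (Orig.closed Y k b) b ma va mw vw

    layout : Layout
    layout = record { A = mem A ; Z = Z ; C = mem W ; whole = Whole-↭ (++⁺ˡ (mem A) (↭-reflexive (≡sym (++-assoc (mem X) (mem Y) (mem W))))) (Quartet.whole q)
                    ; closed-A = Orig.closed A ; closed-Z = Closed-++ (Orig.closed X) (Orig.closed Y) ; closed-C = Orig.closed W
                    ; ring = ring ; σ-~ = λ m → B-~ (τ-B m) ; barrier = λ {i} {v} → bar i {v} }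
      where
      bar : ∀ i {v} → inL Z v ∧ sees (if i then mem A else mem W) v ≡ true → inL Z (τ v) ∧ sees (if not i then mem A else mem W) (τ v) ≡ true → ⊥
      bar true {v} e f with sees-elim {mem A} (∧-snd {inL Z v} e) | sees-elim {mem W} (∧-snd {inL Z (τ v)} f)
      ... | a , ma , va | w , mw , vw = cross (inL-∈ (∧-fst e)) (τ-B (inL-∈ (∧-fst e))) ma va mw vw
      bar false {v} e f with sees-elim {mem W} (∧-snd {inL Z v} e) | sees-elim {mem A} (∧-snd {inL Z (τ v)} f)
      ... | w , mw , vw | a , ma , va = cross (inL-∈ (∧-fst f)) (B-sym (τ-B (inL-∈ (∧-fst e)))) ma va mw vw

    open Layout layout using (S; any; K; pure; J; side; K-S; S-intro; S-elim; S-Z; any-S; S-any; where-is; NoMerge; exit-or-all; barrier; apex-iso)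

    no-merges : ∀ i → NoMerge i
    no-merges true mv mh mg hg vh vg with XY mv
    ... | inj₁ k = NM-sym {A} {X} (Quartet.pq q) k mh (τ-B mv) hg vh vg
    ... | inj₂ k = NM-sym {A} {Y} (Quartet.pr q) k mh (τ-B mv) hg vh vg
    no-merges false mv mh mg hg vh vg with XY mv
    ... | inj₁ k = Quartet.qs q k mh (τ-B mv) hg vh vg
    ... | inj₂ k = Quartet.rs q k mh (τ-B mv) hg vh vg

    opaque
      nonempty : ∀ i → ∃ λ v → S i v ≡ true
      nonempty true = let (a , x , ma , mx , e) = ax in x , S-intro true (∈-++⁺ˡ mx) ma (~-sym e)
      nonempty false with crossing (inL (mem W)) (∈-inL (proj₂ (Orig.some W))) (∉-inL λ m → disjoint q (proj₂ (Orig.some A)) (inj₂ (inj₂ m)))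
      ... | w , b , tw , fb , wb with place q b
      ... | inj₁ m = ⊥-elim (aw m (inL-∈ tw) (~-sym wb))
      ... | inj₂ (inj₁ m) = b , S-intro false (∈-++⁺ˡ m) (inL-∈ tw) (~-sym wb)
      ... | inj₂ (inj₂ (inj₁ m)) = b , S-intro false (∈-++⁺ʳ (mem X) m) (inL-∈ tw) (~-sym wb)
      ... | inj₂ (inj₂ (inj₂ m)) = ⊥-elim (inL-∉ fb m)

    J-iso : ∀ {p i} → p ∈ Z → Apex (mem A) p → J i p ≡ true → ⊥
    J-iso {p} {i} m x j = true≢false (apex-iso true (no-merges true) m x) (not-true (∧-snd {pure i p} j))

    J-pure : ∀ i {v} → J i v ≡ true → S (not i) v ≡ true → ⊥
    J-pure i {v} j e = true≢false e (not-true (∧-snd {S i v} (∧-fst {pure i v} j)))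

    opaque
      -- `A` touches `X`, so `i` is `true` and no vertex of `X` sees `W`. Apexes are isolated, so
      -- both lie on `Y`, which is then too long by `sole-witness`.
      all-X : ∀ i → (∀ {w} → w ∈ mem X → J i w ≡ true) → ⊥
      all-X false all = let (a , x , ma , mx , e) = ax in J-pure false (all mx) (S-intro true (∈-++⁺ˡ mx) ma (~-sym e))
      all-X true all with found | nonempty false
      ... | p , p' , x , x' , ne , _ | u , su with apex-XY x | apex-XY x' | XY (S-Z {false} su) | S-elim false su
      ... | inj₁ m | _ | _ | _ = J-iso {i = true} (∈-++⁺ˡ m) x (all m)
      ... | inj₂ _ | inj₁ m | _ | _ = J-iso {i = true} (∈-++⁺ˡ m) x' (all m)
      ... | inj₂ _ | inj₂ _ | inj₁ k | _ = J-pure true (all k) su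
      ... | inj₂ m | inj₂ m' | inj₂ k | w , mw , uw =
        too-big lY (sole-witness q ax aw (λ mx mw' e → J-pure true (all mx) (S-intro false (∈-++⁺ˡ mx) mw' e)) (u , w , k , mw , uw) m m' x x' ne)

      all-Y : ∀ i → (∀ {w} → w ∈ mem Y → J i w ≡ true) → ⊥
      all-Y false all = let (a , y , ma , my , e) = ay in J-pure false (all my) (S-intro true (∈-++⁺ʳ (mem X) my) ma (~-sym e))
      all-Y true all with found | nonempty false
      ... | p , p' , x , x' , ne , _ | u , su with apex-XY x | apex-XY x' | XY (S-Z {false} su) | S-elim false su
      ... | inj₂ m | _ | _ | _ = J-iso {i = true} (∈-++⁺ʳ (mem X) m) x (all m)
      ... | inj₁ _ | inj₂ m | _ | _ = J-iso {i = true} (∈-++⁺ʳ (mem X) m) x' (all m)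
      ... | inj₁ _ | inj₁ _ | inj₂ k | _ = J-pure true (all k) su
      ... | inj₁ m | inj₁ m' | inj₁ k | w , mw , uw =
        too-big lX (sole-witness qY ay aw (λ my mw' e → J-pure true (all my) (S-intro false (∈-++⁺ʳ (mem X) my) mw' e)) (u , w , k , mw , uw) m m' x x' ne)

      exit : ∀ {i v} → J i v ≡ true → ∃ λ w → J i w ≡ true × Ring.gap ring any w ≡ true
      exit {i} {v} j with XY (S-Z {i} {v} (∧-fst {S i v} (∧-fst {pure i v} j)))
      ... | inj₁ k with exit-or-all {mem X} ∈-++⁺ˡ (λ P m pz f → Orig.σ-closed X P m pz (λ mu pu → subst P (pick-X mu) (f mu pu))) i k j
      ... | inj₁ r = r
      ... | inj₂ all = ⊥-elim (all-X i all)
      exit {i} {v} j | inj₂ k with exit-or-all {mem Y} (∈-++⁺ʳ (mem X)) (λ P m pz f → Orig.σ-closed Y P m pz (λ mu pu → subst P (pick-Y mu) (f mu pu))) i k j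
      ... | inj₁ r = r
      ... | inj₂ all = ⊥-elim (all-Y i all)

    ready : Ready layout
    ready = record { separate = aw ; nonempty = nonempty ; exit = λ {i} {v} → exit {i} {v} ; no-merges = λ i _ → no-merges i ; cycles = λ { true _ → Orig.bcyc A ; false _ → Orig.bcyc W } }

    Z≤11 : length Z ≤ 11
    Z≤11 = +-cancelˡ-≤ 8 (length Z) 11 (≤-trans (≤-reflexive eq) (≤-trans (+-mono-≤ (Orig.len A) (+-monoʳ-≤ (length (mem X)) (+-monoʳ-≤ (length (mem Y)) (Orig.len W)))) (≤-trans (sizes q) (s≤s⁻¹ n<20))))
      where
      open +-*-Solver
      eq : 8 + length Z ≡ 4 + (length (mem X) + (length (mem Y) + 4))
      eq = trans (cong (8 +_) (length-++ (mem X))) (solve 2 (λ x y → con 8 :+ (x :+ y) := con 4 :+ (x :+ (y :+ con 4))) refl (length (mem X)) (length (mem Y)))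

    module HexClass (i : Bool) (h : Hexagonal layout i) (T T' : Orig) (T-Z : ∀ {v} → v ∈ mem T → v ∈ Z) (T'-Z : ∀ {v} → v ∈ mem T' → v ∈ Z)
      (τT : ∀ {v} → v ∈ mem T → τ v ≡ Orig.σ T v) (τT⁻ : ∀ {v} → v ∈ mem T → τ⁻ v ≡ Orig.σ⁻ T v) (τT' : ∀ {v} → v ∈ mem T' → τ v ≡ Orig.σ T' v)
      (cases : ∀ {v} → v ∈ Z → v ∈ mem T ⊎ v ∈ mem T') (apart : ∀ {v} → v ∈ mem T → v ∈ mem T' → ⊥)
      (trips : ∀ {z y t t' a c} → Trip (mem T) z y → y ~ t → Trip (mem T') t t' → a ∈ side i → z ~ a → c ∈ side (not i) → t' ~ c → ⊥)
      (lT : length (mem T) ≤ 6) (y∈T : Hexagonal.y h ∈ mem T) where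
      open Hexagonal h
      private
        module T = Orig T

      si : ∀ {x} → J i x ≡ true → S i x ≡ true
      si {x} j = ∧-fst {S i x} (∧-fst {pure i x} j)
      σyT : T.σ y ≡ z
      σyT = trans (≡sym (τT y∈T)) σy
      z∈T : z ∈ mem T
      z∈T = subst (_∈ mem T) σyT (T.σ-∈ y∈T)
      yz : B y z
      yz = subst (B y) σyT (T.σ-B y∈T)
      side-∉ : ∀ {f v} → f ∈ side i → v ∈ mem T → f ≢ v
      side-∉ mf mv refl = Layout.side-Z layout i mf (T-Z mv)
      full : ∀ {v} → v ∈ Z → Ring.empty-gap ring any v ≡ true → ⊥
      full m e = count-none (Ring.empty-gap ring any) Z (n≤0⇒n≡0 (+-cancelˡ-≤ 11 _ 0 (≤-trans long Z≤11))) m e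
      next-any : ∀ {t} → t ∈ Z → any t ≡ false → any (τ t) ≡ true
      next-any {t} mt f with bool-cases (any (τ t))
      ... | inj₁ e = e
      ... | inj₂ e = ⊥-elim (full mt (∧-both (not-false f) (not-false e)))
      prev-any : ∀ {t} → t ∈ Z → any t ≡ false → any (τ⁻ t) ≡ true
      prev-any {t} mt f with bool-cases (any (τ⁻ t))
      ... | inj₁ e = e
      ... | inj₂ e = ⊥-elim (full (Ring.σ⁻-∈ ring mt) (∧-both (not-false e) (not-false (trans (cong any (Ring.σσ⁻ ring mt)) f))))

      module _ {t : V} (f : any t ≡ false) (yt : y ~ t) (zt : z ~ t) where

        -- The successor of `t` is a seer on the other cycle, so it is shared. Then `T` from `z`
        -- round to `y`, followed by `T'` from `t` round to that successor, links both sides.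
        far : t ∈ mem T' → ⊥
        far mt with only (next-any (T'-Z mt) f)
        ... | inj₂ (inj₁ e) = apart y∈T (subst (_∈ mem T') (trans (≡sym (τT' mt)) e) (Orig.σ-∈ T' mt))
        ... | inj₂ (inj₂ e) = apart z∈T (subst (_∈ mem T') (trans (≡sym (τT' mt)) e) (Orig.σ-∈ T' mt))
        ... | inj₁ k with S-elim i (si Jz) | S-elim (not i) (K-S (not i) k)
        ... | a , ma , za | c , mc , tc = trips (subst (λ x → Trip (mem T) x y) σyT (T.σ-tour y∈T)) yt (trip-sym (Orig.σ-tour T' mt)) ma za mc (subst (_~ c) (τT' mt) tc)

        module _ (mt : t ∈ mem T) where

          -- `w` would be an ear over the edge `w' t` and see neither side, but it sees side `i`.
          blocked : ∀ {w w'} → w ∈ mem T → w' ∈ mem T → J i w ≡ true → B w t → B w w' → w' ≢ t → w' ~ t → ⊥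
          blocked mw mw' jw b b' ne a with S-elim i (si jw)
          ... | g , mg , wg with ear b' b ne a wg
          ... | inj₁ e = side-∉ mg mw' e
          ... | inj₂ e = side-∉ mg mt e

          K-next : K (T.σ t) ≡ true
          K-next with only (next-any (T-Z mt) f)
          ... | inj₁ k = subst (λ x → K x ≡ true) (τT mt) k
          ... | inj₂ (inj₁ e) = ⊥-elim (blocked y∈T z∈T Jy (B-sym (subst (B t) (trans (≡sym (τT mt)) e) (T.σ-B mt))) yz (~⇒≢ zt) zt)
          ... | inj₂ (inj₂ e) = ⊥-elim (~-irrefl (subst (y ~_) (trans (≡sym (T.σ⁻σ mt)) (trans (cong T.σ⁻ (trans (≡sym (τT mt)) (trans e (≡sym σyT)))) (T.σ⁻σ y∈T))) yt))

          K-prev : K (T.σ⁻ t) ≡ true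
          K-prev with only (prev-any (T-Z mt) f)
          ... | inj₁ k = subst (λ x → K x ≡ true) (τT⁻ mt) k
          ... | inj₂ (inj₁ e) = ⊥-elim (~-irrefl (subst (z ~_) (trans (≡sym (T.σσ⁻ mt)) (trans (cong T.σ (trans (≡sym (τT⁻ mt)) e)) σyT)) zt))
          ... | inj₂ (inj₂ e) = ⊥-elim (blocked z∈T y∈T Jz (B-sym (subst (B t) (trans (≡sym (τT⁻ mt)) e) (T.σ⁻-B mt))) (B-sym yz) (~⇒≢ yt) yt)

          z-gap : any (T.σ z) ≡ false
          z-gap = ¬true λ e → bad (only e)
            where
            bad : K (T.σ z) ≡ true ⊎ T.σ z ≡ y ⊎ T.σ z ≡ z → ⊥
            bad (inj₁ k) = barrier {i} {z} (si Jz) (subst (λ x → S (not i) x ≡ true) (≡sym (τT z∈T)) (K-S (not i) k))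
            bad (inj₂ (inj₁ e)) = T.σ≢ y∈T (trans σyT (trans (≡sym (T.σ⁻σ z∈T)) (cong T.σ⁻ e)))
            bad (inj₂ (inj₂ e)) = B-irrefl (subst (B z) e (T.σ-B z∈T))

          K-gap : ∀ {v} → v ∈ mem T → K v ≡ true → any (T.σ v) ≡ false
          K-gap {v} mv k = ¬true λ e → [ (λ s → barrier {false} {v} (K-S false k) (subst (λ x → S true x ≡ true) (≡sym (τT mv)) s))
                                        , (λ s → barrier {true} {v} (K-S true k) (subst (λ x → S false x ≡ true) (≡sym (τT mv)) s)) ]′ (any-S true {T.σ v} e)

          K≢J : ∀ {v w} → K v ≡ true → J i w ≡ true → v ≢ w
          K≢J k j refl = J-pure i j (K-S (not i) k)

          any-K : ∀ {v} → K v ≡ true → any v ≡ true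
          any-K {v} k = S-any true {v} (K-S true k)

          -- Both cycle neighbours of `t` are shared. Together with `y` and `z` they are four seers
          -- with three gaps on `T`, hence 7 vertices.
          near : ⊥
          near = too-big lT (≤-trans (+-mono-≤ (count-≥ any (mem T) u4 h4) (≤-trans (count-≥ (Ring.gap T.ring any) (mem T) u3 h3) (m≤m+n _ _))) (Ring.gap-bound T.ring any))
            where
            n≢p : T.σ t ≢ T.σ⁻ t
            n≢p = T.σ≢ mt
            u3 : Unique (T.σ t ∷ T.σ⁻ t ∷ z ∷ [])
            u3 = ∉⇒Unique (λ { (here e) → n≢p e ; (there (here e)) → K≢J K-next Jz e }) (pair (K≢J K-prev Jz))
            u4 : Unique (y ∷ T.σ t ∷ T.σ⁻ t ∷ z ∷ [])
            u4 = ∉⇒Unique (λ { (here e) → K≢J K-next Jy (≡sym e) ; (there (here e)) → K≢J K-prev Jy (≡sym e) ; (there (there (here e))) → ~⇒≢ (B-~ yz) e }) u3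
            h4 : Holds any (mem T) (y ∷ T.σ t ∷ T.σ⁻ t ∷ z ∷ [])
            h4 (here refl) = y∈T , S-any i {y} (si Jy)
            h4 (there (here refl)) = T.σ-∈ mt , any-K K-next
            h4 (there (there (here refl))) = T.σ⁻-∈ mt , any-K K-prev
            h4 (there (there (there (here refl)))) = z∈T , S-any i {z} (si Jz)
            h3 : Holds (Ring.gap T.ring any) (mem T) (T.σ t ∷ T.σ⁻ t ∷ z ∷ [])
            h3 (here refl) = T.σ-∈ mt , ∧-both (any-K K-next) (not-false (K-gap (T.σ-∈ mt) K-next))
            h3 (there (here refl)) = T.σ⁻-∈ mt , ∧-both (any-K K-prev) (not-false (K-gap (T.σ⁻-∈ mt) K-prev))
            h3 (there (there (here refl))) = z∈T , ∧-both (S-any i {z} (si Jz)) (not-false z-gap)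

      refuted : ⊥
      refuted with common (B-~ yz)
      ... | t , yt , zt with where-is i t
      ... | inj₁ m = hex-face layout ready h yz m (yt , zt)
      ... | inj₂ (inj₂ m) = J-pure i Jy (S-intro (not i) (T-Z y∈T) m yt)
      ... | inj₂ (inj₁ m) with bool-cases (any t)
      ... | inj₁ e = no-common e yt zt
      ... | inj₂ f with cases m
      ... | inj₁ k = near f yt zt k
      ... | inj₂ k = far f yt zt k

    reversed : ∀ {P Q R S} → Quartet P Q R S → Quartet S Q R P
    reversed c = sw₁₂ (sw₂₃ (sw₃₄ (sw₂₃ (sw₁₂ c))))

    no-hex : ∀ i → Hexagonal layout i → ⊥
    no-hex i h with XY (S-Z {i} (∧-fst {S i (Hexagonal.y h)} (∧-fst {pure i (Hexagonal.y h)} (Hexagonal.Jy h))))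
    ... | inj₁ k = HexClass.refuted i h X Y ∈-++⁺ˡ (∈-++⁺ʳ (mem X)) (λ m → pick-X m) (λ m → pick-X m) (λ m → pick-Y m) XY (λ m k → disjoint (sw₁₂ q) m (inj₂ (inj₁ k))) (trips i) lX k
      where
      trips : ∀ i {z y t t' a c} → Trip (mem X) z y → y ~ t → Trip (mem Y) t t' → a ∈ side i → z ~ a → c ∈ side (not i) → t' ~ c → ⊥
      trips true p e r ma za mc tc = chain q ma (~-sym za) p e r tc mc
      trips false p e r ma za mc tc = chain (reversed q) ma (~-sym za) p e r tc mc
    ... | inj₂ k = HexClass.refuted i h Y X (∈-++⁺ʳ (mem X)) ∈-++⁺ˡ (λ m → pick-Y m) (λ m → pick-Y m) (λ m → pick-X m) (λ m → swap (XY m)) (λ m k → disjoint (sw₁₂ q) k (inj₂ (inj₁ m))) (trips i) lY k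
      where
      trips : ∀ i {z y t t' a c} → Trip (mem Y) z y → y ~ t → Trip (mem X) t t' → a ∈ side i → z ~ a → c ∈ side (not i) → t' ~ c → ⊥
      trips true p e r ma za mc tc = chain qY ma (~-sym za) p e r tc mc
      trips false p e r ma za mc tc = chain (reversed qY) ma (~-sym za) p e r tc mc

    impossible : ⊥
    impossible with layout-bound layout ready
    ... | inj₂ (i , h) = no-hex i h
    ... | inj₁ le = <-irrefl refl (≤-trans n<20 (≤-trans (sum20 (length (mem A)) (length Z) (length (mem W)) ⟦ is4 (length (mem A)) ⟧ ⟦ is4 (length (mem W)) ⟧
                      (is4-five (Orig.len A)) (is4-five (Orig.len W)) le) (whole-length (mem A) Z (mem W) (Layout.whole layout))))

  module _ (n<20 : n < 20) where

    too-many : 20 ≤ n → ⊥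
    too-many le = <-irrefl refl (≤-trans n<20 le)

    two-colours : ∀ {A X Y W} → Quartet A X Y W → length (mem A) ≡ 4 → Touches A X → Touches A Y → Apart A W → 7 ≤ length (mem X) ⊎ 7 ≤ length (mem Y)
    two-colours {A} {X} {Y} {W} q e ax ay aw with ≤-or-> (length (mem X)) 6 | ≤-or-> (length (mem Y)) 6
    ... | inj₂ l | _ = inj₁ l
    ... | inj₁ _ | inj₂ l = inj₂ l
    ... | inj₁ l | inj₁ l' = ⊥-elim (TwoColours.impossible q e ax ay aw n<20 l l')

    Two : Orig → Orig → Orig → Orig → Set
    Two A X Y W = Touches A X × Touches A Y × Apart A W × (7 ≤ length (mem X) ⊎ 7 ≤ length (mem Y))

    colours : ∀ {A X Y W} → Quartet A X Y W → length (mem A) ≡ 4 → Two A X Y W ⊎ Two A X W Y ⊎ Two A Y W X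
    colours {A} {X} {Y} {W} q e with touches? A X | touches? A Y | touches? A W
    ... | inj₁ x | inj₁ y | inj₁ w = ⊥-elim (too-many (three-colours q e x y w))
    ... | inj₁ x | inj₁ y | inj₂ w = inj₁ (x , y , w , two-colours q e x y w)
    ... | inj₁ x | inj₂ y | inj₁ w = inj₂ (inj₁ (x , w , y , two-colours (sw₃₄ q) e x w y))
    ... | inj₂ x | inj₁ y | inj₁ w = inj₂ (inj₂ (y , w , x , two-colours (sw₃₄ (sw₂₃ q)) e y w x))
    ... | inj₁ x | inj₂ y | inj₂ w = ⊥-elim (too-many (one-colour q e y w))
    ... | inj₂ x | inj₁ y | inj₂ w = ⊥-elim (too-many (one-colour (sw₂₃ q) e x w))
    ... | inj₂ x | inj₂ y | inj₁ w = ⊥-elim (too-many (one-colour (sw₂₃ (sw₃₄ q)) e x y))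
    ... | inj₂ x | inj₂ y | inj₂ w = ⊥-elim (lonely (crossing (inL (mem A)) (∈-inL (proj₂ (Orig.some A))) (∉-inL λ m → disjoint q m (inj₁ (proj₂ (Orig.some X))))))
      where
      lonely : (∃ λ a → ∃ λ b → inL (mem A) a ≡ true × inL (mem A) b ≡ false × a ~ b) → ⊥
      lonely (a , b , ta , fb , ab) with place q b
      ... | inj₁ m = inL-∉ fb m
      ... | inj₂ (inj₁ m) = x (inL-∈ ta) m ab
      ... | inj₂ (inj₂ (inj₁ m)) = y (inL-∈ ta) m ab
      ... | inj₂ (inj₂ (inj₂ m)) = w (inL-∈ ta) m ab

    exactly-4 : ∀ (P : Orig) → (5 ≤ length (mem P) → ⊥) → length (mem P) ≡ 4
    exactly-4 P h with m≤n⇒m<n∨m≡n (Orig.len P)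
    ... | inj₁ l = ⊥-elim (h l)
    ... | inj₂ e = ≡sym e

    not-7 : ∀ {P : Orig} → length (mem P) ≡ 4 → 7 ≤ length (mem P) → ⊥
    not-7 e l = <-irrefl refl (≤-trans (s≤s (s≤s (s≤s (s≤s (s≤s z≤n))))) (≤-trans l (≤-reflexive e)))

    -- As 4 + 7 + 5 + 4 = 20, both `Y` and `W` are squares. Apply `colours` to `Y`, which touches
    -- `A`: then `W` is apart from `A` and `Y`, against `one-colour`, or one of the squares `A`, `W`
    -- has 7 vertices.
    long-X : ∀ {A X Y W} → Quartet A X Y W → length (mem A) ≡ 4 → 7 ≤ length (mem X) → Touches A Y → Apart A W → ⊥
    long-X {A} {X} {Y} {W} q e l ay aw = go (colours {Y} {A} {X} {W} (sw₁₂ (sw₂₃ q)) y4)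
      where
      y4 : length (mem Y) ≡ 4
      y4 = exactly-4 Y λ h → too-many (at-least q (Orig.len A) l h (Orig.len W))
      w4 : length (mem W) ≡ 4
      w4 = exactly-4 W λ h → too-many (at-least q (Orig.len A) l (Orig.len Y) h)
      go : _ → ⊥
      go (inj₁ (_ , _ , yw , _)) = too-many (one-colour {W} {X} {A} {Y} (sw₂₃ (sw₁₂ (sw₂₃ (sw₃₄ q)))) w4 (Apart-sym {A} {W} aw) (Apart-sym {Y} {W} yw))
      go (inj₂ (inj₁ (_ , _ , _ , inj₁ h))) = not-7 {A} e h
      go (inj₂ (inj₁ (_ , _ , _ , inj₂ h))) = not-7 {W} w4 h
      go (inj₂ (inj₂ (_ , _ , ya , _))) = let (a , y , ma , my , ad) = ay in ya my ma (~-sym ad)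

    no-square : ∀ {A X Y W} → Quartet A X Y W → length (mem A) ≡ 4 → ⊥
    no-square {A} {X} {Y} {W} q e = go (colours q e)
      where
      go : _ → ⊥
      go (inj₁ (x , y , w , inj₁ l)) = long-X q e l y w
      go (inj₁ (x , y , w , inj₂ l)) = long-X (sw₂₃ q) e l x w
      go (inj₂ (inj₁ (x , w , y , inj₁ l))) = long-X (sw₃₄ q) e l w y
      go (inj₂ (inj₁ (x , w , y , inj₂ l))) = long-X (sw₂₃ (sw₃₄ q)) e l x y
      go (inj₂ (inj₂ (y , w , x , inj₁ l))) = long-X (sw₃₄ (sw₂₃ q)) e l w x
      go (inj₂ (inj₂ (y , w , x , inj₂ l))) = long-X (sw₂₃ (sw₃₄ (sw₂₃ q))) e l y x

    no-quartet : ∀ {P Q R S} → Quartet P Q R S → ⊥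
    no-quartet {P} {Q} {R} {S} q = too-many (at-least q p5 q5 r5 s5)
      where
      long : ∀ (P : Orig) → (length (mem P) ≡ 4 → ⊥) → 5 ≤ length (mem P)
      long P h with m≤n⇒m<n∨m≡n (Orig.len P)
      ... | inj₁ l = l
      ... | inj₂ e = ⊥-elim (h (≡sym e))
      p5 : 5 ≤ length (mem P)
      p5 = long P (no-square q)
      q5 : 5 ≤ length (mem Q)
      q5 = long Q (no-square (sw₁₂ q))
      r5 : 5 ≤ length (mem R)
      r5 = long R (no-square (sw₁₂ (sw₂₃ q)))
      s5 : 5 ≤ length (mem S)
      s5 = long S (no-square (sw₁₂ (sw₂₃ (sw₃₄ q))))

  four-cycles : ∀ (P Q R S : Orig) → Whole (mem P ++ (mem Q ++ (mem R ++ mem S))) → 20 ≤ n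
  four-cycles P Q R S wh with ≤-or-> 20 n | quartet P Q R S wh
  ... | inj₁ le | _ = le
  ... | inj₂ _ | inj₁ le = le
  ... | inj₂ lt | inj₂ q = ⊥-elim (no-quartet lt q)

  -- The bound on the number of vertices

  next-orig : ∀ D → Closed D → (∀ x → x ∈ D) ⊎ ∃ λ (O : Orig) → ∀ {x} → x ∈ mem O → x ∈ D → ⊥
  next-orig D cl with any-in (λ v → not (inL D v)) (allFin n)
  ... | inj₂ f = inj₁ λ x → here-in x (f (∈-allFin x))
    where
    here-in : ∀ x → not (inL D x) ≡ false → x ∈ D
    here-in x e with bool-cases (inL D x)
    ... | inj₁ t = inL-∈ t
    ... | inj₂ g = ⊥-elim (true≢false (not-false g) e)
  ... | inj₁ (v , _ , e) with fresh-cycle (_∈ D) (λ b m → cl m b) v (inL-∉ (not-true e))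
  ... | c , cyc , le , clc , _ , dis = inj₂ (record { mem = c ; bcyc = cyc ; len = le ; closed = clc } , dis)

  record Triple : Set where
    field
      {P Q R} : Orig
      PQ : ∀ {x} → x ∈ mem P → x ∈ mem Q → ⊥
      PR : ∀ {x} → x ∈ mem P → x ∈ mem R → ⊥
      QR : ∀ {x} → x ∈ mem Q → x ∈ mem R → ⊥

  -- A single boundary cycle would be a spanning cycle, and two would be joined to a spanning path
  -- by any edge between them.
  triple : V → Triple
  triple v with fresh-cycle (λ _ → ⊥) (λ _ ()) v (λ ())
  ... | c , cyc , le , cl , mv , _ = second (next-orig c cl)
    where
    P : Orig
    P = record { mem = c ; bcyc = cyc ; len = le ; closed = cl }
    third : (Q : Orig) → (∀ {x} → x ∈ mem Q → x ∈ c → ⊥) → (∀ x → x ∈ c ++ mem Q) ⊎ (∃ λ (O : Orig) → ∀ {x} → x ∈ mem O → x ∈ c ++ mem Q → ⊥) → Triple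
    third Q d (inj₂ (R , d')) = record { P = P ; Q = Q ; R = R ; PQ = λ m k → d k m ; PR = λ m k → d' k (∈-++⁺ˡ m) ; QR = λ m k → d' k (∈-++⁺ʳ c m) }
    third Q d (inj₁ all) = ⊥-elim (join-two (crossing (inL c) (∈-inL mv) (∉-inL λ m → d (proj₂ (Orig.some Q)) m)))
      where
      join-two : (∃ λ a → ∃ λ b → inL c a ≡ true × inL c b ≡ false × a ~ b) → ⊥
      join-two (a , b , ta , fb , ab) with ∈-++⁻ c (all b)
      ... | inj₁ m = inL-∉ fb m
      ... | inj₂ m = no-trip {c ++ mem Q} (Unique-++ (Cycle.unique cyc) (Orig.unique Q) (λ x y → d y x) , all)
                       (trip-join (trip-sym (proj₂ (Orig.enter P (inL-∈ ta)))) ab (proj₂ (Orig.enter Q m)))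
    second : (∀ x → x ∈ c) ⊎ (∃ λ (O : Orig) → ∀ {x} → x ∈ mem O → x ∈ c → ⊥) → Triple
    second (inj₁ all) = ⊥-elim (no-trip {c} (Cycle.unique cyc , all) (proj₂ (Orig.enter P mv)))
    second (inj₂ (Q , d)) = third Q d (next-orig (c ++ mem Q) (Closed-++ cl (Orig.closed Q)))

  twenty : V → 20 ≤ n
  twenty v = go₃ (next-orig D₃ cl₃)
    where
    open Triple (triple v)
    D₃ : List V
    D₃ = mem P ++ (mem Q ++ mem R)
    cl₃ : Closed D₃
    cl₃ = Closed-++ (Orig.closed P) (Closed-++ (Orig.closed Q) (Orig.closed R))
    u₃ : Unique D₃
    u₃ = Unique-++ (Orig.unique P) (Unique-++ (Orig.unique Q) (Orig.unique R) QR) λ m k → [ PQ m , PR m ]′ (∈-++⁻ (mem Q) k)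
    go₄ : (S : Orig) → (∀ {x} → x ∈ mem S → x ∈ D₃ → ⊥) → (∀ x → x ∈ mem S ++ D₃) ⊎ (∃ λ (O : Orig) → ∀ {x} → x ∈ mem O → x ∈ mem S ++ D₃ → ⊥) → 20 ≤ n
    go₄ S d (inj₁ all) = four-cycles S P Q R (Unique-++ (Orig.unique S) u₃ d , all)
    go₄ S d (inj₂ (O , d')) = ≤-trans (+-mono-≤ (Orig.len O) (+-mono-≤ (Orig.len S) (+-mono-≤ (Orig.len P) (+-mono-≤ (Orig.len Q) (Orig.len R)))))
        (≤-trans (≤-reflexive (≡sym (trans (length-++ (mem O)) (cong (length (mem O) +_) (trans (length-++ (mem S)) (cong (length (mem S) +_) (trans (length-++ (mem P)) (cong (length (mem P) +_) (length-++ (mem Q))))))))))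
          (Unique-length (Unique-++ (Orig.unique O) (Unique-++ (Orig.unique S) u₃ d) d')))
    go₃ : (∀ x → x ∈ D₃) ⊎ (∃ λ (O : Orig) → ∀ {x} → x ∈ mem O → x ∈ D₃ → ⊥) → 20 ≤ n
    go₃ (inj₁ all) = three-groups (Orig.group P) (Orig.group Q) (Orig.group R) (u₃ , all)
    go₃ (inj₂ (S , d)) = go₄ S d (next-orig (mem S ++ D₃) (Closed-++ (Orig.closed S) cl₃))

  -- Faces and edges

  Vs : List V
  Vs = allFin n

  uVs : Unique Vs
  uVs = Unique.allFin⁺ n

  Vs-length : length Vs ≡ n
  Vs-length = length-tabulate {n = n} (λ i → i)

  lt : V → V → Bool
  lt a b = toℕ a <ᵇ toℕ b

  lt-< : ∀ {a b} → lt a b ≡ true → toℕ a < toℕ b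
  lt-< {a} {b} e = <ᵇ⇒< (toℕ a) (toℕ b) (toT e)

  <-lt : ∀ {a b} → toℕ a < toℕ b → lt a b ≡ true
  <-lt {a} {b} l with lt a b in eq
  ... | true = refl
  ... | false = ⊥-elim (subst T eq (<⇒<ᵇ l))

  lt-flip : ∀ {a b} → a ≢ b → lt b a ≡ not (lt a b)
  lt-flip {a} {b} ne with <-cmp (toℕ a) (toℕ b)
  ... | tri≈ _ e _ = ⊥-elim (ne (toℕ-injective e))
  ... | tri< l _ nl = trans (¬true (λ e → nl (lt-< {b} {a} e))) (cong not (≡sym (<-lt {a} {b} l)))
  ... | tri> nl _ l = trans (<-lt {b} {a} l) (cong not (≡sym (¬true (λ e → nl (lt-< {a} {b} e)))))

  lt-trans : ∀ {a b c} → lt a b ≡ true → lt b c ≡ true → lt a c ≡ true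
  lt-trans {a} {b} {c} x y = <-lt {a} {c} (<-trans (lt-< {a} {b} x) (lt-< {b} {c} y))

  size-sum : size G ≡ ∑ Vs (λ i → ∑ Vs (λ j → ⟦ lt i j ∧ adj G i j ⟧))
  size-sum = size-∑ G

  half-sum : ∀ (f : V → V → Bool) → (∀ a → f a a ≡ false) → (∀ a b → f a b ≡ f b a) →
    let h = ∑ Vs (λ a → ∑ Vs (λ b → ⟦ lt a b ∧ f a b ⟧)) in ∑ Vs (λ a → ∑ Vs (λ b → ⟦ f a b ⟧)) ≡ h + h
  half-sum f d s = begin
    ∑ Vs (λ a → ∑ Vs (λ b → ⟦ f a b ⟧)) ≡⟨ ∑-cong Vs (λ {a} _ → trans (∑-cong Vs (λ {b} _ → split a b)) (∑-+ Vs _ _)) ⟩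
    ∑ Vs (λ a → ∑ Vs (λ b → ⟦ lt a b ∧ f a b ⟧) + ∑ Vs (λ b → ⟦ lt b a ∧ f b a ⟧)) ≡⟨ ∑-+ Vs _ _ ⟩
    h + ∑ Vs (λ a → ∑ Vs (λ b → ⟦ lt b a ∧ f b a ⟧)) ≡⟨ cong (h +_) (∑-swap Vs Vs (λ a b → ⟦ lt b a ∧ f b a ⟧)) ⟩
    h + h ∎
    where
    open ≡-Reasoning
    h = ∑ Vs (λ a → ∑ Vs (λ b → ⟦ lt a b ∧ f a b ⟧))
    split : ∀ a b → ⟦ f a b ⟧ ≡ ⟦ lt a b ∧ f a b ⟧ + ⟦ lt b a ∧ f b a ⟧
    split a b with a ≟ b
    ... | yes refl rewrite d a | ∧-comm (lt a a) false = refl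
    ... | no ne rewrite lt-flip ne | s b a with lt a b | f a b
    ... | true | true = refl
    ... | true | false = refl
    ... | false | true = refl
    ... | false | false = refl

  iff : ∀ {x y} → (x ≡ true → y ≡ true) → (y ≡ true → x ≡ true) → x ≡ y
  iff {true} f g = ≡sym (f refl)
  iff {false} {false} f g = refl
  iff {false} {true} f g = g refl

  tri : V → V → V → Bool
  tri a b c = adj G a b ∧ (adj G b c ∧ adj G a c)

  tri-elim : ∀ {a b c} → tri a b c ≡ true → a ~ b × b ~ c × a ~ c
  tri-elim {a} {b} {c} e = ∧-fst e , ∧-fst (∧-snd {adj G a b} e) , ∧-snd {adj G b c} (∧-snd {adj G a b} e)

  tri-intro : ∀ {a b c} → a ~ b → b ~ c → a ~ c → tri a b c ≡ true
  tri-intro x y z = ∧-both x (∧-both y z)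

  tri-12 : ∀ a b c → tri a b c ≡ tri b a c
  tri-12 a b c = iff (λ e → let (x , y , z) = tri-elim {a} {b} {c} e in tri-intro (~-sym x) z y) (λ e → let (x , y , z) = tri-elim {b} {a} {c} e in tri-intro (~-sym x) z y)

  tri-23 : ∀ a b c → tri a b c ≡ tri a c b
  tri-23 a b c = iff (λ e → let (x , y , z) = tri-elim {a} {b} {c} e in tri-intro z (~-sym y) x) (λ e → let (x , y , z) = tri-elim {a} {c} {b} e in tri-intro z (~-sym y) x)

  opaque
    bb : V → V → Bool
    bb a b = ⌊ B? a b ⌋

    bb-B : ∀ {a b} → bb a b ≡ true → B a b
    bb-B {a} {b} e with B? a b
    ... | yes x = x

    B-bb : ∀ {a b} → B a b → bb a b ≡ true
    B-bb {a} {b} x with B? a b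
    ... | yes _ = refl
    ... | no nx = ⊥-elim (nx x)

  bb-sym : ∀ a b → bb a b ≡ bb b a
  bb-sym a b = iff (λ e → B-bb (B-sym (bb-B {a} {b} e))) (λ e → B-bb (B-sym (bb-B {b} {a} e)))

  bb-irrefl : ∀ a → bb a a ≡ false
  bb-irrefl a = ¬true λ e → B-irrefl (bb-B {a} {a} e)

  b-degree : ∀ a → ∑ Vs (λ b → ⟦ bb a b ⟧) ≡ 2
  b-degree a with B-ends a
  ... | x , y , bx , by , x≢y , f = count-exact (bb a) uVs (pair x≢y)
        (λ { (here refl) → ∈-allFin _ , B-bb bx ; (there (here refl)) → ∈-allFin _ , B-bb by })
        (λ {v} _ e → [ (λ { refl → here refl }) , (λ { refl → there (here refl) }) ]′ (f (bb-B {a} {v} e)))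

  -- A boundary edge lies in one triangle and any other edge in two; the boundary indicator makes up
  -- the difference.
  apex-count : ∀ a b → ∑ Vs (λ c → ⟦ tri a b c ⟧) + ⟦ bb a b ⟧ ≡ ⟦ adj G a b ⟧ + ⟦ adj G a b ⟧
  apex-count a b with bool-cases (adj G a b)
  ... | inj₂ f = trans (cong₂ _+_ (count-zero (tri a b) Vs (λ {c} _ e → true≢false (proj₁ (tri-elim {a} {b} {c} e)) f)) (cong ⟦_⟧ (¬true λ e → true≢false (B-~ (bb-B {a} {b} e)) f)))
                  (≡sym (cong (λ x → ⟦ x ⟧ + ⟦ x ⟧) f))
  ... | inj₁ ab with B? a b
  ... | yes x with common ab
  ... | t , at , bt = trans (cong₂ _+_ (count-exact (tri a b) {Vs} {t ∷ []} uVs ([] ∷ []) (λ { (here refl) → ∈-allFin _ , tri-intro ab bt at })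
                        (λ {v} _ e → let (_ , bv , av) = tri-elim {a} {b} {v} e in here (proj₂ x v t (av , bv) (at , bt)))) (cong ⟦_⟧ (B-bb x))) (≡sym (cong (λ x → ⟦ x ⟧ + ⟦ x ⟧) ab))
  apex-count a b | inj₁ ab | no nx with interior ab nx
  ... | s , t , (as , bs) , (at , bt) , s≢t = trans (cong₂ _+_ (count-exact (tri a b) uVs (pair s≢t)
                        (λ { (here refl) → ∈-allFin _ , tri-intro ab bs as ; (there (here refl)) → ∈-allFin _ , tri-intro ab bt at }) cover) (cong ⟦_⟧ (¬true λ e → nx (bb-B e)))) (≡sym (cong (λ x → ⟦ x ⟧ + ⟦ x ⟧) ab))
    where
    cover : ∀ {v} → v ∈ Vs → tri a b v ≡ true → v ∈ s ∷ t ∷ []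
    cover {v} _ e with v ≟ s | v ≟ t | tri-elim {a} {b} {v} e
    ... | yes refl | _ | _ = here refl
    ... | no _ | yes refl | _ = there (here refl)
    ... | no x | no y | _ , bv , av = ⊥-elim (no-three-common ab (as , bs) (at , bt) (av , bv) s≢t (λ e → y (≡sym e)) (λ e → x (≡sym e)))

  E I T₃ N₆ : ℕ
  E = ∑ Vs (λ i → ∑ Vs (λ j → ⟦ lt i j ∧ adj G i j ⟧))
  I = ∑ Vs (λ i → ∑ Vs (λ j → ⟦ lt i j ∧ (adj G i j ∧ not (bb i j)) ⟧))
  T₃ = ∑ Vs (λ a → ∑ Vs (λ b → ∑ Vs (λ c → ⟦ lt a b ∧ (lt b c ∧ tri a b c) ⟧)))
  N₆ = ∑ Vs (λ a → ∑ Vs (λ b → ∑ Vs (λ c → ⟦ tri a b c ⟧)))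

  opaque
    -- The sum of `apex-count` over ordered pairs; the indicators sum to 2 at every vertex.
    faces-edges : N₆ + (n + n) ≡ (E + E) + (E + E)
    faces-edges = begin
      N₆ + (n + n) ≡⟨ cong (N₆ +_) (≡sym total-b) ⟩
      N₆ + ∑ Vs (λ a → ∑ Vs (λ b → ⟦ bb a b ⟧)) ≡⟨ ≡sym (∑-+ Vs _ _) ⟩
      ∑ Vs (λ a → ∑ Vs (λ b → ∑ Vs (λ c → ⟦ tri a b c ⟧)) + ∑ Vs (λ b → ⟦ bb a b ⟧)) ≡⟨ ∑-cong Vs (λ _ → ≡sym (∑-+ Vs _ _)) ⟩
      ∑ Vs (λ a → ∑ Vs (λ b → ∑ Vs (λ c → ⟦ tri a b c ⟧) + ⟦ bb a b ⟧)) ≡⟨ ∑-cong Vs (λ {a} _ → ∑-cong Vs (λ {b} _ → apex-count a b)) ⟩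
      ∑ Vs (λ a → ∑ Vs (λ b → ⟦ adj G a b ⟧ + ⟦ adj G a b ⟧)) ≡⟨ ∑-cong Vs (λ _ → ∑-+ Vs _ _) ⟩
      ∑ Vs (λ a → ∑ Vs (λ b → ⟦ adj G a b ⟧) + ∑ Vs (λ b → ⟦ adj G a b ⟧)) ≡⟨ ∑-+ Vs _ _ ⟩
      _ ≡⟨ cong₂ _+_ (half-sum (adj G) (irrefl G) (sym G)) (half-sum (adj G) (irrefl G) (sym G)) ⟩
      (E + E) + (E + E) ∎
      where
      open ≡-Reasoning
      total-b : ∑ Vs (λ a → ∑ Vs (λ b → ⟦ bb a b ⟧)) ≡ n + n
      total-b = trans (∑-cong Vs (λ {a} _ → b-degree a)) (trans (∑-+ Vs (λ _ → 1) (λ _ → 1)) (cong₂ _+_ (trans (∑-one Vs) Vs-length) (trans (∑-one Vs) Vs-length)))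

    -- The boundary is 2-regular and spanning, so it has `n` edges.
    edges-interior : E ≡ n + I
    edges-interior = trans (trans (∑-cong Vs (λ {a} _ → trans (∑-cong Vs (λ {b} _ → split a b)) (∑-+ Vs _ _))) (∑-+ Vs _ _)) (cong (_+ I) nB)
      where
      split : ∀ a b → ⟦ lt a b ∧ adj G a b ⟧ ≡ ⟦ lt a b ∧ bb a b ⟧ + ⟦ lt a b ∧ (adj G a b ∧ not (bb a b)) ⟧
      split a b = go (lt a b) (adj G a b) (bb a b) (λ e → B-~ (bb-B {a} {b} e))
        where
        go : ∀ l x y → (y ≡ true → x ≡ true) → ⟦ l ∧ x ⟧ ≡ ⟦ l ∧ y ⟧ + ⟦ l ∧ (x ∧ not y) ⟧
        go false x y h = refl
        go true true true h = refl
        go true true false h = refl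
        go true false false h = refl
        go true false true h = ⊥-elim (true≢false refl (≡sym (h refl)))
      halve : ∀ m k → m + m ≡ k + k → m ≡ k
      halve m k e = *-cancelˡ-≡ m k 2 (trans (cong (m +_) (+-identityʳ m)) (trans e (cong (k +_) (≡sym (+-identityʳ k)))))
      nB : ∑ Vs (λ a → ∑ Vs (λ b → ⟦ lt a b ∧ bb a b ⟧)) ≡ n
      nB = halve _ n (trans (≡sym (half-sum bb bb-irrefl bb-sym))
             (trans (∑-cong Vs (λ {a} _ → b-degree a)) (trans (∑-+ Vs (λ _ → 1) (λ _ → 1)) (cong₂ _+_ (trans (∑-one Vs) Vs-length) (trans (∑-one Vs) Vs-length)))))

    -- Every triangle is counted once in each of the six orders of its vertices.
    sixfold : N₆ ≡ 6 * T₃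
    sixfold = begin
      N₆ ≡⟨ ∑₃-cong (λ a b c → six a b c) ⟩
      ∑₃ (λ a b c → (O a b c + O a c b) + ((O b a c + O b c a) + (O c a b + O c b a))) ≡⟨ ∑₃-+ _ _ ⟩
      ∑₃ (λ a b c → O a b c + O a c b) + ∑₃ (λ a b c → (O b a c + O b c a) + (O c a b + O c b a)) ≡⟨ cong₂ _+_ (∑₃-+ _ _) (trans (∑₃-+ _ _) (cong₂ _+_ (∑₃-+ _ _) (∑₃-+ _ _))) ⟩
      (T₃ + ∑₃ (λ a b c → O a c b)) + ((∑₃ (λ a b c → O b a c) + ∑₃ (λ a b c → O b c a)) + (∑₃ (λ a b c → O c a b) + ∑₃ (λ a b c → O c b a)))
        ≡⟨ cong₂ _+_ (cong (T₃ +_) (sw23 O)) (cong₂ _+_ (cong₂ _+_ (sw12 O) (trans (sw12 (λ a b c → O a c b)) (sw23 O)))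
             (cong₂ _+_ (trans (sw23 (λ a b c → O b a c)) (sw12 O)) (trans (sw12 (λ a b c → O c a b)) (trans (sw23 (λ a b c → O b a c)) (sw12 O))))) ⟩
      (T₃ + T₃) + ((T₃ + T₃) + (T₃ + T₃)) ≡⟨ solve 1 (λ t → (t :+ t) :+ ((t :+ t) :+ (t :+ t)) := con 6 :* t) refl T₃ ⟩
      6 * T₃ ∎
      where
      open ≡-Reasoning
      open +-*-Solver using (solve; _:+_; _:*_; _:=_; con)
      ∑₃ : (V → V → V → ℕ) → ℕ
      ∑₃ f = ∑ Vs (λ a → ∑ Vs (λ b → ∑ Vs (λ c → f a b c)))
      ∑₃-cong : ∀ {f g} → (∀ a b c → f a b c ≡ g a b c) → ∑₃ f ≡ ∑₃ g
      ∑₃-cong h = ∑-cong Vs (λ {a} _ → ∑-cong Vs (λ {b} _ → ∑-cong Vs (λ {c} _ → h a b c)))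
      ∑₃-+ : ∀ f g → ∑₃ (λ a b c → f a b c + g a b c) ≡ ∑₃ f + ∑₃ g
      ∑₃-+ f g = trans (∑-cong Vs (λ _ → trans (∑-cong Vs (λ _ → ∑-+ Vs _ _)) (∑-+ Vs _ _))) (∑-+ Vs _ _)
      sw12 : ∀ f → ∑₃ (λ a b c → f b a c) ≡ ∑₃ f
      sw12 f = ∑-swap Vs Vs (λ a b → ∑ Vs (λ c → f b a c))
      sw23 : ∀ f → ∑₃ (λ a b c → f a c b) ≡ ∑₃ f
      sw23 f = ∑-cong Vs (λ {a} _ → ∑-swap Vs Vs (λ b c → f a c b))
      O : V → V → V → ℕ
      O a b c = ⟦ lt a b ∧ (lt b c ∧ tri a b c) ⟧
      order : ∀ x y z → (x ≡ true → y ≡ true → z ≡ true) → (x ≡ false → y ≡ false → z ≡ false) →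
        1 ≡ (⟦ x ∧ (y ∧ true) ⟧ + ⟦ z ∧ (not y ∧ true) ⟧) + ((⟦ not x ∧ (z ∧ true) ⟧ + ⟦ y ∧ (not z ∧ true) ⟧) + (⟦ not z ∧ (x ∧ true) ⟧ + ⟦ not y ∧ (not x ∧ true) ⟧))
      order true true true p q = refl
      order true true false p q = ⊥-elim (true≢false refl (≡sym (p refl refl)))
      order true false true p q = refl
      order true false false p q = refl
      order false true true p q = refl
      order false true false p q = refl
      order false false true p q = ⊥-elim (true≢false refl (q refl refl))
      order false false false p q = refl
      none : ∀ x y → ⟦ x ∧ (y ∧ false) ⟧ ≡ 0
      none true true = refl
      none true false = refl
      none false y = refl
      p₁ : ∀ a b c → tri a c b ≡ tri a b c
      p₁ a b c = ≡sym (tri-23 a b c)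
      p₂ : ∀ a b c → tri b a c ≡ tri a b c
      p₂ a b c = ≡sym (tri-12 a b c)
      p₃ : ∀ a b c → tri b c a ≡ tri a b c
      p₃ a b c = trans (tri-23 b c a) (p₂ a b c)
      p₄ : ∀ a b c → tri c a b ≡ tri a b c
      p₄ a b c = trans (tri-12 c a b) (p₁ a b c)
      p₅ : ∀ a b c → tri c b a ≡ tri a b c
      p₅ a b c = trans (tri-12 c b a) (p₃ a b c)
      six : ∀ a b c → ⟦ tri a b c ⟧ ≡ (O a b c + O a c b) + ((O b a c + O b c a) + (O c a b + O c b a))
      six a b c with bool-cases (tri a b c)
      ... | inj₂ f rewrite p₁ a b c | p₂ a b c | p₃ a b c | p₄ a b c | p₅ a b c | f
            | none (lt a b) (lt b c) | none (lt a c) (lt c b) | none (lt b a) (lt a c) | none (lt b c) (lt c a) | none (lt c a) (lt a b) | none (lt c b) (lt b a) = refl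
      ... | inj₁ t rewrite p₁ a b c | p₂ a b c | p₃ a b c | p₄ a b c | p₅ a b c | t
            | lt-flip {a} {b} (~⇒≢ (proj₁ (tri-elim {a} {b} {c} t))) | lt-flip {b} {c} (~⇒≢ (proj₁ (proj₂ (tri-elim {a} {b} {c} t)))) | lt-flip {a} {c} (~⇒≢ (proj₂ (proj₂ (tri-elim {a} {b} {c} t)))) =
            order (lt a b) (lt b c) (lt a c) (lt-trans {a} {b} {c}) λ x y → ¬true λ z →
              true≢false (lt-trans {a} {c} {b} z (trans (lt-flip {b} {c} (~⇒≢ (proj₁ (proj₂ (tri-elim {a} {b} {c} t))))) (not-false y))) x

  -- The counts give 6 `T₃` = 2 `n` + 4 `I`. With `T₃` + 1 at most `I` this yields `n` + 3 ≤ `I`,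
  -- and the size is `n` + `I`.
  count-size : suc T₃ ≤ I → 2 * n + 3 ≤ size G
  count-size le = ≤-trans (≤-reflexive (solve 1 (λ n → con 2 :* n :+ con 3 := n :+ (n :+ con 3)) refl n)) (≤-trans (+-monoʳ-≤ n main) (≤-reflexive (trans (≡sym edges-interior) (≡sym size-sum))))
    where
    open +-*-Solver using (solve; _:+_; _:*_; _:=_; con)
    eq : 6 * T₃ ≡ 2 * n + 4 * I
    eq = +-cancelʳ-≡ (n + n) _ _ (trans (cong (_+ (n + n)) (≡sym sixfold)) (trans faces-edges (trans (cong (λ e → (e + e) + (e + e)) edges-interior)
           (solve 2 (λ n i → ((n :+ i) :+ (n :+ i)) :+ ((n :+ i) :+ (n :+ i)) := (con 2 :* n :+ con 4 :* i) :+ (n :+ n)) refl n I))))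
    main : n + 3 ≤ I
    main = *-cancelˡ-≤ 2 (+-cancelˡ-≤ (4 * I) _ _ (begin
      4 * I + 2 * (n + 3) ≡⟨ solve 2 (λ n i → con 4 :* i :+ con 2 :* (n :+ con 3) := con 6 :+ (con 2 :* n :+ con 4 :* i)) refl n I ⟩
      6 + (2 * n + 4 * I) ≡⟨ cong (6 +_) (≡sym eq) ⟩
      6 + 6 * T₃ ≡⟨ ≡sym (*-suc 6 T₃) ⟩
      6 * suc T₃ ≤⟨ *-monoʳ-≤ 6 le ⟩
      6 * I ≡⟨ solve 1 (λ i → con 6 :* i := con 4 :* i :+ con 2 :* i) refl I ⟩
      4 * I + 2 * I ∎))
      where open ≤-Reasoning

  -- Connectivity of the dual graph

  sort₂ : V → V → V × V
  sort₂ a b = if lt a b then (a , b) else (b , a)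

  sort₂-≡ : ∀ {a b c d} → sort₂ a b ≡ sort₂ c d → (a ≡ c × b ≡ d) ⊎ (a ≡ d × b ≡ c)
  sort₂-≡ {a} {b} {c} {d} e with lt a b | lt c d
  sort₂-≡ refl | true | true = inj₁ (refl , refl)
  sort₂-≡ refl | true | false = inj₂ (refl , refl)
  sort₂-≡ refl | false | true = inj₂ (refl , refl)
  sort₂-≡ refl | false | false = inj₁ (refl , refl)

  Face : Set
  Face = V × (V × V)

  -- A triangle is represented by its increasing triple, so that a colouring of triangles can be
  -- evaluated at its vertices in any order.
  sort₃ : V → V → V → Face
  sort₃ a b c = if lt a b then (if lt b c then (a , b , c) else (if lt a c then (a , c , b) else (c , a , b)))
                          else (if lt a c then (b , a , c) else (if lt b c then (b , c , a) else (c , b , a)))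

  sort₃-12 : ∀ {a b} c → a ≢ b → sort₃ a b c ≡ sort₃ b a c
  sort₃-12 {a} {b} c ne rewrite lt-flip {a} {b} ne with lt a b
  ... | true = refl
  ... | false = refl

  sort₃-23 : ∀ {a b c} → a ≢ b → b ≢ c → a ≢ c → sort₃ a b c ≡ sort₃ a c b
  sort₃-23 {a} {b} {c} ab bc ac rewrite lt-flip {b} {c} bc with lt a b in x | lt b c in y | lt a c in z
  ... | true | true | true = refl
  ... | true | true | false = ⊥-elim (true≢false (lt-trans {a} {b} {c} x y) z)
  ... | true | false | true = refl
  ... | true | false | false = refl
  ... | false | true | true = refl
  ... | false | true | false = refl
  ... | false | false | true = ⊥-elim (true≢false (lt-trans {a} {c} {b} z (trans (lt-flip {b} {c} bc) (not-false y))) x)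
  ... | false | false | false = refl

  opaque
    -- The third vertices on both sides of an interior edge; `a , a` is a filler for all other
    -- pairs.
    apex-pair : V → V → V × V
    apex-pair a b with a ~? b | B? a b
    ... | yes ab | no nb = let (s , t , _) = interior ab nb in s , t
    ... | yes _ | yes _ = a , a
    ... | no _ | _ = a , a

    apex-pair-common : ∀ {a b} → a ~ b → ¬ B a b → Common a b (proj₁ (apex-pair a b)) × Common a b (proj₂ (apex-pair a b)) × proj₁ (apex-pair a b) ≢ proj₂ (apex-pair a b)
    apex-pair-common {a} {b} ab nb with a ~? b | B? a b
    ... | yes ab' | no nb' = let (s , t , cs , ct , ne) = interior ab' nb' in cs , ct , ne
    ... | yes _ | yes x = ⊥-elim (nb x)
    ... | no na | _ = ⊥-elim (na ab)

  two-commons : ∀ {a b c d s} → a ~ b → Common a b c → Common a b d → c ≢ d → Common a b s → s ≡ c ⊎ s ≡ d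
  two-commons {c = c} {d} {s} ab cc cd ne cs with s ≟ c | s ≟ d
  ... | yes e | _ = inj₁ e
  ... | no _ | yes e = inj₂ e
  ... | no x | no y = ⊥-elim (no-three-common ab cc cd cs ne (λ e → y (≡sym e)) (λ e → x (≡sym e)))

  _≟F_ : (x y : Face) → Dec (x ≡ y)
  _≟F_ = ≡-dec _≟_ (≡-dec _≟_ _≟_)

  _≟P_ : (x y : V × V) → Dec (x ≡ y)
  _≟P_ = ≡-dec _≟_ _≟_

  faceB : Face → Bool
  faceB (a , b , c) = lt a b ∧ (lt b c ∧ tri a b c)

  innerB : V × V → Bool
  innerB (a , b) = lt a b ∧ (adj G a b ∧ not (bb a b))

  Pairs : List (V × V)
  Pairs = cartesianProduct Vs Vs

  Faces : List Face
  Faces = select faceB (cartesianProduct Vs Pairs)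

  Pairs-all : ∀ p → p ∈ Pairs
  Pairs-all (a , b) = ∈-cartesianProduct⁺ (∈-allFin a) (∈-allFin b)

  uPairs : Unique Pairs
  uPairs = Unique.cartesianProduct⁺ uVs uVs

  Faces-length : length Faces ≡ T₃
  Faces-length = trans (select-length faceB (cartesianProduct Vs Pairs)) (trans (∑-× Vs Pairs (λ p → ⟦ faceB p ⟧)) (∑-cong Vs (λ {a} _ → ∑-× Vs Vs (λ p → ⟦ faceB (a , p) ⟧))))

  uFaces : Unique Faces
  uFaces = select-unique faceB (cartesianProduct Vs Pairs) (Unique.cartesianProduct⁺ uVs uPairs)

  I-count : count innerB Pairs ≡ I
  I-count = ∑-× Vs Vs (λ p → ⟦ innerB p ⟧)

  innerB-intro : ∀ {a b} → lt a b ≡ true → a ~ b → ¬ B a b → innerB (a , b) ≡ true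
  innerB-intro l ab nb = ∧-both l (∧-both ab (not-false (¬true λ e → nb (bb-B e))))

  sorted-inner : ∀ {a b} → a ~ b → ¬ B a b → innerB (sort₂ a b) ≡ true
  sorted-inner {a} {b} ab nb with lt a b in eq
  ... | true = innerB-intro {a} {b} eq ab nb
  ... | false = innerB-intro {b} {a} (trans (lt-flip {a} {b} (~⇒≢ ab)) (not-false eq)) (~-sym ab) (λ x → nb (B-sym x))

  -- The complement of α ∪ β plays the role of a middle part touching α along a m and β along b m'. For a colouring g of the
  -- triangles, each triangle meeting the cut around α meets it in two edges, so the number of cut edges with two colours is even.
  record Leaves : Set where
    field
      α β : V → Bool
      α-closed : closed-sub α
      β-closed : closed-sub β
      αβ : ∀ v → α v ≡ true → β v ≡ true → ⊥
      {a m b m'} : V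
      αa : α a ≡ true
      αm : α m ≡ false
      βm : β m ≡ false
      a~m : a ~ m
      βb : β b ≡ true
      αm' : α m' ≡ false
      βm' : β m' ≡ false
      b~m' : b ~ m'

    ê f̂ : V × V
    ê = sort₂ a m
    f̂ = sort₂ b m'

    keep : V × V → Bool
    keep p = innerB p ∧ (not ⌊ p ≟P ê ⌋ ∧ not ⌊ p ≟P f̂ ⌋)

    kept : List (V × V)
    kept = select keep Pairs

    -- The dual edge that crosses the edge `x y`.
    link : V × V → Face × Face
    link (x , y) = sort₃ x y (proj₁ (apex-pair x y)) , sort₃ x y (proj₂ (apex-pair x y))

    ¬B-α : ∀ {u v} → α u ≡ true → α v ≡ false → ¬ B u v
    ¬B-α t f b = true≢false (trans (≡sym (α-closed b)) t) f

    ¬B-β : ∀ {u v} → β u ≡ true → β v ≡ false → ¬ B u v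
    ¬B-β t f b = true≢false (trans (≡sym (β-closed b)) t) f

    ê≢f̂ : ê ≢ f̂
    ê≢f̂ eq with sort₂-≡ {a} {m} {b} {m'} eq
    ... | inj₁ (e , _) = αβ b (trans (cong α (≡sym e)) αa) βb
    ... | inj₂ (e , _) = true≢false αa (trans (cong α e) αm')

    -- Boundary edges do not leave a closed set, so `ê` and `f̂` are two distinct interior edges.
    kept-count : 2 + length kept ≤ I
    kept-count = ≤-trans (count-≥ innerB Pairs {ê ∷ f̂ ∷ kept} u h) (≤-reflexive I-count)
      where
      ne : ∀ p q → not ⌊ p ≟P q ⌋ ≡ true → p ≢ q
      ne p q e with p ≟P q
      ... | no n = n
      out : ∀ {p} → p ∈ kept → innerB p ≡ true × p ≢ ê × p ≢ f̂
      out {p} k = let e = proj₂ (∈-select keep Pairs k) ; e' = ∧-snd {innerB p} e in ∧-fst e , ne p ê (∧-fst e') , ne p f̂ (∧-snd {not ⌊ p ≟P ê ⌋} e')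
      u : Unique (ê ∷ f̂ ∷ kept)
      u = ∉⇒Unique (λ { (here e) → ê≢f̂ e ; (there k) → proj₁ (proj₂ (out k)) refl }) (∉⇒Unique (λ k → proj₂ (proj₂ (out k)) refl) (select-unique keep Pairs uPairs))
      h : Holds innerB Pairs (ê ∷ f̂ ∷ kept)
      h (here refl) = Pairs-all _ , sorted-inner a~m (¬B-α αa αm)
      h (there (here refl)) = Pairs-all _ , sorted-inner b~m' (¬B-β βb βm')
      h (there (there k)) = Pairs-all _ , proj₁ (out k)

  module Colouring (L : Leaves) (c₀ : Face → Bool) (agree : ∀ {x y} → (x , y) ∈ map (Leaves.link L) (Leaves.kept L) → c₀ x ≡ c₀ y) where
    open Leaves L

    g : V → V → V → Bool
    g x y z = c₀ (sort₃ x y z)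

    g-12 : ∀ {x y} z → x ~ y → g x y z ≡ g y x z
    g-12 z xy = cong c₀ (sort₃-12 z (~⇒≢ xy))

    g-23 : ∀ {x y z} → x ~ y → y ~ z → x ~ z → g x y z ≡ g x z y
    g-23 xy yz xz = cong c₀ (sort₃-23 (~⇒≢ xy) (~⇒≢ yz) (~⇒≢ xz))

    Off : V → V → Set
    Off x y = sort₂ x y ≢ ê × sort₂ x y ≢ f̂

    flat-sorted : ∀ {x y} → lt x y ≡ true → x ~ y → ¬ B x y → (x , y) ≢ ê → (x , y) ≢ f̂ → ∀ {s t} → Common x y s → Common x y t → g x y s ≡ g x y t
    flat-sorted {x} {y} l xy nb ne nf {s} {t} cs ct = go (two-commons xy c₁ c₂ c≢ cs) (two-commons xy c₁ c₂ c≢ ct)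
      where
      c₁ = proj₁ (apex-pair-common xy nb)
      c₂ = proj₁ (proj₂ (apex-pair-common xy nb))
      c≢ = proj₂ (proj₂ (apex-pair-common xy nb))
      off : ∀ p q → p ≢ q → not ⌊ p ≟P q ⌋ ≡ true
      off p q n with p ≟P q
      ... | yes e = ⊥-elim (n e)
      ... | no _ = refl
      base : g x y (proj₁ (apex-pair x y)) ≡ g x y (proj₂ (apex-pair x y))
      base = agree (∈-map⁺ link (select-∈ keep (Pairs-all (x , y)) (∧-both (innerB-intro {x} {y} l xy nb) (∧-both (off _ ê ne) (off _ f̂ nf)))))
      go : s ≡ proj₁ (apex-pair x y) ⊎ s ≡ proj₂ (apex-pair x y) → t ≡ proj₁ (apex-pair x y) ⊎ t ≡ proj₂ (apex-pair x y) → g x y s ≡ g x y t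
      go (inj₁ e) (inj₁ e') = cong (g x y) (trans e (≡sym e'))
      go (inj₂ e) (inj₂ e') = cong (g x y) (trans e (≡sym e'))
      go (inj₁ e) (inj₂ e') = trans (cong (g x y) e) (trans base (cong (g x y) (≡sym e')))
      go (inj₂ e) (inj₁ e') = trans (cong (g x y) e) (trans (≡sym base) (cong (g x y) (≡sym e')))

    flat : ∀ {x y} → x ~ y → ¬ B x y → Off x y → ∀ {s t} → Common x y s → Common x y t → g x y s ≡ g x y t
    flat {x} {y} xy nb (ne , nf) {s} {t} cs ct with bool-cases (lt x y)
    ... | inj₁ eq = flat-sorted {x} {y} eq xy nb (λ h → ne (trans (pick eq) h)) (λ h → nf (trans (pick eq) h)) cs ct
      where
      pick : ∀ {b} → b ≡ true → (if b then (x , y) else (y , x)) ≡ (x , y)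
      pick refl = refl
    ... | inj₂ eq = trans (g-12 s xy) (trans (flat-sorted {y} {x} (trans (lt-flip {x} {y} (~⇒≢ xy)) (not-false eq)) (~-sym xy) (λ b → nb (B-sym b))
                      (λ h → ne (trans (pick eq) h)) (λ h → nf (trans (pick eq) h)) (common-sym cs) (common-sym ct)) (≡sym (g-12 t xy)))
      where
      pick : ∀ {b} → b ≡ false → (if b then (x , y) else (y , x)) ≡ (y , x)
      pick refl = refl

    module Cut (γ : V → Bool) (γ-closed : closed-sub γ) (p q : V) (γp : γ p ≡ true) (γq : γ q ≡ false) (pq : p ~ q)
      (off : ∀ {x y} → γ x ≡ true → γ y ≡ false → x ~ y → ¬ (x ≡ p × y ≡ q) → Off x y) where

      cut : V → V → Bool
      cut x y = γ x ∧ not (γ y)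

      -- The triangles of colour `true` on a cut edge, directed out of `γ` and indexed by the third
      -- vertex.
      φ : V → V → V → Bool
      φ x y z = cut x y ∧ (tri x y z ∧ g x y z)

      weigh : V → V → V → Bool
      weigh x y z = tri x y z ∧ g x y z

      tri-diag : ∀ x y → tri x y x ≡ false
      tri-diag x y = ¬true λ e → ~-irrefl (proj₂ (proj₂ (tri-elim {x} {y} {x} e)))

      tri-diag' : ∀ x y → tri x y y ≡ false
      tri-diag' x y = ¬true λ e → ~-irrefl (proj₁ (proj₂ (tri-elim {x} {y} {y} e)))

      weigh-23 : ∀ x y z → weigh x y z ≡ weigh x z y
      weigh-23 x y z with bool-cases (tri x y z)
      ... | inj₂ f = trans (cong (_∧ g x y z) f) (≡sym (cong (_∧ g x z y) (trans (≡sym (tri-23 x y z)) f)))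
      ... | inj₁ t = let (xy , yz , xz) = tri-elim {x} {y} {z} t in cong₂ _∧_ (tri-23 x y z) (g-23 xy yz xz)

      weigh-12 : ∀ x y z → weigh x y z ≡ weigh y x z
      weigh-12 x y z with bool-cases (tri x y z)
      ... | inj₂ f = trans (cong (_∧ g x y z) f) (≡sym (cong (_∧ g y x z) (trans (≡sym (tri-12 x y z)) f)))
      ... | inj₁ t = let (xy , yz , xz) = tri-elim {x} {y} {z} t in cong₂ _∧_ (tri-12 x y z) (g-12 z xy)

      weigh-13 : ∀ x y z → weigh x y z ≡ weigh z y x
      weigh-13 x y z = trans (weigh-12 x y z) (trans (weigh-23 y x z) (weigh-12 y z x))

      opaque
        -- The two cut edges of a triangle share a vertex, and exchanging their other ends pairs
        -- equal terms: `x` with `z` when `z` is in `γ`, and `y` with `z` when it is not.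
        balanced : parity Vs (λ x → parity Vs (λ y → parity Vs (λ z → φ x y z))) ≡ false
        balanced = begin
          parity Vs (λ x → parity Vs (λ y → parity Vs (λ z → φ x y z)))
            ≡⟨ parity-cong Vs (λ x → parity-cong Vs (λ y → trans (parity-cong Vs (λ z → split (φ x y z) (γ z))) (parity-xor Vs _ _))) ⟩
          parity Vs (λ x → parity Vs (λ y → parity Vs (λ z → φ x y z ∧ γ z) xor parity Vs (λ z → φ x y z ∧ not (γ z))))
            ≡⟨ parity-cong Vs (λ x → parity-xor Vs _ _) ⟩
          parity Vs (λ x → parity Vs (λ y → parity Vs (λ z → φ x y z ∧ γ z)) xor parity Vs (λ y → parity Vs (λ z → φ x y z ∧ not (γ z)))) ≡⟨ parity-xor Vs _ _ ⟩
          parity Vs (λ x → parity Vs (λ y → parity Vs (λ z → φ x y z ∧ γ z))) xor parity Vs (λ x → parity Vs (λ y → parity Vs (λ z → φ x y z ∧ not (γ z))))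
            ≡⟨ cong₂ _xor_ (trans (parity-swap Vs Vs (λ x y → parity Vs (λ z → φ x y z ∧ γ z))) (parity-zero Vs (λ {y} _ → parity-sym Vs (λ x z → φ x y z ∧ γ z) (λ x → diag₁ x y) (λ x z → sym₁ x y z))))
                 (parity-zero Vs (λ {x} _ → parity-sym Vs (λ y z → φ x y z ∧ not (γ z)) (λ y → diag₂ x y) (λ y z → sym₂ x y z))) ⟩
          false ∎
          where
          open ≡-Reasoning
          split : ∀ u v → u ≡ (u ∧ v) xor (u ∧ not v)
          split true true = refl
          split true false = refl
          split false v = refl
          vanish : ∀ u v w r → u ≡ false → (v ∧ (u ∧ w)) ∧ r ≡ false
          vanish .false true w r refl = refl
          vanish .false false w r refl = refl
          diag₁ : ∀ x y → φ x y x ∧ γ x ≡ false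
          diag₁ x y = vanish (tri x y x) (cut x y) (g x y x) (γ x) (tri-diag x y)
          diag₂ : ∀ x y → φ x y y ∧ not (γ y) ≡ false
          diag₂ x y = vanish (tri x y y) (cut x y) (g x y y) (not (γ y)) (tri-diag' x y)
          bool₁ : ∀ a b c w → ((a ∧ not b) ∧ w) ∧ c ≡ ((c ∧ not b) ∧ w) ∧ a
          bool₁ true b true w = refl
          bool₁ false b false w = refl
          bool₁ true true false w = refl
          bool₁ true false false true = refl
          bool₁ true false false false = refl
          bool₁ false true true w = refl
          bool₁ false false true true = refl
          bool₁ false false true false = refl
          bool₂ : ∀ a b c w → ((a ∧ not b) ∧ w) ∧ not c ≡ ((a ∧ not c) ∧ w) ∧ not b
          bool₂ false b c w = refl
          bool₂ true true true w = refl
          bool₂ true false false w = refl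
          bool₂ true true false true = refl
          bool₂ true true false false = refl
          bool₂ true false true true = refl
          bool₂ true false true false = refl
          sym₁ : ∀ x y z → φ x y z ∧ γ z ≡ φ z y x ∧ γ x
          sym₁ x y z = trans (cong (λ w → ((γ x ∧ not (γ y)) ∧ w) ∧ γ z) (weigh-13 x y z)) (bool₁ (γ x) (γ y) (γ z) (weigh z y x))
          sym₂ : ∀ x y z → φ x y z ∧ not (γ z) ≡ φ x z y ∧ not (γ y)
          sym₂ x y z = trans (cong (λ w → ((γ x ∧ not (γ y)) ∧ w) ∧ not (γ z)) (weigh-23 x y z)) (bool₂ (γ x) (γ y) (γ z) (weigh x z y))

        inner-parity : ∀ {x y s t} → γ x ≡ true → γ y ≡ false → x ~ y → Common x y s → Common x y t → s ≢ t → parity Vs (φ x y) ≡ g x y s xor g x y t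
        inner-parity {x} {y} {s} {t} γx γy xy cs ct s≢t =
          trans (parity-double (φ x y) uVs (∈-allFin s) (∈-allFin t) s≢t other) (cong₂ _xor_ (value cs) (value ct))
          where
          value : ∀ {u} → Common x y u → φ x y u ≡ g x y u
          value {u} (xu , yu) = trans (cong₂ (λ k r → k ∧ (r ∧ g x y u)) (∧-both γx (not-false γy)) (tri-intro xy yu xu)) refl
          other : ∀ {z} → z ∈ Vs → z ≢ s → z ≢ t → φ x y z ≡ false
          other {z} _ ns nt = ¬true λ e → let (_ , yz , xz) = tri-elim {x} {y} {z} (∧-fst {tri x y z} (∧-snd {cut x y} e)) in
            [ ns , nt ]′ (two-commons xy cs ct s≢t (xz , yz))

        ordinary : ∀ {x y} → ¬ (x ≡ p × y ≡ q) → parity Vs (φ x y) ≡ false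
        ordinary {x} {y} ne = cases (bool-cases (cut x y)) (bool-cases (adj G x y))
          where
          cases : cut x y ≡ true ⊎ cut x y ≡ false → adj G x y ≡ true ⊎ adj G x y ≡ false → parity Vs (φ x y) ≡ false
          cases (inj₂ f) _ = parity-zero Vs (λ {z} _ → cong (_∧ weigh x y z) f)
          cases (inj₁ t) (inj₂ f) = parity-zero Vs (λ {z} _ → ¬true λ e → true≢false (proj₁ (tri-elim {x} {y} {z} (∧-fst {tri x y z} (∧-snd {cut x y} e)))) f)
          cases (inj₁ t) (inj₁ xy) with interior xy (λ b → true≢false (trans (≡sym (γ-closed b)) (∧-fst t)) (not-true (∧-snd {γ x} t)))
          ... | s , u , cs , cu , s≢u = trans (inner-parity (∧-fst t) (not-true (∧-snd {γ x} t)) xy cs cu s≢u)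
                  (trans (cong (_xor g x y u) (flat xy (λ b → true≢false (trans (≡sym (γ-closed b)) (∧-fst t)) (not-true (∧-snd {γ x} t))) (off (∧-fst t) (not-true (∧-snd {γ x} t)) xy ne) cs cu)) (xor-same (g x y u)))

        -- Every other cut edge has the same colour on both sides and contributes nothing, so the
        -- even total forces this at `p q` too.
        special : ∀ {s t} → Common p q s → Common p q t → g p q s ≡ g p q t
        special {s} {t} cs ct with s ≟ t
        ... | yes refl = refl
        ... | no s≢t = xor-eq (g p q s) (g p q t) (trans (≡sym (inner-parity γp γq pq cs ct s≢t)) (trans (≡sym total) balanced))
          where
          xor-eq : ∀ u v → u xor v ≡ false → u ≡ v
          xor-eq true true e = refl
          xor-eq false false e = refl
          row : ∀ {x} → x ≢ p → parity Vs (λ y → parity Vs (φ x y)) ≡ false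
          row ne = parity-zero Vs (λ _ → ordinary (λ e → ne (proj₁ e)))
          total : parity Vs (λ x → parity Vs (λ y → parity Vs (φ x y))) ≡ parity Vs (φ p q)
          total = trans (parity-single (λ x → parity Vs (λ y → parity Vs (φ x y))) uVs (∈-allFin p) (λ _ ne → row ne))
                        (parity-single (λ y → parity Vs (φ p y)) uVs (∈-allFin q) (λ _ ne → ordinary (λ e → ne (proj₂ e))))

    -- The other deleted edge `b m'` has both ends outside `α`, so `a m` is the only deleted edge in
    -- this cut.
    flat-e : ∀ {s t} → Common a m s → Common a m t → g a m s ≡ g a m t
    flat-e = Cut.special α α-closed a m αa αm a~m off
      where
      off : ∀ {x y} → α x ≡ true → α y ≡ false → x ~ y → ¬ (x ≡ a × y ≡ m) → Off x y
      off {x} {y} αx αy _ ne = (λ e → [ ne , (λ { (refl , _) → true≢false αx αm }) ]′ (sort₂-≡ {x} {y} {a} {m} e)) ,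
        (λ e → [ (λ { (refl , _) → αβ x αx βb }) , (λ { (refl , _) → true≢false αx αm' }) ]′ (sort₂-≡ {x} {y} {b} {m'} e))

    flat-f : ∀ {s t} → Common b m' s → Common b m' t → g b m' s ≡ g b m' t
    flat-f = Cut.special β β-closed b m' βb βm' b~m' off
      where
      off : ∀ {x y} → β x ≡ true → β y ≡ false → x ~ y → ¬ (x ≡ b × y ≡ m') → Off x y
      off {x} {y} βx βy _ ne = (λ e → [ (λ { (refl , _) → αβ x αa βx }) , (λ { (refl , _) → true≢false βx βm }) ]′ (sort₂-≡ {x} {y} {a} {m} e)) ,
        (λ e → [ ne , (λ { (refl , _) → true≢false βx βm' }) ]′ (sort₂-≡ {x} {y} {b} {m'} e))

    opaque
      flat-all : ∀ {x y} → x ~ y → ∀ {s t} → Common x y s → Common x y t → g x y s ≡ g x y t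
      flat-all {x} {y} xy {s} {t} cs ct with B? x y
      ... | yes bd = cong (g x y) (proj₂ bd s t cs ct)
      ... | no nb with sort₂ x y ≟P ê | sort₂ x y ≟P f̂
      ... | no ne | no nf = flat xy nb (ne , nf) cs ct
      ... | yes e | _ with sort₂-≡ {x} {y} {a} {m} e
      ... | inj₁ (refl , refl) = flat-e cs ct
      ... | inj₂ (refl , refl) = trans (g-12 s xy) (trans (flat-e (common-sym cs) (common-sym ct)) (≡sym (g-12 t xy)))
      flat-all {x} {y} xy {s} {t} cs ct | no nb | no _ | yes e with sort₂-≡ {x} {y} {b} {m'} e
      ... | inj₁ (refl , refl) = flat-f cs ct
      ... | inj₂ (refl , refl) = trans (g-12 s xy) (trans (flat-f (common-sym cs) (common-sym ct)) (≡sym (g-12 t xy)))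

      first-face : ∀ v → ∃ λ x → ∃ λ y → At v 0 x × At v 1 y
      first-face v with <-at {v} {0} (deg≥1 v) | <-at {v} {1} (deg≥2 v)
      ... | x , ax | y , ay = x , y , ax , ay

      val : V → Bool
      val v = g v (proj₁ (first-face v)) (proj₁ (proj₂ (first-face v)))

      -- Successive triangles around `v` share an edge at `v`, so `flat-all` carries the colour
      -- along the link.
      val-at : ∀ {v} p {x y} → At v p x → At v (suc p) y → g v x y ≡ val v
      val-at {v} zero ax ay = cong₂ (g v) (at-fun ax (proj₁ (proj₂ (proj₂ (first-face v))))) (at-fun ay (proj₂ (proj₂ (proj₂ (first-face v)))))
      val-at {v} (suc p) {x} {y} ax ay with <-at {v} {p} (<-trans (n<1+n p) (at-< ax))
      ... | w , aw = trans (flat-all (at-~ ax) (at-common ax ay) (at-common' ax aw)) (trans (g-23 (at-~ ax) (~-sym (at-next aw ax)) (at-~ aw)) (val-at p aw ax))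

      val-face : ∀ {v x y} → v ~ x → x ~ y → v ~ y → g v x y ≡ val v
      val-face vx xy vy with ~-at vx | ~-at vy
      ... | p , ax | q , ay with at-near ax ay xy
      ... | inj₁ refl = val-at p ax ay
      ... | inj₂ refl = trans (g-23 vx xy vy) (val-at q ay ax)

      val-~ : ∀ {u v} → u ~ v → val u ≡ val v
      val-~ {u} {v} uv with common uv
      ... | t , ut , vt = trans (≡sym (val-face uv vt ut)) (trans (g-12 t uv) (val-face (~-sym uv) ut vt))

      val-const : ∀ u v → val u ≡ val v
      val-const u = everywhere (λ v → val u ≡ val v) (λ e h → trans h (val-~ e)) u refl

      face-const : ∀ {x y} → x ∈ Faces → y ∈ Faces → c₀ x ≡ c₀ y
      face-const {x} {y} mx my = trans (at-face x (proj₂ (∈-select faceB (cartesianProduct Vs Pairs) mx))) (trans (val-const (proj₁ x) (proj₁ y)) (≡sym (at-face y (proj₂ (∈-select faceB (cartesianProduct Vs Pairs) my)))))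
        where
        at-face : ∀ x → faceB x ≡ true → c₀ x ≡ val (proj₁ x)
        at-face (u , v , w) e = trans (cong c₀ (≡sym (sorted (∧-fst e) (∧-fst (∧-snd {lt u v} e))))) (let (uv , vw , uw) = tri-elim {u} {v} {w} (∧-snd {lt v w} (∧-snd {lt u v} e)) in val-face uv vw uw)
          where
          sorted : lt u v ≡ true → lt v w ≡ true → sort₃ u v w ≡ (u , v , w)
          sorted p q rewrite p | q = refl

  -- Otherwise at most `T₃` - 2 dual edges are kept, too few to connect `T₃` triangles, and a
  -- colouring exists that is constant across kept edges but not on all triangles.
  leaves-bound : Leaves → suc T₃ ≤ I
  leaves-bound L with ≤-or-> (suc T₃) I
  ... | inj₁ le = le
  ... | inj₂ lt with bicolour _≟F_ (map link kept) Faces uFaces (≤-trans (s≤s (s≤s (≤-reflexive (length-map link kept)))) (≤-trans kept-count (≤-trans (s≤s⁻¹ lt) (≤-reflexive (≡sym Faces-length)))))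
    where open Leaves L
  ... | c₀ , agree , x , y , mx , my , ne = ⊥-elim (ne (Colouring.face-const L c₀ agree mx my))

  -- Two boundary cycles and the remaining vertices are three parts. Since the graph is connected,
  -- one of them is joined to both others; it becomes the middle part, and the others are the
  -- leaves.
  size-bound : V → 2 * n + 3 ≤ size G
  size-bound v = count-size (leaves-bound leaves)
    where
    open Triple (triple v)
    π κ ρ : V → Bool
    π = inL (mem P)
    κ = inL (mem Q)
    ρ v = not (π v) ∧ not (κ v)
    π-closed : closed-sub π
    π-closed = closed-inL (Orig.closed P)
    κ-closed : closed-sub κ
    κ-closed = closed-inL (Orig.closed Q)
    ρ-closed : closed-sub ρ
    ρ-closed b = cong₂ (λ x y → not x ∧ not y) (π-closed b) (κ-closed b)
    πκ : ∀ v → π v ≡ true → κ v ≡ true → ⊥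
    πκ v a b = PQ (inL-∈ a) (inL-∈ b)
    πρ : ∀ v → π v ≡ true → ρ v ≡ true → ⊥
    πρ v a b = true≢false a (not-true (∧-fst b))
    κρ : ∀ v → κ v ≡ true → ρ v ≡ true → ⊥
    κρ v a b = true≢false a (not-true (∧-snd {not (π v)} b))
    make : (α β : V → Bool) → closed-sub α → closed-sub β → (∀ v → α v ≡ true → β v ≡ true → ⊥) → ∀ {a m b m'} → α a ≡ true → a ~ m → β b ≡ true → b ~ m' →
      (α m ≡ true → ⊥) → (β m ≡ true → ⊥) → (α m' ≡ true → ⊥) → (β m' ≡ true → ⊥) → Leaves
    make α β ca cb d αa am βb bm x y z w = record { α = α ; β = β ; α-closed = ca ; β-closed = cb ; αβ = d ; αa = αa ; αm = ¬true x ; βm = ¬true y ; a~m = am ; βb = βb ; αm' = ¬true z ; βm' = ¬true w ; b~m' = bm }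
    p₀ = proj₂ (Orig.some P)
    q₀ = proj₂ (Orig.some Q)
    r₀ = proj₂ (Orig.some R)
    ρr : ρ (proj₁ (Orig.some R)) ≡ true
    ρr = ∧-both (not-false (∉-inL λ k → PR k r₀)) (not-false (∉-inL λ k → QR k r₀))
    leaves : Leaves
    leaves with crossing π (∈-inL p₀) (∉-inL λ k → PQ k q₀)
    ... | p , x , πp , πx , px with bool-cases (κ x)
    ... | inj₁ κx with crossing ρ {v = proj₁ (Orig.some P)} ρr (¬true λ e → πρ _ (∈-inL p₀) e)
    ... | r , y , ρr' , ρy , ry with bool-cases (π y)
    ... | inj₁ πy = make κ ρ κ-closed ρ-closed κρ κx (~-sym px) ρr' ry (λ e → πκ p πp e) (λ e → πρ p πp e) (λ e → πκ y πy e) (λ e → true≢false e ρy)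
    ... | inj₂ ny with bool-cases (κ y)
    ... | inj₁ κy = make π ρ π-closed ρ-closed πρ πp px ρr' ry (λ e → true≢false e πx) (λ e → κρ x κx e) (λ e → true≢false e ny) (λ e → true≢false e ρy)
    ... | inj₂ nk = ⊥-elim (true≢false (∧-both (not-false ny) (not-false nk)) ρy)
    leaves | p , x , πp , πx , px | inj₂ nκx with crossing κ {v = proj₁ (Orig.some P)} (∈-inL q₀) (∉-inL λ k → PQ p₀ k)
    ... | q , y , κq , κy , qy with bool-cases (π y)
    ... | inj₁ πy = make ρ κ ρ-closed κ-closed (λ v a b → κρ v b a) {x} {p} (∧-both (not-false πx) (not-false nκx)) (~-sym px) κq qy (λ e → πρ p πp e) (λ e → πκ p πp e) (λ e → πρ y πy e) (λ e → true≢false e κy)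
    ... | inj₂ ny = make π κ π-closed κ-closed πκ πp px κq qy (λ e → true≢false e πx) (λ e → true≢false e nκx) (λ e → true≢false e ny) (λ e → true≢false e κy)

-- Extremal graphs

-- The minimum order is attained by a pair of pants: squares 0–3 and 10–13 in annuli bounded by the
-- 4-cycles 4 5 6 7 and 4 8 9 7, which share the edge 4 7, and an ear on each of the six other edges.
links₂₀ : Vec (List (Fin 20)) 20
links₂₀ =
  (# 1 ∷ # 5 ∷ # 4 ∷ # 3 ∷ []) ∷
  (# 0 ∷ # 5 ∷ # 6 ∷ # 2 ∷ []) ∷
  (# 1 ∷ # 6 ∷ # 7 ∷ # 3 ∷ []) ∷
  (# 0 ∷ # 4 ∷ # 7 ∷ # 2 ∷ []) ∷
  (# 14 ∷ # 5 ∷ # 0 ∷ # 3 ∷ # 7 ∷ # 13 ∷ # 10 ∷ # 8 ∷ # 17 ∷ []) ∷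
  (# 14 ∷ # 4 ∷ # 0 ∷ # 1 ∷ # 6 ∷ # 15 ∷ []) ∷
  (# 15 ∷ # 5 ∷ # 1 ∷ # 2 ∷ # 7 ∷ # 16 ∷ []) ∷
  (# 16 ∷ # 6 ∷ # 2 ∷ # 3 ∷ # 4 ∷ # 13 ∷ # 12 ∷ # 9 ∷ # 19 ∷ []) ∷
  (# 17 ∷ # 4 ∷ # 10 ∷ # 11 ∷ # 9 ∷ # 18 ∷ []) ∷
  (# 18 ∷ # 8 ∷ # 11 ∷ # 12 ∷ # 7 ∷ # 19 ∷ []) ∷
  (# 11 ∷ # 8 ∷ # 4 ∷ # 13 ∷ []) ∷
  (# 10 ∷ # 8 ∷ # 9 ∷ # 12 ∷ []) ∷
  (# 11 ∷ # 9 ∷ # 7 ∷ # 13 ∷ []) ∷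
  (# 10 ∷ # 4 ∷ # 7 ∷ # 12 ∷ []) ∷
  (# 4 ∷ # 5 ∷ []) ∷
  (# 5 ∷ # 6 ∷ []) ∷
  (# 6 ∷ # 7 ∷ []) ∷
  (# 4 ∷ # 8 ∷ []) ∷
  (# 8 ∷ # 9 ∷ []) ∷
  (# 7 ∷ # 9 ∷ []) ∷ []

link₂₀ : Fin 20 → List (Fin 20)
link₂₀ v = Vec.lookup links₂₀ v

adj₂₀ : Fin 20 → Fin 20 → Bool
adj₂₀ u v = ⌊ any? (_≟ v) (link₂₀ u) ⌋

G₂₀ : Graph 20
G₂₀ = record
  { adj = adj₂₀
  ; sym = toWitness {a? = all? (λ u → all? (λ v → adj₂₀ u v ≟ᵇ adj₂₀ v u))} tt
  ; irrefl = toWitness {a? = all? (λ v → adj₂₀ v v ≟ᵇ false)} tt }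

near? : ∀ {k} (i j : Fin k) → Dec (toℕ j ≡ suc (toℕ i) ⊎ toℕ i ≡ suc (toℕ j))
near? i j = (toℕ j ≟ⁿ suc (toℕ i)) ⊎-dec (toℕ i ≟ⁿ suc (toℕ j))

linear₂₀ : LocallyLinear G₂₀
linear₂₀ v = length (link₂₀ v) , lookup (link₂₀ v) , nonempty v , (λ {i} {j} → injective v i j) , adjacent v , covers v , λ i j → consecutive v i j
  where
  _≈_ : Fin 20 → Fin 20 → Set
  u ≈ v = adj₂₀ u v ≡ true
  _≈?_ : ∀ u v → Dec (u ≈ v)
  u ≈? v = adj₂₀ u v ≟ᵇ true
  nonempty : ∀ v → 1 ≤ length (link₂₀ v)
  nonempty = toWitness {a? = all? (λ v → 1 ≤? length (link₂₀ v))} tt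
  injective : ∀ v i j → lookup (link₂₀ v) i ≡ lookup (link₂₀ v) j → i ≡ j
  injective = toWitness {a? = all? (λ v → all? (λ i → all? (λ j → (lookup (link₂₀ v) i ≟ lookup (link₂₀ v) j) →-dec (i ≟ j))))} tt
  adjacent : ∀ v i → v ≈ lookup (link₂₀ v) i
  adjacent = toWitness {a? = all? (λ v → all? (λ i → v ≈? lookup (link₂₀ v) i))} tt
  covers : ∀ v u → v ≈ u → ∃ λ i → lookup (link₂₀ v) i ≡ u
  covers = toWitness {a? = all? (λ v → all? (λ u → (v ≈? u) →-dec Fin.any? (λ i → lookup (link₂₀ v) i ≟ u)))} tt
  consecutive : ∀ v i j → (lookup (link₂₀ v) i ≈ lookup (link₂₀ v) j → toℕ j ≡ suc (toℕ i) ⊎ toℕ i ≡ suc (toℕ j))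
                        × (toℕ j ≡ suc (toℕ i) ⊎ toℕ i ≡ suc (toℕ j) → lookup (link₂₀ v) i ≈ lookup (link₂₀ v) j)
  consecutive = toWitness {a? = all? (λ v → all? (λ i → all? (λ j →
    ((lookup (link₂₀ v) i ≈? lookup (link₂₀ v) j) →-dec near? i j) ×-dec (near? i j →-dec (lookup (link₂₀ v) i ≈? lookup (link₂₀ v) j)))))} tt

module _ {n : ℕ} {G : Graph n} where

  walk-trans : ∀ {u v w} → Walk G u v → Walk G v w → Walk G u w
  walk-trans here q = q
  walk-trans (step a p) q = step a (walk-trans p q)

  walk-sym : ∀ {u v} → Walk G u v → Walk G v u
  walk-sym here = here
  walk-sym (step {u} {w} a p) = walk-trans (walk-sym p) (step (trans (sym G w u) a) here)

opaque
  below : ∀ v → toℕ v ≡ 0 ⊎ ∃ λ w → toℕ w < toℕ v × adj₂₀ w v ≡ true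
  below = toWitness {a? = all? (λ v → (toℕ v ≟ⁿ 0) ⊎-dec Fin.any? (λ w → (toℕ w <? toℕ v) ×-dec (adj₂₀ w v ≟ᵇ true)))} tt

connected₂₀ : Connected G₂₀
connected₂₀ u v = walk-trans (walk-sym (root (toℕ u) u ≤-refl)) (root (toℕ v) v ≤-refl)
  where
  root : ∀ k v → toℕ v ≤ k → Walk G₂₀ zero v
  root k v le with below v
  root k zero le | inj₁ e = here
  root (suc k) v le | inj₂ (w , lt , a) = walk-trans (root k w (s≤s⁻¹ (≤-trans lt le))) (step a here)
  root zero v le | inj₂ (w , lt , a) = ⊥-elim (<-irrefl refl (≤-trans (≤-trans (s≤s z≤n) lt) le))

-- Deleting six vertices leaves eight pieces, whereas a spanning path would leave at most seven.
record Scattered {n : ℕ} (G : Graph n) : Set where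
  field
    cut : Fin n → Bool
    cut-list : List (Fin n)
    cut-length : length cut-list ≡ 6
    cut-∈ : ∀ v → cut v ≡ true → v ∈ cut-list
    label : Fin n → Fin 8
    label-edge : ∀ u v → Adj G u v → cut u ≡ false → cut v ≡ false → label u ≡ label v
    label-onto : ∀ l → ∃ λ v → cut v ≡ false × label v ≡ l

module _ {n : ℕ} {G : Graph n} (sc : Scattered G) where
  open Scattered sc

  Covered : List (Fin n) → List (Fin 8) → Set
  Covered p L = ∀ {v} → v ∈ p → cut v ≡ false → label v ∈ L

  -- Consecutive vertices off the cut have the same label, so a new label can begin only at the
  -- start or after a cut vertex.
  pieces : ∀ {k} (x : Fin (suc k) → Fin n) → (∀ i j → toℕ j ≡ suc (toℕ i) → Adj G (x i) (x j)) →
    ∃ λ L → Covered (tabulate x) L × length L ≡ (if cut (x zero) then count cut (tabulate x) else suc (count cut (tabulate x)))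
      × (cut (x zero) ≡ false → label (x zero) ∈ L)
  pieces {zero} x adj with cut (x zero) in eq
  ... | true = label (x zero) ∷ [] , (λ { (here refl) f → here refl }) , refl , λ ()
  ... | false = label (x zero) ∷ [] , (λ { (here refl) f → here refl }) , refl , λ _ → here refl
  pieces {suc k} x adj with pieces (λ i → x (suc i)) (λ i j e → adj (suc i) (suc j) (cong suc e))
  ... | L , cov , len , hd with cut (x zero) in eq | cut (x (suc zero)) in eq'
  -- There is no piece between two consecutive cut vertices; the label is added only to keep the
  -- length exact.
  ... | true | true = x₀ ∷ L , (λ { (here refl) f → here refl ; (there m) f → there (cov m f) }) , cong suc len , λ ()
    where x₀ = label (x zero)
  ... | true | false = L , (λ { (here refl) f → ⊥-elim (true≢false eq f) ; (there m) f → cov m f }) , len , λ ()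
  ... | false | true = label (x zero) ∷ L , (λ { (here refl) f → here refl ; (there m) f → there (cov m f) }) , cong suc len , λ _ → here refl
  ... | false | false = L , (λ { (here refl) f → same ; (there m) f → cov m f }) , len , λ _ → same
    where
    same : label (x zero) ∈ L
    same = subst (_∈ L) (≡sym (label-edge (x zero) (x (suc zero)) (adj zero (suc zero) refl) eq eq')) (hd refl)

  scattered-untraceable : ¬ Traceable G
  scattered-untraceable = go n refl
    where
    -- The order is generalised so that it can be matched as a successor: `pieces` needs a nonempty
    -- path.
    go : ∀ m → m ≡ n → ¬ Traceable G
    go zero refl _ with proj₁ (label-onto zero)
    ... | ()
    go (suc m) refl (x , inj , sur , adj) with pieces x adj
    ... | L , cov , len , _ = <-irrefl refl (≤-trans (s≤s (s≤s (s≤s (s≤s (s≤s (s≤s (s≤s (s≤s z≤n)))))))) (≤-trans eight (≤-trans (≤-reflexive len) (seven (cut (x zero)) six))))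
      where
      eight : 8 ≤ length L
      eight = ≤-trans (≤-reflexive refl) (Unique-⊆-length {xs = allFin 8} (Unique.allFin⁺ 8) all-labels)
        where
        all-labels : ∀ {l} → l ∈ allFin 8 → l ∈ L
        all-labels {l} _ with label-onto l
        ... | v , f , refl with sur v
        ... | i , refl = cov (∈-tabulate⁺ {f = x} i) f
      six : count cut (tabulate x) ≤ 6
      six = ≤-trans (≤-reflexive (≡sym (select-length cut (tabulate x)))) (≤-trans (Unique-⊆-length (select-unique cut (tabulate x) (Unique.tabulate⁺ inj))
              (λ {v} m → cut-∈ v (proj₂ (∈-select cut (tabulate x) m)))) (≤-reflexive cut-length))
      seven : ∀ b {k} → k ≤ 6 → (if b then k else suc k) ≤ 7
      seven true le = ≤-trans le (n≤1+n 6)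
      seven false le = s≤s le

-- The cut consists of the vertices of the two 4-cycles around the squares; the two squares and the
-- six ears remain.
scattered₂₀ : Scattered G₂₀
scattered₂₀ = record
  { cut = λ v → (3 <ᵇ toℕ v) ∧ (toℕ v <ᵇ 10)
  ; cut-list = # 4 ∷ # 5 ∷ # 6 ∷ # 7 ∷ # 8 ∷ # 9 ∷ []
  ; cut-length = refl
  ; cut-∈ = toWitness {a? = all? (λ v → (((3 <ᵇ toℕ v) ∧ (toℕ v <ᵇ 10)) ≟ᵇ true) →-dec any? (v ≟_) (# 4 ∷ # 5 ∷ # 6 ∷ # 7 ∷ # 8 ∷ # 9 ∷ []))} tt
  ; label = label
  ; label-edge = toWitness {a? = all? (λ u → all? (λ v → (adj₂₀ u v ≟ᵇ true) →-dec ((((3 <ᵇ toℕ u) ∧ (toℕ u <ᵇ 10)) ≟ᵇ false) →-dec ((((3 <ᵇ toℕ v) ∧ (toℕ v <ᵇ 10)) ≟ᵇ false) →-dec (label u ≟ label v)))))} tt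
  ; label-onto = toWitness {a? = all? (λ l → Fin.any? (λ v → (((3 <ᵇ toℕ v) ∧ (toℕ v <ᵇ 10)) ≟ᵇ false) ×-dec (label v ≟ l)))} tt }
  where
  label : Fin 20 → Fin 8
  -- The labels of the cut vertices 4 to 9 are fillers.
  label v = Vec.lookup (# 0 ∷ # 0 ∷ # 0 ∷ # 0 ∷ # 0 ∷ # 0 ∷ # 0 ∷ # 0 ∷ # 0 ∷ # 0 ∷ # 1 ∷ # 1 ∷ # 1 ∷ # 1 ∷ # 2 ∷ # 3 ∷ # 4 ∷ # 5 ∷ # 6 ∷ # 7 ∷ []) v

-- A boundary edge uv, recorded by v being first in the link of u and vice versa, both off the cut.
record Extendable (n : ℕ) : Set where
  field
    G : Graph n
    connected : Connected G
    linear : LocallyLinear G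
    scattered : Scattered G
    size-≡ : size G ≡ 2 * n + 3
    u v : Fin n
    uv : Adj G u v
    link-u : ∀ i → toℕ i ≡ 0 → proj₁ (proj₂ (linear u)) i ≡ v
    link-v : ∀ i → toℕ i ≡ 0 → proj₁ (proj₂ (linear v)) i ≡ u
    u-off : Scattered.cut scattered u ≡ false
    v-off : Scattered.cut scattered v ≡ false

-- The edge from 0 to 1 belongs to a boundary square, and its ends head each other's lists in
-- `links₂₀`.
extendable₂₀ : Extendable 20
extendable₂₀ = record { G = G₂₀ ; connected = connected₂₀ ; linear = linear₂₀ ; scattered = scattered₂₀ ; size-≡ = refl ; u = # 0 ; v = # 1 ; uv = refl
  ; link-u = λ { zero _ → refl ; (suc _) () } ; link-v = λ { zero _ → refl ; (suc _) () } ; u-off = refl ; v-off = refl }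

-- Adding an ear

module Ear {n : ℕ} (X : Extendable n) where
  open Extendable X
  open Scattered scattered

  uv? : Fin n → Bool
  uv? w = ⌊ w ≟ u ⌋ ∨ ⌊ w ≟ v ⌋

  uv?-elim : ∀ {w} → uv? w ≡ true → w ≡ u ⊎ w ≡ v
  uv?-elim {w} e with w ≟ u | w ≟ v
  ... | yes p | _ = inj₁ p
  ... | no _ | yes p = inj₂ p

  uv?-u : uv? u ≡ true
  uv?-u with u ≟ u
  ... | yes _ = refl
  ... | no ne = ⊥-elim (ne refl)

  uv?-v : uv? v ≡ true
  uv?-v with v ≟ v
  ... | yes _ = ∨-right {⌊ v ≟ u ⌋} refl
  ... | no ne = ⊥-elim (ne refl)

  adj′ : Fin (suc n) → Fin (suc n) → Bool
  adj′ zero zero = false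
  adj′ zero (suc j) = uv? j
  adj′ (suc i) zero = uv? i
  adj′ (suc i) (suc j) = adj G i j

  G′ : Graph (suc n)
  G′ = record { adj = adj′ ; sym = sym′ ; irrefl = irrefl′ }
    where
    sym′ : ∀ a b → adj′ a b ≡ adj′ b a
    sym′ zero zero = refl
    sym′ zero (suc j) = refl
    sym′ (suc i) zero = refl
    sym′ (suc i) (suc j) = sym G i j
    irrefl′ : ∀ a → adj′ a a ≡ false
    irrefl′ zero = refl
    irrefl′ (suc i) = irrefl G i

  lift : ∀ {a b} → Walk G a b → Walk G′ (suc a) (suc b)
  lift here = here
  lift (step a p) = step a (lift p)

  connected′ : Connected G′
  connected′ zero zero = here
  connected′ zero (suc b) = step uv?-u (lift (connected u b))
  connected′ (suc a) zero = walk-trans (lift (connected a u)) (step uv?-u here)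
  connected′ (suc a) (suc b) = lift (connected a b)

  -- The new vertex is put in front of the link of w, where w is an end of the edge uv and w′ the other.
  extended : ∀ w w′ → uv? w ≡ true → uv? w′ ≡ true → Adj G w w′ → (∀ {x} → uv? x ≡ true → x ≡ w ⊎ x ≡ w′) →
    ((k , x , _) : NbhdIsPath G w) → (∀ i → toℕ i ≡ 0 → x i ≡ w′) → NbhdIsPath G′ (suc w)
  extended w w′ tw tw′ ww′ ends (suc k , x , le , inj , adjacent , cover , path) head =
    suc (suc k) , x′ , s≤s z≤n , (λ {i} {j} → inj′ i j) , adjacent′ , cover′ , path′
    where
    x′ : Fin (suc (suc k)) → Fin (suc n)
    x′ zero = zero
    x′ (suc i) = suc (x i)
    inj′ : ∀ i j → x′ i ≡ x′ j → i ≡ j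
    inj′ zero zero e = refl
    inj′ (suc i) (suc j) e = cong suc (inj (Fin.suc-injective e))
    adjacent′ : ∀ i → Adj G′ (suc w) (x′ i)
    adjacent′ zero = tw
    adjacent′ (suc i) = adjacent i
    cover′ : ∀ y → Adj G′ (suc w) y → ∃ λ i → x′ i ≡ y
    cover′ zero _ = zero , refl
    cover′ (suc y) a = let (i , e) = cover y a in suc i , cong suc e
    first : ∀ j → uv? (x j) ≡ true → suc (toℕ j) ≡ 1
    first j e with ends {x j} e
    ... | inj₁ e' = ⊥-elim (true≢false (adjacent j) (trans (cong (adj G w) e') (irrefl G w)))
    ... | inj₂ e' = cong (λ i → suc (toℕ i)) (inj {j} {zero} (trans e' (≡sym (head zero refl))))
    first⁻ : ∀ j → suc (toℕ j) ≡ 1 → uv? (x j) ≡ true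
    first⁻ j e = trans (cong uv? (head j (NP.suc-injective e))) tw′
    path′ : ∀ i j → (Adj G′ (x′ i) (x′ j) → toℕ j ≡ suc (toℕ i) ⊎ toℕ i ≡ suc (toℕ j)) × (toℕ j ≡ suc (toℕ i) ⊎ toℕ i ≡ suc (toℕ j) → Adj G′ (x′ i) (x′ j))
    path′ zero zero = (λ ()) , λ { (inj₁ ()) ; (inj₂ ()) }
    path′ zero (suc j) = (λ a → inj₁ (first j a)) , λ { (inj₁ e) → first⁻ j e ; (inj₂ ()) }
    path′ (suc i) zero = (λ a → inj₂ (first i a)) , λ { (inj₁ ()) ; (inj₂ e) → first⁻ i e }
    path′ (suc i) (suc j) = (λ a → near (proj₁ (path i j) a)) , (λ e → proj₂ (path i j) (unnear e))
      where
      near : ∀ {a b} → a ≡ suc b ⊎ b ≡ suc a → suc a ≡ suc (suc b) ⊎ suc b ≡ suc (suc a)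
      near (inj₁ e) = inj₁ (cong suc e)
      near (inj₂ e) = inj₂ (cong suc e)
      unnear : ∀ {a b} → suc a ≡ suc (suc b) ⊎ suc b ≡ suc (suc a) → a ≡ suc b ⊎ b ≡ suc a
      unnear (inj₁ e) = inj₁ (NP.suc-injective e)
      unnear (inj₂ e) = inj₂ (NP.suc-injective e)

  unchanged : ∀ w → uv? w ≡ false → NbhdIsPath G w → NbhdIsPath G′ (suc w)
  unchanged w off (k , x , le , inj , adjacent , cover , path) =
    k , (λ i → suc (x i)) , le , (λ e → inj (Fin.suc-injective e)) , adjacent , cover′ , path
    where
    cover′ : ∀ y → Adj G′ (suc w) y → ∃ λ i → suc (x i) ≡ y
    cover′ zero a = ⊥-elim (true≢false a off)
    cover′ (suc y) a = let (i , e) = cover y a in i , cong suc e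

  new-link : NbhdIsPath G′ zero
  new-link = 2 , x , s≤s z≤n , (λ {i} {j} → inj i j) , adjacent , cover , path
    where
    x : Fin 2 → Fin (suc n)
    x zero = suc u
    x (suc zero) = suc v
    u≢v : u ≢ v
    u≢v e = true≢false uv (trans (cong (λ w → adj G w v) e) (irrefl G v))
    inj : ∀ i j → x i ≡ x j → i ≡ j
    inj zero zero e = refl
    inj zero (suc zero) e = ⊥-elim (u≢v (Fin.suc-injective e))
    inj (suc zero) zero e = ⊥-elim (u≢v (≡sym (Fin.suc-injective e)))
    inj (suc zero) (suc zero) e = refl
    adjacent : ∀ i → Adj G′ zero (x i)
    adjacent zero = uv?-u
    adjacent (suc zero) = uv?-v
    cover : ∀ y → Adj G′ zero y → ∃ λ i → x i ≡ y
    cover (suc y) a with uv?-elim {y} a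
    ... | inj₁ refl = zero , refl
    ... | inj₂ refl = suc zero , refl
    path : ∀ i j → (Adj G′ (x i) (x j) → toℕ j ≡ suc (toℕ i) ⊎ toℕ i ≡ suc (toℕ j)) × (toℕ j ≡ suc (toℕ i) ⊎ toℕ i ≡ suc (toℕ j) → Adj G′ (x i) (x j))
    path zero zero = (λ a → ⊥-elim (true≢false a (irrefl G u))) , λ { (inj₁ ()) ; (inj₂ ()) }
    path zero (suc zero) = (λ _ → inj₁ refl) , λ _ → uv
    path (suc zero) zero = (λ _ → inj₂ refl) , λ _ → trans (sym G v u) uv
    path (suc zero) (suc zero) = (λ a → ⊥-elim (true≢false a (irrefl G v))) , λ { (inj₁ ()) ; (inj₂ ()) }

  extended-u : NbhdIsPath G′ (suc u)
  extended-u = extended u v uv?-u uv?-v uv (λ {w} → uv?-elim {w}) (linear u) link-u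

  linear′ : LocallyLinear G′
  linear′ zero = new-link
  linear′ (suc w) with w ≟ u | w ≟ v
  ... | yes refl | _ = extended-u
  ... | no _ | yes refl = extended v u uv?-v uv?-u (trans (sym G v u) uv) (λ {w} e → swap (uv?-elim {w} e)) (linear v) link-v
  ... | no nu | no nv = unchanged w (¬true λ e → [ nu , nv ]′ (uv?-elim {w} e)) (linear w)

  extended-head : ∀ w w′ tw tw′ ww′ (ends : ∀ {x} → uv? x ≡ true → x ≡ w ⊎ x ≡ w′) (l : NbhdIsPath G w) hd i → toℕ i ≡ 0 →
    proj₁ (proj₂ (extended w w′ tw tw′ ww′ ends l hd)) i ≡ zero
  extended-head w w′ tw tw′ ww′ ends (suc k , _) hd zero _ = refl

  size′ : size G′ ≡ 2 * suc n + 3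
  size′ = trans (trans sum′ (cong₂ _+_ two (≡sym (sums G)))) (trans (cong (2 +_) size-≡) (solve 1 (λ n → con 2 :+ (con 2 :* n :+ con 3) := con 2 :* (con 1 :+ n) :+ con 3) refl n))
    where
    open +-*-Solver using (solve; _:+_; _:*_; _:=_; con)
    lt : ∀ {m} → Fin m → Fin m → Bool
    lt i j = toℕ i <ᵇ toℕ j
    sums : ∀ {m} (H : Graph m) → size H ≡ ∑ (allFin m) (λ i → ∑ (allFin m) (λ j → ⟦ lt i j ∧ adj H i j ⟧))
    sums = size-∑
    tab : ∀ {m} (f : Fin (suc m) → ℕ) → ∑ (allFin (suc m)) f ≡ f zero + ∑ (allFin m) (λ i → f (suc i))
    tab {m} f = cong (f zero +_) (trans (cong (λ l → ∑ l f) (≡sym (map-tabulate (λ i → i) suc))) (mapped (allFin m)))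
      where
      mapped : ∀ l → ∑ (map suc l) f ≡ ∑ l (λ i → f (suc i))
      mapped [] = refl
      mapped (x ∷ l) = cong (f (suc x) +_) (mapped l)
    sum′ : size G′ ≡ ∑ (allFin n) (λ j → ⟦ uv? j ⟧) + ∑ (allFin n) (λ i → ∑ (allFin n) (λ j → ⟦ lt i j ∧ adj G i j ⟧))
    sum′ = trans (sums G′) (trans (tab (λ i → ∑ (allFin (suc n)) (λ j → ⟦ lt i j ∧ adj′ i j ⟧)))
             (cong₂ _+_ (tab (λ j → ⟦ lt (zero {n}) j ∧ adj′ zero j ⟧)) (∑-cong (allFin n) (λ {i} _ → tab (λ j → ⟦ lt (suc i) j ∧ adj′ (suc i) j ⟧)))))
    two : ∑ (allFin n) (λ j → ⟦ uv? j ⟧) ≡ 2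
    two = count-exact uv? (Unique.allFin⁺ n) (pair {a = u} {b = v} (λ e → true≢false uv (trans (cong (λ w → adj G w v) e) (irrefl G v))))
            (λ { (here refl) → ∈-allFin _ , uv?-u ; (there (here refl)) → ∈-allFin _ , uv?-v })
            (λ {w} _ e → [ here , (λ p → there (here p)) ]′ (uv?-elim {w} e))

  -- The ear joins the piece of `u`, which contains `v` too, as both are off the cut; so neither the
  -- cut nor the number of pieces changes.
  scattered′ : Scattered G′
  scattered′ = record { cut = cut′ ; cut-list = map suc cut-list ; cut-length = trans (length-map suc cut-list) cut-length ; cut-∈ = cut′-∈ ; label = label′ ; label-edge = edge′ ; label-onto = onto′ }
    where
    cut′ : Fin (suc n) → Bool
    cut′ zero = false
    cut′ (suc i) = cut i
    cut′-∈ : ∀ w → cut′ w ≡ true → w ∈ map suc cut-list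
    cut′-∈ (suc w) e = ∈-map⁺ suc (cut-∈ w e)
    label′ : Fin (suc n) → Fin 8
    label′ zero = label u
    label′ (suc i) = label i
    near : ∀ {w} → uv? w ≡ true → label u ≡ label w
    near {w} e with uv?-elim {w} e
    ... | inj₁ refl = refl
    ... | inj₂ refl = label-edge u v uv u-off v-off
    edge′ : ∀ a b → Adj G′ a b → cut′ a ≡ false → cut′ b ≡ false → label′ a ≡ label′ b
    edge′ zero (suc b) a _ _ = near {b} a
    edge′ (suc i) zero a _ _ = ≡sym (near {i} a)
    edge′ (suc i) (suc j) a f g = label-edge i j a f g
    onto′ : ∀ l → ∃ λ w → cut′ w ≡ false × label′ w ≡ l
    onto′ l = let (w , f , e) = label-onto l in suc w , f , e

  -- The next ear goes on the edge from `u` to the new vertex: the new vertex heads the link of `u`,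
  -- and `new-link` begins with `u`.
  next-extendable : Extendable (suc n)
  next-extendable = record { G = G′ ; connected = connected′ ; linear = linear′ ; scattered = scattered′ ; size-≡ = size′ ; u = suc u ; v = zero ; uv = uv?-u
    ; link-u = head-u ; link-v = λ { zero _ → refl ; (suc _) () } ; u-off = u-off ; v-off = refl }
    where
    head-u : ∀ i → toℕ i ≡ 0 → proj₁ (proj₂ (linear′ (suc u))) i ≡ zero
    head-u with u ≟ u | u ≟ v
    ... | yes refl | _ = extended-head u v uv?-u uv?-v uv (λ {w} → uv?-elim {w}) (linear u) link-u
    ... | no ne | _ = ⊥-elim (ne refl)

extendable : ∀ k → Extendable (k + 20)
extendable zero = extendable₂₀
extendable (suc k) = Ear.next-extendable (extendable k)

theorem3 : (n : ℕ) → 1 ≤ n → (∃ λ (G : Graph n) → CNLL G) →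
    (∃ λ (G : Graph n) → CNLL G × size G ≡ 2 * n + 3)
    × (∀ (G : Graph n) → CNLL G → 2 * n + 3 ≤ size G)
theorem3 n 1≤n (H , walk , ¬tr , ll) = example , λ G (w , t , l) → World.size-bound G l w t (fromℕ< 1≤n)
  where
  example : ∃ λ (G : Graph n) → CNLL G × size G ≡ 2 * n + 3
  -- The given graph yields `n ≥ 20`, so that subtracting 20 from `n` and adding it again is exact.
  example = subst (λ m → ∃ λ (G : Graph m) → CNLL G × size G ≡ 2 * m + 3) (m∸n+n≡m (World.twenty H ll walk ¬tr (fromℕ< 1≤n)))
    (let open Extendable (extendable (n ∸ 20)) in G , (connected , scattered-untraceable scattered , linear) , size-≡)
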